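{- Let $p_d$ denote the number of isomorphism classes of perfect $d$-dimensional primitive integral lattices (equivalently, the number of similarity classes of perfect $d$-dimensional Euclidean lattices). For every $\epsilon>0$ there exists $N(\epsilon)$ such that for all $d\ge N(\epsilon)$, $$e^{d^{1-\epsilon}}<p_d<e^{d^{3+\epsilon}}.$$
   Context: A lattice is a discrete subgroup $\Lambda$ of a Euclidean vector space; its dimension (rank) is $d=\dim(\Lambda\otimes_{\mathbb Z}\mathbb R)$. $\Lambda_{\min}$ denotes the set of nonzero vectors of $\Lambda$ of minimal length. $\Lambda$ is perfect if the tensors $\{v\otimes v\}_{v\in\Lambda_{\min}}$ span the full $\binom{d+1}{2}$-dimensional space of symmetric tensors in $(\Lambda\otimes\mathbb R)\otimes_{\mathbb R}(\Lambda\otimes\mathbb R)$. A lattice is primitive integral if all scalar products of its elements are integers and the set of all these scalar products has greatest common divisor $1$. -}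

module Defs where

open import Algebra.Bundles.Raw using (RawGroup)
open import Algebra.Morphism.Structures using (module GroupMorphisms)
open import Data.Fin.Base using (Fin)
open import Data.Integer.Base as ℤ using (ℤ; +_)
import Data.Integer.Properties as ℤ
import Data.Integer.Divisibility as ℤ
open import Data.Nat.Base as ℕ using (ℕ; zero; suc)
import Data.Nat.Properties as ℕ
open import Data.Product.Base using (Σ-syntax; ∃-syntax; _×_; _,_)
open import Data.Rational.Base
open import Data.Rational.Properties
open import Data.Rational.Solver using (module +-*-Solver)
import Data.Rational.Unnormalised.Base as ℚᵘ
import Data.Rational.Unnormalised.Properties as ℚᵘ
open import Data.Sum.Base using (_⊎_; inj₁; inj₂)
import Data.Vec.Functional as V
open import Function.Definitions using (Bijective)
open import Level using (0ℓ)
open import Relation.Binary.PropositionalEquality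
open import Relation.Nullary.Negation.Core using (¬_)

open +-*-Solver using (solve; _:=_; _:+_; _:*_; _:-_; :-_; con)

ι : ℕ → ℚ
ι n = + n / 1

recip : ℕ → ℚ
recip k = + 1 / suc k

ι-suc : ∀ n → ι (suc n) ≡ ι n + 1ℚ
ι-suc n = toℚᵘ-injective (begin
  toℚᵘ (ι (suc n))               ≈⟨ toℚᵘ-fromℚᵘ (ℚᵘ.mkℚᵘ (+ suc n) 0) ⟩
  ℚᵘ.mkℚᵘ (+ suc n) 0            ≈⟨ ℚᵘ.*≡* eq ⟩
  ℚᵘ.mkℚᵘ (+ n) 0 ℚᵘ.+ ℚᵘ.1ℚᵘ    ≈⟨ ℚᵘ.+-cong (ℚᵘ.≃-sym (toℚᵘ-fromℚᵘ (ℚᵘ.mkℚᵘ (+ n) 0))) (ℚᵘ.≃-refl {ℚᵘ.1ℚᵘ}) ⟩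
  toℚᵘ (ι n) ℚᵘ.+ toℚᵘ 1ℚ        ≈⟨ ℚᵘ.≃-sym (toℚᵘ-homo-+ (ι n) 1ℚ) ⟩
  toℚᵘ (ι n + 1ℚ)                ∎)
  where
  open ℚᵘ.≃-Reasoning
  eq : (+ suc n) ℤ.* (+ 1) ≡ ((+ n) ℤ.* (+ 1) ℤ.+ (+ 1)) ℤ.* (+ 1)
  eq = cong (ℤ._* (+ 1)) (trans (ℤ.+-comm (+ 1) (+ n)) (cong (ℤ._+ (+ 1)) (sym (ℤ.*-identityʳ (+ n)))))

ι*recip : ∀ k → ι (suc k) * recip k ≡ 1ℚ
ι*recip k = toℚᵘ-injective (begin
  toℚᵘ (ι (suc k) * recip k)               ≈⟨ toℚᵘ-homo-* (ι (suc k)) (recip k) ⟩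
  toℚᵘ (ι (suc k)) ℚᵘ.* toℚᵘ (recip k)     ≈⟨ ℚᵘ.*-cong (toℚᵘ-fromℚᵘ (ℚᵘ.mkℚᵘ (+ suc k) 0)) (toℚᵘ-fromℚᵘ (ℚᵘ.mkℚᵘ (+ 1) k)) ⟩
  ℚᵘ.mkℚᵘ (+ suc k) 0 ℚᵘ.* ℚᵘ.mkℚᵘ (+ 1) k ≈⟨ ℚᵘ.*≡* eq ⟩
  ℚᵘ.1ℚᵘ                                   ∎)
  where
  open ℚᵘ.≃-Reasoning
  eq : ((+ suc k) ℤ.* (+ 1)) ℤ.* (+ 1) ≡ (+ 1) ℤ.* (+ (1 ℕ.* suc k))
  eq = trans (ℤ.*-identityʳ _) (trans (ℤ.*-identityʳ _)
         (trans (cong +_ (sym (ℕ.*-identityˡ (suc k)))) (sym (ℤ.*-identityˡ _))))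

1>0 : 0ℚ < 1ℚ
1>0 = positive⁻¹ 1ℚ

½>0 : 0ℚ < ½
½>0 = positive⁻¹ ½

0≤ι : ∀ n → 0ℚ ≤ ι n
0≤ι n = nonNegative⁻¹ (ι n) {{normalize-nonNeg n 1}}

0<ι : ∀ n → 0ℚ < ι (suc n)
0<ι n = positive⁻¹ (ι (suc n)) {{normalize-pos (suc n) 1}}

0<recip : ∀ k → 0ℚ < recip k
0<recip k = positive⁻¹ (recip k) {{normalize-pos 1 (suc k)}}

*-pos : ∀ {p q} → 0ℚ < p → 0ℚ < q → 0ℚ < p * q
*-pos {p} {q} 0<p 0<q =
  positive⁻¹ (p * q) {{pos*pos⇒pos p {{positive 0<p}} q {{positive 0<q}}}}

*-nonNeg : ∀ {p q} → 0ℚ ≤ p → 0ℚ ≤ q → 0ℚ ≤ p * q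
*-nonNeg {p} {q} 0≤p 0≤q =
  nonNegative⁻¹ (p * q) {{nonNeg*nonNeg⇒nonNeg p {{nonNegative 0≤p}} q {{nonNegative 0≤q}}}}

*-monoʳ : ∀ {p q} r → 0ℚ ≤ r → p ≤ q → r * p ≤ r * q
*-monoʳ r 0≤r = *-monoˡ-≤-nonNeg r {{nonNegative 0≤r}}

*-monoˡ : ∀ {p q} r → 0ℚ ≤ r → p ≤ q → p * r ≤ q * r
*-monoˡ r 0≤r = *-monoʳ-≤-nonNeg r {{nonNegative 0≤r}}

*-mono : ∀ {p q r s} → 0ℚ ≤ r → 0ℚ ≤ q → p ≤ q → r ≤ s → p * r ≤ q * s
*-mono {p} {q} {r} {s} 0≤r 0≤q p≤q r≤s =
  ≤-trans (*-monoˡ r 0≤r p≤q) (*-monoʳ q 0≤q r≤s)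

ι-mono : ∀ j n → ι n ≤ ι (j ℕ.+ n)
ι-mono zero    n = ≤-refl
ι-mono (suc j) n = ≤-trans (ι-mono j n)
  (subst₂ _≤_ (+-identityʳ (ι (j ℕ.+ n))) (sym (ι-suc (j ℕ.+ n)))
    (+-monoʳ-≤ (ι (j ℕ.+ n)) (<⇒≤ 1>0)))

ι-mono-≤ : ∀ {m n} → m ℕ.≤ n → ι m ≤ ι n
ι-mono-≤ {m} {n} m≤n = subst (λ t → ι m ≤ ι t) (ℕ.m∸n+n≡m m≤n) (ι-mono (n ℕ.∸ m) m)

recip-anti : ∀ k → recip (suc k) ≤ recip k
recip-anti k = subst₂ _≤_ lhs rhs (*-monoʳ (recip (suc k) * recip k)
    (*-nonNeg (<⇒≤ (0<recip (suc k))) (<⇒≤ (0<recip k))) (ι-mono 1 (suc k)))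
  where
  lhs : recip (suc k) * recip k * ι (suc k) ≡ recip (suc k)
  lhs = trans (solve 3 (λ a b c → a :* b :* c := a :* (c :* b)) refl (recip (suc k)) (recip k) (ι (suc k)))
          (trans (cong (recip (suc k) *_) (ι*recip k)) (*-identityʳ (recip (suc k))))
  rhs : recip (suc k) * recip k * ι (suc (suc k)) ≡ recip k
  rhs = trans (solve 3 (λ a b c → a :* b :* c := (c :* a) :* b) refl (recip (suc k)) (recip k) (ι (suc (suc k))))
          (trans (cong (_* recip k) (ι*recip (suc k))) (*-identityˡ (recip k)))

archimedean : ∀ q → ∃[ m ] ∣ q ∣ ≤ ι m
archimedean (mkℚ n d c) = ℤ.∣ n ∣ , toℚᵘ-cancel-≤
  (ℚᵘ.≤-respʳ-≃ (ℚᵘ.≃-sym (toℚᵘ-fromℚᵘ (ℚᵘ.mkℚᵘ (+ ℤ.∣ n ∣) 0)))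
    (ℚᵘ.*≤* (subst₂ ℤ._≤_ (ℤ.pos-* ℤ.∣ n ∣ 1) (ℤ.pos-* ℤ.∣ n ∣ (suc d))
      (ℤ.+≤+ (ℕ.*-monoʳ-≤ ℤ.∣ n ∣ (ℕ.s≤s ℕ.z≤n))))))

p≤∣p∣ : ∀ p → p ≤ ∣ p ∣
p≤∣p∣ p with ≤-total 0ℚ p
... | inj₁ 0≤p = ≤-reflexive (sym (0≤p⇒∣p∣≡p 0≤p))
... | inj₂ p≤0 = ≤-trans p≤0 (0≤∣p∣ p)

archimedean-< : ∀ q {δ} → 0ℚ < δ → ∃[ j ] q < ι j * δ
archimedean-< q {δ} 0<δ with archimedean (q * (1/ δ) {{>-nonZero 0<δ}})
... | m , ∣q/δ∣≤m = suc m , subst (_< ι (suc m) * δ) cancel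
        (*-monoˡ-<-pos δ {{positive 0<δ}} (≤-<-trans (≤-trans (p≤∣p∣ _) ∣q/δ∣≤m) m<m+1))
  where
  instance _ = >-nonZero 0<δ
  m<m+1 : ι m < ι (suc m)
  m<m+1 = subst₂ _<_ (+-identityʳ (ι m)) (sym (ι-suc m)) (+-monoʳ-< (ι m) 1>0)
  cancel : q * (1/ δ) * δ ≡ q
  cancel = trans (*-assoc q (1/ δ) δ) (trans (cong (q *_) (*-inverseˡ δ)) (*-identityʳ q))

½+½ : ∀ δ → δ * ½ + δ * ½ ≡ δ
½+½ δ = trans (sym (*-distribˡ-+ δ ½ ½)) (*-identityʳ δ)

∣p-q∣≡∣q-p∣ : ∀ p q → ∣ p - q ∣ ≡ ∣ q - p ∣
∣p-q∣≡∣q-p∣ p q = trans (cong ∣_∣ (solve 2 (λ a b → a :- b := :- (b :- a)) refl p q)) (∣-p∣≡∣p∣ (q - p))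

triangle : ∀ p q r → ∣ p - r ∣ ≤ ∣ p - q ∣ + ∣ q - r ∣
triangle p q r = subst (λ t → ∣ t ∣ ≤ ∣ p - q ∣ + ∣ q - r ∣)
  (solve 3 (λ a b c → (a :- b) :+ (b :- c) := a :- c) refl p q r) (∣p+q∣≤∣p∣+∣q∣ (p - q) (q - r))

IsCauchy : (ℕ → ℚ) → Set
IsCauchy s = ∀ δ → 0ℚ < δ → ∃[ N ] (∀ m n → N ℕ.≤ m → N ℕ.≤ n → ∣ s m - s n ∣ < δ)

cauchy-const : ∀ q → IsCauchy (λ _ → q)
cauchy-const q δ 0<δ = 0 , λ _ _ _ _ → subst (_< δ) (cong ∣_∣ (sym (+-inverseʳ q))) 0<δ

cauchy-+ : ∀ {s t} → IsCauchy s → IsCauchy t → IsCauchy (λ n → s n + t n)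
cauchy-+ {s} {t} cs ct δ 0<δ =
  let M , hs = cs (δ * ½) (*-pos 0<δ ½>0)
      N , ht = ct (δ * ½) (*-pos 0<δ ½>0)
  in M ℕ.⊔ N , λ m n p q →
  ≤-<-trans
    (subst (λ u → ∣ u ∣ ≤ ∣ s m - s n ∣ + ∣ t m - t n ∣)
      (solve 4 (λ a b c d → (a :- c) :+ (b :- d) := (a :+ b) :- (c :+ d)) refl (s m) (t m) (s n) (t n))
      (∣p+q∣≤∣p∣+∣q∣ (s m - s n) (t m - t n)))
    (subst (∣ s m - s n ∣ + ∣ t m - t n ∣ <_) (½+½ δ)
      (+-mono-< (hs m n (ℕ.m⊔n≤o⇒m≤o M N p) (ℕ.m⊔n≤o⇒m≤o M N q))
                (ht m n (ℕ.m⊔n≤o⇒n≤o M N p) (ℕ.m⊔n≤o⇒n≤o M N q))))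

cauchy-neg : ∀ {s} → IsCauchy s → IsCauchy (λ n → - s n)
cauchy-neg {s} cs δ 0<δ with cs δ 0<δ
... | N , h = N , λ m n p q → subst (_< δ)
  (trans (sym (∣-p∣≡∣p∣ (s m - s n)))
    (cong ∣_∣ (solve 2 (λ a b → :- (a :- b) := (:- a) :- (:- b)) refl (s m) (s n))))
  (h m n p q)

cauchy-bounded : ∀ {s} → IsCauchy s → ∃[ B ] ∃[ N ] (∀ n → N ℕ.≤ n → ∣ s n ∣ ≤ ι (suc B))
cauchy-bounded {s} cs with cs 1ℚ 1>0
... | N , h with archimedean (s N)
...   | B , b = B , N , λ n N≤n → begin
        ∣ s n ∣                    ≡⟨ cong ∣_∣ (solve 2 (λ a c → a := c :+ (a :- c)) refl (s n) (s N)) ⟩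
        ∣ s N + (s n - s N) ∣      ≤⟨ ∣p+q∣≤∣p∣+∣q∣ (s N) (s n - s N) ⟩
        ∣ s N ∣ + ∣ s n - s N ∣    ≤⟨ +-mono-≤ b (<⇒≤ (h n N N≤n ℕ.≤-refl)) ⟩
        ι B + 1ℚ                   ≡⟨ sym (ι-suc B) ⟩
        ι (suc B)                  ∎
  where open ≤-Reasoning

share : ∀ B {δ} → 0ℚ < δ → ∀ {p} → p < δ * recip B → ι (suc B) * p < δ
share B {δ} 0<δ {p} p<δ/B = subst (ι (suc B) * p <_)
  (trans (solve 3 (λ a d r → a :* (d :* r) := d :* (a :* r)) refl (ι (suc B)) δ (recip B))
    (trans (cong (δ *_) (ι*recip B)) (*-identityʳ δ)))
  (*-monoʳ-<-pos (ι (suc B)) {{positive (0<ι B)}} p<δ/B)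

cauchy-* : ∀ {s t} → IsCauchy s → IsCauchy t → IsCauchy (λ n → s n * t n)
cauchy-* {s} {t} cs ct δ 0<δ =
  let A , N₁ , hA = cauchy-bounded {s} cs
      B , N₂ , hB = cauchy-bounded {t} ct
      N₃ , hs = cs (δ * ½ * recip B) (*-pos (*-pos 0<δ ½>0) (0<recip B))
      N₄ , ht = ct (δ * ½ * recip A) (*-pos (*-pos 0<δ ½>0) (0<recip A))
      open Bound A N₁ hA B N₂ hB N₃ hs N₄ ht
  in N , bound
  where
  module Bound
    (A N₁ : ℕ) (hA : ∀ n → N₁ ℕ.≤ n → ∣ s n ∣ ≤ ι (suc A))
    (B N₂ : ℕ) (hB : ∀ n → N₂ ℕ.≤ n → ∣ t n ∣ ≤ ι (suc B))
    (N₃ : ℕ) (hs : ∀ m n → N₃ ℕ.≤ m → N₃ ℕ.≤ n → ∣ s m - s n ∣ < δ * ½ * recip B)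
    (N₄ : ℕ) (ht : ∀ m n → N₄ ℕ.≤ m → N₄ ℕ.≤ n → ∣ t m - t n ∣ < δ * ½ * recip A) where
    N = (N₁ ℕ.⊔ N₂) ℕ.⊔ (N₃ ℕ.⊔ N₄)
    0<δ/2 = *-pos 0<δ ½>0
    bound : ∀ m n → N ℕ.≤ m → N ℕ.≤ n → ∣ s m * t m - s n * t n ∣ < δ
    bound m n p q = begin-strict
      ∣ s m * t m - s n * t n ∣
        ≡⟨ cong ∣_∣ (solve 4 (λ a b c d → a :* b :- c :* d := a :* (b :- d) :+ d :* (a :- c)) refl (s m) (t m) (s n) (t n)) ⟩
      ∣ s m * (t m - t n) + t n * (s m - s n) ∣
        ≤⟨ ∣p+q∣≤∣p∣+∣q∣ (s m * (t m - t n)) (t n * (s m - s n)) ⟩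
      ∣ s m * (t m - t n) ∣ + ∣ t n * (s m - s n) ∣
        ≡⟨ cong₂ _+_ (∣p*q∣≡∣p∣*∣q∣ (s m) (t m - t n)) (∣p*q∣≡∣p∣*∣q∣ (t n) (s m - s n)) ⟩
      ∣ s m ∣ * ∣ t m - t n ∣ + ∣ t n ∣ * ∣ s m - s n ∣
        ≤⟨ +-mono-≤ (*-monoˡ _ (0≤∣p∣ (t m - t n)) (hA m (l₁ p))) (*-monoˡ _ (0≤∣p∣ (s m - s n)) (hB n (l₂ q))) ⟩
      ι (suc A) * ∣ t m - t n ∣ + ι (suc B) * ∣ s m - s n ∣
        <⟨ +-mono-< (share A 0<δ/2 (ht m n (l₄ p) (l₄ q))) (share B 0<δ/2 (hs m n (l₃ p) (l₃ q))) ⟩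
      δ * ½ + δ * ½
        ≡⟨ ½+½ δ ⟩
      δ ∎
      where
      open ≤-Reasoning
      l₁ : ∀ {k} → N ℕ.≤ k → N₁ ℕ.≤ k
      l₁ h = ℕ.m⊔n≤o⇒m≤o N₁ N₂ (ℕ.m⊔n≤o⇒m≤o (N₁ ℕ.⊔ N₂) (N₃ ℕ.⊔ N₄) h)
      l₂ : ∀ {k} → N ℕ.≤ k → N₂ ℕ.≤ k
      l₂ h = ℕ.m⊔n≤o⇒n≤o N₁ N₂ (ℕ.m⊔n≤o⇒m≤o (N₁ ℕ.⊔ N₂) (N₃ ℕ.⊔ N₄) h)
      l₃ : ∀ {k} → N ℕ.≤ k → N₃ ℕ.≤ k
      l₃ h = ℕ.m⊔n≤o⇒m≤o N₃ N₄ (ℕ.m⊔n≤o⇒n≤o (N₁ ℕ.⊔ N₂) (N₃ ℕ.⊔ N₄) h)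
      l₄ : ∀ {k} → N ℕ.≤ k → N₄ ℕ.≤ k
      l₄ h = ℕ.m⊔n≤o⇒n≤o N₃ N₄ (ℕ.m⊔n≤o⇒n≤o (N₁ ℕ.⊔ N₂) (N₃ ℕ.⊔ N₄) h)

cauchy-ordered : ∀ {s} →
  (∀ δ → 0ℚ < δ → ∃[ N ] (∀ j m → N ℕ.≤ m → ∣ s (j ℕ.+ m) - s m ∣ < δ)) → IsCauchy s
cauchy-ordered {s} h δ 0<δ with h δ 0<δ
... | N , b = N , λ m n N≤m N≤n → case-≤ m n N≤m N≤n (ℕ.≤-total m n)
  where
  case-≤ : ∀ m n → N ℕ.≤ m → N ℕ.≤ n → m ℕ.≤ n ⊎ n ℕ.≤ m → ∣ s m - s n ∣ < δ
  case-≤ m n N≤m N≤n (inj₁ m≤n) = subst (_< δ) (∣p-q∣≡∣q-p∣ (s n) (s m))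
    (subst (λ k → ∣ s k - s m ∣ < δ) (ℕ.m∸n+n≡m m≤n) (b (n ℕ.∸ m) m N≤m))
  case-≤ m n N≤m N≤n (inj₂ n≤m) =
    subst (λ k → ∣ s k - s n ∣ < δ) (ℕ.m∸n+n≡m n≤m) (b (m ℕ.∸ n) n N≤n)

partialSum : (ℕ → ℚ) → ℕ → ℚ
partialSum f zero    = 0ℚ
partialSum f (suc n) = partialSum f n + f n

dominated : ∀ {f u} → (∀ k → ∣ f k ∣ ≤ u k) → ∀ j m →
  ∣ partialSum f (j ℕ.+ m) - partialSum f m ∣ ≤ partialSum u (j ℕ.+ m) - partialSum u m
dominated {f} {u} h zero m = ≤-reflexive
  (trans (cong ∣_∣ (+-inverseʳ (partialSum f m))) (sym (+-inverseʳ (partialSum u m))))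
dominated {f} {u} h (suc j) m = begin
  ∣ (F + f k) - F₀ ∣       ≡⟨ cong ∣_∣ (solve 3 (λ a b c → (a :+ b) :- c := (a :- c) :+ b) refl F (f k) F₀) ⟩
  ∣ (F - F₀) + f k ∣       ≤⟨ ∣p+q∣≤∣p∣+∣q∣ (F - F₀) (f k) ⟩
  ∣ F - F₀ ∣ + ∣ f k ∣     ≤⟨ +-mono-≤ (dominated {f} {u} h j m) (h k) ⟩
  (U - U₀) + u k           ≡⟨ solve 3 (λ a b c → (a :- c) :+ b := (a :+ b) :- c) refl U (u k) U₀ ⟩
  (U + u k) - U₀           ∎
  where
  open ≤-Reasoning
  k = j ℕ.+ m
  F = partialSum f k
  F₀ = partialSum f m
  U = partialSum u k
  U₀ = partialSum u m

module RatioTest (u : ℕ → ℚ) (0≤u : ∀ k → 0ℚ ≤ u k) (c K : ℕ)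
  (ratio : ∀ k → K ℕ.≤ k → u (suc k) + recip c * u k ≤ u k) where

  private
    U = partialSum u

  decreasing : ∀ k → K ℕ.≤ k → u (suc k) ≤ u k
  decreasing k K≤k = ≤-trans
    (subst (_≤ u (suc k) + recip c * u k) (+-identityʳ (u (suc k)))
      (+-monoʳ-≤ (u (suc k)) (*-nonNeg (<⇒≤ (0<recip c)) (0≤u k))))
    (ratio k K≤k)

  telescope : ∀ j m → K ℕ.≤ m → recip c * (U (j ℕ.+ m) - U m) ≤ u m - u (j ℕ.+ m)
  telescope zero m K≤m = ≤-reflexive
    (solve 3 (λ r a b → r :* (a :- a) := b :- b) refl (recip c) (U m) (u m))
  telescope (suc j) m K≤m = begin
    r * ((U k + u k) - U m)        ≡⟨ solve 4 (λ r a b e → r :* ((a :+ b) :- e) := r :* (a :- e) :+ r :* b) refl r (U k) (u k) (U m) ⟩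
    r * (U k - U m) + r * u k      ≤⟨ +-mono-≤ (telescope j m K≤m) r*u≤ ⟩
    (u m - u k) + (u k - u (suc k)) ≡⟨ solve 3 (λ a b e → (a :- b) :+ (b :- e) := a :- e) refl (u m) (u k) (u (suc k)) ⟩
    u m - u (suc k)                ∎
    where
    open ≤-Reasoning
    k = j ℕ.+ m
    r = recip c
    r*u≤ : r * u k ≤ u k - u (suc k)
    r*u≤ = subst (_≤ u k - u (suc k))
      (solve 2 (λ a b → (a :+ b) :- a := b) refl (u (suc k)) (r * u k))
      (+-monoˡ-≤ (- u (suc k)) (ratio k (ℕ.≤-trans K≤m (ℕ.m≤n+m m j))))

  tail≤ : ∀ j m → K ℕ.≤ m → U (j ℕ.+ m) - U m ≤ ι (suc c) * u m
  tail≤ j m K≤m = begin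
    D                              ≡⟨ sym (*-identityˡ D) ⟩
    1ℚ * D                         ≡⟨ cong (_* D) (sym (ι*recip c)) ⟩
    ι (suc c) * recip c * D        ≡⟨ *-assoc (ι (suc c)) (recip c) D ⟩
    ι (suc c) * (recip c * D)      ≤⟨ *-monoʳ (ι (suc c)) (0≤ι (suc c)) (telescope j m K≤m) ⟩
    ι (suc c) * (u m - u (j ℕ.+ m)) ≤⟨ *-monoʳ (ι (suc c)) (0≤ι (suc c)) drop ⟩
    ι (suc c) * u m                ∎
    where
    open ≤-Reasoning
    D = U (j ℕ.+ m) - U m
    drop : u m - u (j ℕ.+ m) ≤ u m
    drop = subst (u m - u (j ℕ.+ m) ≤_) (+-identityʳ (u m))
      (+-monoʳ-≤ (u m) (neg-antimono-≤ (0≤u (j ℕ.+ m))))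

  j*u≤ : ∀ j → ι j * u (j ℕ.+ K) ≤ U (j ℕ.+ K) - U K
  j*u≤ zero    = ≤-reflexive (trans (*-zeroˡ (u K)) (sym (+-inverseʳ (U K))))
  j*u≤ (suc j) = begin
    ι (suc j) * u (suc k)      ≤⟨ *-monoʳ (ι (suc j)) (0≤ι (suc j)) (decreasing k (ℕ.m≤n+m K j)) ⟩
    ι (suc j) * u k            ≡⟨ cong (_* u k) (ι-suc j) ⟩
    (ι j + 1ℚ) * u k           ≡⟨ solve 2 (λ a b → (a :+ con 1ℚ) :* b := a :* b :+ b) refl (ι j) (u k) ⟩
    ι j * u k + u k            ≤⟨ +-monoˡ-≤ (u k) (j*u≤ j) ⟩
    (U k - U K) + u k          ≡⟨ solve 3 (λ a b e → (a :- e) :+ b := (a :+ b) :- e) refl (U k) (u k) (U K) ⟩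
    (U k + u k) - U K          ∎
    where
    open ≤-Reasoning
    k = j ℕ.+ K

  tail-small : ∀ δ → 0ℚ < δ → ∃[ N ] (∀ j m → N ℕ.≤ m → U (j ℕ.+ m) - U m < δ)
  tail-small δ 0<δ =
    let J , hJ = archimedean-< (ι (suc c) * (ι (suc c) * u K)) 0<δ
    in J ℕ.+ K , λ j m N≤m →
         ≤-<-trans (tail≤ j m (ℕ.≤-trans (ℕ.m≤n+m K J) N≤m)) (small J hJ m N≤m)
    where
    open ≤-Reasoning
    small : ∀ J → ι (suc c) * (ι (suc c) * u K) < ι J * δ →
            ∀ m → J ℕ.+ K ℕ.≤ m → ι (suc c) * u m < δ
    small J hJ m N≤m = *-cancelˡ-<-nonNeg (ι J) {{nonNegative (0≤ι J)}} (begin-strict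
      ι J * (ι (suc c) * u m)          ≡⟨ solve 3 (λ a b e → a :* (b :* e) := b :* (a :* e)) refl (ι J) (ι (suc c)) (u m) ⟩
      ι (suc c) * (ι J * u m)          ≤⟨ *-monoʳ (ι (suc c)) (0≤ι (suc c)) J*u≤ ⟩
      ι (suc c) * (ι (suc c) * u K)    <⟨ hJ ⟩
      ι J * δ                          ∎)
      where
      i = m ℕ.∸ K
      i+K≡m : i ℕ.+ K ≡ m
      i+K≡m = ℕ.m∸n+n≡m (ℕ.≤-trans (ℕ.m≤n+m K J) N≤m)
      J≤i : J ℕ.≤ i
      J≤i = ℕ.+-cancelʳ-≤ K J i (subst (J ℕ.+ K ℕ.≤_) (sym i+K≡m) N≤m)
      J*u≤ : ι J * u m ≤ ι (suc c) * u K
      J*u≤ = begin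
        ι J * u m               ≤⟨ *-monoˡ (u m) (0≤u m) (ι-mono-≤ J≤i) ⟩
        ι i * u m               ≡⟨ cong (λ t → ι i * u t) (sym i+K≡m) ⟩
        ι i * u (i ℕ.+ K)       ≤⟨ j*u≤ i ⟩
        U (i ℕ.+ K) - U K       ≤⟨ tail≤ i K ℕ.≤-refl ⟩
        ι (suc c) * u K         ∎

  cauchy : ∀ {f} → (∀ k → ∣ f k ∣ ≤ u k) → IsCauchy (partialSum f)
  cauchy {f} h = cauchy-ordered {partialSum f} λ δ 0<δ → let N , b = tail-small δ 0<δ in
    N , λ j m N≤m → ≤-<-trans (dominated {f} {u} h j m) (b j m N≤m)

record ℝ : Set where
  constructor mkℝ
  field
    seq    : ℕ → ℚ
    cauchy : IsCauchy seq

open ℝ public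

infix  4 _≃ᴿ_ _<ᴿ_ _≤ᴿ_ _#ᴿ_
infixl 6 _+ᴿ_ _-ᴿ_
infixl 7 _*ᴿ_
infix  8 -ᴿ_
infixr 8 _^ᴿ_

_≃ᴿ_ : ℝ → ℝ → Set
x ≃ᴿ y = ∀ δ → 0ℚ < δ → ∃[ N ] (∀ n → N ℕ.≤ n → ∣ seq x n - seq y n ∣ < δ)

_<ᴿ_ : ℝ → ℝ → Set
x <ᴿ y = ∃[ δ ] (0ℚ < δ × ∃[ N ] (∀ n → N ℕ.≤ n → δ < seq y n - seq x n))

_≤ᴿ_ : ℝ → ℝ → Set
x ≤ᴿ y = ¬ (y <ᴿ x)

-- Constructive form of x ≠ y.
_#ᴿ_ : ℝ → ℝ → Set
x #ᴿ y = x <ᴿ y ⊎ y <ᴿ x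

-- Only the sequences enter into _≃ᴿ_ and _<ᴿ_; the Cauchy proofs of the
-- operations are opaque to keep types involving reals small.
opaque
  const-cauchy : ∀ q → IsCauchy (λ _ → q)
  const-cauchy = cauchy-const

  +-cauchy : ∀ x y → IsCauchy (λ n → seq x n + seq y n)
  +-cauchy x y = cauchy-+ {seq x} {seq y} (cauchy x) (cauchy y)

  neg-cauchy : ∀ x → IsCauchy (λ n → - seq x n)
  neg-cauchy x = cauchy-neg {seq x} (cauchy x)

  *-cauchy : ∀ x y → IsCauchy (λ n → seq x n * seq y n)
  *-cauchy x y = cauchy-* {seq x} {seq y} (cauchy x) (cauchy y)

fromℚ : ℚ → ℝ
fromℚ q = mkℝ (λ _ → q) (const-cauchy q)

fromℤ : ℤ → ℝ
fromℤ z = fromℚ (z / 1)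

fromℕ : ℕ → ℝ
fromℕ n = fromℤ (+ n)

0ᴿ : ℝ
0ᴿ = fromℕ 0

_+ᴿ_ : ℝ → ℝ → ℝ
x +ᴿ y = mkℝ (λ n → seq x n + seq y n) (+-cauchy x y)

-ᴿ_ : ℝ → ℝ
-ᴿ x = mkℝ (λ n → - seq x n) (neg-cauchy x)

_-ᴿ_ : ℝ → ℝ → ℝ
x -ᴿ y = x +ᴿ (-ᴿ y)

_*ᴿ_ : ℝ → ℝ → ℝ
x *ᴿ y = mkℝ (λ n → seq x n * seq y n) (*-cauchy x y)

∑ : ∀ {n} → (Fin n → ℝ) → ℝ
∑ = V.foldr _+ᴿ_ 0ᴿ

-- expTerm x k = x ^ k / k !
expTerm : ℚ → ℕ → ℚ
expTerm x zero    = 1ℚ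
expTerm x (suc k) = expTerm x k * (x * recip k)

0≤expTerm : ∀ {x} → 0ℚ ≤ x → ∀ k → 0ℚ ≤ expTerm x k
0≤expTerm 0≤x zero    = <⇒≤ 1>0
0≤expTerm 0≤x (suc k) = *-nonNeg (0≤expTerm 0≤x k) (*-nonNeg 0≤x (<⇒≤ (0<recip k)))

∣recip∣ : ∀ k → ∣ recip k ∣ ≡ recip k
∣recip∣ k = 0≤p⇒∣p∣≡p (<⇒≤ (0<recip k))

∣expTerm∣≤ : ∀ {x b} → ∣ x ∣ ≤ b → ∀ k → ∣ expTerm x k ∣ ≤ expTerm b k
∣expTerm∣≤ h zero = ≤-refl
∣expTerm∣≤ {x} {b} h (suc k) = begin
  ∣ expTerm x k * (x * recip k) ∣          ≡⟨ ∣p*q∣≡∣p∣*∣q∣ (expTerm x k) (x * recip k) ⟩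
  ∣ expTerm x k ∣ * ∣ x * recip k ∣        ≡⟨ cong (∣ expTerm x k ∣ *_) (trans (∣p*q∣≡∣p∣*∣q∣ x (recip k)) (cong (∣ x ∣ *_) (∣recip∣ k))) ⟩
  ∣ expTerm x k ∣ * (∣ x ∣ * recip k)      ≤⟨ *-mono (*-nonNeg (0≤∣p∣ x) 0≤r) (0≤expTerm (≤-trans (0≤∣p∣ x) h) k)
                                                (∣expTerm∣≤ h k) (*-monoˡ (recip k) 0≤r h) ⟩
  expTerm b k * (b * recip k)              ∎
  where
  open ≤-Reasoning
  0≤r = <⇒≤ (0<recip k)

expTerm-lipschitz : ∀ {x y b} → ∣ x ∣ ≤ b → ∣ y ∣ ≤ b → ∀ k →
  ∣ expTerm x (suc k) - expTerm y (suc k) ∣ ≤ ∣ x - y ∣ * expTerm b k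
expTerm-lipschitz {x} {y} {b} hx hy zero = ≤-reflexive (begin
  ∣ 1ℚ * (x * 1ℚ) - 1ℚ * (y * 1ℚ) ∣  ≡⟨ cong ∣_∣ (solve 2 (λ a c → con 1ℚ :* (a :* con 1ℚ) :- con 1ℚ :* (c :* con 1ℚ) := a :- c) refl x y) ⟩
  ∣ x - y ∣                          ≡⟨ sym (*-identityʳ ∣ x - y ∣) ⟩
  ∣ x - y ∣ * 1ℚ                     ∎)
  where open ≡-Reasoning
expTerm-lipschitz {x} {y} {b} hx hy (suc k) = begin
  ∣ tx * (x * r) - ty * (y * r) ∣
    ≡⟨ cong ∣_∣ (solve 5 (λ t a s c r → t :* (a :* r) :- s :* (c :* r) := r :* ((t :- s) :* a :+ s :* (a :- c))) refl tx x ty y r) ⟩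
  ∣ r * ((tx - ty) * x + ty * (x - y)) ∣
    ≡⟨ trans (∣p*q∣≡∣p∣*∣q∣ r _) (cong (_* ∣ (tx - ty) * x + ty * (x - y) ∣) (∣recip∣ (suc k))) ⟩
  r * ∣ (tx - ty) * x + ty * (x - y) ∣
    ≤⟨ *-monoʳ r 0≤r (∣p+q∣≤∣p∣+∣q∣ ((tx - ty) * x) (ty * (x - y))) ⟩
  r * (∣ (tx - ty) * x ∣ + ∣ ty * (x - y) ∣)
    ≡⟨ cong (r *_) (cong₂ _+_ (∣p*q∣≡∣p∣*∣q∣ (tx - ty) x) (∣p*q∣≡∣p∣*∣q∣ ty (x - y))) ⟩
  r * (∣ tx - ty ∣ * ∣ x ∣ + ∣ ty ∣ * ∣ x - y ∣)
    ≤⟨ *-monoʳ r 0≤r (+-mono-≤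
         (*-mono (0≤∣p∣ x) (*-nonNeg (0≤∣p∣ (x - y)) (0≤expTerm 0≤b k)) (expTerm-lipschitz hx hy k) hx)
         (*-monoˡ ∣ x - y ∣ (0≤∣p∣ (x - y)) (∣expTerm∣≤ hy (suc k)))) ⟩
  r * (D * tb * b + tb * (b * r′) * D)
    ≡⟨ cong (λ t → r * (D * tb * t + tb * (b * r′) * D)) b≡ ⟩
  r * (D * tb * (ι (suc k) * (b * r′)) + tb * (b * r′) * D)
    ≡⟨ solve 5 (λ r d t i e → r :* (d :* t :* (i :* e) :+ t :* e :* d) := (i :+ con 1ℚ) :* r :* (d :* (t :* e))) refl r D tb (ι (suc k)) (b * r′) ⟩
  (ι (suc k) + 1ℚ) * r * (D * (tb * (b * r′)))
    ≡⟨ cong (_* (D * (tb * (b * r′)))) (trans (cong (_* r) (sym (ι-suc (suc k)))) (ι*recip (suc k))) ⟩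
  1ℚ * (D * (tb * (b * r′)))
    ≡⟨ *-identityˡ _ ⟩
  D * (tb * (b * r′)) ∎
  where
  open ≤-Reasoning
  tx = expTerm x (suc k)
  ty = expTerm y (suc k)
  tb = expTerm b k
  D  = ∣ x - y ∣
  r  = recip (suc k)
  r′ = recip k
  0≤r = <⇒≤ (0<recip (suc k))
  0≤b = ≤-trans (0≤∣p∣ x) hx
  b≡ : b ≡ ι (suc k) * (b * r′)
  b≡ = trans (sym (*-identityʳ b)) (trans (cong (b *_) (sym (ι*recip k)))
         (solve 3 (λ a i e → a :* (i :* e) := i :* (a :* e)) refl b (ι (suc k)) r′))

expSum-lipschitz : ∀ {x y b} → ∣ x ∣ ≤ b → ∣ y ∣ ≤ b → ∀ n →
  ∣ partialSum (expTerm x) (suc n) - partialSum (expTerm y) (suc n) ∣ ≤ ∣ x - y ∣ * partialSum (expTerm b) n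
expSum-lipschitz {x} {y} hx hy zero = ≤-reflexive (sym (*-zeroʳ ∣ x - y ∣))
expSum-lipschitz {x} {y} {b} hx hy (suc n) = begin
  ∣ (X + tx) - (Y + ty) ∣            ≡⟨ cong ∣_∣ (solve 4 (λ a c e f → (a :+ c) :- (e :+ f) := (a :- e) :+ (c :- f)) refl X tx Y ty) ⟩
  ∣ (X - Y) + (tx - ty) ∣            ≤⟨ ∣p+q∣≤∣p∣+∣q∣ (X - Y) (tx - ty) ⟩
  ∣ X - Y ∣ + ∣ tx - ty ∣            ≤⟨ +-mono-≤ (expSum-lipschitz hx hy n) (expTerm-lipschitz hx hy n) ⟩
  D * B + D * expTerm b n            ≡⟨ sym (*-distribˡ-+ D B (expTerm b n)) ⟩
  D * (B + expTerm b n)              ∎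
  where
  open ≤-Reasoning
  X = partialSum (expTerm x) (suc n)
  Y = partialSum (expTerm y) (suc n)
  tx = expTerm x (suc n)
  ty = expTerm y (suc n)
  B = partialSum (expTerm b) n
  D = ∣ x - y ∣

module ExpBound (M : ℕ) where

  u : ℕ → ℚ
  u = expTerm (ι M)

  0≤u : ∀ k → 0ℚ ≤ u k
  0≤u = 0≤expTerm (0≤ι M)

  ι-double : ∀ m n → ι (m ℕ.+ n) ≡ ι m + ι n
  ι-double zero    n = sym (+-identityˡ (ι n))
  ι-double (suc m) n = trans (ι-suc (m ℕ.+ n)) (trans (cong (_+ 1ℚ) (ι-double m n))
    (trans (solve 3 (λ a b c → (a :+ b) :+ c := (a :+ c) :+ b) refl (ι m) (ι n) 1ℚ)
      (cong (_+ ι n) (sym (ι-suc m)))))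

  ratio : ∀ k → M ℕ.+ M ℕ.≤ k → u (suc k) + recip 1 * u k ≤ u k
  ratio k 2M≤k = begin
    u k * (ι M * recip k) + ½ * u k              ≡⟨ solve 2 (λ a b → a :* b :+ con ½ :* a := a :* (con ½ :* (b :+ b) :+ con ½)) refl (u k) (ι M * recip k) ⟩
    u k * (½ * (ι M * recip k + ι M * recip k) + ½) ≤⟨ *-monoʳ (u k) (0≤u k) (+-monoˡ-≤ ½ (*-monoʳ ½ (<⇒≤ ½>0) 2Mr≤1)) ⟩
    u k * 1ℚ                                     ≡⟨ *-identityʳ (u k) ⟩
    u k                                          ∎
    where
    open ≤-Reasoning
    2Mr≤1 : ι M * recip k + ι M * recip k ≤ 1ℚ
    2Mr≤1 = subst₂ _≤_
      (trans (cong (_* recip k) (ι-double M M)) (*-distribʳ-+ (recip k) (ι M) (ι M)))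
      (ι*recip k)
      (*-monoˡ (recip k) (<⇒≤ (0<recip k)) (ι-mono-≤ (ℕ.m≤n⇒m≤1+n 2M≤k)))

  open RatioTest u 0≤u 1 (M ℕ.+ M) ratio public

expSeq : (ℕ → ℚ) → ℕ → ℚ
expSeq s n = partialSum (expTerm (s n)) (suc n)

cauchy-exp : ∀ {s} → IsCauchy s → IsCauchy (expSeq s)
cauchy-exp {s} cs = let M , N₁ , hM = cauchy-bounded {s} cs in cauchy-ordered {expSeq s} (Main.main M N₁ hM)
  where
  module Main (M N₁ : ℕ) (hM : ∀ n → N₁ ℕ.≤ n → ∣ s n ∣ ≤ ι (suc M)) where
    open ExpBound (suc M) using (u; 0≤u; tail-small) renaming (cauchy to cauchy-u)
    cu : IsCauchy (partialSum u)
    cu = cauchy-u {u} (λ k → ≤-reflexive (0≤p⇒∣p∣≡p (0≤u k)))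
    main : ∀ δ → 0ℚ < δ → ∃[ N ] (∀ j m → N ℕ.≤ m → ∣ expSeq s (j ℕ.+ m) - expSeq s m ∣ < δ)
    main δ 0<δ =
      let B , N₂ , hB = cauchy-bounded {partialSum u} cu
          N₃ , ht = tail-small (δ * ½) (*-pos 0<δ ½>0)
          N₄ , hs = cs (δ * ½ * recip B) (*-pos (*-pos 0<δ ½>0) (0<recip B))
          open Bound B N₂ hB N₃ ht N₄ hs
      in N , bound
      where
      module Bound
        (B N₂ : ℕ) (hB : ∀ n → N₂ ℕ.≤ n → ∣ partialSum u n ∣ ≤ ι (suc B))
        (N₃ : ℕ) (ht : ∀ j m → N₃ ℕ.≤ m → partialSum u (j ℕ.+ m) - partialSum u m < δ * ½)
        (N₄ : ℕ) (hs : ∀ m n → N₄ ℕ.≤ m → N₄ ℕ.≤ n → ∣ s m - s n ∣ < δ * ½ * recip B) where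
        N = (N₁ ℕ.⊔ N₂) ℕ.⊔ (N₃ ℕ.⊔ N₄)
        bound : ∀ j m → N ℕ.≤ m → ∣ expSeq s (j ℕ.+ m) - expSeq s m ∣ < δ
        bound j m N≤m = begin-strict
          ∣ S x (suc n) - S y (suc m) ∣
            ≤⟨ triangle (S x (suc n)) (S x (suc m)) (S y (suc m)) ⟩
          ∣ S x (suc n) - S x (suc m) ∣ + ∣ S x (suc m) - S y (suc m) ∣
            <⟨ +-mono-< truncation perturbation ⟩
          δ * ½ + δ * ½
            ≡⟨ ½+½ δ ⟩
          δ ∎
          where
          open ≤-Reasoning
          n = j ℕ.+ m
          x = s n
          y = s m
          S : ℚ → ℕ → ℚ
          S z = partialSum (expTerm z)
          N₁₂≤m = ℕ.m⊔n≤o⇒m≤o (N₁ ℕ.⊔ N₂) (N₃ ℕ.⊔ N₄) N≤m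
          N₃₄≤m = ℕ.m⊔n≤o⇒n≤o (N₁ ℕ.⊔ N₂) (N₃ ℕ.⊔ N₄) N≤m
          N₁≤m = ℕ.m⊔n≤o⇒m≤o N₁ N₂ N₁₂≤m
          N₂≤m = ℕ.m⊔n≤o⇒n≤o N₁ N₂ N₁₂≤m
          N₃≤m = ℕ.m⊔n≤o⇒m≤o N₃ N₄ N₃₄≤m
          N₄≤m = ℕ.m⊔n≤o⇒n≤o N₃ N₄ N₃₄≤m
          hx = hM n (ℕ.≤-trans N₁≤m (ℕ.m≤n+m m j))
          hy = hM m N₁≤m
          truncation : ∣ S x (suc n) - S x (suc m) ∣ < δ * ½
          truncation = subst (λ t → ∣ S x t - S x (suc m) ∣ < δ * ½) (ℕ.+-suc j m)
            (≤-<-trans (dominated {expTerm x} {u} (∣expTerm∣≤ hx) j (suc m)) (ht j (suc m) (ℕ.m≤n⇒m≤1+n N₃≤m)))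
          perturbation : ∣ S x (suc m) - S y (suc m) ∣ < δ * ½
          perturbation = begin-strict
            ∣ S x (suc m) - S y (suc m) ∣          ≤⟨ expSum-lipschitz hx hy m ⟩
            ∣ x - y ∣ * partialSum u m             ≤⟨ *-monoʳ ∣ x - y ∣ (0≤∣p∣ (x - y)) (≤-trans (p≤∣p∣ _) (hB m N₂≤m)) ⟩
            ∣ x - y ∣ * ι (suc B)                  ≡⟨ *-comm ∣ x - y ∣ (ι (suc B)) ⟩
            ι (suc B) * ∣ x - y ∣                  <⟨ share B (*-pos 0<δ ½>0) (hs n m (ℕ.≤-trans N₄≤m (ℕ.m≤n+m m j)) N₄≤m) ⟩
            δ * ½                                  ∎

opaque
  exp-cauchy : ∀ x → IsCauchy (expSeq (seq x))
  exp-cauchy x = cauchy-exp {seq x} (cauchy x)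

-- The n-th approximation of exp x is the sum of xₙ ^ k / k ! over k ≤ n.
exp : ℝ → ℝ
exp x = mkℝ (expSeq (seq x)) (exp-cauchy x)

infixr 8 _^ℚ_

_^ℚ_ : ℚ → ℕ → ℚ
y ^ℚ zero    = 1ℚ
y ^ℚ (suc k) = y ^ℚ k * y

logTerm : ℚ → ℕ → ℚ
logTerm y k = y ^ℚ suc k * recip k

cauchy-log : ∀ c y → 0ℚ ≤ y → y + recip c ≡ 1ℚ → IsCauchy (partialSum (logTerm y))
cauchy-log c y 0≤y y+r≡1 = RatioTest.cauchy (logTerm y) 0≤u c 0 ratio {logTerm y}
  (λ k → ≤-reflexive (0≤p⇒∣p∣≡p (0≤u k)))
  where
  0≤y^ : ∀ k → 0ℚ ≤ y ^ℚ k
  0≤y^ zero    = <⇒≤ 1>0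
  0≤y^ (suc k) = *-nonNeg (0≤y^ k) 0≤y
  0≤u : ∀ k → 0ℚ ≤ logTerm y k
  0≤u k = *-nonNeg (0≤y^ (suc k)) (<⇒≤ (0<recip k))
  ratio : ∀ k → 0 ℕ.≤ k → logTerm y (suc k) + recip c * logTerm y k ≤ logTerm y k
  ratio k _ = begin
    g * y * recip (suc k) + recip c * (g * recip k)
      ≤⟨ +-monoˡ-≤ (recip c * (g * recip k)) (*-monoʳ (g * y) (0≤y^ (suc (suc k))) (recip-anti k)) ⟩
    g * y * recip k + recip c * (g * recip k)
      ≡⟨ solve 4 (λ g y s r → g :* y :* r :+ s :* (g :* r) := (y :+ s) :* (g :* r)) refl g y (recip c) (recip k) ⟩
    (y + recip c) * (g * recip k)
      ≡⟨ trans (cong (_* (g * recip k)) y+r≡1) (*-identityˡ (g * recip k)) ⟩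
    g * recip k ∎
    where
    open ≤-Reasoning
    g = y ^ℚ suc k

recip≤1 : ∀ k → recip k ≤ 1ℚ
recip≤1 zero    = ≤-refl
recip≤1 (suc k) = ≤-trans (recip-anti k) (recip≤1 k)

p≤q⇒0≤q-p : ∀ {p q} → p ≤ q → 0ℚ ≤ q - p
p≤q⇒0≤q-p {p} {q} p≤q = subst (_≤ q - p) (+-inverseʳ p) (+-monoˡ-≤ (- p) p≤q)

p-q+q≡p : ∀ p q → p - q + q ≡ p
p-q+q≡p = solve 2 (λ a b → a :- b :+ b := a) refl

opaque
  log-cauchy : ∀ c → IsCauchy (partialSum (logTerm (1ℚ - recip c)))
  log-cauchy c = cauchy-log c (1ℚ - recip c)
    (p≤q⇒0≤q-p {recip c} {1ℚ} (recip≤1 c)) (p-q+q≡p 1ℚ (recip c))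

-- log d = - log (1 - y) = Σ_{k ≥ 1} y ^ k / k   with y = 1 - 1 / d.
log : (d : ℕ) .{{_ : ℕ.NonZero d}} → ℝ
log (suc c) = mkℝ (partialSum (logTerm (1ℚ - recip c))) (log-cauchy c)

_^ᴿ_ : (d : ℕ) .{{_ : ℕ.NonZero d}} → ℝ → ℝ
d ^ᴿ s = exp (s *ᴿ log d)

ℝ^_ : ℕ → Set
ℝ^ d = Fin d → ℝ

ℤ^_ : ℕ → Set
ℤ^ d = Fin d → ℤ

toℝ^ : ∀ {d} → ℤ^ d → ℝ^ d
toℝ^ v i = fromℤ (v i)

-- A discrete subgroup Λ of rank d of a Euclidean space is generated over ℤ by
-- vectors b₁ , … , b_d that are linearly independent over ℝ.  In coordinates
-- with respect to such a basis Λ is ℤ^ d, and the Euclidean space Λ ⊗ ℝ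
-- spanned by it is ℝ^ d with the scalar product of Gram matrix ⟨ bᵢ , bⱼ ⟩.
record Lattice (d : ℕ) : Set where
  field
    gram : Fin d → Fin d → ℝ

  -- Scalar product of Λ ⊗ ℝ; ⟨_,_⟩ below is its restriction to Λ.
  ⟪_,_⟫ : ℝ^ d → ℝ^ d → ℝ
  ⟪ x , y ⟫ = ∑ λ i → ∑ λ j → x i *ᴿ gram i j *ᴿ y j

  field
    symmetric        : ∀ i j → gram i j ≃ᴿ gram j i
    positiveDefinite : ∀ x → (∃[ i ] x i #ᴿ 0ᴿ) → 0ᴿ <ᴿ ⟪ x , x ⟫

  ⟨_,_⟩ : ℤ^ d → ℤ^ d → ℝ
  ⟨ v , w ⟩ = ⟪ toℝ^ v , toℝ^ w ⟫

NonZeroVector : ∀ {d} → ℤ^ d → Set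
NonZeroVector v = ∃[ i ] v i ≢ + 0

-- Elements of (Λ ⊗ ℝ) ⊗ (Λ ⊗ ℝ) are the d × d matrices of their coefficients
-- in the basis bᵢ ⊗ bⱼ.
Tensor : ℕ → Set
Tensor d = Fin d → Fin d → ℝ

IsSymmetric : ∀ {d} → Tensor d → Set
IsSymmetric t = ∀ i j → t i j ≃ᴿ t j i

_⊗_ : ∀ {d} → ℝ^ d → ℝ^ d → Tensor d
(x ⊗ y) i j = x i *ᴿ y j

module _ {d : ℕ} (Λ : Lattice d) where
  open Lattice Λ

  IsMinimal : ℤ^ d → Set
  IsMinimal v = NonZeroVector v × (∀ w → NonZeroVector w → ⟨ v , v ⟩ ≤ᴿ ⟨ w , w ⟩)

  IsPerfect : Set
  IsPerfect = ∀ (t : Tensor d) → IsSymmetric t →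
    ∃[ m ] Σ[ v ∈ (Fin m → ℤ^ d) ] Σ[ c ∈ (Fin m → ℝ) ]
      (∀ k → IsMinimal (v k)) ×
      (∀ i j → t i j ≃ᴿ ∑ λ k → c k *ᴿ (toℝ^ (v k) ⊗ toℝ^ (v k)) i j)

  IsIntegral : Set
  IsIntegral = ∀ v w → ∃[ z ] ⟨ v , w ⟩ ≃ᴿ fromℤ z

  -- gcd = 1: no natural number other than 1 divides all scalar products
  -- (0 included, so that the zero form is not primitive).
  IsPrimitive : Set
  IsPrimitive = ∀ (k : ℕ) → (∀ v w z → ⟨ v , w ⟩ ≃ᴿ fromℤ z → (+ k) ℤ.∣ z) → k ≡ 1

ℤ^-rawGroup : ℕ → RawGroup 0ℓ 0ℓ
ℤ^-rawGroup d = record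
  { Carrier = ℤ^ d
  ; _≈_     = _≗_
  ; _∙_     = λ v w i → v i ℤ.+ w i
  ; ε       = λ _ → + 0
  ; _⁻¹     = λ v i → ℤ.- v i
  }

record _≅_ {d : ℕ} (Λ Λ′ : Lattice d) : Set where
  open GroupMorphisms (ℤ^-rawGroup d) (ℤ^-rawGroup d) using (IsGroupIsomorphism)
  field
    to                 : ℤ^ d → ℤ^ d
    isGroupIsomorphism : IsGroupIsomorphism to
    isometric          : ∀ v w → Lattice.⟨_,_⟩ Λ′ (to v) (to w) ≃ᴿ Lattice.⟨_,_⟩ Λ v w

record PerfectPrimitiveLattice (d : ℕ) : Set where
  field
    lattice     : Lattice d
    isPerfect   : IsPerfect lattice
    isIntegral  : IsIntegral lattice
    isPrimitive : IsPrimitive lattice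

open PerfectPrimitiveLattice using (lattice)

_≅ₚ_ : ∀ {d} → PerfectPrimitiveLattice d → PerfectPrimitiveLattice d → Set
Λ ≅ₚ Λ′ = lattice Λ ≅ lattice Λ′

-- Injectivity up to _≅ₚ_ says that the n representatives are pairwise
-- non-isomorphic, surjectivity that every isomorphism class is represented.
IsNumberOfClasses : (d n : ℕ) → Set
IsNumberOfClasses d n = Σ[ r ∈ (Fin n → PerfectPrimitiveLattice d) ] Bijective _≡_ _≅ₚ_ r

{-# OPTIONS --safe #-}

-- A lattice is handled through its Gram matrix g, and perfection says that g is
-- determined up to scaling by its minimal vectors.  In a basis produced by
-- reduction theory, Dirichlet's theorem on simultaneous approximation bounds the
-- coordinates of minimal vectors by B = 2 (2 d²)^d; hence there are finitely many
-- classes.  Rounding g with precision d² B² determines the minimal vectors up to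
-- their residues modulo 4, so there are at most exp (O (d³ log d)) classes.
--
-- For the lower bound let H consist of 0, …, m and of one element of each of k
-- pairs of integers beyond a gap at m + 1, where k is proportional to d, and
-- consider the X ∈ ℤ^(d+2) with Σ Xᵢ = Σ Hᵢ Xᵢ = 0.  The vectors
-- e_a + e_b − e_c − e_f with H_a + H_b = H_c + H_f are minimal and make this
-- lattice perfect and primitive.  A linear functional whose square is at most the
-- norm is a multiple of a coordinate; therefore isometries permute the coordinates
-- up to sign, H is an isometry invariant, and there are 2^k classes.

module Submission where

open import Defs
open import Algebra.Bundles using (CommutativeRing)
open import Algebra.Morphism.Structures using (module GroupMorphisms)
import Algebra.Properties.Semiring.Sum as SemiringSum
open import Data.Empty using (⊥-elim)
open import Data.Fin.Base as F using (Fin; zero; suc; toℕ)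
open import Data.Fin.Permutation using (Permutation; permutation)
import Data.Fin.Properties as F
open import Data.Integer.Base as ℤ using (ℤ; +_; -[1+_])
import Data.Integer.DivMod as ℤ
import Data.Integer.Divisibility.Signed as ℤˢ
import Data.Integer.Properties as ℤ
import Data.Integer.Solver as ℤ
open import Data.List.Base as List using (List; []; _∷_; _++_; length)
open import Data.List.Membership.Propositional using (_∈_; find; lose)
import Data.List.Membership.Propositional.Properties as ∈
open import Data.List.Relation.Unary.Any using (Any; here; there; any?; index)
open import Data.List.Relation.Unary.Any.Properties using (lookup-index)
open import Data.Nat.Base as ℕ using (ℕ; zero; suc; z≤n; s≤s)
import Data.Nat.DivMod as ℕ
import Data.Nat.Divisibility as ℕ
import Data.Nat.GCD as ℕ
import Data.Nat.Properties as ℕ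
import Data.Nat.Solver as ℕ
open import Data.Product.Base using (Σ; Σ-syntax; ∃-syntax; _×_; _,_; proj₁; proj₂)
open import Data.Rational.Solver using (module +-*-Solver)
import Data.Rational.Unnormalised.Base as ℚᵘ
import Data.Rational.Unnormalised.Properties as ℚᵘ
open import Data.Sum.Base using (_⊎_; inj₁; inj₂)
open import Function.Base using (_∘_; case_of_)
import Level
open import Relation.Binary.Definitions using (tri<; tri≈; tri>)
open import Relation.Binary.PropositionalEquality
open import Relation.Nullary using (¬_; Dec; yes; no; contradiction)
open import Relation.Nullary.Decidable using (map′; _×-dec_; ¬?)

-- The class number has to be computed, not only bounded, so positivity, minimality, perfection and
-- isometry are made decidable. This works because the Gram matrices are integral: the relevant
-- scalar products converge to rationals, and `lagrange` and `symGauss` are dichotomies that return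
-- a witness in either case. Listing all tuples of d² vectors with coordinates at most B yields the
-- exact number, but its size is only exp (O (d⁴ log d)); hence the separate injection into codes.
-- There the rounded Gram matrix costs d² entries of O(d log d) bits, and the residues cost 2 bits
-- for each of d³ coordinates. In the lower bound, the condition Σ Xᵢ = 0 alone would give a root
-- lattice of minimum 2. The second condition, with pairwise distinct heights, removes the vectors
-- e_a - e_b and raises the minimum to 4, so that minimal vectors record additive relations in H.
-- The pairs keep the dimension fixed while each contributes one free bit, and the gap prevents H
-- from being confused with its reflection.

module PerfectLattices where

  open import Data.Rational.Base
  open import Data.Rational.Properties
  open +-*-Solver using (solve; _:=_; _:+_; _:*_; _:-_; :-_; con)
  module ΣQ = SemiringSum (CommutativeRing.semiring +-*-commutativeRing)
  module ΣZ = SemiringSum (CommutativeRing.semiring ℤ.+-*-commutativeRing)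
  open ΣQ using (sum)
  open ΣZ using () renaming (sum to sumᶻ)
  open ℤ.+-*-Solver using () renaming (solve to solveᶻ; _:=_ to infix 4 _≐_; _:+_ to infixl 6 _⊕_; _:*_ to infixl 7 _⊛_; _:-_ to infixl 6 _⊖_; :-_ to infix 8 ⊝_; con to conᶻ)
  open ℕ.+-*-Solver using () renaming (solve to solveⁿ; _:=_ to infix 4 _≗′_; _:+_ to infixl 6 _⊞_; _:*_ to infixl 7 _⊗ⁿ_; con to conⁿ)

  -- Finite sums and quadratic forms over ℚ.

  ⟦_⟧ : ℤ → ℚ
  ⟦ z ⟧ = z / 1

  toℚᵘ-⟦⟧ : ∀ z → toℚᵘ ⟦ z ⟧ ℚᵘ.≃ ℚᵘ.mkℚᵘ z 0
  toℚᵘ-⟦⟧ z = toℚᵘ-fromℚᵘ (ℚᵘ.mkℚᵘ z 0)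

  ⟦⟧-+ : ∀ x y → ⟦ x ℤ.+ y ⟧ ≡ ⟦ x ⟧ + ⟦ y ⟧
  ⟦⟧-+ x y = toℚᵘ-injective (begin
    toℚᵘ ⟦ x ℤ.+ y ⟧                    ≈⟨ toℚᵘ-⟦⟧ (x ℤ.+ y) ⟩
    ℚᵘ.mkℚᵘ (x ℤ.+ y) 0                 ≈⟨ ℚᵘ.*≡* (cong (ℤ._* + 1) (sym (cong₂ ℤ._+_ (ℤ.*-identityʳ x) (ℤ.*-identityʳ y)))) ⟩
    ℚᵘ.mkℚᵘ x 0 ℚᵘ.+ ℚᵘ.mkℚᵘ y 0        ≈⟨ ℚᵘ.+-cong (ℚᵘ.≃-sym (toℚᵘ-⟦⟧ x)) (ℚᵘ.≃-sym (toℚᵘ-⟦⟧ y)) ⟩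
    toℚᵘ ⟦ x ⟧ ℚᵘ.+ toℚᵘ ⟦ y ⟧          ≈⟨ ℚᵘ.≃-sym (toℚᵘ-homo-+ ⟦ x ⟧ ⟦ y ⟧) ⟩
    toℚᵘ (⟦ x ⟧ + ⟦ y ⟧)                ∎)
    where open ℚᵘ.≃-Reasoning

  ⟦⟧-* : ∀ x y → ⟦ x ℤ.* y ⟧ ≡ ⟦ x ⟧ * ⟦ y ⟧
  ⟦⟧-* x y = toℚᵘ-injective (begin
    toℚᵘ ⟦ x ℤ.* y ⟧                    ≈⟨ toℚᵘ-⟦⟧ (x ℤ.* y) ⟩
    ℚᵘ.mkℚᵘ (x ℤ.* y) 0                 ≈⟨ ℚᵘ.*≡* refl ⟩
    ℚᵘ.mkℚᵘ x 0 ℚᵘ.* ℚᵘ.mkℚᵘ y 0        ≈⟨ ℚᵘ.*-cong (ℚᵘ.≃-sym (toℚᵘ-⟦⟧ x)) (ℚᵘ.≃-sym (toℚᵘ-⟦⟧ y)) ⟩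
    toℚᵘ ⟦ x ⟧ ℚᵘ.* toℚᵘ ⟦ y ⟧          ≈⟨ ℚᵘ.≃-sym (toℚᵘ-homo-* ⟦ x ⟧ ⟦ y ⟧) ⟩
    toℚᵘ (⟦ x ⟧ * ⟦ y ⟧)                ∎)
    where open ℚᵘ.≃-Reasoning

  ⟦⟧-injective : ∀ {x y} → ⟦ x ⟧ ≡ ⟦ y ⟧ → x ≡ y
  ⟦⟧-injective {x} {y} eq with fromℚᵘ-injective {ℚᵘ.mkℚᵘ x 0} {ℚᵘ.mkℚᵘ y 0} eq
  ... | ℚᵘ.*≡* e = trans (sym (ℤ.*-identityʳ x)) (trans e (ℤ.*-identityʳ y))

  ⟦⟧-neg : ∀ x → ⟦ ℤ.- x ⟧ ≡ - ⟦ x ⟧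
  ⟦⟧-neg x = begin
    ⟦ ℤ.- x ⟧                        ≡⟨ solve 2 (λ a b → a := (b :+ a) :+ :- b) refl ⟦ ℤ.- x ⟧ ⟦ x ⟧ ⟩
    (⟦ x ⟧ + ⟦ ℤ.- x ⟧) + - ⟦ x ⟧    ≡⟨ cong (_+ - ⟦ x ⟧) (trans (sym (⟦⟧-+ x (ℤ.- x))) (cong ⟦_⟧ (ℤ.+-inverseʳ x))) ⟩
    0ℚ + - ⟦ x ⟧                     ≡⟨ +-identityˡ _ ⟩
    - ⟦ x ⟧                          ∎
    where open ≡-Reasoning

  ⟦⟧-- : ∀ x y → ⟦ x ℤ.- y ⟧ ≡ ⟦ x ⟧ - ⟦ y ⟧
  ⟦⟧-- x y = trans (⟦⟧-+ x (ℤ.- y)) (cong (_+_ ⟦ x ⟧) (⟦⟧-neg y))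

  ⟦⟧-mono-≤ : ∀ {x y} → x ℤ.≤ y → ⟦ x ⟧ ≤ ⟦ y ⟧
  ⟦⟧-mono-≤ {x} {y} x≤y = toℚᵘ-cancel-≤
    (ℚᵘ.≤-respˡ-≃ (ℚᵘ.≃-sym (toℚᵘ-⟦⟧ x)) (ℚᵘ.≤-respʳ-≃ (ℚᵘ.≃-sym (toℚᵘ-⟦⟧ y))
      (ℚᵘ.*≤* (ℤ.*-monoʳ-≤-nonNeg (+ 1) x≤y))))

  ⟦⟧-mono-< : ∀ {x y} → x ℤ.< y → ⟦ x ⟧ < ⟦ y ⟧
  ⟦⟧-mono-< x<y = ≤∧≢⇒< (⟦⟧-mono-≤ (ℤ.<⇒≤ x<y)) λ eq → ℤ.<⇒≢ x<y (⟦⟧-injective eq)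
    where
    ≤∧≢⇒< : ∀ {p q} → p ≤ q → p ≢ q → p < q
    ≤∧≢⇒< {p} {q} p≤q p≢q with <-cmp p q
    ... | tri< a _ _ = a
    ... | tri≈ _ b _ = contradiction b p≢q
    ... | tri> _ _ c = contradiction (≤-antisym p≤q (<⇒≤ c)) p≢q

  ⟦⟧-cancel-≤ : ∀ {x y} → ⟦ x ⟧ ≤ ⟦ y ⟧ → x ℤ.≤ y
  ⟦⟧-cancel-≤ {x} {y} h with x ℤ.≤? y
  ... | yes p = p
  ... | no ¬p = contradiction (<-≤-trans (⟦⟧-mono-< (ℤ.≰⇒> ¬p)) h) (<-irrefl refl)

  ≤-by : ∀ {p q} r → 0ℚ ≤ r → p + r ≡ q → p ≤ q
  ≤-by {p} r 0≤r eq = subst₂ _≤_ (+-identityʳ p) eq (+-monoʳ-≤ p 0≤r)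

  <-by : ∀ {p q} r → 0ℚ < r → p + r ≡ q → p < q
  <-by {p} r 0<r eq = subst₂ _<_ (+-identityʳ p) eq (+-monoʳ-< p 0<r)

  +-nonNeg : ∀ {p q} → 0ℚ ≤ p → 0ℚ ≤ q → 0ℚ ≤ p + q
  +-nonNeg {p} {q} 0≤p 0≤q = subst (_≤ p + q) (+-identityˡ 0ℚ) (+-mono-≤ 0≤p 0≤q)

  p<q⇒0<q-p : ∀ {p q} → p < q → 0ℚ < q - p
  p<q⇒0<q-p {p} {q} p<q = subst (_< q - p) (+-inverseʳ p) (+-monoˡ-< (- p) p<q)

  square : ∀ p → 0ℚ ≤ p * p
  square p with ≤-total 0ℚ p
  ... | inj₁ 0≤p = *-nonNeg 0≤p 0≤p
  ... | inj₂ p≤0 = subst (0ℚ ≤_) (solve 1 (λ a → :- a :* :- a := a :* a) refl p)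
                     (*-nonNeg (neg-antimono-≤ p≤0) (neg-antimono-≤ p≤0))

  square-pos : ∀ {p} → p ≢ 0ℚ → 0ℚ < p * p
  square-pos {p} p≢0 with <-cmp 0ℚ p
  ... | tri< a _ _ = *-pos a a
  ... | tri≈ _ b _ = contradiction (sym b) p≢0
  ... | tri> _ _ c = subst (0ℚ <_) (solve 1 (λ a → :- a :* :- a := a :* a) refl p)
                       (*-pos (neg-antimono-< c) (neg-antimono-< c))

  recip-cancel : ∀ {p q} → p ≢ 0ℚ → p * q ≡ 0ℚ → q ≡ 0ℚ
  recip-cancel {p} {q} p≢0 eq = begin
    q                     ≡⟨ sym (*-identityˡ q) ⟩
    1ℚ * q                ≡⟨ cong (_* q) (sym (*-inverseˡ p)) ⟩
    (1/ p) * p * q        ≡⟨ *-assoc (1/ p) p q ⟩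
    (1/ p) * (p * q)      ≡⟨ cong ((1/ p) *_) eq ⟩
    (1/ p) * 0ℚ           ≡⟨ *-zeroʳ (1/ p) ⟩
    0ℚ                    ∎
    where
    open ≡-Reasoning
    instance _ = ≢-nonZero p≢0

  p-q≡0⇒p≡q : ∀ p q → p - q ≡ 0ℚ → p ≡ q
  p-q≡0⇒p≡q p q eq = trans (sym (p-q+q≡p p q)) (trans (cong (_+ q) eq) (+-identityˡ q))

  *-cancel : ∀ {r} p q → r ≢ 0ℚ → r * p ≡ r * q → p ≡ q
  *-cancel {r} p q r≢0 eq = p-q≡0⇒p≡q p q (recip-cancel r≢0
    (trans (solve 3 (λ r p q → r :* (p :- q) := r :* p :- r :* q) refl r p q)
      (trans (cong (_- r * q) eq) (+-inverseʳ (r * q)))))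

  sum-cong : ∀ {n} {f g : Fin n → ℚ} → (∀ i → f i ≡ g i) → sum f ≡ sum g
  sum-cong = ΣQ.sum-cong-≗

  sum-0 : ∀ {n} {f : Fin n → ℚ} → (∀ i → f i ≡ 0ℚ) → sum f ≡ 0ℚ
  sum-0 {n} h = trans (sum-cong h) (ΣQ.sum-replicate-zero n)

  sum-+ : ∀ {n} (f g : Fin n → ℚ) → sum (λ i → f i + g i) ≡ sum f + sum g
  sum-+ = ΣQ.∑-distrib-+

  sum-* : ∀ {n} c (f : Fin n → ℚ) → sum (λ i → c * f i) ≡ c * sum f
  sum-* c f = sym (ΣQ.*-distribˡ-sum c f)

  sum-*ʳ : ∀ {n} c (f : Fin n → ℚ) → sum (λ i → f i * c) ≡ sum f * c
  sum-*ʳ c f = sym (ΣQ.*-distribʳ-sum c f)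

  sum-neg : ∀ {n} (f : Fin n → ℚ) → sum (λ i → - f i) ≡ - sum f
  sum-neg f = trans (sum-cong λ i → solve 1 (λ a → :- a := con (- 1ℚ) :* a) refl (f i))
    (trans (sum-* (- 1ℚ) f) (solve 1 (λ a → con (- 1ℚ) :* a := :- a) refl (sum f)))

  sum-- : ∀ {n} (f g : Fin n → ℚ) → sum (λ i → f i - g i) ≡ sum f - sum g
  sum-- f g = trans (sum-+ f (λ i → - g i)) (cong (_+_ (sum f)) (sum-neg g))

  sum-swap : ∀ {m n} (f : Fin m → Fin n → ℚ) →
    sum (λ i → sum (λ j → f i j)) ≡ sum (λ j → sum (λ i → f i j))
  sum-swap = ΣQ.∑-comm

  sum-mono : ∀ {n} {f g : Fin n → ℚ} → (∀ i → f i ≤ g i) → sum f ≤ sum g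
  sum-mono {zero}  h = ≤-refl
  sum-mono {suc n} h = +-mono-≤ (h zero) (sum-mono (h ∘ suc))

  sum-nonNeg : ∀ {n} {f : Fin n → ℚ} → (∀ i → 0ℚ ≤ f i) → 0ℚ ≤ sum f
  sum-nonNeg {n} {f} h = subst (_≤ sum f) (sum-0 {n} (λ _ → refl)) (sum-mono h)

  term≤sum : ∀ {n} {f : Fin n → ℚ} → (∀ i → 0ℚ ≤ f i) → ∀ i → f i ≤ sum f
  term≤sum {f = f} h zero    = ≤-by _ (sum-nonNeg (h ∘ suc)) refl
  term≤sum {f = f} h (suc i) = ≤-trans (term≤sum (h ∘ suc) i) (≤-by (f zero) (h zero) (+-comm _ (f zero)))

  sum-const : ∀ n c → sum {n} (λ _ → c) ≡ ι n * c
  sum-const zero    c = sym (*-zeroˡ c)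
  sum-const (suc n) c = trans (cong (_+_ c) (sum-const n c))
    (trans (solve 2 (λ a b → a :+ b :* a := (b :+ con 1ℚ) :* a) refl c (ι n)) (cong (_* c) (sym (ι-suc n))))

  ∣sum∣≤ : ∀ {n} (f : Fin n → ℚ) → ∣ sum f ∣ ≤ sum (λ i → ∣ f i ∣)
  ∣sum∣≤ {zero}  f = ≤-refl
  ∣sum∣≤ {suc n} f = ≤-trans (∣p+q∣≤∣p∣+∣q∣ (f zero) _) (+-monoʳ-≤ ∣ f zero ∣ (∣sum∣≤ (f ∘ suc)))

  ⟦⟧-sum : ∀ {n} (f : Fin n → ℤ) → ⟦ sumᶻ f ⟧ ≡ sum (λ i → ⟦ f i ⟧)
  ⟦⟧-sum {zero}  f = refl
  ⟦⟧-sum {suc n} f = trans (⟦⟧-+ (f zero) _) (cong (_+_ ⟦ f zero ⟧) (⟦⟧-sum (f ∘ suc)))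

  -- Serves both as the identity matrix and, row by row, as the list of standard basis vectors.
  δᶻ : ∀ {n} → Fin n → Fin n → ℤ
  δᶻ zero    zero    = + 1
  δᶻ zero    (suc j) = + 0
  δᶻ (suc i) zero    = + 0
  δᶻ (suc i) (suc j) = δᶻ i j

  δ : ∀ {n} → Fin n → Fin n → ℚ
  δ i j = ⟦ δᶻ i j ⟧

  δ-sym : ∀ {n} (i j : Fin n) → δᶻ i j ≡ δᶻ j i
  δ-sym zero    zero    = refl
  δ-sym zero    (suc j) = refl
  δ-sym (suc i) zero    = refl
  δ-sym (suc i) (suc j) = δ-sym i j

  δ-refl : ∀ {n} (i : Fin n) → δᶻ i i ≡ + 1
  δ-refl zero    = refl
  δ-refl (suc i) = δ-refl i

  δ-≢ : ∀ {n} {i j : Fin n} → i ≢ j → δᶻ i j ≡ + 0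
  δ-≢ {i = zero}  {zero}  i≢j = contradiction refl i≢j
  δ-≢ {i = zero}  {suc j} i≢j = refl
  δ-≢ {i = suc i} {zero}  i≢j = refl
  δ-≢ {i = suc i} {suc j} i≢j = δ-≢ (i≢j ∘ cong suc)

  sum-δ : ∀ {n} (i : Fin n) (f : Fin n → ℚ) → sum (λ j → δ i j * f j) ≡ f i
  sum-δ zero    f = trans (cong₂ _+_ (*-identityˡ (f zero)) (sum-0 λ j → *-zeroˡ (f (suc j)))) (+-identityʳ _)
  sum-δ (suc i) f = trans (cong (_+ sum (λ j → δ i j * f (suc j))) (*-zeroˡ (f zero))) (trans (+-identityˡ (sum λ j → δ i j * f (suc j))) (sum-δ i (f ∘ suc)))

  sum-δʳ : ∀ {n} (i : Fin n) (f : Fin n → ℚ) → sum (λ j → f j * δ j i) ≡ f i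
  sum-δʳ i f = trans (sum-cong λ j → trans (*-comm (f j) _) (cong (λ z → ⟦ z ⟧ * f j) (δ-sym j i))) (sum-δ i f)

  Vec : ℕ → Set
  Vec n = Fin n → ℚ

  Mat : ℕ → Set
  Mat n = Fin n → Fin n → ℚ

  ⟦_⟧ᵛ : ∀ {n} → ℤ^ n → Vec n
  ⟦ v ⟧ᵛ i = ⟦ v i ⟧

  ⟦_⟧ᵐ : ∀ {n} → (Fin n → Fin n → ℤ) → Mat n
  ⟦ g ⟧ᵐ i j = ⟦ g i j ⟧

  bil : ∀ {n} → Mat n → Vec n → Vec n → ℚ
  bil A x y = sum λ i → sum λ j → x i * A i j * y j

  quad : ∀ {n} → Mat n → Vec n → ℚ
  quad A x = bil A x x

  Symm : ∀ {n} → Mat n → Set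
  Symm A = ∀ i j → A i j ≡ A j i

  bil-cong : ∀ {n} {A A′ : Mat n} {x x′ y y′ : Vec n} →
    (∀ i j → A i j ≡ A′ i j) → (∀ i → x i ≡ x′ i) → (∀ i → y i ≡ y′ i) → bil A x y ≡ bil A′ x′ y′
  bil-cong hA hx hy = sum-cong λ i → sum-cong λ j → cong₂ _*_ (cong₂ _*_ (hx i) (hA i j)) (hy j)

  quad-cong : ∀ {n} (A : Mat n) {x x′ : Vec n} → (∀ i → x i ≡ x′ i) → quad A x ≡ quad A x′
  quad-cong A h = bil-cong (λ _ _ → refl) h h

  bil-sym : ∀ {n} {A : Mat n} → Symm A → ∀ x y → bil A x y ≡ bil A y x
  bil-sym {A = A} sy x y = trans (sum-swap λ i j → x i * A i j * y j)
    (sum-cong λ j → sum-cong λ i → trans (cong (λ a → x i * a * y j) (sy i j))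
      (solve 3 (λ a b c → a :* b :* c := c :* b :* a) refl (x i) (A j i) (y j)))

  bil-+ˡ : ∀ {n} (A : Mat n) x x′ y → bil A (λ i → x i + x′ i) y ≡ bil A x y + bil A x′ y
  bil-+ˡ A x x′ y = trans (sum-cong λ i → trans
      (sum-cong λ j → solve 4 (λ a b c d → (a :+ b) :* c :* d := a :* c :* d :+ b :* c :* d) refl (x i) (x′ i) (A i j) (y j))
      (sum-+ (λ j → x i * A i j * y j) (λ j → x′ i * A i j * y j)))
    (sum-+ (λ i → sum λ j → x i * A i j * y j) (λ i → sum λ j → x′ i * A i j * y j))

  bil-*ˡ : ∀ {n} (A : Mat n) c x y → bil A (λ i → c * x i) y ≡ c * bil A x y
  bil-*ˡ A c x y = trans (sum-cong λ i → trans
      (sum-cong λ j → solve 4 (λ c a b d → c :* a :* b :* d := c :* (a :* b :* d)) refl c (x i) (A i j) (y j))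
      (sum-* c (λ j → x i * A i j * y j)))
    (sum-* c (λ i → sum λ j → x i * A i j * y j))

  bil-+ʳ : ∀ {n} (A : Mat n) x y y′ → bil A x (λ i → y i + y′ i) ≡ bil A x y + bil A x y′
  bil-+ʳ A x y y′ = trans (sum-cong λ i → trans
      (sum-cong λ j → *-distribˡ-+ (x i * A i j) (y j) (y′ j))
      (sum-+ (λ j → x i * A i j * y j) (λ j → x i * A i j * y′ j)))
    (sum-+ (λ i → sum λ j → x i * A i j * y j) (λ i → sum λ j → x i * A i j * y′ j))

  bil-*ʳ : ∀ {n} (A : Mat n) c x y → bil A x (λ i → c * y i) ≡ c * bil A x y
  bil-*ʳ A c x y = trans (sum-cong λ i → trans
      (sum-cong λ j → solve 4 (λ c a b d → a :* b :* (c :* d) := c :* (a :* b :* d)) refl c (x i) (A i j) (y j))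
      (sum-* c (λ j → x i * A i j * y j)))
    (sum-* c (λ i → sum λ j → x i * A i j * y j))

  bil-0ˡ : ∀ {n} (A : Mat n) {x} y → (∀ i → x i ≡ 0ℚ) → bil A x y ≡ 0ℚ
  bil-0ˡ A y h = sum-0 λ i → sum-0 λ j → trans (cong (λ t → t * A i j * y j) (h i))
    (solve 2 (λ a b → con 0ℚ :* a :* b := con 0ℚ) refl (A i j) (y j))

  bil-sumˡ : ∀ {m n} (A : Mat n) (c : Fin m → ℚ) (x : Fin m → Vec n) y →
    bil A (λ i → sum λ k → c k * x k i) y ≡ sum λ k → c k * bil A (x k) y
  bil-sumˡ {zero}  A c x y = bil-0ˡ A y (λ _ → refl)
  bil-sumˡ {suc m} A c x y = trans (bil-+ˡ A (λ i → c zero * x zero i) (λ i → sum λ k → c (suc k) * x (suc k) i) y)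
    (cong₂ _+_ (bil-*ˡ A (c zero) (x zero) y) (bil-sumˡ A (c ∘ suc) (x ∘ suc) y))

  bil-0ʳ : ∀ {n} (A : Mat n) x {y} → (∀ i → y i ≡ 0ℚ) → bil A x y ≡ 0ℚ
  bil-0ʳ A x h = sum-0 λ i → sum-0 λ j → trans (cong (x i * A i j *_) (h j)) (*-zeroʳ (x i * A i j))

  bil-sumʳ : ∀ {m n} (A : Mat n) (c : Fin m → ℚ) x (y : Fin m → Vec n) →
    bil A x (λ i → sum λ k → c k * y k i) ≡ sum λ k → c k * bil A x (y k)
  bil-sumʳ {zero}  A c x y = bil-0ʳ A x (λ _ → refl)
  bil-sumʳ {suc m} A c x y = trans (bil-+ʳ A x (λ i → c zero * y zero i) (λ i → sum λ k → c (suc k) * y (suc k) i))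
    (cong₂ _+_ (bil-*ʳ A (c zero) x (y zero)) (bil-sumʳ A (c ∘ suc) x (y ∘ suc)))

  bil-δ : ∀ {n} (A : Mat n) i j → bil A (δ i) (δ j) ≡ A i j
  bil-δ A i j = trans (sum-cong λ k → trans
      (sum-cong λ l → solve 3 (λ a b c → a :* b :* c := c :* (a :* b)) refl (δ i k) (A k l) (δ j l))
      (sum-δ j (λ l → δ i k * A k l)))
    (sum-δ i (λ k → A k j))

  bil-lin : ∀ {n} (A : Mat n) s x t x′ y →
    bil A (λ i → s * x i + t * x′ i) y ≡ s * bil A x y + t * bil A x′ y
  bil-lin A s x t x′ y = trans (bil-+ˡ A (λ i → s * x i) (λ i → t * x′ i) y) (cong₂ _+_ (bil-*ˡ A s x y) (bil-*ˡ A t x′ y))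

  quad-lin : ∀ {n} {A : Mat n} → Symm A → ∀ s x t y →
    quad A (λ i → s * x i + t * y i) ≡ s * s * quad A x + (s * t + s * t) * bil A x y + t * t * quad A y
  quad-lin {A = A} sy s x t y = begin
    bil A z z                                     ≡⟨ bil-lin A s x t y z ⟩
    s * bil A x z + t * bil A y z                 ≡⟨ cong₂ (λ a b → s * a + t * b) (exp-ʳ x) (exp-ʳ y) ⟩
    s * (s * bil A x x + t * bil A x y) + t * (s * bil A y x + t * bil A y y)
                                                  ≡⟨ cong (λ u → s * (s * bil A x x + t * bil A x y) + t * (s * u + t * bil A y y)) (bil-sym sy y x) ⟩
    s * (s * bil A x x + t * bil A x y) + t * (s * bil A x y + t * bil A y y)
      ≡⟨ solve 5 (λ s t a b c → s :* (s :* a :+ t :* b) :+ t :* (s :* b :+ t :* c) := s :* s :* a :+ (s :* t :+ s :* t) :* b :+ t :* t :* c) refl s t (bil A x x) (bil A x y) (bil A y y) ⟩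
    s * s * quad A x + (s * t + s * t) * bil A x y + t * t * quad A y ∎
    where
    open ≡-Reasoning
    z = λ i → s * x i + t * y i
    exp-ʳ : ∀ w → bil A w z ≡ s * bil A w x + t * bil A w y
    exp-ʳ w = trans (bil-+ʳ A w (λ i → s * x i) (λ i → t * y i)) (cong₂ _+_ (bil-*ʳ A s w x) (bil-*ʳ A t w y))

  quad-* : ∀ {n} (A : Mat n) c x → quad A (λ i → c * x i) ≡ c * c * quad A x
  quad-* A c x = trans (bil-*ˡ A c x _) (trans (cong (c *_) (bil-*ʳ A c x x)) (sym (*-assoc c c (bil A x x))))

  -- Linear algebra.

  -- `C` is a left inverse of the matrix with rows `A k`. The opposite case, `Annihilated`, is a
  -- nonzero vector orthogonal to every row.
  Spanning : ∀ {m n} → (Fin m → Vec n) → Set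
  Spanning {m} {n} A = Σ[ C ∈ (Fin n → Fin m → ℚ) ] (∀ i j → sum (λ k → C i k * A k j) ≡ δ i j)

  Annihilated : ∀ {m n} → (Fin m → Vec n) → Set
  Annihilated {m} {n} A = Σ[ f ∈ Vec n ] (∃[ j ] f j ≢ 0ℚ) × (∀ k → sum (λ j → A k j * f j) ≡ 0ℚ)

  spanning-functional : ∀ {m n} {A : Fin m → Vec n} ((C , _) : Spanning A) → ∀ f i →
    f i ≡ sum (λ k → C i k * sum (λ j → A k j * f j))
  spanning-functional {A = A} (C , h) f i = begin
    f i                                                   ≡⟨ sym (sum-δ i f) ⟩
    sum (λ j → δ i j * f j)                               ≡⟨ sum-cong (λ j → cong (_* f j) (sym (h i j))) ⟩
    sum (λ j → sum (λ k → C i k * A k j) * f j)           ≡⟨ sum-cong (λ j → sym (sum-*ʳ (f j) λ k → C i k * A k j)) ⟩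
    sum (λ j → sum (λ k → C i k * A k j * f j))           ≡⟨ sum-swap (λ j k → C i k * A k j * f j) ⟩
    sum (λ k → sum (λ j → C i k * A k j * f j))           ≡⟨ sum-cong (λ k → trans (sum-cong λ j → *-assoc (C i k) (A k j) (f j)) (sum-* (C i k) λ j → A k j * f j)) ⟩
    sum (λ k → C i k * sum (λ j → A k j * f j))           ∎
    where open ≡-Reasoning

  -- Elimination, one column at a time. The spanning case keeps a single pivot row per column, so
  -- the selected family has `n` members whatever `m` is; this later fixes the size of a frame of
  -- minimal vectors.
  gauss : ∀ {m n} (A : Fin m → Vec n) → (Σ[ s ∈ (Fin n → Fin m) ] Spanning (A ∘ s)) ⊎ Annihilated A
  gauss {m} {zero}  A = inj₁ ((λ ()) , (λ ()) , λ ())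
  gauss {m} {suc n} A with F.any? (λ k → ¬? (A k zero ≟ 0ℚ))
  ... | no ¬pivot = inj₂ ((λ j → δ j zero) , (zero , λ ()) , λ k → trans (sum-δʳ zero (A k)) (column-0 k))
    where
    column-0 : ∀ k → A k zero ≡ 0ℚ
    column-0 k with A k zero ≟ 0ℚ
    ... | yes eq = eq
    ... | no ne = contradiction (k , ne) ¬pivot
  ... | yes (k₀ , p≢0) = extend (gauss A′)
    where
    open ≡-Reasoning
    p = A k₀ zero
    instance _ = ≢-nonZero p≢0
    p⁻¹ = 1/ p
    b : Fin m → ℚ
    b k = A k zero * p⁻¹
    b*p : ∀ k → b k * p ≡ A k zero
    b*p k = trans (*-assoc (A k zero) p⁻¹ p) (trans (cong (A k zero *_) (*-inverseˡ p)) (*-identityʳ (A k zero)))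
    v : Vec n
    v j = A k₀ (suc j)
    A′ : Fin m → Vec n
    A′ k j = A k (suc j) - b k * v j
    extend : (Σ[ s ∈ (Fin n → Fin m) ] Spanning (A′ ∘ s)) ⊎ Annihilated A′ →
             (Σ[ s ∈ (Fin (suc n) → Fin m) ] Spanning (A ∘ s)) ⊎ Annihilated A
    extend (inj₂ (f′ , (j₀ , f≢0) , h)) = inj₂ (f , (suc j₀ , f≢0) , annihilates)
      where
      V = sum (λ j → v j * f′ j)
      f : Vec (suc n)
      -- The one value for which the pivot row annihilates `f`.
      f zero    = - (p⁻¹ * V)
      f (suc j) = f′ j
      annihilates : ∀ k → sum (λ j → A k j * f j) ≡ 0ℚ
      annihilates k = begin
        A k zero * - (p⁻¹ * V) + S
          ≡⟨ solve 4 (λ a q x y → a :* :- (q :* x) :+ y := y :- (a :* q) :* x) refl (A k zero) p⁻¹ V S ⟩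
        S - b k * V
          ≡⟨ cong (λ t → S - t) (sym (sum-* (b k) λ j → v j * f′ j)) ⟩
        S - sum (λ j → b k * (v j * f′ j))
          ≡⟨ sym (sum-- (λ j → A k (suc j) * f′ j) (λ j → b k * (v j * f′ j))) ⟩
        sum (λ j → A k (suc j) * f′ j - b k * (v j * f′ j))
          ≡⟨ sum-cong (λ j → solve 4 (λ a b v f → a :* f :- b :* (v :* f) := (a :- b :* v) :* f) refl (A k (suc j)) (b k) (v j) (f′ j)) ⟩
        sum (λ j → A′ k j * f′ j)
          ≡⟨ h k ⟩
        0ℚ ∎
        where S = sum (λ j → A k (suc j) * f′ j)
    extend (inj₁ (s′ , C′ , h)) = inj₁ (s , C , spans)
      where
      s : Fin (suc n) → Fin m
      s zero    = k₀
      s (suc l) = s′ l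
      T : Fin n → ℚ
      T i = sum (λ l → C′ i l * b (s′ l))
      -- Undoes the elimination: the coefficient `- T i` of the pivot row collects the multiples of
      -- it that were subtracted from the other rows.
      D : Fin n → Fin (suc n) → ℚ
      D i zero    = - T i
      D i (suc l) = C′ i l
      C : Fin (suc n) → Fin (suc n) → ℚ
      -- The pivot row is `p` times the first basis vector plus the later ones with coefficients
      -- `v`. The later ones are already expressed by `D`, so the first can be solved for.
      C zero    k = p⁻¹ * (δ k zero - sum (λ i → v i * D i k))
      C (suc i) k = D i k
      spans-suc : ∀ i j → sum (λ k → D i k * A (s k) j) ≡ δ (suc i) j
      spans-suc i zero = begin
        - T i * p + sum (λ l → C′ i l * A (s′ l) zero)
          ≡⟨ cong (λ t → - T i * p + t) (sum-cong λ l → trans (cong (C′ i l *_) (sym (b*p (s′ l)))) (sym (*-assoc (C′ i l) (b (s′ l)) p))) ⟩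
        - T i * p + sum (λ l → C′ i l * b (s′ l) * p)
          ≡⟨ cong (λ t → - T i * p + t) (sum-*ʳ p λ l → C′ i l * b (s′ l)) ⟩
        - T i * p + T i * p
          ≡⟨ solve 2 (λ t p → :- t :* p :+ t :* p := con 0ℚ) refl (T i) p ⟩
        0ℚ ∎
      spans-suc i (suc j) = begin
        - T i * v j + S
          ≡⟨ solve 3 (λ t v s → :- t :* v :+ s := s :- t :* v) refl (T i) (v j) S ⟩
        S - T i * v j
          ≡⟨ cong (λ t → S - t) (sym (sum-*ʳ (v j) λ l → C′ i l * b (s′ l))) ⟩
        S - sum (λ l → C′ i l * b (s′ l) * v j)
          ≡⟨ sym (sum-- (λ l → C′ i l * A (s′ l) (suc j)) (λ l → C′ i l * b (s′ l) * v j)) ⟩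
        sum (λ l → C′ i l * A (s′ l) (suc j) - C′ i l * b (s′ l) * v j)
          ≡⟨ sum-cong (λ l → solve 4 (λ c a b v → c :* a :- c :* b :* v := c :* (a :- b :* v)) refl (C′ i l) (A (s′ l) (suc j)) (b (s′ l)) (v j)) ⟩
        sum (λ l → C′ i l * A′ (s′ l) j)
          ≡⟨ h i j ⟩
        δ i j ∎
        where S = sum (λ l → C′ i l * A (s′ l) (suc j))
      spans : ∀ i j → sum (λ k → C i k * A (s k) j) ≡ δ i j
      spans (suc i) j = spans-suc i j
      spans zero    j = begin
        sum (λ k → p⁻¹ * (δ k zero - sum (λ i → v i * D i k)) * A (s k) j)
          ≡⟨ sum-cong (λ k → solve 4 (λ q d x a → q :* (d :- x) :* a := q :* (a :* d :- x :* a)) refl p⁻¹ (δ k zero) (sum λ i → v i * D i k) (A (s k) j)) ⟩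
        sum (λ k → p⁻¹ * (A (s k) j * δ k zero - sum (λ i → v i * D i k) * A (s k) j))
          ≡⟨ sum-* p⁻¹ (λ k → A (s k) j * δ k zero - sum (λ i → v i * D i k) * A (s k) j) ⟩
        p⁻¹ * sum (λ k → A (s k) j * δ k zero - sum (λ i → v i * D i k) * A (s k) j)
          ≡⟨ cong (p⁻¹ *_) (sum-- (λ k → A (s k) j * δ k zero) (λ k → sum (λ i → v i * D i k) * A (s k) j)) ⟩
        p⁻¹ * (sum (λ k → A (s k) j * δ k zero) - sum (λ k → sum (λ i → v i * D i k) * A (s k) j))
          ≡⟨ cong₂ (λ x y → p⁻¹ * (x - y)) (sum-δʳ zero λ k → A (s k) j) (begin
               sum (λ k → sum (λ i → v i * D i k) * A (s k) j)
                 ≡⟨ sum-cong (λ k → sym (sum-*ʳ (A (s k) j) λ i → v i * D i k)) ⟩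
               sum (λ k → sum (λ i → v i * D i k * A (s k) j))
                 ≡⟨ sum-swap (λ k i → v i * D i k * A (s k) j) ⟩
               sum (λ i → sum (λ k → v i * D i k * A (s k) j))
                 ≡⟨ sum-cong (λ i → trans (sum-cong λ k → *-assoc (v i) (D i k) (A (s k) j)) (sum-* (v i) λ k → D i k * A (s k) j)) ⟩
               sum (λ i → v i * sum (λ k → D i k * A (s k) j))
                 ≡⟨ sum-cong (λ i → cong (v i *_) (spans-suc i j)) ⟩
               sum (λ i → v i * δ (suc i) j) ∎) ⟩
        p⁻¹ * (A k₀ j - sum (λ i → v i * δ (suc i) j))
          ≡⟨ last j ⟩
        δ zero j ∎
        where
        last : ∀ j → p⁻¹ * (A k₀ j - sum (λ i → v i * δ (suc i) j)) ≡ δ zero j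
        last zero    = trans (cong (λ t → p⁻¹ * (p - t)) (sum-0 λ i → *-zeroʳ (v i)))
          (trans (solve 2 (λ q p → q :* (p :- con 0ℚ) := q :* p) refl p⁻¹ p) (*-inverseˡ p))
        last (suc j) = trans (cong (λ t → p⁻¹ * (v j - t)) (sum-δʳ j v))
          (solve 2 (λ q a → q :* (a :- a) := con 0ℚ) refl p⁻¹ (v j))

  -- Dual form of the statement that the squares of the `v k` span the symmetric tensors: a
  -- symmetric matrix is recovered linearly from the values of its quadratic form at the `v k`.
  SymSpanning : ∀ {m d} → (Fin m → Vec d) → Set
  SymSpanning {m} {d} v = Σ[ C ∈ (Fin d → Fin d → Fin m → ℚ) ]
    (∀ A → Symm A → ∀ i j → A i j ≡ sum (λ k → C i j k * quad A (v k)))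

  SymAnnihilated : ∀ {m d} → (Fin m → Vec d) → Set
  SymAnnihilated {m} {d} v = Σ[ A ∈ Mat d ] Symm A × (∃[ i ] ∃[ j ] A i j ≢ 0ℚ) × (∀ k → quad A (v k) ≡ 0ℚ)

  sum-split : ∀ m {n} (f : Fin (m ℕ.+ n) → ℚ) → sum f ≡ sum (λ i → f (i F.↑ˡ n)) + sum (λ j → f (m F.↑ʳ j))
  sum-split zero    f = sym (+-identityˡ (sum f))
  sum-split (suc m) {n} f = trans (cong (_+_ (f zero)) (sum-split m (f ∘ suc)))
    (sym (+-assoc (f zero) (sum λ i → f (suc i F.↑ˡ n)) (sum λ j → f (suc m F.↑ʳ j))))

  sum-combine : ∀ m {n} (f : Fin (m ℕ.* n) → ℚ) → sum f ≡ sum (λ i → sum (λ j → f (F.combine {m} {n} i j)))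
  sum-combine zero    f = refl
  sum-combine (suc m) {n} f = trans (sum-split n f)
    (cong (_+_ (sum λ j → f (j F.↑ˡ (m ℕ.* n)))) (sum-combine m (λ p → f (n F.↑ʳ p))))

  sum-δδ : ∀ {d} (A : Mat d) i j → sum (λ a → sum (λ b → δ i a * δ j b * A a b)) ≡ A i j
  sum-δδ A i j = trans (sum-cong λ a → trans (sum-cong λ b → *-assoc (δ i a) (δ j b) (A a b))
      (trans (sum-* (δ i a) λ b → δ j b * A a b) (cong (δ i a *_) (sum-δ j (A a)))))
    (sum-δ i λ a → A a j)

  -- Adding the antisymmetric tensors to the family reduces spanning the
  -- symmetric tensors to spanning all tensors.
  symGauss : ∀ {m d} (v : Fin (suc m) → Vec d) →
    (Σ[ s ∈ (Fin (d ℕ.* d) → Fin (suc m)) ] SymSpanning (v ∘ s)) ⊎ SymAnnihilated v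
  symGauss {m} {d} v = convert (gauss rows)
    where
    open ≡-Reasoning
    row : Fin (suc m) ⊎ Fin (d ℕ.* d) → Fin d → Fin d → ℚ
    row (inj₁ k) a b = v k a * v k b
    row (inj₂ p) a b = let i , j = F.remQuot {d} d p in δ i a * δ j b - δ i b * δ j a
    rows : Fin (suc m ℕ.+ d ℕ.* d) → Vec (d ℕ.* d)
    rows r p = let a , b = F.remQuot {d} d p in row (F.splitAt (suc m) r) a b
    pairing : ∀ r (f : Vec (d ℕ.* d)) →
      sum (λ p → rows r p * f p) ≡ sum (λ a → sum (λ b → row (F.splitAt (suc m) r) a b * f (F.combine a b)))
    pairing r f = trans (sum-combine d _) (sum-cong λ a → sum-cong λ b →
      cong (λ (x , y) → row (F.splitAt (suc m) r) x y * f (F.combine a b)) (F.remQuot-combine {d} {d} a b))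
    pair₁ : ∀ k (A : Mat d) → sum (λ a → sum (λ b → row (inj₁ k) a b * A a b)) ≡ quad A (v k)
    pair₁ k A = sum-cong λ a → sum-cong λ b →
      solve 3 (λ x y z → x :* y :* z := x :* z :* y) refl (v k a) (v k b) (A a b)
    pair₂ : ∀ p (A : Mat d) → let i , j = F.remQuot {d} d p in
      sum (λ a → sum (λ b → row (inj₂ p) a b * A a b)) ≡ A i j - A j i
    pair₂ p A = let i , j = F.remQuot {d} d p in begin
      sum (λ a → sum (λ b → (δ i a * δ j b - δ i b * δ j a) * A a b))
        ≡⟨ sum-cong (λ a → trans (sum-cong λ b →
             solve 5 (λ x y z w t → (x :* y :- z :* w) :* t := x :* y :* t :- w :* z :* t) refl (δ i a) (δ j b) (δ i b) (δ j a) (A a b))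
             (sum-- (λ b → δ i a * δ j b * A a b) (λ b → δ j a * δ i b * A a b))) ⟩
      sum (λ a → sum (λ b → δ i a * δ j b * A a b) - sum (λ b → δ j a * δ i b * A a b))
        ≡⟨ sum-- (λ a → sum (λ b → δ i a * δ j b * A a b)) (λ a → sum (λ b → δ j a * δ i b * A a b)) ⟩
      sum (λ a → sum (λ b → δ i a * δ j b * A a b)) - sum (λ a → sum (λ b → δ j a * δ i b * A a b))
        ≡⟨ cong₂ _-_ (sum-δδ A i j) (sum-δδ A j i) ⟩
      A i j - A j i ∎
    convert : (Σ[ s ∈ (Fin (d ℕ.* d) → Fin (suc m ℕ.+ d ℕ.* d)) ] Spanning (rows ∘ s)) ⊎ Annihilated rows →
      (Σ[ s ∈ (Fin (d ℕ.* d) → Fin (suc m)) ] SymSpanning (v ∘ s)) ⊎ SymAnnihilated v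
    convert (inj₁ (s , C , h)) = inj₁ (pick ∘ s′ , (λ i j k → weight (s′ k) (C (F.combine i j) k)) , spans)
      where
      s′ = F.splitAt (suc m) ∘ s
      -- An antisymmetric tensor pairs to zero with a symmetric matrix. Its row is replaced by the
      -- vector of index `zero` with weight 0; the index exists because the family has size `suc m`.
      pick : Fin (suc m) ⊎ Fin (d ℕ.* d) → Fin (suc m)
      pick (inj₁ k) = k
      pick (inj₂ _) = zero
      weight : Fin (suc m) ⊎ Fin (d ℕ.* d) → ℚ → ℚ
      weight (inj₁ _) c = c
      weight (inj₂ _) c = 0ℚ
      spans : ∀ A → Symm A → ∀ i j → A i j ≡ sum (λ k → weight (s′ k) (C (F.combine i j) k) * quad A (v (pick (s′ k))))
      spans A sy i j = begin
        A i j
          ≡⟨ cong (λ (x , y) → A x y) (sym (F.remQuot-combine {d} {d} i j)) ⟩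
        f (F.combine i j)
          ≡⟨ spanning-functional {A = rows ∘ s} (C , h) f (F.combine i j) ⟩
        sum (λ k → C (F.combine i j) k * sum (λ p → rows (s k) p * f p))
          ≡⟨ sum-cong (λ k → trans (cong (C (F.combine i j) k *_) (trans (pairing (s k) f)
               (sum-cong λ a → sum-cong λ b → cong (λ (x , y) → row (s′ k) a b * A x y) (F.remQuot-combine {d} {d} a b))))
               (term (s′ k) (C (F.combine i j) k))) ⟩
        sum (λ k → weight (s′ k) (C (F.combine i j) k) * quad A (v (pick (s′ k)))) ∎
        where
        f : Vec (d ℕ.* d)
        f p = let a , b = F.remQuot {d} d p in A a b
        term : ∀ r c → c * sum (λ a → sum (λ b → row r a b * A a b)) ≡ weight r c * quad A (v (pick r))
        term (inj₁ k) c = cong (c *_) (pair₁ k A)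
        term (inj₂ p) c = let i , j = F.remQuot {d} d p in
          trans (cong (c *_) (trans (pair₂ p A) (trans (cong (λ t → t - A j i) (sy i j)) (+-inverseʳ (A j i)))))
            (trans (*-zeroʳ c) (sym (*-zeroˡ (quad A (v zero)))))
    convert (inj₂ (f , (p₀ , f≢0) , h)) = inj₂ (A , symA ,
      (let i , j = F.remQuot {d} d p₀ in i , j , λ eq → f≢0 (trans (cong f (sym (F.combine-remQuot {d} d p₀))) eq)) ,
      λ k → trans (sym (pair₁ k A)) (trans (cong (λ r → sum (λ a → sum (λ b → row r a b * A a b))) (sym (F.splitAt-↑ˡ (suc m) k (d ℕ.* d))))
        (trans (sym (pairing (k F.↑ˡ (d ℕ.* d)) f)) (h (k F.↑ˡ (d ℕ.* d))))))
      where
      A : Mat d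
      A i j = f (F.combine i j)
      symA : Symm A
      symA i j = p-q≡0⇒p≡q (A i j) (A j i) (begin
        A i j - A j i
          ≡⟨ cong (λ (x , y) → A x y - A y x) (sym (F.remQuot-combine {d} {d} i j)) ⟩
        _ ≡⟨ sym (pair₂ (F.combine i j) A) ⟩
        sum (λ a → sum (λ b → row (inj₂ (F.combine i j)) a b * A a b))
          ≡⟨ cong (λ r → sum (λ a → sum (λ b → row r a b * A a b))) (sym (F.splitAt-↑ʳ (suc m) (d ℕ.* d) (F.combine i j))) ⟩
        _ ≡⟨ sym (pairing (suc m F.↑ʳ F.combine i j) f) ⟩
        _ ≡⟨ h (suc m F.↑ʳ F.combine i j) ⟩
        0ℚ ∎)

  symSpanning⇒unannihilated : ∀ {m d} {v : Fin m → Vec d} → SymSpanning v →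
    ∀ A → Symm A → (∀ k → quad A (v k) ≡ 0ℚ) → ∀ i j → A i j ≡ 0ℚ
  symSpanning⇒unannihilated (C , h) A sy q i j =
    trans (h A sy i j) (sum-0 λ k → trans (cong (C i j k *_) (q k)) (*-zeroʳ (C i j k)))

  -- Gram matrices.

  -- Positive definiteness in quantitative form. It confines short integral vectors to a cube, and
  -- it carries over to real vectors because it can be applied to each rational approximation.
  record Bounded {n} (A : Mat n) : Set where
    field
      bound    : ℚ
      bound≥0  : 0ℚ ≤ bound
      quad≥0   : ∀ x → 0ℚ ≤ quad A x
      square≤  : ∀ x i → x i * x i ≤ bound * quad A x

  Isotropic : ∀ {n} → Mat n → Set
  Isotropic {n} A = Σ[ x ∈ Vec n ] (∃[ i ] x i ≢ 0ℚ) × quad A x ≤ 0ℚ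

  square-+≤ : ∀ p q → (p + q) * (p + q) ≤ (p * p + p * p) + (q * q + q * q)
  square-+≤ p q = ≤-by ((p - q) * (p - q)) (square (p - q))
    (solve 2 (λ p q → (p :+ q) :* (p :+ q) :+ (p :- q) :* (p :- q) := (p :* p :+ p :* p) :+ (q :* q :+ q :* q)) refl p q)

  -- A crude Cauchy-Schwarz inequality whose constant comes from iterating `(p + q)² ≤ 2p² + 2q²`.
  linear-bound : ∀ {n} (b : Vec n) → Σ[ c ∈ ℚ ] 0ℚ ≤ c × (∀ (x : Vec n) M → (∀ j → x j * x j ≤ M) →
    0ℚ ≤ M → sum (λ j → b j * x j) * sum (λ j → b j * x j) ≤ c * M)
  linear-bound {zero}  b = 0ℚ , ≤-refl , λ x M _ _ → ≤-reflexive (solve 1 (λ m → con 0ℚ :* con 0ℚ := con 0ℚ :* m) refl M)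
  linear-bound {suc n} b = (β + β) + (c + c) , +-nonNeg (+-nonNeg (square (b zero)) (square (b zero))) (+-nonNeg 0≤c 0≤c) , bound
    where
    β = b zero * b zero
    c = proj₁ (linear-bound (b ∘ suc))
    0≤c = proj₁ (proj₂ (linear-bound (b ∘ suc)))
    bound : ∀ (x : Vec (suc n)) M → (∀ j → x j * x j ≤ M) → 0ℚ ≤ M →
      sum (λ j → b j * x j) * sum (λ j → b j * x j) ≤ ((β + β) + (c + c)) * M
    bound x M x≤M 0≤M = begin
      (b zero * x zero + S) * (b zero * x zero + S)
        ≤⟨ square-+≤ (b zero * x zero) S ⟩
      (b zero * x zero * (b zero * x zero) + b zero * x zero * (b zero * x zero)) + (S * S + S * S)
        ≤⟨ +-mono-≤ (+-mono-≤ p≤ p≤) (+-mono-≤ S≤ S≤) ⟩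
      (β * M + β * M) + (c * M + c * M)
        ≡⟨ solve 3 (λ b c m → (b :* m :+ b :* m) :+ (c :* m :+ c :* m) := ((b :+ b) :+ (c :+ c)) :* m) refl β c M ⟩
      ((β + β) + (c + c)) * M ∎
      where
      open ≤-Reasoning
      S = sum (λ j → b (suc j) * x (suc j))
      p≤ : b zero * x zero * (b zero * x zero) ≤ β * M
      p≤ = subst (_≤ β * M) (solve 2 (λ b x → b :* b :* (x :* x) := b :* x :* (b :* x)) refl (b zero) (x zero))
             (*-monoʳ β (square (b zero)) (x≤M zero))
      S≤ : S * S ≤ c * M
      S≤ = proj₂ (proj₂ (linear-bound (b ∘ suc))) (x ∘ suc) M (x≤M ∘ suc) 0≤M

  -- `complement` is the Gram matrix of the projection orthogonal to the first basis vector, and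
  -- `y x` is the scalar product of `x` with that vector.
  module Schur {n} (A : Mat (suc n)) (symA : Symm A) (0<a : 0ℚ < A zero zero) where

    a : ℚ
    a = A zero zero

    instance a-nonZero = >-nonZero 0<a

    a⁻¹ : ℚ
    a⁻¹ = 1/ a

    0<a⁻¹ : 0ℚ < a⁻¹
    0<a⁻¹ = positive⁻¹ a⁻¹ {{1/pos⇒pos a {{positive 0<a}}}}

    b : Vec n
    b j = A zero (suc j)

    complement : Mat n
    complement i j = A (suc i) (suc j) - b i * b j * a⁻¹

    complement-symm : Symm complement
    complement-symm i j = cong₂ _-_ (symA (suc i) (suc j)) (cong (_* a⁻¹) (*-comm (b i) (b j)))

    β : Vec n → ℚ
    β x = sum (λ j → b j * x j)

    y : Vec (suc n) → ℚ
    y x = a * x zero + β (x ∘ suc)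

    quad-complement : ∀ x → quad complement x ≡ quad (λ i j → A (suc i) (suc j)) x - β x * β x * a⁻¹
    quad-complement x = begin
      sum (λ i → sum (λ j → x i * (A (suc i) (suc j) - b i * b j * a⁻¹) * x j))
        ≡⟨ sum-cong (λ i → trans (sum-cong λ j → solve 6 (λ x c b d q z → x :* (c :- b :* d :* q) :* z := x :* c :* z :- b :* x :* q :* (d :* z)) refl (x i) (A (suc i) (suc j)) (b i) (b j) a⁻¹ (x j))
             (trans (sum-- (λ j → x i * A (suc i) (suc j) * x j) (λ j → b i * x i * a⁻¹ * (b j * x j)))
               (cong (λ t → sum (λ j → x i * A (suc i) (suc j) * x j) - t) (sum-* (b i * x i * a⁻¹) λ j → b j * x j)))) ⟩
      sum (λ i → sum (λ j → x i * A (suc i) (suc j) * x j) - b i * x i * a⁻¹ * β x)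
        ≡⟨ sum-- (λ i → sum (λ j → x i * A (suc i) (suc j) * x j)) (λ i → b i * x i * a⁻¹ * β x) ⟩
      Q - sum (λ i → b i * x i * a⁻¹ * β x)
        ≡⟨ cong (λ t → Q - t) (trans (sum-cong λ i → *-assoc (b i * x i) a⁻¹ (β x)) (sum-*ʳ (a⁻¹ * β x) λ i → b i * x i)) ⟩
      Q - β x * (a⁻¹ * β x)
        ≡⟨ solve 3 (λ q b i → q :- b :* (i :* b) := q :- b :* b :* i) refl Q (β x) a⁻¹ ⟩
      Q - β x * β x * a⁻¹ ∎
      where
      open ≡-Reasoning
      Q = quad (λ i j → A (suc i) (suc j)) x

    quad-expand : ∀ x → quad A x ≡ x zero * a * x zero + (x zero * β (x ∘ suc) + x zero * β (x ∘ suc)) + quad (λ i j → A (suc i) (suc j)) (x ∘ suc)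
    quad-expand x = begin
      x₀ * a * x₀ + sum (λ j → x₀ * b j * x′ j) + sum (λ i → x′ i * A (suc i) zero * x₀ + sum (λ j → x′ i * A (suc i) (suc j) * x′ j))
        ≡⟨ cong₂ (λ s t → x₀ * a * x₀ + s + t)
             (trans (sum-cong λ j → *-assoc x₀ (b j) (x′ j)) (sum-* x₀ λ j → b j * x′ j))
             (trans (sum-+ (λ i → x′ i * A (suc i) zero * x₀) (λ i → sum (λ j → x′ i * A (suc i) (suc j) * x′ j)))
               (cong (_+ Q) (trans (sum-cong λ i → trans (cong (λ t → x′ i * t * x₀) (symA (suc i) zero))
                 (solve 3 (λ x b z → x :* b :* z := z :* (b :* x)) refl (x′ i) (b i) x₀)) (sum-* x₀ λ j → b j * x′ j)))) ⟩
      x₀ * a * x₀ + x₀ * β x′ + (x₀ * β x′ + Q)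
        ≡⟨ solve 3 (λ s t q → s :+ t :+ (t :+ q) := s :+ (t :+ t) :+ q) refl (x₀ * a * x₀) (x₀ * β x′) Q ⟩
      x₀ * a * x₀ + (x₀ * β x′ + x₀ * β x′) + Q ∎
      where
      open ≡-Reasoning
      x₀ = x zero
      x′ = x ∘ suc
      Q = quad (λ i j → A (suc i) (suc j)) x′

    complete-square : ∀ x → quad A x ≡ a⁻¹ * (y x * y x) + quad complement (x ∘ suc)
    complete-square x = trans (quad-expand x) (trans eq (sym (cong (λ t → a⁻¹ * (y x * y x) + t) (quad-complement x′))))
      where
      x₀ = x zero
      x′ = x ∘ suc
      B = β x′
      Q = quad (λ i j → A (suc i) (suc j)) x′
      eq : x₀ * a * x₀ + (x₀ * B + x₀ * B) + Q ≡ a⁻¹ * ((a * x₀ + B) * (a * x₀ + B)) + (Q - B * B * a⁻¹)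
      eq = sym (trans
        (solve 5 (λ i a x b q → i :* ((a :* x :+ b) :* (a :* x :+ b)) :+ (q :- b :* b :* i) := (i :* a) :* (x :* a :* x :+ (x :* b :+ x :* b)) :+ q) refl a⁻¹ a x₀ B Q)
        (cong (_+ Q) (trans (cong (_* (x₀ * a * x₀ + (x₀ * B + x₀ * B))) (*-inverseˡ a)) (*-identityˡ (x₀ * a * x₀ + (x₀ * B + x₀ * B))))))

  -- Completing squares decides positive definiteness: either every pivot is positive and the bounds
  -- for the successive complements combine, or a nonpositive pivot lifts to a vector on which the
  -- form is not positive.
  lagrange : ∀ {n} (A : Mat n) → Symm A → Bounded A ⊎ Isotropic A
  lagrange {zero}  A symA = inj₁ record { bound = 0ℚ ; bound≥0 = ≤-refl ; quad≥0 = λ _ → ≤-refl ; square≤ = λ _ () }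
  lagrange {suc n} A symA with 0ℚ <? A zero zero
  ... | no ¬pos = inj₂ (δ zero , (zero , λ ()) , subst (_≤ 0ℚ) (sym (bil-δ A zero zero)) (≮⇒≥ ¬pos))
  ... | yes 0<a = extend (lagrange complement complement-symm)
    where
    open Schur A symA 0<a
    extend : Bounded complement ⊎ Isotropic complement → Bounded A ⊎ Isotropic A
    extend (inj₂ (x′ , (i , x≢0) , q≤0)) = inj₂ (x , (suc i , x≢0) , subst (_≤ 0ℚ) (sym eq) q≤0)
      where
      x : Vec (suc n)
      -- Chosen so that `y x` vanishes; the form then takes on `x` the value of the complement on
      -- `x′`.
      x zero    = - (a⁻¹ * β x′)
      x (suc j) = x′ j
      y≡0 : y x ≡ 0ℚ
      y≡0 = trans (solve 3 (λ a i b → a :* :- (i :* b) :+ b := b :- (i :* a) :* b) refl a a⁻¹ (β x′))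
        (trans (cong (λ t → β x′ - t * β x′) (*-inverseˡ a)) (solve 1 (λ b → b :- con 1ℚ :* b := con 0ℚ) refl (β x′)))
      eq : quad A x ≡ quad complement x′
      eq = trans (complete-square x) (trans (cong (λ t → a⁻¹ * (t * t) + quad complement x′) y≡0)
        (solve 2 (λ i q → i :* (con 0ℚ :* con 0ℚ) :+ q := q) refl a⁻¹ (quad complement x′)))
    extend (inj₁ B′) = inj₁ record { bound = c ; bound≥0 = +-nonNeg 0≤c′ 0≤e ; quad≥0 = Q≥0 ; square≤ = sq }
      where
      open Bounded B′ renaming (bound to c′; bound≥0 to 0≤c′; quad≥0 to Q′≥0; square≤ to sq′)
      cb = proj₁ (linear-bound b)
      0≤cb = proj₁ (proj₂ (linear-bound b))
      0≤a⁻¹ = <⇒≤ 0<a⁻¹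
      -- From `x₀ = a⁻¹ (y - β)` one gets `x₀² ≤ a⁻² (2 y² + 2 β²)`, where `y² ≤ a Q` and
      -- `β² ≤ cb c′ Q`.
      e = a⁻¹ * a⁻¹ * ((a + a) + (cb * c′ + cb * c′))
      0≤e = *-nonNeg (*-nonNeg 0≤a⁻¹ 0≤a⁻¹) (+-nonNeg (+-nonNeg (<⇒≤ 0<a) (<⇒≤ 0<a)) (+-nonNeg (*-nonNeg 0≤cb 0≤c′) (*-nonNeg 0≤cb 0≤c′)))
      c = c′ + e
      Q≥0 : ∀ x → 0ℚ ≤ quad A x
      Q≥0 x = subst (0ℚ ≤_) (sym (complete-square x)) (+-nonNeg (*-nonNeg 0≤a⁻¹ (square (y x))) (Q′≥0 (x ∘ suc)))
      Q′≤Q : ∀ x → quad complement (x ∘ suc) ≤ quad A x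
      Q′≤Q x = ≤-by (a⁻¹ * (y x * y x)) (*-nonNeg 0≤a⁻¹ (square (y x)))
        (trans (+-comm (quad complement (x ∘ suc)) (a⁻¹ * (y x * y x))) (sym (complete-square x)))
      y²≤ : ∀ x → y x * y x ≤ a * quad A x
      y²≤ x = ≤-by (a * quad complement (x ∘ suc)) (*-nonNeg (<⇒≤ 0<a) (Q′≥0 (x ∘ suc)))
        (sym (trans (cong (a *_) (complete-square x))
          (trans (solve 4 (λ a i y q → a :* (i :* y :+ q) := (i :* a) :* y :+ a :* q) refl a a⁻¹ (y x * y x) (quad complement (x ∘ suc)))
            (trans (cong (λ t → t * (y x * y x) + a * quad complement (x ∘ suc)) (*-inverseˡ a))
              (cong (_+ a * quad complement (x ∘ suc)) (*-identityˡ (y x * y x)))))))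
      sq : ∀ x i → x i * x i ≤ c * quad A x
      sq x (suc i) = ≤-trans (sq′ (x ∘ suc) i) (≤-trans (*-monoʳ c′ 0≤c′ (Q′≤Q x))
        (*-monoˡ {c′} {c} (quad A x) (Q≥0 x) (≤-by e 0≤e refl)))
      sq x zero = begin
        x zero * x zero
          ≡⟨ x₀≡ ⟩
        a⁻¹ * a⁻¹ * ((y x + - B) * (y x + - B))
          ≤⟨ *-monoʳ (a⁻¹ * a⁻¹) (*-nonNeg 0≤a⁻¹ 0≤a⁻¹) (square-+≤ (y x) (- B)) ⟩
        a⁻¹ * a⁻¹ * ((y x * y x + y x * y x) + (- B * - B + - B * - B))
          ≡⟨ cong (λ t → a⁻¹ * a⁻¹ * ((y x * y x + y x * y x) + t)) (solve 1 (λ b → :- b :* :- b :+ :- b :* :- b := b :* b :+ b :* b) refl B) ⟩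
        a⁻¹ * a⁻¹ * ((y x * y x + y x * y x) + (B * B + B * B))
          ≤⟨ *-monoʳ (a⁻¹ * a⁻¹) (*-nonNeg 0≤a⁻¹ 0≤a⁻¹) (+-mono-≤ (+-mono-≤ (y²≤ x) (y²≤ x)) (+-mono-≤ B²≤ B²≤)) ⟩
        a⁻¹ * a⁻¹ * ((a * Q + a * Q) + (cb * (c′ * Q) + cb * (c′ * Q)))
          ≡⟨ solve 5 (λ i a q c b → i :* i :* ((a :* q :+ a :* q) :+ (b :* (c :* q) :+ b :* (c :* q))) := i :* i :* ((a :+ a) :+ (b :* c :+ b :* c)) :* q) refl a⁻¹ a Q c′ cb ⟩
        e * Q
          ≤⟨ *-monoˡ {e} {c} Q (Q≥0 x) (≤-by c′ 0≤c′ (+-comm e c′)) ⟩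
        c * Q ∎
        where
        open ≤-Reasoning
        Q = quad A x
        B = β (x ∘ suc)
        x₀≡ : x zero * x zero ≡ a⁻¹ * a⁻¹ * ((y x + - B) * (y x + - B))
        x₀≡ = sym (trans (solve 4 (λ i a x b → i :* i :* ((a :* x :+ b :+ :- b) :* (a :* x :+ b :+ :- b)) := (i :* a) :* (i :* a) :* (x :* x)) refl a⁻¹ a (x zero) B)
          (trans (cong (λ t → t * t * (x zero * x zero)) (*-inverseˡ a)) (solve 1 (λ x → con 1ℚ :* con 1ℚ :* x := x) refl (x zero * x zero))))
        B²≤ : B * B ≤ cb * (c′ * Q)
        B²≤ = proj₂ (proj₂ (linear-bound b)) (x ∘ suc) (c′ * Q)
          (λ j → ≤-trans (sq′ (x ∘ suc) j) (*-monoʳ c′ 0≤c′ (Q′≤Q x))) (*-nonNeg 0≤c′ (Q≥0 x))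

  quad≡0⇒0 : ∀ {n} {A : Mat n} → Bounded A → ∀ x → quad A x ≤ 0ℚ → ∀ i → x i ≡ 0ℚ
  quad≡0⇒0 B x q≤0 i with x i ≟ 0ℚ
  ... | yes eq = eq
  ... | no ne = contradiction (<-≤-trans (square-pos ne) (≤-trans (square≤ x i)
          (subst (bound * quad _ x ≤_) (*-zeroʳ bound) (*-monoʳ bound bound≥0 q≤0)))) (<-irrefl refl)
    where open Bounded B

  -- Enumeration of short vectors and decidability of perfection.

  ∣z∣≤ : ∀ z N → ⟦ z ⟧ * ⟦ z ⟧ ≤ ι N → ℤ.∣ z ∣ ℕ.≤ N
  ∣z∣≤ z N h = ℕ.≤-trans (m≤m*m ℤ.∣ z ∣) (ℤ.drop‿+≤+ (subst (ℤ._≤ + N) (abs z) (⟦⟧-cancel-≤ {z ℤ.* z} {+ N} (subst (_≤ ι N) (sym (⟦⟧-* z z)) h))))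
    where
    m≤m*m : ∀ m → m ℕ.≤ m ℕ.* m
    m≤m*m zero    = z≤n
    m≤m*m (suc m) = ℕ.m≤m*n (suc m) (suc m)
    abs : ∀ z → z ℤ.* z ≡ + (ℤ.∣ z ∣ ℕ.* ℤ.∣ z ∣)
    abs (+ m)      = sym (ℤ.pos-* m m)
    abs (-[1+ m ]) = refl

  integers : ℕ → List ℤ
  integers B = List.map +_ (List.upTo (suc B)) ++ List.map (λ m → ℤ.- + m) (List.upTo (suc B))

  ∈-integers : ∀ {B} z → ℤ.∣ z ∣ ℕ.≤ B → z ∈ integers B
  ∈-integers {B} (+ m)      m≤B = ∈.∈-++⁺ˡ (∈.∈-map⁺ +_ (∈.∈-upTo⁺ (s≤s m≤B)))
  ∈-integers {B} (-[1+ m ]) m≤B = ∈.∈-++⁺ʳ (List.map +_ (List.upTo (suc B))) (∈.∈-map⁺ (λ m → ℤ.- + m) (∈.∈-upTo⁺ (s≤s m≤B)))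

  infixr 5 _◂_
  _◂_ : ∀ {a} {X : Set a} {n} → X → (Fin n → X) → Fin (suc n) → X
  (x ◂ f) zero    = x
  (x ◂ f) (suc i) = f i

  functions : ∀ {a} {X : Set a} → List X → ∀ n → List (Fin n → X)
  functions l zero    = (λ ()) ∷ []
  functions l (suc n) = List.concatMap (λ x → List.map (x ◂_) (functions l n)) l

  -- Functions are compared only pointwise, so membership is stated up to a relation `R`. It is a
  -- parameter because the values may themselves be functions, as for tuples of vectors.
  ∈-functions : ∀ {a r} {X : Set a} (R : X → X → Set r) (l : List X) {n} (f : Fin n → X) →
    (∀ i → ∃[ x ] x ∈ l × R x (f i)) → ∃[ g ] g ∈ functions l n × (∀ i → R (g i) (f i))
  ∈-functions R l {zero}  f h = (λ ()) , here refl , λ ()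
  ∈-functions R l {suc n} f h =
    let x , x∈l , rx = h zero
        g , g∈ , rg = ∈-functions R l (f ∘ suc) (h ∘ suc)
    in x ◂ g , ∈.∈-concatMap⁺ (λ x → List.map (x ◂_) (functions l n)) (lose x∈l (∈.∈-map⁺ (x ◂_) g∈)) ,
       λ { zero → rx ; (suc i) → rg i }

  cube : ∀ n → ℕ → List (ℤ^ n)
  cube n B = functions (integers B) n

  ∈-cube : ∀ {n B} (v : ℤ^ n) → (∀ i → ℤ.∣ v i ∣ ℕ.≤ B) → ∃[ w ] w ∈ cube n B × (∀ i → w i ≡ v i)
  ∈-cube {B = B} v h = ∈-functions _≡_ (integers B) v λ i → v i , ∈-integers (v i) (h i) , refl

  nonZeroVector? : ∀ {n} (v : ℤ^ n) → Dec (NonZeroVector v)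
  nonZeroVector? v = F.any? λ i → ¬? (v i ℤ.≟ + 0)

  ⟦⟧ᵛ-cong : ∀ {n} {v w : ℤ^ n} → (∀ i → v i ≡ w i) → ∀ i → ⟦ v ⟧ᵛ i ≡ ⟦ w ⟧ᵛ i
  ⟦⟧ᵛ-cong h i = cong ⟦_⟧ (h i)

  q[_] : ∀ {n} → Mat n → ℤ^ n → ℚ
  q[ A ] v = quad A ⟦ v ⟧ᵛ

  Min : ∀ {n} → Mat n → ℤ^ n → Set
  Min A v = NonZeroVector v × (∀ w → NonZeroVector w → q[ A ] v ≤ q[ A ] w)

  nonZeroVector-cong : ∀ {n} {v w : ℤ^ n} → (∀ i → v i ≡ w i) → NonZeroVector v → NonZeroVector w
  nonZeroVector-cong h (i , v≢0) = i , λ eq → v≢0 (trans (h i) eq)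

  Min-cong : ∀ {n} {A A′ : Mat n} {v w} → (∀ i j → A i j ≡ A′ i j) → (∀ i → v i ≡ w i) → Min A v → Min A′ w
  Min-cong {A = A} {A′} hA h (nz , m) = nonZeroVector-cong h nz , λ u nu →
    subst₂ _≤_ (bil-cong {A = A} {A′} hA (⟦⟧ᵛ-cong h) (⟦⟧ᵛ-cong h)) (bil-cong {A = A} {A′} {⟦ u ⟧ᵛ} {⟦ u ⟧ᵛ} {⟦ u ⟧ᵛ} {⟦ u ⟧ᵛ} hA (λ _ → refl) (λ _ → refl)) (m u nu)

  module _ {n} {A : Mat n} (B : Bounded A) where
    open Bounded B

    radius : ℚ → ℕ
    radius M = proj₁ (archimedean (bound * M))

    short⇒∈cube : ∀ M w → q[ A ] w ≤ M → ∃[ w′ ] w′ ∈ cube n (radius M) × (∀ i → w′ i ≡ w i)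
    short⇒∈cube M w q≤M = ∈-cube w λ i → ∣z∣≤ (w i) (radius M)
      (≤-trans (square≤ ⟦ w ⟧ᵛ i) (≤-trans (*-monoʳ bound bound≥0 q≤M)
        (≤-trans (p≤∣p∣ (bound * M)) (proj₂ (archimedean (bound * M))))))

    -- A nonzero vector shorter than `v` lies in the cube whose radius is computed from the norm of
    -- `v`, so minimality is a finite check.
    min? : ∀ v → Dec (Min A v)
    min? v with nonZeroVector? v
    ... | no z = no (z ∘ proj₁)
    ... | yes nz with any? (λ w → nonZeroVector? w ×-dec (q[ A ] w <? q[ A ] v)) (cube n (radius (q[ A ] v)))
    ...   | yes shorter = no λ (_ , m) → let w , _ , nw , w<v = find shorter in <-irrefl refl (<-≤-trans w<v (m w nw))
    ...   | no ¬shorter = yes (nz , λ w nw → ≮⇒≥ λ w<v →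
              let w′ , w′∈ , eq = short⇒∈cube (q[ A ] v) w (<⇒≤ w<v)
              in ¬shorter (lose w′∈ (nonZeroVector-cong (sym ∘ eq) nw ,
                   subst (_< q[ A ] v) (quad-cong A (⟦⟧ᵛ-cong (sym ∘ eq))) w<v)))

    minimalVectors : ∀ e → NonZeroVector e →
      Σ[ l ∈ List (ℤ^ n) ] (∀ {v} → v ∈ l → Min A v) × (∀ v → Min A v → ∃[ w ] w ∈ l × (∀ i → w i ≡ v i))
    minimalVectors e ne = List.filter min? C , (λ v∈ → proj₂ (∈.∈-filter⁻ min? {xs = C} v∈)) , complete
      where
      C = cube n (radius (q[ A ] e))
      complete : ∀ v → Min A v → ∃[ w ] w ∈ List.filter min? C × (∀ i → w i ≡ v i)
      complete v mv =
        let w , w∈ , eq = short⇒∈cube (q[ A ] e) v (proj₂ mv e ne)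
        in w , ∈.∈-filter⁺ min? w∈ (Min-cong (λ _ _ → refl) (sym ∘ eq) mv) , eq

  -- Negative form of perfection: no nonzero symmetric matrix vanishes on all minimal vectors.
  -- `MinimalFrame` below is the positive form, and over ℚ the two are equivalent by elimination.
  Perfect : ∀ {n} → Mat n → Set
  Perfect {n} A = ∀ S → Symm S → (∀ v → Min A v → q[ S ] v ≡ 0ℚ) → ∀ i j → S i j ≡ 0ℚ

  MinimalFrame : ∀ {n} → Mat n → Set
  MinimalFrame {n} A = Σ[ w ∈ (Fin (n ℕ.* n) → ℤ^ n) ] (∀ k → Min A (w k)) × SymSpanning (λ k → ⟦ w k ⟧ᵛ)

  minimalFrame⇒perfect : ∀ {n} {A : Mat n} → MinimalFrame A → Perfect A
  minimalFrame⇒perfect (w , mw , sp) S symS h = symSpanning⇒unannihilated {v = λ k → ⟦ w k ⟧ᵛ} sp S symS (λ k → h (w k) (mw k))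

  minimalFrame? : ∀ {n} {A : Mat (suc n)} → Bounded A → MinimalFrame A ⊎ (¬ Perfect A)
  minimalFrame? {n} {A} B =
    let l , sound , complete = minimalVectors B (δᶻ zero) (zero , λ ()) in go l sound complete
    where
    go : (l : List (ℤ^ suc n)) → (∀ {v} → v ∈ l → Min A v) → (∀ v → Min A v → ∃[ w ] w ∈ l × (∀ i → w i ≡ v i)) →
      MinimalFrame A ⊎ (¬ Perfect A)
    -- With no minimal vectors, the matrix of ones vanishes on all of them vacuously, which refutes
    -- `Perfect`.
    go [] sound complete = inj₂ λ p → contradiction (p (λ _ _ → 1ℚ) (λ _ _ → refl) none zero zero) λ ()
      where
      none : ∀ v → Min A v → q[ (λ _ _ → 1ℚ) ] v ≡ 0ℚ
      none v mv = ⊥-elim (case proj₁ (proj₂ (complete v mv)) of λ ())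
    go (v₀ ∷ l) sound complete = frame (symGauss family)
      where
      family : Fin (suc (length l)) → Vec (suc n)
      family k = ⟦ List.lookup (v₀ ∷ l) k ⟧ᵛ
      frame : (Σ[ s ∈ (Fin (suc n ℕ.* suc n) → Fin (suc (length l))) ] SymSpanning (family ∘ s)) ⊎ SymAnnihilated family →
        MinimalFrame A ⊎ (¬ Perfect A)
      frame (inj₁ (s , sp)) = inj₁ (List.lookup (v₀ ∷ l) ∘ s , (λ k → sound (∈.∈-lookup (s k))) , sp)
      frame (inj₂ (S , symS , (i , j , S≢0) , kill)) = inj₂ λ p → S≢0 (p S symS vanish i j)
        where
        vanish : ∀ v → Min A v → q[ S ] v ≡ 0ℚ
        vanish v mv =
          let w , w∈ , w≗v = complete v mv
          in trans (quad-cong S (⟦⟧ᵛ-cong (sym ∘ w≗v)))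
               (trans (cong (λ u → quad S ⟦ u ⟧ᵛ) (lookup-index w∈)) (kill (index w∈)))

  -- Content of an integral matrix and primitivity.

  gcds : ∀ {n} → (Fin n → ℕ) → ℕ
  gcds {zero}  f = 0
  gcds {suc n} f = ℕ.gcd (f zero) (gcds (f ∘ suc))

  gcds∣ : ∀ {n} (f : Fin n → ℕ) i → gcds f ℕ.∣ f i
  gcds∣ f zero    = ℕ.gcd[m,n]∣m (f zero) _
  gcds∣ f (suc i) = ℕ.∣-trans (ℕ.gcd[m,n]∣n (f zero) _) (gcds∣ (f ∘ suc) i)

  gcds-greatest : ∀ {n} (f : Fin n → ℕ) {k} → (∀ i → k ℕ.∣ f i) → k ℕ.∣ gcds f
  gcds-greatest {zero}  f h = _ ℕ.∣0
  gcds-greatest {suc n} f h = ℕ.gcd-greatest (h zero) (gcds-greatest (f ∘ suc) (h ∘ suc))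

  gcds-* : ∀ {n} c (f : Fin n → ℕ) → gcds (λ i → c ℕ.* f i) ≡ c ℕ.* gcds f
  gcds-* {zero}  c f = sym (ℕ.*-zeroʳ c)
  gcds-* {suc n} c f = trans (cong (ℕ.gcd (c ℕ.* f zero)) (gcds-* c (f ∘ suc))) (sym (ℕ.c*gcd[m,n]≡gcd[cm,cn] c (f zero) _))

  gcds-cong : ∀ {n} {f f′ : Fin n → ℕ} → (∀ i → f i ≡ f′ i) → gcds f ≡ gcds f′
  gcds-cong {zero}  h = refl
  gcds-cong {suc n} h = cong₂ ℕ.gcd (h zero) (gcds-cong (h ∘ suc))

  content : ∀ {n} → (Fin n → Fin n → ℤ) → ℕ
  content g = gcds λ i → gcds λ j → ℤ.∣ g i j ∣

  content∣ : ∀ {n} (g : Fin n → Fin n → ℤ) i j → content g ℕ.∣ ℤ.∣ g i j ∣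
  content∣ g i j = ℕ.∣-trans (gcds∣ (λ i → gcds λ j → ℤ.∣ g i j ∣) i) (gcds∣ (λ j → ℤ.∣ g i j ∣) j)

  content-* : ∀ {n} (c : ℕ) (g : Fin n → Fin n → ℤ) → content (λ i j → + c ℤ.* g i j) ≡ c ℕ.* content g
  content-* c g = trans (gcds-cong λ i → trans (gcds-cong λ j → ℤ.abs-* (+ c) (g i j)) (gcds-* c λ j → ℤ.∣ g i j ∣))
    (gcds-* c λ i → gcds λ j → ℤ.∣ g i j ∣)

  content-cong : ∀ {n} {g g′ : Fin n → Fin n → ℤ} → (∀ i j → g i j ≡ g′ i j) → content g ≡ content g′
  content-cong h = gcds-cong λ i → gcds-cong λ j → cong ℤ.∣_∣ (h i j)

  -- Only the entries are tested: all other scalar products are integral combinations of them, as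
  -- `∣-bilᶻ` uses later.
  Primitive : ∀ {n} → (Fin n → Fin n → ℤ) → Set
  Primitive g = ∀ k → (∀ i j → k ℕ.∣ ℤ.∣ g i j ∣) → k ≡ 1

  primitive⇒content : ∀ {n} {g : Fin n → Fin n → ℤ} → Primitive g → content g ≡ 1
  primitive⇒content {g = g} p = p (content g) (content∣ g)

  content⇒primitive : ∀ {n} {g : Fin n → Fin n → ℤ} → content g ≡ 1 → Primitive g
  content⇒primitive {g = g} c≡1 k h = ℕ.∣1⇒≡1 (subst (k ℕ.∣_) c≡1
    (gcds-greatest (λ i → gcds λ j → ℤ.∣ g i j ∣) λ i → gcds-greatest (λ j → ℤ.∣ g i j ∣) (h i)))

  record Good {n} (g : Fin n → Fin n → ℤ) : Set where
    field
      symmetric : ∀ i j → g i j ≡ g j i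
      bounded   : Bounded ⟦ g ⟧ᵐ
      perfect   : Perfect ⟦ g ⟧ᵐ
      coprime   : Primitive g

    symm : Symm ⟦ g ⟧ᵐ
    symm i j = cong ⟦_⟧ (symmetric i j)

  bounded⇒anisotropic : ∀ {n} {A : Mat n} → Bounded A → ¬ Isotropic A
  bounded⇒anisotropic B (x , (i , x≢0) , q≤0) = x≢0 (quad≡0⇒0 B x q≤0 i)

  module _ {n} (g : Fin (suc n) → Fin (suc n) → ℤ) where

    private
      step₃ : (∀ i j → g i j ≡ g j i) → Bounded ⟦ g ⟧ᵐ → Perfect ⟦ g ⟧ᵐ → Dec (content g ≡ 1) → Dec (Good g)
      step₃ sy B P (yes c≡1) = yes record { symmetric = sy ; bounded = B ; perfect = P ; coprime = content⇒primitive {g = g} c≡1 }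
      step₃ sy B P (no c≢1)  = no λ G → c≢1 (primitive⇒content {g = g} (Good.coprime G))

      step₂ : (∀ i j → g i j ≡ g j i) → Bounded ⟦ g ⟧ᵐ → MinimalFrame ⟦ g ⟧ᵐ ⊎ (¬ Perfect ⟦ g ⟧ᵐ) → Dec (Good g)
      step₂ sy B (inj₁ frame) = step₃ sy B (minimalFrame⇒perfect {A = ⟦ g ⟧ᵐ} frame) (content g ℕ.≟ 1)
      step₂ sy B (inj₂ ¬perf) = no λ G → ¬perf (Good.perfect G)

      step₁ : (∀ i j → g i j ≡ g j i) → Bounded ⟦ g ⟧ᵐ ⊎ Isotropic ⟦ g ⟧ᵐ → Dec (Good g)
      step₁ sy (inj₁ B)   = step₂ sy B (minimalFrame? {A = ⟦ g ⟧ᵐ} B)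
      step₁ sy (inj₂ iso) = no λ G → bounded⇒anisotropic {A = ⟦ g ⟧ᵐ} (Good.bounded G) iso

      step₀ : Dec (∀ i j → g i j ≡ g j i) → Dec (Good g)
      step₀ (yes sy) = step₁ sy (lagrange ⟦ g ⟧ᵐ (λ i j → cong ⟦_⟧ (sy i j)))
      step₀ (no ¬sy) = no λ G → ¬sy (Good.symmetric G)

    good? : Dec (Good g)
    good? = step₀ (F.all? λ i → F.all? λ j → g i j ℤ.≟ g j i)

  -- Isometries.

  app : ∀ {m n} → (Fin m → Vec n) → Vec m → Vec n
  app u x i = sum λ j → x j * u j i

  appᶻ : ∀ {m n} → (Fin m → ℤ^ n) → ℤ^ m → ℤ^ n
  appᶻ u x i = sumᶻ λ j → x j ℤ.* u j i

  ⟦_⟧ᶠ : ∀ {m n} → (Fin m → ℤ^ n) → Fin m → Vec n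
  ⟦ u ⟧ᶠ j = ⟦ u j ⟧ᵛ

  ⟦appᶻ⟧ : ∀ {m n} (u : Fin m → ℤ^ n) x i → ⟦ appᶻ u x i ⟧ ≡ app ⟦ u ⟧ᶠ ⟦ x ⟧ᵛ i
  ⟦appᶻ⟧ u x i = trans (⟦⟧-sum λ j → x j ℤ.* u j i) (sum-cong λ j → ⟦⟧-* (x j) (u j i))

  app-app : ∀ {l m n} (u : Fin m → Vec n) (w : Fin l → Vec m) x i →
    app u (app w x) i ≡ sum (λ k → x k * app u (w k) i)
  app-app u w x i = begin
    sum (λ j → sum (λ k → x k * w k j) * u j i)     ≡⟨ sum-cong (λ j → sym (sum-*ʳ (u j i) λ k → x k * w k j)) ⟩
    sum (λ j → sum (λ k → x k * w k j * u j i))     ≡⟨ sum-swap (λ j k → x k * w k j * u j i) ⟩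
    sum (λ k → sum (λ j → x k * w k j * u j i))     ≡⟨ sum-cong (λ k → trans (sum-cong λ j → *-assoc (x k) (w k j) (u j i)) (sum-* (x k) λ j → w k j * u j i)) ⟩
    sum (λ k → x k * sum (λ j → w k j * u j i))     ∎
    where open ≡-Reasoning

  app-δ : ∀ {m n} (u : Fin m → Vec n) k i → app u (δ k) i ≡ u k i
  app-δ u k i = sum-δ k λ j → u j i

  bil-app : ∀ {m n} (A : Mat n) (u : Fin m → Vec n) x y →
    bil A (app u x) (app u y) ≡ bil (λ i j → bil A (u i) (u j)) x y
  bil-app A u x y = begin
    bil A (app u x) (app u y)                            ≡⟨ bil-sumˡ A x u (app u y) ⟩
    sum (λ i → x i * bil A (u i) (app u y))              ≡⟨ sum-cong (λ i → cong (x i *_) (bil-sumʳ A y (u i) u)) ⟩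
    sum (λ i → x i * sum (λ j → y j * bil A (u i) (u j)))
      ≡⟨ sum-cong (λ i → trans (sym (sum-* (x i) λ j → y j * bil A (u i) (u j)))
           (sum-cong λ j → solve 3 (λ x y a → x :* (y :* a) := x :* a :* y) refl (x i) (y j) (bil A (u i) (u j)))) ⟩
    sum (λ i → sum (λ j → x i * bil A (u i) (u j) * y j)) ∎
    where open ≡-Reasoning

  -- u and w list the images of the basis vectors under an isometry from A to A′ and its inverse.
  record IsIso {n} (A A′ : Mat n) (u w : Fin n → ℤ^ n) : Set where
    field
      uw        : ∀ k i → app ⟦ u ⟧ᶠ ⟦ w k ⟧ᵛ i ≡ δ k i
      wu        : ∀ k i → app ⟦ w ⟧ᶠ ⟦ u k ⟧ᵛ i ≡ δ k i
      preserves : ∀ i j → bil A′ ⟦ u i ⟧ᵛ ⟦ u j ⟧ᵛ ≡ A i j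

    uw-app : ∀ x i → app ⟦ u ⟧ᶠ (app ⟦ w ⟧ᶠ x) i ≡ x i
    uw-app x i = trans (app-app ⟦ u ⟧ᶠ ⟦ w ⟧ᶠ x i) (trans (sum-cong λ k → cong (x k *_) (uw k i)) (sum-δʳ i x))

    wu-app : ∀ x i → app ⟦ w ⟧ᶠ (app ⟦ u ⟧ᶠ x) i ≡ x i
    wu-app x i = trans (app-app ⟦ w ⟧ᶠ ⟦ u ⟧ᶠ x i) (trans (sum-cong λ k → cong (x k *_) (wu k i)) (sum-δʳ i x))

    bil-u : ∀ x y → bil A′ (app ⟦ u ⟧ᶠ x) (app ⟦ u ⟧ᶠ y) ≡ bil A x y
    bil-u x y = trans (bil-app A′ ⟦ u ⟧ᶠ x y) (bil-cong {x = x} {x} {y} {y} preserves (λ _ → refl) (λ _ → refl))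

    bil-w : ∀ x y → bil A (app ⟦ w ⟧ᶠ x) (app ⟦ w ⟧ᶠ y) ≡ bil A′ x y
    bil-w x y = trans (sym (bil-u (app ⟦ w ⟧ᶠ x) (app ⟦ w ⟧ᶠ y))) (bil-cong {A = A′} (λ _ _ → refl) (uw-app x) (uw-app y))

  Iso : ∀ {n} → Mat n → Mat n → Set
  Iso {n} A A′ = Σ[ u ∈ (Fin n → ℤ^ n) ] Σ[ w ∈ (Fin n → ℤ^ n) ] IsIso A A′ u w

  iso-sym : ∀ {n} {A A′ : Mat n} → Iso A A′ → Iso A′ A
  iso-sym {A = A} {A′} (u , w , I) = w , u , record { uw = wu ; wu = uw ; preserves = pres }
    where
    open IsIso I
    pres : ∀ i j → bil A ⟦ w i ⟧ᵛ ⟦ w j ⟧ᵛ ≡ A′ i j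
    pres i j = trans (bil-cong {A = A} (λ _ _ → refl) (λ k → sym (app-δ ⟦ w ⟧ᶠ i k)) (λ k → sym (app-δ ⟦ w ⟧ᶠ j k)))
      (trans (bil-w (δ i) (δ j)) (bil-δ A′ i j))

  iso-≡ : ∀ {n} {A A′ : Mat n} → (∀ i j → A′ i j ≡ A i j) → Iso A A′
  iso-≡ {A = A} {A′} h = δᶻ , δᶻ , record
    { uw = λ k i → app-δ δ k i ; wu = λ k i → app-δ δ k i ; preserves = λ i j → trans (bil-δ A′ i j) (h i j) }

  iso-trans : ∀ {n} {A A′ A″ : Mat n} → Iso A A′ → Iso A′ A″ → Iso A A″
  iso-trans {A = A} {A′} {A″} (u , w , I) (u′ , w′ , I′) = (λ k → appᶻ u′ (u k)) , (λ k → appᶻ w (w′ k)) , record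
    { uw        = inverse u′ u w w′ (IsIso.uw-app I) (IsIso.uw I′)
    ; wu        = inverse w w′ u′ u (IsIso.wu-app I′) (IsIso.wu I)
    ; preserves = λ i j → trans (bil-cong {A = A″} (λ _ _ → refl) (⟦appᶻ⟧ u′ (u i)) (⟦appᶻ⟧ u′ (u j)))
                    (trans (IsIso.bil-u I′ ⟦ u i ⟧ᵛ ⟦ u j ⟧ᵛ) (IsIso.preserves I i j))
    }
    where
    open ≡-Reasoning
    inverse : ∀ (a b c d : Fin _ → ℤ^ _) → (∀ x i → app ⟦ b ⟧ᶠ (app ⟦ c ⟧ᶠ x) i ≡ x i) →
      (∀ k i → app ⟦ a ⟧ᶠ ⟦ d k ⟧ᵛ i ≡ δ k i) →
      ∀ k i → app ⟦ (λ l → appᶻ a (b l)) ⟧ᶠ ⟦ appᶻ c (d k) ⟧ᵛ i ≡ δ k i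
    inverse a b c d bc ad k i = begin
      sum (λ l → ⟦ appᶻ c (d k) l ⟧ * ⟦ appᶻ a (b l) i ⟧)
        ≡⟨ sum-cong (λ l → cong₂ _*_ (⟦appᶻ⟧ c (d k) l) (⟦appᶻ⟧ a (b l) i)) ⟩
      sum (λ l → app ⟦ c ⟧ᶠ ⟦ d k ⟧ᵛ l * app ⟦ a ⟧ᶠ ⟦ b l ⟧ᵛ i)
        ≡⟨ sym (app-app ⟦ a ⟧ᶠ ⟦ b ⟧ᶠ (app ⟦ c ⟧ᶠ ⟦ d k ⟧ᵛ) i) ⟩
      app ⟦ a ⟧ᶠ (app ⟦ b ⟧ᶠ (app ⟦ c ⟧ᶠ ⟦ d k ⟧ᵛ)) i
        ≡⟨ sum-cong (λ j → cong (_* ⟦ a j i ⟧) (bc ⟦ d k ⟧ᵛ j)) ⟩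
      app ⟦ a ⟧ᶠ ⟦ d k ⟧ᵛ i
        ≡⟨ ad k i ⟩
      δ k i ∎

  isIso-cong : ∀ {n} {A A′ : Mat n} {u w u′ w′} → (∀ k i → u k i ≡ u′ k i) → (∀ k i → w k i ≡ w′ k i) →
    IsIso A A′ u w → IsIso A A′ u′ w′
  isIso-cong {A = A} {A′} {u} {w} {u′} {w′} hu hw I = record
    { uw        = λ k i → trans (sum-cong λ j → cong₂ _*_ (cong ⟦_⟧ (sym (hw k j))) (cong ⟦_⟧ (sym (hu j i)))) (uw k i)
    ; wu        = λ k i → trans (sum-cong λ j → cong₂ _*_ (cong ⟦_⟧ (sym (hu k j))) (cong ⟦_⟧ (sym (hw j i)))) (wu k i)
    ; preserves = λ i j → trans (bil-cong {A = A′} (λ _ _ → refl) (⟦⟧ᵛ-cong (sym ∘ hu i)) (⟦⟧ᵛ-cong (sym ∘ hu j))) (preserves i j)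
    }
    where open IsIso I

  isIso? : ∀ {n} (A A′ : Mat n) u w → Dec (IsIso A A′ u w)
  isIso? A A′ u w = map′ (λ (a , b , c) → record { uw = a ; wu = b ; preserves = c })
    (λ I → IsIso.uw I , IsIso.wu I , IsIso.preserves I)
    (F.all? (λ k → F.all? λ i → app ⟦ u ⟧ᶠ ⟦ w k ⟧ᵛ i ≟ δ k i) ×-dec
    (F.all? (λ k → F.all? λ i → app ⟦ w ⟧ᶠ ⟦ u k ⟧ᵛ i ≟ δ k i) ×-dec
     F.all? (λ i → F.all? λ j → bil A′ ⟦ u i ⟧ᵛ ⟦ u j ⟧ᵛ ≟ A i j)))

  -- The images of the basis vectors have the norms `A j j` and therefore lie in an explicit cube.
  -- The images under the inverse are enumerated in the same way.
  iso? : ∀ {n} {A A′ : Mat n} → Bounded A → Bounded A′ → Dec (Iso A A′)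
  iso? {n} {A} {A′} B B′ = decide (any? (λ u → any? (isIso? A A′ u) ws) us)
    where
    diagonal : Mat n → ℚ
    diagonal S = sum λ j → ∣ S j j ∣
    diagonal≤ : ∀ S j → S j j ≤ diagonal S
    diagonal≤ S j = ≤-trans (p≤∣p∣ (S j j)) (term≤sum {f = λ j → ∣ S j j ∣} (λ j → 0≤∣p∣ (S j j)) j)
    us ws : List (Fin n → ℤ^ n)
    us = functions (cube n (radius B′ (diagonal A))) n
    ws = functions (cube n (radius B (diagonal A′))) n
    candidates : ∀ {S S′} (BS′ : Bounded S′) (u : Fin n → ℤ^ n) → (∀ j → q[ S′ ] (u j) ≡ S j j) →
      ∃[ u′ ] u′ ∈ functions (cube n (radius BS′ (diagonal S))) n × (∀ k i → u′ k i ≡ u k i)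
    candidates {S} {S′} BS′ u h = ∈-functions (λ v w → ∀ i → v i ≡ w i) (cube n (radius BS′ (diagonal S))) u λ j →
      short⇒∈cube BS′ (diagonal S) (u j) (subst (_≤ diagonal S) (sym (h j)) (diagonal≤ S j))
    decide : Dec (Any (λ u → Any (IsIso A A′ u) ws) us) → Dec (Iso A A′)
    decide (yes p) = let u , _ , q = find p ; w , _ , I = find q in yes (u , w , I)
    decide (no ¬p) = no λ (u , w , I) →
      let u′ , u∈ , hu = candidates {A} {A′} B′ u (λ j → IsIso.preserves I j j)
          w′ , w∈ , hw = candidates {A′} {A} B w (λ j → IsIso.preserves (proj₂ (proj₂ (iso-sym (u , w , I)))) j j)
      in ¬p (lose u∈ (lose w∈ (isIso-cong (λ k i → sym (hu k i)) (λ k i → sym (hw k i)) I)))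

  min-iso : ∀ {n} {A A′ : Mat n} ((u , w , _) : Iso A A′) → ∀ v → Min A′ v → Min A (appᶻ w v)
  min-iso {A = A} {A′} (u , w , I) v ((i₀ , v≢0) , m) = nonzero , shortest
    where
    open IsIso I
    nonzero : NonZeroVector (appᶻ w v)
    nonzero with F.any? (λ i → ¬? (appᶻ w v i ℤ.≟ + 0))
    ... | yes p = p
    ... | no ¬p = contradiction (⟦⟧-injective {v i₀} {+ 0} (trans (sym (uw-app ⟦ v ⟧ᵛ i₀))
            (sum-0 λ j → trans (cong (_* ⟦ u j i₀ ⟧) (trans (sym (⟦appᶻ⟧ w v j)) (cong ⟦_⟧ (zero-at j)))) (*-zeroˡ ⟦ u j i₀ ⟧)))) v≢0
      where
      zero-at : ∀ j → appᶻ w v j ≡ + 0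
      zero-at j with appᶻ w v j ℤ.≟ + 0
      ... | yes eq = eq
      ... | no ne = contradiction (j , ne) ¬p
    shortest : ∀ x → NonZeroVector x → q[ A ] (appᶻ w v) ≤ q[ A ] x
    shortest x (i , x≢0) = subst₂ _≤_
      (sym (trans (quad-cong A (⟦appᶻ⟧ w v)) (bil-w ⟦ v ⟧ᵛ ⟦ v ⟧ᵛ)))
      (trans (quad-cong A′ (⟦appᶻ⟧ u x)) (bil-u ⟦ x ⟧ᵛ ⟦ x ⟧ᵛ))
      (m (appᶻ u x) nz)
      where
      nz : NonZeroVector (appᶻ u x)
      nz with F.any? (λ i → ¬? (appᶻ u x i ℤ.≟ + 0))
      ... | yes p = p
      ... | no ¬p = contradiction (⟦⟧-injective {x i} {+ 0} (trans (sym (wu-app ⟦ x ⟧ᵛ i))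
              (sum-0 λ j → trans (cong (_* ⟦ w j i ⟧) (trans (sym (⟦appᶻ⟧ u x j)) (cong ⟦_⟧ (zero-at j)))) (*-zeroˡ ⟦ w j i ⟧)))) x≢0
        where
        zero-at : ∀ j → appᶻ u x j ≡ + 0
        zero-at j with appᶻ u x j ℤ.≟ + 0
        ... | yes eq = eq
        ... | no ne = contradiction (j , ne) ¬p

  ∣-sum : ∀ {n} k (f : Fin n → ℤ) → (∀ i → k ℕ.∣ ℤ.∣ f i ∣) → k ℕ.∣ ℤ.∣ sumᶻ f ∣
  ∣-sum {zero}  k f h = k ℕ.∣0
  ∣-sum {suc n} k f h = ℤˢ.∣⇒∣ᵤ {+ k} {sumᶻ f} (ℤˢ.∣m∣n⇒∣m+n {+ k} {f zero} {sumᶻ (f ∘ suc)} (ℤˢ.∣ᵤ⇒∣ {+ k} {f zero} (h zero)) (ℤˢ.∣ᵤ⇒∣ {+ k} {sumᶻ (f ∘ suc)} (∣-sum k (f ∘ suc) (h ∘ suc))))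

  bilᶻ : ∀ {n} → (Fin n → Fin n → ℤ) → ℤ^ n → ℤ^ n → ℤ
  bilᶻ g x y = sumᶻ λ i → sumᶻ λ j → x i ℤ.* g i j ℤ.* y j

  ⟦bilᶻ⟧ : ∀ {n} (g : Fin n → Fin n → ℤ) x y → ⟦ bilᶻ g x y ⟧ ≡ bil ⟦ g ⟧ᵐ ⟦ x ⟧ᵛ ⟦ y ⟧ᵛ
  ⟦bilᶻ⟧ g x y = trans (⟦⟧-sum λ i → sumᶻ λ j → x i ℤ.* g i j ℤ.* y j) (sum-cong λ i →
    trans (⟦⟧-sum λ j → x i ℤ.* g i j ℤ.* y j) (sum-cong λ j →
      trans (⟦⟧-* (x i ℤ.* g i j) (y j)) (cong (_* ⟦ y j ⟧) (⟦⟧-* (x i) (g i j)))))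

  ∣-bilᶻ : ∀ {n} k (g : Fin n → Fin n → ℤ) x y → (∀ i j → k ℕ.∣ ℤ.∣ g i j ∣) → k ℕ.∣ ℤ.∣ bilᶻ g x y ∣
  ∣-bilᶻ k g x y h = ∣-sum k (λ i → sumᶻ λ j → x i ℤ.* g i j ℤ.* y j) λ i → ∣-sum k (λ j → x i ℤ.* g i j ℤ.* y j) λ j →
    subst (k ℕ.∣_) (sym (trans (ℤ.abs-* (x i ℤ.* g i j) (y j)) (cong (ℕ._* ℤ.∣ y j ∣) (ℤ.abs-* (x i) (g i j)))))
      (ℕ.∣m⇒∣m*n ℤ.∣ y j ∣ (ℕ.∣n⇒∣m*n ℤ.∣ x i ∣ (h i j)))

  -- A vector isotropic for `A` would be carried to one isotropic for `A′`, so `lagrange` must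
  -- return a bound for `A`.
  bounded-iso : ∀ {n} {A A′ : Mat n} → Iso A A′ → Symm A → Bounded A′ → Bounded A
  bounded-iso {n} {A} {A′} (u , w , I) symA B = anisotropic (lagrange A symA)
    where
    open IsIso I
    anisotropic : Bounded A ⊎ Isotropic A → Bounded A
    anisotropic (inj₁ B′) = B′
    anisotropic (inj₂ (x , (i , x≢0) , q≤0)) = contradiction
      (trans (sym (wu-app x i)) (sum-0 λ j → trans (cong (_* ⟦ w j i ⟧) (ux≡0 j)) (*-zeroˡ ⟦ w j i ⟧))) x≢0
      where
      ux≡0 : ∀ j → app ⟦ u ⟧ᶠ x j ≡ 0ℚ
      ux≡0 = quad≡0⇒0 B (app ⟦ u ⟧ᶠ x) (subst (_≤ 0ℚ) (sym (bil-u x x)) q≤0)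

  good-iso : ∀ {n} {g g′ : Fin n → Fin n → ℤ} → Iso ⟦ g ⟧ᵐ ⟦ g′ ⟧ᵐ → Good g′ → Good g
  good-iso {n} {g} {g′} (u , w , I) G = record { symmetric = sy ; bounded = bounded′ ; perfect = perf ; coprime = prim }
    where
    open IsIso I
    open Good G
    sy : ∀ i j → g i j ≡ g j i
    sy i j = ⟦⟧-injective {g i j} {g j i} (trans (sym (preserves i j)) (trans (bil-sym symm ⟦ u i ⟧ᵛ ⟦ u j ⟧ᵛ) (preserves j i)))
    bounded′ = bounded-iso (u , w , I) (λ i j → cong ⟦_⟧ (sy i j)) bounded
    perf : Perfect ⟦ g ⟧ᵐ
    perf S symS h i j = begin
      S i j                                               ≡⟨ sym (bil-δ S i j) ⟩
      bil S (δ i) (δ j)                                   ≡⟨ bil-cong {A = S} (λ _ _ → refl) (sym ∘ wu i) (sym ∘ wu j) ⟩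
      bil S (app ⟦ w ⟧ᶠ ⟦ u i ⟧ᵛ) (app ⟦ w ⟧ᶠ ⟦ u j ⟧ᵛ)   ≡⟨ bil-app S ⟦ w ⟧ᶠ ⟦ u i ⟧ᵛ ⟦ u j ⟧ᵛ ⟩
      bil S′ ⟦ u i ⟧ᵛ ⟦ u j ⟧ᵛ                            ≡⟨ sum-0 (λ a → sum-0 λ b → trans (cong (λ t → ⟦ u i a ⟧ * t * ⟦ u j b ⟧) (S′≡0 a b))
                                                               (solve 2 (λ x y → x :* con 0ℚ :* y := con 0ℚ) refl ⟦ u i a ⟧ ⟦ u j b ⟧)) ⟩
      0ℚ                                                  ∎
      where
      open ≡-Reasoning
      S′ : Mat n
      S′ a b = bil S ⟦ w a ⟧ᵛ ⟦ w b ⟧ᵛ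
      -- `S′` is `S` transported along `w`. It vanishes on the minimal vectors of `g′` because `w`
      -- maps them to minimal vectors of `g`.
      S′≡0 : ∀ a b → S′ a b ≡ 0ℚ
      S′≡0 = perfect S′ (λ a b → bil-sym symS ⟦ w a ⟧ᵛ ⟦ w b ⟧ᵛ) λ v mv →
        trans (sym (bil-app S ⟦ w ⟧ᶠ ⟦ v ⟧ᵛ ⟦ v ⟧ᵛ))
          (trans (quad-cong S (sym ∘ ⟦appᶻ⟧ w v)) (h (appᶻ w v) (min-iso (u , w , I) v mv)))
    prim : Primitive g
    prim k h = coprime k λ i j → subst (λ z → k ℕ.∣ ℤ.∣ z ∣)
      (⟦⟧-injective {bilᶻ g (w i) (w j)} {g′ i j} (trans (⟦bilᶻ⟧ g (w i) (w j)) (IsIso.preserves (proj₂ (proj₂ (iso-sym (u , w , I)))) i j)))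
      (∣-bilᶻ k g (w i) (w j) h)

  -- Real lattices and integral Gram matrices.

  -- Convergence to a rational limit. Order and equality of the scalar products of an integral
  -- lattice are read off from their limits, where they are decidable, unlike for general reals.
  Tends : (ℕ → ℚ) → ℚ → Set
  Tends s q = ∀ δ → 0ℚ < δ → ∃[ N ] (∀ n → N ℕ.≤ n → ∣ s n - q ∣ < δ)

  tends-const : ∀ q → Tends (λ _ → q) q
  tends-const q δ 0<δ = 0 , λ _ _ → subst (_< δ) (cong ∣_∣ (sym (+-inverseʳ q))) 0<δ

  tends-cong : ∀ {s t q} → (∀ n → s n ≡ t n) → Tends s q → Tends t q
  tends-cong {q = q} h T δ 0<δ = let N , b = T δ 0<δ in N , λ n N≤n → subst (λ u → ∣ u - q ∣ < δ) (h n) (b n N≤n)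

  tends-+ : ∀ {s t p q} → Tends s p → Tends t q → Tends (λ n → s n + t n) (p + q)
  tends-+ {s} {t} {p} {q} S T δ 0<δ =
    let M , hs = S (δ * ½) (*-pos 0<δ ½>0)
        N , ht = T (δ * ½) (*-pos 0<δ ½>0)
    in M ℕ.⊔ N , λ n h → ≤-<-trans
      (subst (λ u → ∣ u ∣ ≤ ∣ s n - p ∣ + ∣ t n - q ∣)
        (solve 4 (λ a b c d → (a :- c) :+ (b :- d) := (a :+ b) :- (c :+ d)) refl (s n) (t n) p q)
        (∣p+q∣≤∣p∣+∣q∣ (s n - p) (t n - q)))
      (subst (∣ s n - p ∣ + ∣ t n - q ∣ <_) (½+½ δ)
        (+-mono-< (hs n (ℕ.m⊔n≤o⇒m≤o M N h)) (ht n (ℕ.m⊔n≤o⇒n≤o M N h))))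

  tends-* : ∀ c {s q} → Tends s q → Tends (λ n → c * s n) (c * q)
  tends-* c {s} {q} S δ 0<δ =
    let m , c≤m = archimedean c
        N , h = S (δ * recip m) (*-pos 0<δ (0<recip m))
    in N , λ n N≤n → ≤-<-trans
      (subst (_≤ ι (suc m) * ∣ s n - q ∣)
        (trans (sym (∣p*q∣≡∣p∣*∣q∣ c (s n - q))) (cong ∣_∣ (solve 3 (λ c a b → c :* (a :- b) := c :* a :- c :* b) refl c (s n) q)))
        (*-monoˡ ∣ s n - q ∣ (0≤∣p∣ (s n - q)) (≤-trans c≤m (ι-mono 1 m))))
      (share m 0<δ (h n N≤n))

  tends-sum : ∀ {k} {s : Fin k → ℕ → ℚ} {q : Fin k → ℚ} → (∀ i → Tends (s i) (q i)) → Tends (λ n → sum (λ i → s i n)) (sum q)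
  tends-sum {zero}  h = tends-const 0ℚ
  tends-sum {suc k} {s} {q} h = tends-+ {s zero} {λ n → sum (λ i → s (suc i) n)} (h zero) (tends-sum (h ∘ suc))

  ∣p∣<δ⇒p≡0 : ∀ p → (∀ δ → 0ℚ < δ → ∣ p ∣ < δ) → p ≡ 0ℚ
  ∣p∣<δ⇒p≡0 p h with ∣ p ∣ ≟ 0ℚ
  ... | yes eq = ∣p∣≡0⇒p≡0 p eq
  ... | no ne with <-cmp 0ℚ ∣ p ∣
  ...   | tri< a _ _ = contradiction (h ∣ p ∣ a) (<-irrefl refl)
  ...   | tri≈ _ b _ = contradiction (sym b) ne
  ...   | tri> _ _ c = contradiction (<-≤-trans c (0≤∣p∣ p)) (<-irrefl refl)

  tends-close : ∀ {s t p q} → (∀ δ → 0ℚ < δ → ∃[ N ] (∀ n → N ℕ.≤ n → ∣ s n - t n ∣ < δ)) →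
    Tends s p → Tends t q → p ≡ q
  tends-close {s} {t} {p} {q} C S T = p-q≡0⇒p≡q p q (∣p∣<δ⇒p≡0 (p - q) λ δ 0<δ →
    let 0<ε  = *-pos (*-pos 0<δ ½>0) ½>0
        K , hc = C (δ * ½) (*-pos 0<δ ½>0)
        M , hs = S (δ * ½ * ½) 0<ε
        N , ht = T (δ * ½ * ½) 0<ε
        n = K ℕ.⊔ (M ℕ.⊔ N)
        K≤ = ℕ.m≤m⊔n K (M ℕ.⊔ N)
        M≤ = ℕ.≤-trans (ℕ.m≤m⊔n M N) (ℕ.m≤n⊔m K (M ℕ.⊔ N))
        N≤ = ℕ.≤-trans (ℕ.m≤n⊔m M N) (ℕ.m≤n⊔m K (M ℕ.⊔ N))
    in ≤-<-trans (≤-trans (triangle p (t n) q) (+-monoˡ-≤ ∣ t n - q ∣ (triangle p (s n) (t n))))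
         (subst (∣ p - s n ∣ + ∣ s n - t n ∣ + ∣ t n - q ∣ <_)
           (trans (solve 1 (λ d → d :* con ½ :* con ½ :+ d :* con ½ :+ d :* con ½ :* con ½ := d :* (con ½ :* con ½ :+ con ½ :+ con ½ :* con ½)) refl δ) (*-identityʳ δ))
           (+-mono-< (+-mono-< (subst (_< δ * ½ * ½) (∣p-q∣≡∣q-p∣ (s n) p) (hs n M≤)) (hc n K≤)) (ht n N≤))))

  tends-unique : ∀ {s p q} → Tends s p → Tends s q → p ≡ q
  tends-unique {s} = tends-close {s} {s} λ δ 0<δ → 0 , λ n _ → subst (_< δ) (cong ∣_∣ (sym (+-inverseʳ (s n)))) 0<δ

  p≤q+∣p-q∣ : ∀ p q → p ≤ q + ∣ p - q ∣
  p≤q+∣p-q∣ p q = subst (_≤ q + ∣ p - q ∣) (solve 2 (λ p q → q :+ (p :- q) := p) refl p q) (+-monoʳ-≤ q (p≤∣p∣ (p - q)))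

  tends-< : ∀ x y {p q} → Tends (seq x) p → Tends (seq y) q → x <ᴿ y → p < q
  tends-< x y {p} {q} X Y (δ , 0<δ , K , h) =
    let M , hx = X (δ * ½) (*-pos 0<δ ½>0)
        N , hy = Y (δ * ½) (*-pos 0<δ ½>0)
        n = K ℕ.⊔ (M ℕ.⊔ N)
        K≤ = ℕ.m≤m⊔n K (M ℕ.⊔ N)
        M≤ = ℕ.≤-trans (ℕ.m≤m⊔n M N) (ℕ.m≤n⊔m K (M ℕ.⊔ N))
        N≤ = ℕ.≤-trans (ℕ.m≤n⊔m M N) (ℕ.m≤n⊔m K (M ℕ.⊔ N))
    in bound (seq x n) (seq y n) (h n K≤) (hx n M≤) (hy n N≤)
    where
    bound : ∀ a b → δ < b - a → ∣ a - p ∣ < δ * ½ → ∣ b - q ∣ < δ * ½ → p < q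
    bound a b δ<b-a ap bq = begin-strict
      p                                        ≤⟨ p≤q+∣p-q∣ p a ⟩
      a + ∣ p - a ∣                            ≡⟨ cong (_+_ a) (∣p-q∣≡∣q-p∣ p a) ⟩
      a + ∣ a - p ∣                            <⟨ +-monoʳ-< a ap ⟩
      a + δ * ½                                ≡⟨ solve 2 (λ a e → a :+ e := a :+ (e :+ e) :- e) refl a (δ * ½) ⟩
      a + (δ * ½ + δ * ½) - δ * ½              ≡⟨ cong (λ t → a + t - δ * ½) (½+½ δ) ⟩
      a + δ - δ * ½                            <⟨ +-monoˡ-< (- (δ * ½)) (subst (a + δ <_) (solve 2 (λ a b → a :+ (b :- a) := b) refl a b) (+-monoʳ-< a δ<b-a)) ⟩
      b - δ * ½                                ≤⟨ +-monoˡ-≤ (- (δ * ½)) (p≤q+∣p-q∣ b q) ⟩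
      q + ∣ b - q ∣ - δ * ½                    <⟨ +-monoˡ-< (- (δ * ½)) (+-monoʳ-< q bq) ⟩
      q + δ * ½ - δ * ½                        ≡⟨ solve 2 (λ q e → q :+ e :- e := q) refl q (δ * ½) ⟩
      q                                        ∎
      where open ≤-Reasoning

  <-tends : ∀ x y {p q} → Tends (seq x) p → Tends (seq y) q → p < q → x <ᴿ y
  <-tends x y {p} {q} X Y p<q =
    let M , hx = X ε 0<ε
        N , hy = Y ε 0<ε
    in η , *-pos 0<η ½>0 , M ℕ.⊔ N , λ n h →
      bound (seq x n) (seq y n) (hx n (ℕ.m⊔n≤o⇒m≤o M N h)) (hy n (ℕ.m⊔n≤o⇒n≤o M N h))
    where
    0<η = p<q⇒0<q-p p<q
    η = (q - p) * ½
    ε = η * ½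
    0<ε = *-pos (*-pos 0<η ½>0) ½>0
    bound : ∀ a b → ∣ a - p ∣ < ε → ∣ b - q ∣ < ε → η < b - a
    bound a b ap bq = begin-strict
      η                                              ≡⟨ solve 2 (λ p q → (q :- p) :* con ½ := q :- p :- (q :- p) :* con ½ :* con ½ :- (q :- p) :* con ½ :* con ½) refl p q ⟩
      q - p - ε - ε                                  <⟨ +-monoʳ-< (q - p - ε) (neg-antimono-< ap) ⟩
      q - p - ε - ∣ a - p ∣                          ≤⟨ +-monoˡ-≤ (- ∣ a - p ∣) (+-monoˡ-≤ (- ε) (+-monoˡ-≤ (- p) (p≤q+∣p-q∣ q b))) ⟩
      b + ∣ q - b ∣ - p - ε - ∣ a - p ∣              ≡⟨ cong (λ t → b + t - p - ε - ∣ a - p ∣) (∣p-q∣≡∣q-p∣ q b) ⟩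
      b + ∣ b - q ∣ - p - ε - ∣ a - p ∣              <⟨ +-monoˡ-< (- ∣ a - p ∣) (+-monoˡ-< (- ε) (+-monoˡ-< (- p) (+-monoʳ-< b bq))) ⟩
      b + ε - p - ε - ∣ a - p ∣                      ≡⟨ solve 4 (λ b e p t → b :+ e :- p :- e :- t := b :- (p :+ t)) refl b ε p ∣ a - p ∣ ⟩
      b - (p + ∣ a - p ∣)                            ≤⟨ +-monoʳ-≤ b (neg-antimono-≤ (p≤q+∣p-q∣ a p)) ⟩
      b - a                                          ∎
      where open ≤-Reasoning

  seq-∑ : ∀ {k} (f : Fin k → ℝ) n → seq (∑ f) n ≡ sum (λ i → seq (f i) n)
  seq-∑ {zero}  f n = refl
  seq-∑ {suc k} f n = cong (_+_ (seq (f zero) n)) (seq-∑ (f ∘ suc) n)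

  module _ {d} (Λ : Lattice d) where
    open Lattice Λ

    gramAt : ℕ → Mat d
    gramAt n i j = seq (gram i j) n

    seq-⟪⟫ : ∀ x y n → seq ⟪ x , y ⟫ n ≡ bil (gramAt n) (λ i → seq (x i) n) (λ i → seq (y i) n)
    seq-⟪⟫ x y n = trans (seq-∑ (λ i → ∑ λ j → x i *ᴿ gram i j *ᴿ y j) n)
      (sum-cong λ i → seq-∑ (λ j → x i *ᴿ gram i j *ᴿ y j) n)

    HasGram : (Fin d → Fin d → ℤ) → Set
    HasGram g = ∀ i j → Tends (seq (gram i j)) ⟦ g i j ⟧

    module _ (g : Fin d → Fin d → ℤ) (hg : HasGram g) where

      tends-⟪⟫ : ∀ (x y : Vec d) → Tends (seq ⟪ fromℚ ∘ x , fromℚ ∘ y ⟫) (bil ⟦ g ⟧ᵐ x y)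
      tends-⟪⟫ x y = tends-cong (λ n → sym (seq-⟪⟫ (fromℚ ∘ x) (fromℚ ∘ y) n))
        (tends-sum {s = λ i n → sum λ j → x i * gramAt n i j * y j} λ i → tends-sum {s = λ j n → x i * gramAt n i j * y j} λ j →
          tends-cong (λ n → solve 3 (λ x y g → y :* (x :* g) := x :* g :* y) refl (x i) (y j) (gramAt n i j))
            (subst (Tends (λ n → y j * (x i * gramAt n i j))) (solve 3 (λ x y g → y :* (x :* g) := x :* g :* y) refl (x i) (y j) ⟦ g i j ⟧)
              (tends-* (y j) {λ n → x i * gramAt n i j} (tends-* (x i) {λ n → gramAt n i j} (hg i j)))))

      tends-⟨⟩ : ∀ v w → Tends (seq ⟨ v , w ⟩) (bil ⟦ g ⟧ᵐ ⟦ v ⟧ᵛ ⟦ w ⟧ᵛ)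
      tends-⟨⟩ v w = tends-⟪⟫ ⟦ v ⟧ᵛ ⟦ w ⟧ᵛ

      isMinimal⇒min : ∀ {v} → IsMinimal Λ v → Min ⟦ g ⟧ᵐ v
      isMinimal⇒min {v} (nz , m) = nz , λ w nw → ≮⇒≥ λ w<v → m w nw (<-tends ⟨ w , w ⟩ ⟨ v , v ⟩ (tends-⟨⟩ w w) (tends-⟨⟩ v v) w<v)

      min⇒isMinimal : ∀ {v} → Min ⟦ g ⟧ᵐ v → IsMinimal Λ v
      min⇒isMinimal {v} (nz , m) = nz , λ w nw w<v → <-irrefl refl (<-≤-trans (tends-< ⟨ w , w ⟩ ⟨ v , v ⟩ (tends-⟨⟩ w w) (tends-⟨⟩ v v) w<v) (m w nw))

    integral⇒hasGram : IsIntegral Λ → ∃[ g ] HasGram g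
    integral⇒hasGram int = (λ i j → proj₁ (int (δᶻ i) (δᶻ j))) , λ i j →
      tends-cong (λ n → trans (seq-⟪⟫ (toℝ^ (δᶻ i)) (toℝ^ (δᶻ j)) n) (bil-δ (gramAt n) i j)) (proj₂ (int (δᶻ i) (δᶻ j)))

  fromℚ-#0 : ∀ {q} → q ≢ 0ℚ → fromℚ q #ᴿ 0ᴿ
  fromℚ-#0 {q} q≢0 with <-cmp q 0ℚ
  ... | tri< a _ _ = inj₁ (<-tends (fromℚ q) 0ᴿ (tends-const q) (tends-const 0ℚ) a)
  ... | tri≈ _ b _ = contradiction b q≢0
  ... | tri> _ _ c = inj₂ (<-tends 0ᴿ (fromℚ q) (tends-const 0ℚ) (tends-const q) c)

  module _ {d} (P : PerfectPrimitiveLattice d) where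
    open PerfectPrimitiveLattice P
    open Lattice lattice using (positiveDefinite; symmetric; gram; ⟪_,_⟫; ⟨_,_⟩)

    good-gram : ∀ g → HasGram lattice g → Good g
    good-gram g hg = record { symmetric = sy ; bounded = anisotropic (lagrange ⟦ g ⟧ᵐ λ i j → cong ⟦_⟧ (sy i j)) ; perfect = perf ; coprime = prim }
      where
      sy : ∀ i j → g i j ≡ g j i
      sy i j = ⟦⟧-injective (tends-close {seq (gram i j)} {seq (gram j i)} (symmetric i j) (hg i j) (hg j i))
      anisotropic : Bounded ⟦ g ⟧ᵐ ⊎ Isotropic ⟦ g ⟧ᵐ → Bounded ⟦ g ⟧ᵐ
      anisotropic (inj₁ B) = B
      anisotropic (inj₂ (x , (i , x≢0) , q≤0)) = contradiction
        (<-≤-trans (tends-< 0ᴿ ⟪ fromℚ ∘ x , fromℚ ∘ x ⟫ (tends-const 0ℚ) (tends-⟪⟫ lattice g hg x x) (positiveDefinite (fromℚ ∘ x) (i , fromℚ-#0 x≢0))) q≤0)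
        (<-irrefl refl)
      -- Expand `S` itself in the squares of minimal vectors. The pairing of `S` with every
      -- approximation of this expansion is zero, while these pairings tend to the sum of the
      -- squares of the entries of `S`.
      perf : Perfect ⟦ g ⟧ᵐ
      perf S symS h a b = square≡0 (S a b) (≤-trans (≤-trans (term≤sum {f = λ j → S a j * S a j} (λ j → square (S a j)) b)
          (term≤sum {f = λ i → sum λ j → S i j * S i j} (λ i → sum-nonNeg λ j → square (S i j)) a)) (≤-reflexive σ≡0))
        where
        square≡0 : ∀ p → p * p ≤ 0ℚ → p ≡ 0ℚ
        square≡0 p h with p ≟ 0ℚ
        ... | yes eq = eq
        ... | no ne = contradiction (<-≤-trans (square-pos ne) h) (<-irrefl refl)
        expansion = isPerfect (λ i j → fromℚ (S i j)) λ i j δ 0<δ → 0 , λ n _ →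
          subst (_< δ) (trans (cong ∣_∣ (sym (+-inverseʳ (S i j)))) (cong (λ t → ∣ S i j - t ∣) (symS i j))) 0<δ
        m = proj₁ expansion
        v = proj₁ (proj₂ expansion)
        c = proj₁ (proj₂ (proj₂ expansion))
        mv = proj₁ (proj₂ (proj₂ (proj₂ expansion)))
        close = proj₂ (proj₂ (proj₂ (proj₂ expansion)))
        term : ℕ → Mat d
        term n i j = sum λ k → seq (c k) n * (⟦ v k i ⟧ * ⟦ v k j ⟧)
        term-tends : ∀ i j → Tends (λ n → term n i j) (S i j)
        term-tends i j δ 0<δ = let N , b = close i j δ 0<δ in N , λ n N≤n → subst (_< δ)
          (trans (∣p-q∣≡∣q-p∣ (S i j) _) (cong (λ t → ∣ t - S i j ∣) (seq-∑ (λ k → c k *ᴿ (toℝ^ (v k) ⊗ toℝ^ (v k)) i j) n))) (b n N≤n)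
        pairing : ℕ → ℚ
        pairing n = sum λ i → sum λ j → S i j * term n i j
        pairing≡0 : ∀ n → 0ℚ ≡ pairing n
        pairing≡0 n = sym (begin
          sum (λ i → sum (λ j → S i j * sum (λ k → C k * (V k i * V k j))))
            ≡⟨ sum-cong (λ i → trans (sum-cong λ j → trans (sym (sum-* (S i j) λ k → C k * (V k i * V k j)))
                 (sum-cong λ k → solve 4 (λ s c x y → s :* (c :* (x :* y)) := c :* (x :* s :* y)) refl (S i j) (C k) (V k i) (V k j)))
                 (sum-swap λ j k → C k * (V k i * S i j * V k j))) ⟩
          sum (λ i → sum (λ k → sum (λ j → C k * (V k i * S i j * V k j))))
            ≡⟨ sum-swap (λ i k → sum (λ j → C k * (V k i * S i j * V k j))) ⟩
          sum (λ k → sum (λ i → sum (λ j → C k * (V k i * S i j * V k j))))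
            ≡⟨ sum-cong (λ k → trans (sum-cong λ i → sum-* (C k) λ j → V k i * S i j * V k j) (sum-* (C k) λ i → sum λ j → V k i * S i j * V k j)) ⟩
          sum (λ k → C k * q[ S ] (v k))
            ≡⟨ sum-0 (λ k → trans (cong (C k *_) (h (v k) (isMinimal⇒min lattice g hg (mv k)))) (*-zeroʳ (C k))) ⟩
          0ℚ ∎)
          where
          open ≡-Reasoning
          C : Fin m → ℚ
          C k = seq (c k) n
          V : Fin m → Vec d
          V k = ⟦ v k ⟧ᵛ
        σ≡0 : sum (λ i → sum λ j → S i j * S i j) ≡ 0ℚ
        σ≡0 = tends-unique {pairing}
          (tends-sum {s = λ i n → sum λ j → S i j * term n i j} λ i → tends-sum {s = λ j n → S i j * term n i j} λ j → tends-* (S i j) {λ n → term n i j} (term-tends i j))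
          (tends-cong {λ _ → 0ℚ} {pairing} {0ℚ} pairing≡0 (tends-const 0ℚ))
      prim : Primitive g
      prim k h = isPrimitive k λ v w z e → subst (λ t → k ℕ.∣ ℤ.∣ t ∣)
        (⟦⟧-injective {bilᶻ g v w} {z} (trans (⟦bilᶻ⟧ g v w) (tends-unique {seq ⟨ v , w ⟩} (tends-⟨⟩ lattice g hg v w) e))) (∣-bilᶻ k g v w h)

  module _ {n} (g : Fin (suc n) → Fin (suc n) → ℤ) (G : Good g) where
    open Good G

    private
      d = suc n

    -- Positivity is required for real vectors. One coordinate of such a vector is eventually
    -- bounded away from zero, and `square≤`, applied to each rational approximation, turns this
    -- into a uniform lower bound for the form.
    toLattice : Lattice d
    toLattice = record
      { gram             = λ i j → fromℤ (g i j)
      ; symmetric        = λ i j δ 0<δ → 0 , λ _ _ → subst (_< δ) (trans (cong ∣_∣ (sym (+-inverseʳ ⟦ g i j ⟧))) (cong (λ t → ∣ ⟦ g i j ⟧ - ⟦ t ⟧ ∣) (symmetric i j))) 0<δ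
      ; positiveDefinite = λ x (i , x#0) → positive-form x i (away x i x#0)
      }
      where
      open Bounded bounded
      away : ∀ (x : ℝ^ d) i → x i #ᴿ 0ᴿ → Σ[ δ ∈ ℚ ] 0ℚ < δ × ∃[ N ] (∀ n → N ℕ.≤ n → δ * δ ≤ seq (x i) n * seq (x i) n)
      away x i (inj₁ (δ , 0<δ , N , h)) = δ , 0<δ , N , λ n N≤n →
        let δ≤ = <⇒≤ (h n N≤n) ; 0≤ = ≤-trans (<⇒≤ 0<δ) δ≤ in
        subst (δ * δ ≤_) (solve 1 (λ x → (con 0ℚ :- x) :* (con 0ℚ :- x) := x :* x) refl (seq (x i) n)) (*-mono (<⇒≤ 0<δ) 0≤ δ≤ δ≤)
      away x i (inj₂ (δ , 0<δ , N , h)) = δ , 0<δ , N , λ n N≤n →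
        let δ≤ = <⇒≤ (h n N≤n) ; 0≤ = ≤-trans (<⇒≤ 0<δ) δ≤ in
        subst (δ * δ ≤_) (solve 1 (λ x → (x :- con 0ℚ) :* (x :- con 0ℚ) := x :* x) refl (seq (x i) n)) (*-mono (<⇒≤ 0<δ) 0≤ δ≤ δ≤)
      form : ℝ^ d → ℝ
      form x = ∑ λ i → ∑ λ j → x i *ᴿ fromℤ (g i j) *ᴿ x j
      positive-form : ∀ (x : ℝ^ d) i → (Σ[ δ ∈ ℚ ] 0ℚ < δ × ∃[ N ] (∀ n → N ℕ.≤ n → δ * δ ≤ seq (x i) n * seq (x i) n)) → 0ᴿ <ᴿ form x
      positive-form x i (δ , 0<δ , N , h) = η , *-pos 0<θ ½>0 , N , λ n N≤n → subst (η <_)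
          (trans (sym (trans (seq-∑ (λ i → ∑ λ j → x i *ᴿ fromℤ (g i j) *ᴿ x j) n) (sum-cong λ i → seq-∑ (λ j → x i *ᴿ fromℤ (g i j) *ᴿ x j) n)))
            (solve 1 (λ q → q := q :- con 0ℚ) refl (seq (form x) n)))
          (large (λ j → seq (x j) n) (h n N≤n))
        where
        m = proj₁ (archimedean bound)
        -- Since `bound ≤ m + 1`, a value of the form at most `θ / 2` would give `δ² < δ²`.
        θ = δ * δ * recip m
        0<θ = *-pos (*-pos 0<δ 0<δ) (0<recip m)
        η = θ * ½
        η<θ : η < θ
        η<θ = subst (η <_) (½+½ θ) (<-by η (*-pos 0<θ ½>0) refl)
        large : ∀ (y : Vec d) → δ * δ ≤ y i * y i → η < quad ⟦ g ⟧ᵐ y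
        large y δ²≤ = ≰⇒> λ Q≤η → <-irrefl refl (≤-<-trans
          (≤-trans δ²≤ (≤-trans (square≤ y i) (*-monoˡ (quad ⟦ g ⟧ᵐ y) (quad≥0 y)
            (≤-trans (≤-trans (p≤∣p∣ bound) (proj₂ (archimedean bound))) (ι-mono 1 m)))))
          (share m (*-pos 0<δ 0<δ) (≤-<-trans Q≤η η<θ)))

    toLattice-hasGram : HasGram toLattice g
    toLattice-hasGram i j = tends-const ⟦ g i j ⟧

    toPerfect : PerfectPrimitiveLattice d
    toPerfect = record
      { lattice     = toLattice
      ; isPerfect   = perf (minimalFrame? {A = ⟦ g ⟧ᵐ} bounded)
      ; isIntegral  = λ v w → bilᶻ g v w , subst (Tends (seq (Lattice.⟨_,_⟩ toLattice v w))) (sym (⟦bilᶻ⟧ g v w)) (tends-⟨⟩ toLattice g toLattice-hasGram v w)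
      ; isPrimitive = λ k h → coprime k λ i j → h (δᶻ i) (δᶻ j) (g i j)
          (subst (Tends (seq (Lattice.⟨_,_⟩ toLattice (δᶻ i) (δᶻ j)))) (bil-δ ⟦ g ⟧ᵐ i j) (tends-⟨⟩ toLattice g toLattice-hasGram (δᶻ i) (δᶻ j)))
      }
      where
      perf : MinimalFrame ⟦ g ⟧ᵐ ⊎ (¬ Perfect ⟦ g ⟧ᵐ) → IsPerfect toLattice
      perf (inj₂ ¬p) = contradiction perfect ¬p
      perf (inj₁ (w , mw , C , spans)) t symT = d ℕ.* d , w , c , (λ k → min⇒isMinimal toLattice g toLattice-hasGram (mw k)) , close
        where
        c : Fin (d ℕ.* d) → ℝ
        -- `SymSpanning` expresses entries by values of the form; its transpose expresses tensors by
        -- squares, with these coefficients.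
        c k = ∑ λ i → ∑ λ j → fromℚ (C i j k) *ᴿ t i j
        close : ∀ a b → t a b ≃ᴿ ∑ λ k → c k *ᴿ (toℝ^ (w k) ⊗ toℝ^ (w k)) a b
        close a b δ 0<δ = let N , h = symT a b δ 0<δ in N , λ n N≤n → ≤-<-trans
            (≤-trans (≤-reflexive (trans (cong (λ u → ∣ seq (t a b) n - u ∣) (expand n))
              (trans (cong ∣_∣ (solve 2 (λ x y → x :- con ½ :* (x :+ y) := con ½ :* (x :- y)) refl (seq (t a b) n) (seq (t b a) n)))
                (∣p*q∣≡∣p∣*∣q∣ ½ (seq (t a b) n - seq (t b a) n)))))
              (≤-by (½ * ∣ seq (t a b) n - seq (t b a) n ∣) (*-nonNeg (<⇒≤ ½>0) (0≤∣p∣ (seq (t a b) n - seq (t b a) n)))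
                (solve 1 (λ x → con ½ :* x :+ con ½ :* x := x) refl ∣ seq (t a b) n - seq (t b a) n ∣)))
            (h n N≤n)
          where
          open ≡-Reasoning
          -- The symmetrized elementary matrix at `(a, b)`. Its quadratic form at `w k` is
          -- `w k a * w k b`, and its pairing with `t` is the mean of `t a b` and `t b a`; hence the
          -- expansion reaches `t a b` only up to the symmetry defect of `t`, which tends to zero.
          S : Mat d
          S i j = ½ * (⟦ δᶻ a i ⟧ * ⟦ δᶻ b j ⟧ + ⟦ δᶻ b i ⟧ * ⟦ δᶻ a j ⟧)
          symS : Symm S
          symS i j = solve 4 (λ x y z w → con ½ :* (x :* y :+ z :* w) := con ½ :* (w :* z :+ y :* x)) refl ⟦ δᶻ a i ⟧ ⟦ δᶻ b j ⟧ ⟦ δᶻ b i ⟧ ⟦ δᶻ a j ⟧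
          sum-S : ∀ (A : Mat d) → sum (λ i → sum λ j → S i j * A i j) ≡ ½ * (A a b + A b a)
          sum-S A = begin
            sum (λ i → sum λ j → S i j * A i j)
              ≡⟨ sum-cong (λ i → trans (sum-cong λ j → solve 5 (λ x y z w t → con ½ :* (x :* y :+ z :* w) :* t := con ½ :* (x :* y :* t :+ z :* w :* t)) refl ⟦ δᶻ a i ⟧ ⟦ δᶻ b j ⟧ ⟦ δᶻ b i ⟧ ⟦ δᶻ a j ⟧ (A i j))
                   (trans (sum-* ½ λ j → ⟦ δᶻ a i ⟧ * ⟦ δᶻ b j ⟧ * A i j + ⟦ δᶻ b i ⟧ * ⟦ δᶻ a j ⟧ * A i j)
                     (cong (½ *_) (sum-+ (λ j → ⟦ δᶻ a i ⟧ * ⟦ δᶻ b j ⟧ * A i j) (λ j → ⟦ δᶻ b i ⟧ * ⟦ δᶻ a j ⟧ * A i j))))) ⟩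
            sum (λ i → ½ * (sum (λ j → ⟦ δᶻ a i ⟧ * ⟦ δᶻ b j ⟧ * A i j) + sum (λ j → ⟦ δᶻ b i ⟧ * ⟦ δᶻ a j ⟧ * A i j)))
              ≡⟨ trans (sum-* ½ λ i → sum (λ j → ⟦ δᶻ a i ⟧ * ⟦ δᶻ b j ⟧ * A i j) + sum (λ j → ⟦ δᶻ b i ⟧ * ⟦ δᶻ a j ⟧ * A i j))
                   (cong (½ *_) (sum-+ (λ i → sum (λ j → ⟦ δᶻ a i ⟧ * ⟦ δᶻ b j ⟧ * A i j)) (λ i → sum (λ j → ⟦ δᶻ b i ⟧ * ⟦ δᶻ a j ⟧ * A i j)))) ⟩
            ½ * (sum (λ i → sum (λ j → ⟦ δᶻ a i ⟧ * ⟦ δᶻ b j ⟧ * A i j)) + sum (λ i → sum (λ j → ⟦ δᶻ b i ⟧ * ⟦ δᶻ a j ⟧ * A i j)))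
              ≡⟨ cong₂ (λ x y → ½ * (x + y)) (sum-δδ A a b) (sum-δδ A b a) ⟩
            ½ * (A a b + A b a) ∎
          quad-S : ∀ k → quad S ⟦ w k ⟧ᵛ ≡ ⟦ w k a ⟧ * ⟦ w k b ⟧
          quad-S k = begin
            sum (λ i → sum λ j → ⟦ w k i ⟧ * S i j * ⟦ w k j ⟧)
              ≡⟨ sum-cong (λ i → sum-cong λ j → solve 3 (λ x s y → x :* s :* y := s :* (x :* y)) refl ⟦ w k i ⟧ (S i j) ⟦ w k j ⟧) ⟩
            sum (λ i → sum λ j → S i j * (⟦ w k i ⟧ * ⟦ w k j ⟧))
              ≡⟨ sum-S (λ i j → ⟦ w k i ⟧ * ⟦ w k j ⟧) ⟩
            ½ * (⟦ w k a ⟧ * ⟦ w k b ⟧ + ⟦ w k b ⟧ * ⟦ w k a ⟧)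
              ≡⟨ solve 2 (λ x y → con ½ :* (x :* y :+ y :* x) := x :* y) refl ⟦ w k a ⟧ ⟦ w k b ⟧ ⟩
            ⟦ w k a ⟧ * ⟦ w k b ⟧ ∎
          expand : ∀ n → seq (∑ λ k → c k *ᴿ (toℝ^ (w k) ⊗ toℝ^ (w k)) a b) n ≡ ½ * (seq (t a b) n + seq (t b a) n)
          expand n = begin
            seq (∑ λ k → c k *ᴿ (toℝ^ (w k) ⊗ toℝ^ (w k)) a b) n
              ≡⟨ seq-∑ (λ k → c k *ᴿ (toℝ^ (w k) ⊗ toℝ^ (w k)) a b) n ⟩
            sum (λ k → seq (c k) n * (⟦ w k a ⟧ * ⟦ w k b ⟧))
              ≡⟨ sum-cong (λ k → cong₂ _*_ (trans (seq-∑ (λ i → ∑ λ j → fromℚ (C i j k) *ᴿ t i j) n) (sum-cong λ i → seq-∑ (λ j → fromℚ (C i j k) *ᴿ t i j) n)) (sym (quad-S k))) ⟩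
            sum (λ k → sum (λ i → sum (λ j → C i j k * T i j)) * Q k)
              ≡⟨ sum-cong (λ k → trans (sym (sum-*ʳ (Q k) λ i → sum λ j → C i j k * T i j)) (sum-cong λ i → sym (sum-*ʳ (Q k) λ j → C i j k * T i j))) ⟩
            sum (λ k → sum (λ i → sum (λ j → C i j k * T i j * Q k)))
              ≡⟨ sum-swap (λ k i → sum (λ j → C i j k * T i j * Q k)) ⟩
            sum (λ i → sum (λ k → sum (λ j → C i j k * T i j * Q k)))
              ≡⟨ sum-cong (λ i → sum-swap (λ k j → C i j k * T i j * Q k)) ⟩
            sum (λ i → sum (λ j → sum (λ k → C i j k * T i j * Q k)))
              ≡⟨ sum-cong (λ i → sum-cong λ j → trans (sum-cong λ k → solve 3 (λ c t q → c :* t :* q := c :* q :* t) refl (C i j k) (T i j) (Q k))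
                   (trans (sum-*ʳ (T i j) λ k → C i j k * Q k) (cong (_* T i j) (sym (spans S symS i j))))) ⟩
            sum (λ i → sum (λ j → S i j * T i j))
              ≡⟨ sum-S T ⟩
            ½ * (seq (t a b) n + seq (t b a) n) ∎
            where
            T : Mat d
            T i j = seq (t i j) n
            Q : Fin (d ℕ.* d) → ℚ
            Q k = quad S ⟦ w k ⟧ᵛ

  -- An additive map is ℤ-linear and so given by the images of the basis vectors. The `w k` are
  -- preimages of the basis vectors; `wu` is verified after applying `to` and then follows from
  -- injectivity.
  ≅⇒iso : ∀ {d} {Λ Λ′ : Lattice d} {g g′} → HasGram Λ g → HasGram Λ′ g′ → Λ ≅ Λ′ → Iso ⟦ g ⟧ᵐ ⟦ g′ ⟧ᵐ
  ≅⇒iso {d} {Λ} {Λ′} {g} {g′} hg hg′ iso = u , w , record { uw = uw ; wu = wu ; preserves = pres }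
    where
    open _≅_ iso
    open GroupMorphisms (ℤ^-rawGroup d) (ℤ^-rawGroup d) using (module IsGroupIsomorphism)
    open IsGroupIsomorphism isGroupIsomorphism
    _≈_ : ℤ^ d → ℤ^ d → Set
    v ≈ v′ = ∀ i → v i ≡ v′ i
    to-cong : ∀ {v v′ : ℤ^ d} → v ≈ v′ → to v ≈ to v′
    to-cong = ⟦⟧-cong
    to-ℕ : ∀ n v → to (λ i → + n ℤ.* v i) ≈ (λ i → + n ℤ.* to v i)
    to-ℕ zero    v i = trans (to-cong {λ i → + 0 ℤ.* v i} {λ _ → + 0} (λ _ → refl) i) (ε-homo i)
    to-ℕ (suc n) v i = trans (to-cong {λ i → + suc n ℤ.* v i} {λ i → v i ℤ.+ + n ℤ.* v i} (λ i → ℤ.suc-* (+ n) (v i)) i)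
      (trans (∙-homo v (λ i → + n ℤ.* v i) i) (trans (cong (ℤ._+_ (to v i)) (to-ℕ n v i)) (sym (ℤ.suc-* (+ n) (to v i)))))
    to-ℤ : ∀ z v → to (λ i → z ℤ.* v i) ≈ (λ i → z ℤ.* to v i)
    to-ℤ (+ n)      v i = to-ℕ n v i
    to-ℤ -[1+ n ] v i = trans (to-cong {λ i → -[1+ n ] ℤ.* v i} {λ i → ℤ.- (+ suc n ℤ.* v i)} (λ i → sym (ℤ.neg-distribˡ-* (+ suc n) (v i))) i)
      (trans (⁻¹-homo (λ i → + suc n ℤ.* v i) i) (trans (cong ℤ.-_ (to-ℕ (suc n) v i)) (ℤ.neg-distribˡ-* (+ suc n) (to v i))))
    to-sum : ∀ {m} (f : Fin m → ℤ^ d) → to (λ i → sumᶻ λ k → f k i) ≈ (λ i → sumᶻ λ k → to (f k) i)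
    to-sum {zero}  f = ε-homo
    to-sum {suc m} f i = trans (∙-homo (f zero) (λ i → sumᶻ λ k → f (suc k) i) i) (cong (ℤ._+_ (to (f zero) i)) (to-sum (f ∘ suc) i))
    u : Fin d → ℤ^ d
    u k = to (δᶻ k)
    to-app : ∀ x → to x ≈ appᶻ u x
    to-app x i = trans (to-cong {x} {λ i → sumᶻ λ k → x k ℤ.* δᶻ k i} (λ i → ⟦⟧-injective (sym (trans (⟦⟧-sum λ k → x k ℤ.* δᶻ k i)
        (trans (sum-cong λ k → ⟦⟧-* (x k) (δᶻ k i)) (sum-δʳ i ⟦ x ⟧ᵛ))))) i)
      (trans (to-sum (λ k i → x k ℤ.* δᶻ k i) i) (ΣZ.sum-cong-≗ λ k → to-ℤ (x k) (δᶻ k) i))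
    w : Fin d → ℤ^ d
    w k = proj₁ (surjective (δᶻ k))
    to-w : ∀ k → to (w k) ≈ δᶻ k
    to-w k = proj₂ (surjective (δᶻ k)) {w k} λ _ → refl
    uw : ∀ k i → app ⟦ u ⟧ᶠ ⟦ w k ⟧ᵛ i ≡ δ k i
    uw k i = trans (sym (⟦appᶻ⟧ u (w k) i)) (cong ⟦_⟧ (trans (sym (to-app (w k) i)) (to-w k i)))
    wu : ∀ k i → app ⟦ w ⟧ᶠ ⟦ u k ⟧ᵛ i ≡ δ k i
    wu k i = trans (sym (⟦appᶻ⟧ w (u k) i)) (cong ⟦_⟧ (injective {appᶻ w (u k)} {δᶻ k} eq i))
      where
      eq : to (appᶻ w (u k)) ≈ to (δᶻ k)
      eq j = trans (to-app (appᶻ w (u k)) j) (⟦⟧-injective {appᶻ u (appᶻ w (u k)) j} {u k j}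
        (trans (⟦appᶻ⟧ u (appᶻ w (u k)) j)
          (trans (sum-cong λ l → cong (_* ⟦ u l j ⟧) (⟦appᶻ⟧ w (u k) l))
            (trans (app-app ⟦ u ⟧ᶠ ⟦ w ⟧ᶠ ⟦ u k ⟧ᵛ j) (trans (sum-cong λ l → cong (⟦ u k l ⟧ *_) (uw l j)) (sum-δʳ j ⟦ u k ⟧ᵛ))))))
    pres : ∀ i j → bil ⟦ g′ ⟧ᵐ ⟦ u i ⟧ᵛ ⟦ u j ⟧ᵛ ≡ ⟦ g i j ⟧
    pres i j = trans (tends-close {seq (Lattice.⟨_,_⟩ Λ′ (u i) (u j))} {seq (Lattice.⟨_,_⟩ Λ (δᶻ i) (δᶻ j))} (isometric (δᶻ i) (δᶻ j))
      (tends-⟨⟩ Λ′ g′ hg′ (u i) (u j)) (tends-⟨⟩ Λ g hg (δᶻ i) (δᶻ j))) (bil-δ ⟦ g ⟧ᵐ i j)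

  iso⇒≅ : ∀ {d} {Λ Λ′ : Lattice d} {g g′} → HasGram Λ g → HasGram Λ′ g′ → Iso ⟦ g ⟧ᵐ ⟦ g′ ⟧ᵐ → Λ ≅ Λ′
  iso⇒≅ {d} {Λ} {Λ′} {g} {g′} hg hg′ (u , w , I) = record
    { to = appᶻ u
    ; isGroupIsomorphism = record
      { isGroupMonomorphism = record
        { isGroupHomomorphism = record
          { isMonoidHomomorphism = record
            { isMagmaHomomorphism = record
              { isRelHomomorphism = record { cong = λ {x} {y} → appᶻ-cong u {x} {y} }
              ; homo = λ x y i → ⟦⟧-injective {appᶻ u (λ i → x i ℤ.+ y i) i} {appᶻ u x i ℤ.+ appᶻ u y i} (begin
                  ⟦ appᶻ u (λ i → x i ℤ.+ y i) i ⟧                     ≡⟨ ⟦appᶻ⟧ u (λ i → x i ℤ.+ y i) i ⟩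
                  sum (λ j → ⟦ x j ℤ.+ y j ⟧ * ⟦ u j i ⟧)              ≡⟨ sum-cong (λ j → trans (cong (_* ⟦ u j i ⟧) (⟦⟧-+ (x j) (y j))) (*-distribʳ-+ ⟦ u j i ⟧ ⟦ x j ⟧ ⟦ y j ⟧)) ⟩
                  sum (λ j → ⟦ x j ⟧ * ⟦ u j i ⟧ + ⟦ y j ⟧ * ⟦ u j i ⟧) ≡⟨ sum-+ (λ j → ⟦ x j ⟧ * ⟦ u j i ⟧) (λ j → ⟦ y j ⟧ * ⟦ u j i ⟧) ⟩
                  app ⟦ u ⟧ᶠ ⟦ x ⟧ᵛ i + app ⟦ u ⟧ᶠ ⟦ y ⟧ᵛ i             ≡⟨ sym (trans (⟦⟧-+ (appᶻ u x i) (appᶻ u y i)) (cong₂ _+_ (⟦appᶻ⟧ u x i) (⟦appᶻ⟧ u y i))) ⟩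
                  ⟦ appᶻ u x i ℤ.+ appᶻ u y i ⟧                        ∎)
              }
            ; ε-homo = λ i → trans (ΣZ.sum-cong-≗ {n = d} λ j → ℤ.*-zeroˡ (u j i)) (ΣZ.sum-replicate-zero d)
            }
          ; ⁻¹-homo = λ x i → ⟦⟧-injective {appᶻ u (λ i → ℤ.- x i) i} {ℤ.- appᶻ u x i} (begin
              ⟦ appᶻ u (λ i → ℤ.- x i) i ⟧                 ≡⟨ ⟦appᶻ⟧ u (λ i → ℤ.- x i) i ⟩
              sum (λ j → ⟦ ℤ.- x j ⟧ * ⟦ u j i ⟧)          ≡⟨ sum-cong (λ j → trans (cong (_* ⟦ u j i ⟧) (⟦⟧-neg (x j))) (sym (neg-distribˡ-* ⟦ x j ⟧ ⟦ u j i ⟧))) ⟩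
              sum (λ j → - (⟦ x j ⟧ * ⟦ u j i ⟧))          ≡⟨ sum-neg (λ j → ⟦ x j ⟧ * ⟦ u j i ⟧) ⟩
              - app ⟦ u ⟧ᶠ ⟦ x ⟧ᵛ i                        ≡⟨ sym (trans (⟦⟧-neg (appᶻ u x i)) (cong -_ (⟦appᶻ⟧ u x i))) ⟩
              ⟦ ℤ.- appᶻ u x i ⟧                           ∎)
          }
        ; injective = λ {x} {y} h i → trans (sym (wux x i)) (trans (appᶻ-cong w {appᶻ u x} {appᶻ u y} h i) (wux y i))
        }
      ; surjective = λ y → appᶻ w y , λ {z} h i → trans (appᶻ-cong u {z} {appᶻ w y} h i) (uwx y i)
      }
    ; isometric = λ v v′ → tends⇒≃ {Lattice.⟨_,_⟩ Λ′ (appᶻ u v) (appᶻ u v′)} {Lattice.⟨_,_⟩ Λ v v′}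
        (tends-⟨⟩ Λ′ g′ hg′ (appᶻ u v) (appᶻ u v′))
        (subst (Tends (seq (Lattice.⟨_,_⟩ Λ v v′))) (sym (trans (bil-cong {A = ⟦ g′ ⟧ᵐ} (λ _ _ → refl) (⟦appᶻ⟧ u v) (⟦appᶻ⟧ u v′)) (bil-u ⟦ v ⟧ᵛ ⟦ v′ ⟧ᵛ)))
          (tends-⟨⟩ Λ g hg v v′))
    }
    where
    open ≡-Reasoning
    open IsIso I
    appᶻ-cong : ∀ (u : Fin d → ℤ^ d) {x y : ℤ^ d} → (∀ i → x i ≡ y i) → ∀ i → appᶻ u x i ≡ appᶻ u y i
    appᶻ-cong u h i = ΣZ.sum-cong-≗ λ j → cong (ℤ._* u j i) (h j)
    wux : ∀ x i → appᶻ w (appᶻ u x) i ≡ x i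
    wux x i = ⟦⟧-injective {appᶻ w (appᶻ u x) i} {x i} (trans (⟦appᶻ⟧ w (appᶻ u x) i)
      (trans (sum-cong λ j → cong (_* ⟦ w j i ⟧) (⟦appᶻ⟧ u x j)) (wu-app ⟦ x ⟧ᵛ i)))
    uwx : ∀ x i → appᶻ u (appᶻ w x) i ≡ x i
    uwx x i = ⟦⟧-injective {appᶻ u (appᶻ w x) i} {x i} (trans (⟦appᶻ⟧ u (appᶻ w x) i)
      (trans (sum-cong λ j → cong (_* ⟦ u j i ⟧) (⟦appᶻ⟧ w x j)) (uw-app ⟦ x ⟧ᵛ i)))
    tends⇒≃ : ∀ {x y q} → Tends (seq x) q → Tends (seq y) q → x ≃ᴿ y
    tends⇒≃ {x} {y} {q} X Y δ 0<δ =
      let M , hx = X (δ * ½) (*-pos 0<δ ½>0)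
          N , hy = Y (δ * ½) (*-pos 0<δ ½>0)
      in M ℕ.⊔ N , λ n h → ≤-<-trans (triangle (seq x n) q (seq y n))
        (subst (∣ seq x n - q ∣ + ∣ q - seq y n ∣ <_) (½+½ δ)
          (+-mono-< (hx n (ℕ.m⊔n≤o⇒m≤o M N h)) (subst (_< δ * ½) (∣p-q∣≡∣q-p∣ (seq y n) q) (hy n (ℕ.m⊔n≤o⇒n≤o M N h)))))

  -- Representatives of a decidable equivalence relation on a list.

  module Classes {a r} {X : Set a} (_~_ : X → X → Set r)
    (~-sym : ∀ {x y} → x ~ y → y ~ x) (~-trans : ∀ {x y z} → x ~ y → y ~ z → x ~ z)
    (~-refl : ∀ {x} → x ~ x) (_~?_ : ∀ x y → Dec (x ~ y)) where

    record Representatives (l : List X) : Set (a Level.⊔ r) where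
      field
        number   : ℕ
        rep      : Fin number → X
        distinct : ∀ {i j} → rep i ~ rep j → i ≡ j
        covers   : ∀ {x} → x ∈ l → ∃[ i ] rep i ~ x

    representatives : ∀ l → Representatives l
    representatives []      = record { number = 0 ; rep = λ () ; distinct = λ {} ; covers = λ () }
    representatives (x ∷ l) = add (F.any? λ i → rep i ~? x)
      where
      open Representatives (representatives l)
      add : Dec (∃[ i ] rep i ~ x) → Representatives (x ∷ l)
      add (yes (i , p)) = record { number = number ; rep = rep ; distinct = distinct
                                 ; covers = λ { (here refl) → i , p ; (there x∈) → covers x∈ } }
      add (no new) = record { number = suc number ; rep = rep′ ; distinct = λ {i} {j} → distinct′ i j ; covers = covers′ }
        where
        rep′ : Fin (suc number) → X
        rep′ = x ◂ rep
        distinct′ : ∀ i j → rep′ i ~ rep′ j → i ≡ j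
        distinct′ zero    zero    p = refl
        distinct′ zero    (suc j) p = contradiction (j , ~-sym p) new
        distinct′ (suc i) zero    p = contradiction (i , p) new
        distinct′ (suc i) (suc j) p = cong suc (distinct p)
        covers′ : ∀ {y} → y ∈ x ∷ l → ∃[ i ] rep′ i ~ y
        covers′ (here refl) = zero , ~-refl
        covers′ (there y∈)  = let i , p = covers y∈ in suc i , p

  -- Reduction theory.

  *-denominator : ∀ q → q * ⟦ + ↧ₙ q ⟧ ≡ ⟦ ↥ q ⟧
  *-denominator q@(mkℚ n d _) = toℚᵘ-injective (begin
    toℚᵘ (q * ⟦ + suc d ⟧)                       ≈⟨ toℚᵘ-homo-* q ⟦ + suc d ⟧ ⟩
    toℚᵘ q ℚᵘ.* toℚᵘ ⟦ + suc d ⟧                 ≈⟨ ℚᵘ.*-congˡ {toℚᵘ q} (toℚᵘ-⟦⟧ (+ suc d)) ⟩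
    ℚᵘ.mkℚᵘ n d ℚᵘ.* ℚᵘ.mkℚᵘ (+ suc d) 0         ≈⟨ ℚᵘ.*≡* (trans (ℤ.*-identityʳ (n ℤ.* + suc d)) (cong (λ t → n ℤ.* + t) (sym (ℕ.*-identityʳ (suc d))))) ⟩
    ℚᵘ.mkℚᵘ n 0                                  ≈⟨ ℚᵘ.≃-sym (toℚᵘ-⟦⟧ n) ⟩
    toℚᵘ ⟦ n ⟧                                   ∎)
    where open ℚᵘ.≃-Reasoning

  floor-spec : ∀ q → Σ[ z ∈ ℤ ] ⟦ z ⟧ ≤ q × q < ⟦ z ⟧ + 1ℚ
  floor-spec q = z , *-cancelʳ-≤-pos D (subst₂ _≤_ (⟦⟧-* z (+ ↧ₙ q)) (sym (*-denominator q)) (⟦⟧-mono-≤ (ℤ.[n/ℕd]*d≤n (↥ q) (↧ₙ q)))) ,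
    *-cancelʳ-<-nonNeg D {{pos⇒nonNeg D}} (subst₂ _<_ (sym (*-denominator q)) (trans (⟦⟧-* (ℤ.suc z) (+ ↧ₙ q)) (cong (_* D) (trans (⟦⟧-+ (+ 1) z) (+-comm 1ℚ ⟦ z ⟧))))
      (⟦⟧-mono-< (ℤ.n<s[n/ℕd]*d (↥ q) (↧ₙ q))))
    where
    z = ↥ q ℤ./ℕ ↧ₙ q
    D = ⟦ + ↧ₙ q ⟧
    instance D-pos : Positive D
             D-pos = normalize-pos (↧ₙ q) 1

  ∣z∣≡± : ∀ z → Σ[ e ∈ ℤ ] e ℤ.* z ≡ + ℤ.∣ z ∣
  ∣z∣≡± (+ n)      = + 1 , ℤ.*-identityˡ (+ n)
  ∣z∣≡± (-[1+ n ]) = -[1+ 0 ] , ℤ.-1*i≡-i -[1+ n ]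

  bezout : ∀ a b → Σ[ (g , x , y , s , r) ∈ ℤ × ℤ × ℤ × ℤ × ℤ ]
    a ≡ g ℤ.* x × b ≡ g ℤ.* y × s ℤ.* x ℤ.+ r ℤ.* y ≡ + 1
  bezout a b = go (ℕ.Bézout.lemma ℤ.∣ a ∣ ℤ.∣ b ∣)
    where
    Result = Σ[ (g , x , y , s , r) ∈ ℤ × ℤ × ℤ × ℤ × ℤ ]
      a ≡ g ℤ.* x × b ≡ g ℤ.* y × s ℤ.* x ℤ.+ r ℤ.* y ≡ + 1
    eᵃ = proj₁ (∣z∣≡± a)
    eᵇ = proj₁ (∣z∣≡± b)
    combine : ∀ g → (+ g) ℤˢ.∣ a → (+ g) ℤˢ.∣ b → ∀ s r → s ℤ.* a ℤ.+ r ℤ.* b ≡ + g → Result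
    -- If both numbers vanish, the cofactors 1 and 0 are used, so that the determinant is 1 in this
    -- case too.
    combine zero (ℤˢ.divides x a≡) (ℤˢ.divides y b≡) s r eq =
      (+ 0 , + 1 , + 0 , + 1 , + 0) , trans a≡ (ℤ.*-zeroʳ x) , trans b≡ (ℤ.*-zeroʳ y) , refl
    combine g@(suc _) (ℤˢ.divides x a≡) (ℤˢ.divides y b≡) s r eq =
      (+ g , x , y , s , r) , trans a≡ (ℤ.*-comm x (+ g)) , trans b≡ (ℤ.*-comm y (+ g)) ,
      ℤ.*-cancelʳ-≡ (s ℤ.* x ℤ.+ r ℤ.* y) (+ 1) (+ g)
        (trans (solveᶻ 5 (λ s x r y g → (s ⊛ x ⊕ r ⊛ y) ⊛ g ≐ s ⊛ (x ⊛ g) ⊕ r ⊛ (y ⊛ g)) refl s x r y (+ g))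
          (trans (cong₂ (λ p q → s ℤ.* p ℤ.+ r ℤ.* q) (sym a≡) (sym b≡)) (trans eq (sym (ℤ.*-identityˡ (+ g))))))
    difference : ∀ d x y m n → d ℕ.+ y ℕ.* n ≡ x ℕ.* m → + d ≡ + x ℤ.* + m ℤ.- + y ℤ.* + n
    difference d x y m n eq = begin
      + d                                       ≡⟨ solveᶻ 2 (λ d t → d ≐ d ⊕ t ⊖ t) refl (+ d) (+ y ℤ.* + n) ⟩
      + d ℤ.+ + y ℤ.* + n ℤ.- + y ℤ.* + n       ≡⟨ cong (ℤ._- + y ℤ.* + n) (trans (cong (ℤ._+_ (+ d)) (sym (ℤ.pos-* y n))) (trans (cong +_ eq) (ℤ.pos-* x m))) ⟩
      + x ℤ.* + m ℤ.- + y ℤ.* + n               ∎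
      where open ≡-Reasoning
    go : ℕ.Bézout.Lemma ℤ.∣ a ∣ ℤ.∣ b ∣ → Result
    go (ℕ.Bézout.result g gcd (ℕ.Bézout.+- x y eq)) = combine g (ℤˢ.∣ᵤ⇒∣ (ℕ.GCD.gcd∣m gcd)) (ℤˢ.∣ᵤ⇒∣ (ℕ.GCD.gcd∣n gcd))
      (+ x ℤ.* eᵃ) (ℤ.- (+ y ℤ.* eᵇ))
      (trans (solveᶻ 6 (λ x e a y f b → x ⊛ e ⊛ a ⊕ ⊝ (y ⊛ f) ⊛ b ≐ x ⊛ (e ⊛ a) ⊖ y ⊛ (f ⊛ b)) refl (+ x) eᵃ a (+ y) eᵇ b)
        (trans (cong₂ (λ p q → + x ℤ.* p ℤ.- + y ℤ.* q) (proj₂ (∣z∣≡± a)) (proj₂ (∣z∣≡± b))) (sym (difference g x y ℤ.∣ a ∣ ℤ.∣ b ∣ eq))))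
    go (ℕ.Bézout.result g gcd (ℕ.Bézout.-+ x y eq)) = combine g (ℤˢ.∣ᵤ⇒∣ (ℕ.GCD.gcd∣m gcd)) (ℤˢ.∣ᵤ⇒∣ (ℕ.GCD.gcd∣n gcd))
      (ℤ.- (+ x ℤ.* eᵃ)) (+ y ℤ.* eᵇ)
      (trans (solveᶻ 6 (λ x e a y f b → ⊝ (x ⊛ e) ⊛ a ⊕ y ⊛ f ⊛ b ≐ y ⊛ (f ⊛ b) ⊖ x ⊛ (e ⊛ a)) refl (+ x) eᵃ a (+ y) eᵇ b)
        (trans (cong₂ (λ p q → + y ℤ.* q ℤ.- + x ℤ.* p) (proj₂ (∣z∣≡± a)) (proj₂ (∣z∣≡± b))) (sym (difference g y x ℤ.∣ b ∣ ℤ.∣ a ∣ eq))))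

  Inverse : ∀ {n} → (u w : Fin n → ℤ^ n) → Set
  Inverse u w = ∀ k i → app ⟦ u ⟧ᶠ ⟦ w k ⟧ᵛ i ≡ δ k i

  sum-*-assoc : ∀ {n} c (f g : Fin n → ℚ) → sum (λ k → c * f k * g k) ≡ c * sum (λ k → f k * g k)
  sum-*-assoc c f g = trans (sum-cong λ k → *-assoc c (f k) (g k)) (sum-* c λ k → f k * g k)

  -- If the tail of `v` is `g′` times `u′ zero`, Bézout's identity for `v zero` and `g′` gives a
  -- matrix with rows `(x, y)` and `(-r, s)` of determinant 1. Acting on the first basis vector and
  -- `u′ zero`, it produces a basis whose first member has `v` as a multiple; `w` is the inverse,
  -- written out.
  primitiveBasis : ∀ {n} (v : ℤ^ suc n) → Σ[ u ∈ (Fin (suc n) → ℤ^ suc n) ] Σ[ w ∈ (Fin (suc n) → ℤ^ suc n) ]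
    Inverse u w × Inverse w u × ∃[ g ] (∀ i → v i ≡ g ℤ.* u zero i)
  primitiveBasis {zero} v = δᶻ , δᶻ , app-δ δ , app-δ δ , v zero , λ { zero → sym (ℤ.*-identityʳ (v zero)) }
  primitiveBasis {suc n} v with primitiveBasis (v ∘ suc)
  ... | u′ , w′ , u′w′ , w′u′ , g′ , tail≡ with bezout (v zero) g′
  ...   | (g , x , y , s , r) , v≡ , g′≡ , det = u , w , uw , wu , g , multiple
    where
    open ≡-Reasoning
    u w : Fin (suc (suc n)) → ℤ^ suc (suc n)
    u zero          = x ◂ λ i → y ℤ.* u′ zero i
    u (suc zero)    = (ℤ.- r) ◂ λ i → s ℤ.* u′ zero i
    u (suc (suc j)) = (+ 0) ◂ u′ (suc j)
    w zero    = s ◂ (ℤ.- y) ◂ λ _ → + 0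
    w (suc k) = (r ℤ.* w′ k zero) ◂ (x ℤ.* w′ k zero) ◂ λ l → w′ k (suc l)
    X = ⟦ x ⟧
    Y = ⟦ y ⟧
    S = ⟦ s ⟧
    R = ⟦ r ⟧
    det′ : S * X + R * Y ≡ 1ℚ
    det′ = trans (sym (trans (⟦⟧-+ (s ℤ.* x) (r ℤ.* y)) (cong₂ _+_ (⟦⟧-* s x) (⟦⟧-* r y)))) (cong ⟦_⟧ det)
    multiple : ∀ i → v i ≡ g ℤ.* u zero i
    multiple zero    = v≡
    multiple (suc i) = trans (tail≡ i) (trans (cong (ℤ._* u′ zero i) g′≡) (ℤ.*-assoc g y (u′ zero i)))
    U′ = ⟦ u′ ⟧ᶠ
    W′ = ⟦ w′ ⟧ᶠ
    uw : Inverse u w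
    uw zero zero = begin
      S * X + (⟦ ℤ.- y ⟧ * ⟦ ℤ.- r ⟧ + sum {n} (λ _ → 0ℚ * 0ℚ))
        ≡⟨ cong₂ (λ p q → S * X + (p + q)) (cong₂ _*_ (⟦⟧-neg y) (⟦⟧-neg r)) (sum-0 {n} λ _ → refl) ⟩
      S * X + (- Y * - R + 0ℚ)
        ≡⟨ solve 4 (λ s x y r → s :* x :+ (:- y :* :- r :+ con 0ℚ) := s :* x :+ r :* y) refl S X Y R ⟩
      S * X + R * Y ≡⟨ det′ ⟩
      1ℚ ∎
    uw zero (suc i) = begin
      S * ⟦ y ℤ.* u′ zero i ⟧ + (⟦ ℤ.- y ⟧ * ⟦ s ℤ.* u′ zero i ⟧ + sum (λ j → 0ℚ * U′ (suc j) i))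
        ≡⟨ cong₂ (λ p q → S * p + q) (⟦⟧-* y (u′ zero i)) (cong₂ _+_ (cong₂ _*_ (⟦⟧-neg y) (⟦⟧-* s (u′ zero i))) (sum-0 λ j → *-zeroˡ (U′ (suc j) i))) ⟩
      S * (Y * U′ zero i) + (- Y * (S * U′ zero i) + 0ℚ)
        ≡⟨ solve 3 (λ s y t → s :* (y :* t) :+ (:- y :* (s :* t) :+ con 0ℚ) := con 0ℚ) refl S Y (U′ zero i) ⟩
      0ℚ ∎
    uw (suc k) zero = begin
      ⟦ r ℤ.* w′ k zero ⟧ * X + (⟦ x ℤ.* w′ k zero ⟧ * ⟦ ℤ.- r ⟧ + sum (λ l → W′ k (suc l) * 0ℚ))
        ≡⟨ cong₂ (λ p q → p * X + q) (⟦⟧-* r (w′ k zero)) (cong₂ _+_ (cong₂ _*_ (⟦⟧-* x (w′ k zero)) (⟦⟧-neg r)) (sum-0 λ l → *-zeroʳ (W′ k (suc l)))) ⟩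
      R * W′ k zero * X + (X * W′ k zero * - R + 0ℚ)
        ≡⟨ solve 3 (λ r t x → r :* t :* x :+ (x :* t :* :- r :+ con 0ℚ) := con 0ℚ) refl R (W′ k zero) X ⟩
      0ℚ ∎
    uw (suc k) (suc i) = begin
      ⟦ r ℤ.* w′ k zero ⟧ * ⟦ y ℤ.* u′ zero i ⟧ + (⟦ x ℤ.* w′ k zero ⟧ * ⟦ s ℤ.* u′ zero i ⟧ + T)
        ≡⟨ cong₂ (λ p q → p + (q + T)) (cong₂ _*_ (⟦⟧-* r (w′ k zero)) (⟦⟧-* y (u′ zero i))) (cong₂ _*_ (⟦⟧-* x (w′ k zero)) (⟦⟧-* s (u′ zero i))) ⟩
      R * W′ k zero * (Y * U′ zero i) + (X * W′ k zero * (S * U′ zero i) + T)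
        ≡⟨ solve 7 (λ r t y z x s q → r :* t :* (y :* z) :+ (x :* t :* (s :* z) :+ q) := (s :* x :+ r :* y) :* (t :* z) :+ q) refl R (W′ k zero) Y (U′ zero i) X S T ⟩
      (S * X + R * Y) * (W′ k zero * U′ zero i) + T
        ≡⟨ cong (_+ T) (trans (cong (_* (W′ k zero * U′ zero i)) det′) (*-identityˡ (W′ k zero * U′ zero i))) ⟩
      W′ k zero * U′ zero i + T
        ≡⟨ u′w′ k i ⟩
      δ k i ∎
      where T = sum (λ l → W′ k (suc l) * U′ (suc l) i)
    scaled : ∀ c j z → sum (λ k → U′ j k * ⟦ c ℤ.* w′ k z ⟧) ≡ ⟦ c ⟧ * δ j z
    scaled c j z = trans (sum-cong λ k → trans (cong (U′ j k *_) (⟦⟧-* c (w′ k z)))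
      (solve 3 (λ u c w → u :* (c :* w) := c :* (u :* w)) refl (U′ j k) ⟦ c ⟧ (W′ k z)))
      (trans (sum-* ⟦ c ⟧ λ k → U′ j k * W′ k z) (cong (⟦ c ⟧ *_) (w′u′ j z)))
    first : ∀ (c z : ℤ) → sum (λ k → ⟦ c ℤ.* u′ zero k ⟧ * ⟦ z ℤ.* w′ k zero ⟧) ≡ ⟦ c ⟧ * ⟦ z ⟧
    first c z = trans (sum-cong λ k → cong (_* ⟦ z ℤ.* w′ k zero ⟧) (⟦⟧-* c (u′ zero k)))
      (trans (sum-*-assoc ⟦ c ⟧ (U′ zero) (λ k → ⟦ z ℤ.* w′ k zero ⟧))
        (cong (⟦ c ⟧ *_) (trans (scaled z zero zero) (*-identityʳ ⟦ z ⟧))))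
    rest : ∀ (c : ℤ) l → sum (λ k → ⟦ c ℤ.* u′ zero k ⟧ * W′ k (suc l)) ≡ 0ℚ
    rest c l = trans (sum-cong λ k → cong (_* W′ k (suc l)) (⟦⟧-* c (u′ zero k)))
      (trans (sum-*-assoc ⟦ c ⟧ (U′ zero) (λ k → W′ k (suc l))) (trans (cong (⟦ c ⟧ *_) (w′u′ zero (suc l))) (*-zeroʳ ⟦ c ⟧)))
    wu : Inverse w u
    wu zero zero = trans (cong (λ t → X * S + t) (first y r)) (trans (solve 4 (λ x s y r → x :* s :+ y :* r := s :* x :+ r :* y) refl X S Y R) det′)
    wu zero (suc zero) = trans (cong₂ (λ p q → X * p + q) (⟦⟧-neg y) (first y x)) (solve 2 (λ x y → x :* :- y :+ y :* x := con 0ℚ) refl X Y)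
    wu zero (suc (suc l)) = trans (cong (λ t → X * 0ℚ + t) (rest y l)) (solve 1 (λ x → x :* con 0ℚ :+ con 0ℚ := con 0ℚ) refl X)
    wu (suc zero) zero = trans (cong₂ (λ p q → p * S + q) (⟦⟧-neg r) (first s r)) (solve 2 (λ r s → :- r :* s :+ s :* r := con 0ℚ) refl R S)
    wu (suc zero) (suc zero) = trans (cong₂ _+_ (cong₂ _*_ (⟦⟧-neg r) (⟦⟧-neg y)) (first s x))
      (trans (solve 4 (λ r y s x → :- r :* :- y :+ s :* x := s :* x :+ r :* y) refl R Y S X) det′)
    wu (suc zero) (suc (suc l)) = trans (cong (λ t → ⟦ ℤ.- r ⟧ * 0ℚ + t) (rest s l)) (solve 1 (λ x → x :* con 0ℚ :+ con 0ℚ := con 0ℚ) refl ⟦ ℤ.- r ⟧)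
    wu (suc (suc j)) zero = trans (cong (λ t → 0ℚ * S + t) (scaled r (suc j) zero)) (solve 2 (λ s r → con 0ℚ :* s :+ r :* con 0ℚ := con 0ℚ) refl S R)
    wu (suc (suc j)) (suc zero) = trans (cong (λ t → 0ℚ * ⟦ ℤ.- y ⟧ + t) (scaled x (suc j) zero)) (solve 2 (λ s r → con 0ℚ :* s :+ r :* con 0ℚ := con 0ℚ) refl ⟦ ℤ.- y ⟧ X)
    wu (suc (suc j)) (suc (suc l)) = trans (cong (λ t → 0ℚ * 0ℚ + t) (w′u′ (suc j) (suc l))) (+-identityˡ (δ j l))

  pullback : ∀ {n} (A : Mat n) (u w : Fin n → ℤ^ n) → Inverse u w → Inverse w u → Iso (λ i j → bil A ⟦ u i ⟧ᵛ ⟦ u j ⟧ᵛ) A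
  pullback A u w uw wu = u , w , record { uw = uw ; wu = wu ; preserves = λ _ _ → refl }

  -- The form of spanning that survives projection in `reduce`; it also guarantees a nonzero vector
  -- among those given.
  Separating : ∀ {M n} → (Fin M → ℤ^ n) → Set
  Separating {M} {n} v = ∀ (f : Vec n) → (∀ k → sum (λ i → f i * ⟦ v k i ⟧) ≡ 0ℚ) → ∀ i → f i ≡ 0ℚ

  separating-app : ∀ {M n} (v : Fin M → ℤ^ n) (u w : Fin n → ℤ^ n) → Inverse w u → Separating v → Separating (λ k → appᶻ w (v k))
  separating-app v u w wu sep f h i = begin
    f i                                                          ≡⟨ sym (sum-δ i f) ⟩
    sum (λ j → δ i j * f j)                                      ≡⟨ sum-cong (λ j → cong (_* f j) (sym (wu i j))) ⟩
    sum (λ j → sum (λ l → ⟦ u i l ⟧ * ⟦ w l j ⟧) * f j)          ≡⟨ sum-cong (λ j → sym (sum-*ʳ (f j) λ l → ⟦ u i l ⟧ * ⟦ w l j ⟧)) ⟩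
    sum (λ j → sum (λ l → ⟦ u i l ⟧ * ⟦ w l j ⟧ * f j))          ≡⟨ sum-swap (λ j l → ⟦ u i l ⟧ * ⟦ w l j ⟧ * f j) ⟩
    sum (λ l → sum (λ j → ⟦ u i l ⟧ * ⟦ w l j ⟧ * f j))          ≡⟨ sum-cong (λ l → sum-*-assoc ⟦ u i l ⟧ (λ j → ⟦ w l j ⟧) f) ⟩
    sum (λ l → ⟦ u i l ⟧ * F l)                                  ≡⟨ sum-0 (λ l → trans (cong (⟦ u i l ⟧ *_) (sep F F≡0 l)) (*-zeroʳ ⟦ u i l ⟧)) ⟩
    0ℚ                                                           ∎
    where
    open ≡-Reasoning
    F : Vec _
    F l = sum λ j → ⟦ w l j ⟧ * f j
    F≡0 : ∀ k → sum (λ l → F l * ⟦ v k l ⟧) ≡ 0ℚ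
    F≡0 k = begin
      sum (λ l → F l * ⟦ v k l ⟧)                                ≡⟨ sum-cong (λ l → sym (sum-*ʳ ⟦ v k l ⟧ λ j → ⟦ w l j ⟧ * f j)) ⟩
      sum (λ l → sum (λ j → ⟦ w l j ⟧ * f j * ⟦ v k l ⟧))        ≡⟨ sum-swap (λ l j → ⟦ w l j ⟧ * f j * ⟦ v k l ⟧) ⟩
      sum (λ j → sum (λ l → ⟦ w l j ⟧ * f j * ⟦ v k l ⟧))
        ≡⟨ sum-cong (λ j → trans (sum-cong λ l → solve 3 (λ w f v → w :* f :* v := f :* (v :* w)) refl ⟦ w l j ⟧ (f j) ⟦ v k l ⟧)
             (sum-* (f j) λ l → ⟦ v k l ⟧ * ⟦ w l j ⟧)) ⟩
      sum (λ j → f j * app ⟦ w ⟧ᶠ ⟦ v k ⟧ᵛ j)                    ≡⟨ sum-cong (λ j → cong (f j *_) (sym (⟦appᶻ⟧ w (v k) j))) ⟩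
      sum (λ j → f j * ⟦ appᶻ w (v k) j ⟧)                       ≡⟨ h k ⟩
      0ℚ                                                         ∎

  module _ {n} {A : Mat (suc n)} (symA : Symm A) (B : Bounded A) (0<a : 0ℚ < A zero zero) where
    open Schur A symA 0<a
    open Bounded B

    -- The complement takes at `x` the value of `A` at the lift of `x` orthogonal to the first basis
    -- vector, so the same bound serves.
    bounded-complement : Bounded complement
    bounded-complement = record
      { bound   = bound
      ; bound≥0 = bound≥0
      ; quad≥0  = λ x → subst (0ℚ ≤_) (lift-quad x) (quad≥0 (lift x))
      ; square≤ = λ x i → subst (λ t → x i * x i ≤ bound * t) (lift-quad x) (square≤ (lift x) (suc i))
      }
      where
      lift : Vec n → Vec (suc n)
      lift x = (- (a⁻¹ * β x)) ◂ x
      y≡0 : ∀ x → y (lift x) ≡ 0ℚ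
      y≡0 x = trans (solve 3 (λ a i b → a :* :- (i :* b) :+ b := b :- (i :* a) :* b) refl a a⁻¹ (β x))
        (trans (cong (λ t → β x - t * β x) (*-inverseˡ a)) (solve 1 (λ b → b :- con 1ℚ :* b := con 0ℚ) refl (β x)))
      lift-quad : ∀ x → quad A (lift x) ≡ quad complement x
      lift-quad x = trans (complete-square (lift x)) (trans (cong (λ t → a⁻¹ * (t * t) + quad complement x) (y≡0 x))
        (solve 2 (λ i q → i :* (con 0ℚ :* con 0ℚ) :+ q := q) refl a⁻¹ (quad complement x)))

  -- Project orthogonally to a primitive multiple of one of the given vectors,
  -- reduce the projection, and lift the reduced basis with a first coordinate
  -- for which the component along that vector is as short as the vector itself.
  reduce : ∀ n {M} (A : Mat n) → Symm A → Bounded A → ∀ m (v : Fin M → ℤ^ n) → (∀ k → q[ A ] (v k) ≤ m) → Separating v →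
    Σ[ A₁ ∈ Mat n ] Iso A₁ A × (∀ j → A₁ j j ≤ ι n * m)
  reduce zero    A symA B m v v≤ sep = A , iso-≡ (λ _ _ → refl) , λ ()
  reduce (suc n) {M} A symA B m v v≤ sep = start (F.any? λ k → nonZeroVector? (v k))
    where
    open ≡-Reasoning
    start : Dec (∃[ k ] NonZeroVector (v k)) → Σ[ A₁ ∈ Mat (suc n) ] Iso A₁ A × (∀ j → A₁ j j ≤ ι (suc n) * m)
    start (no ¬nz) = contradiction (sep (δ zero) (λ k → trans (sum-δ zero ⟦ v k ⟧ᵛ) (cong ⟦_⟧ (vanish k))) zero) λ ()
      where
      vanish : ∀ k → v k zero ≡ + 0
      vanish k with v k zero ℤ.≟ + 0
      ... | yes eq = eq
      ... | no ne = contradiction (k , zero , ne) ¬nz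
    start (yes (k₀ , nz)) = step (primitiveBasis (v k₀))
      where
      step : (Σ[ u ∈ (Fin (suc n) → ℤ^ suc n) ] Σ[ w ∈ (Fin (suc n) → ℤ^ suc n) ]
        Inverse u w × Inverse w u × ∃[ g ] (∀ i → v k₀ i ≡ g ℤ.* u zero i)) →
        Σ[ A₁ ∈ Mat (suc n) ] Iso A₁ A × (∀ j → A₁ j j ≤ ι (suc n) * m)
      step (u , w , uw , wu , g , v≡) = extend (reduce n complement complement-symm (bounded-complement symA′ B′ 0<a) m tails tails≤ tails-separate)
        where
        A′ : Mat (suc n)
        A′ i j = bil A ⟦ u i ⟧ᵛ ⟦ u j ⟧ᵛ
        I′ : Iso A′ A
        I′ = pullback A u w uw wu
        symA′ : Symm A′
        symA′ i j = bil-sym symA ⟦ u i ⟧ᵛ ⟦ u j ⟧ᵛ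
        B′ : Bounded A′
        B′ = bounded-iso I′ symA′ B
        0<a : 0ℚ < A′ zero zero
        0<a = ≰⇒> λ a≤0 → contradiction (quad≡0⇒0 B′ (δ zero) (subst (_≤ 0ℚ) (sym (bil-δ A′ zero zero)) a≤0) zero) λ ()
        open Schur A′ symA′ 0<a
        v≡′ : ∀ i → ⟦ v k₀ i ⟧ ≡ ⟦ g ⟧ * ⟦ u zero i ⟧
        v≡′ i = trans (cong ⟦_⟧ (v≡ i)) (⟦⟧-* g (u zero i))
        g≢0 : g ≢ + 0
        g≢0 refl = let i , ne = nz in ne (trans (v≡ i) (ℤ.*-zeroˡ (u zero i)))
        -- Passing from `v k₀` to the primitive vector `u zero` divides the norm by `g²`, so it
        -- stays at most `m`.
        1≤g² : 1ℚ ≤ ⟦ g ⟧ * ⟦ g ⟧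
        1≤g² = subst (1ℚ ≤_) (⟦⟧-* g g) (⟦⟧-mono-≤ {+ 1} {g ℤ.* g} (1≤z² g g≢0))
          where
          1≤z² : ∀ z → z ≢ + 0 → + 1 ℤ.≤ z ℤ.* z
          1≤z² (+ zero)   ne = contradiction refl ne
          1≤z² (+ suc k)  ne = ℤ.+≤+ (s≤s z≤n)
          1≤z² -[1+ k ] ne = ℤ.+≤+ (s≤s z≤n)
        a≤m : a ≤ m
        a≤m = ≤-trans (subst (_≤ ⟦ g ⟧ * ⟦ g ⟧ * a) (*-identityˡ a) (*-monoˡ a (<⇒≤ 0<a) 1≤g²))
          (subst (_≤ m) (trans (quad-cong A v≡′) (quad-* A ⟦ g ⟧ ⟦ u zero ⟧ᵛ)) (v≤ k₀))
        v′ : Fin M → ℤ^ suc n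
        v′ k = appᶻ w (v k)
        v′≤ : ∀ k → q[ A′ ] (v′ k) ≤ m
        v′≤ k = subst (_≤ m) (sym (trans (quad-cong A′ (⟦appᶻ⟧ w (v k))) (IsIso.bil-w (proj₂ (proj₂ I′)) ⟦ v k ⟧ᵛ ⟦ v k ⟧ᵛ))) (v≤ k)
        tails : Fin M → ℤ^ n
        tails k = v′ k ∘ suc
        tails≤ : ∀ k → q[ complement ] (tails k) ≤ m
        tails≤ k = ≤-trans (≤-by (a⁻¹ * (y ⟦ v′ k ⟧ᵛ * y ⟦ v′ k ⟧ᵛ)) (*-nonNeg (<⇒≤ 0<a⁻¹) (square (y ⟦ v′ k ⟧ᵛ)))
          (trans (+-comm (q[ complement ] (tails k)) (a⁻¹ * (y ⟦ v′ k ⟧ᵛ * y ⟦ v′ k ⟧ᵛ))) (sym (complete-square ⟦ v′ k ⟧ᵛ)))) (v′≤ k)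
        tails-separate : Separating tails
        tails-separate f h i = separating-app v u w wu sep (0ℚ ◂ f)
          (λ k → trans (cong (_+ sum (λ i → f i * ⟦ tails k i ⟧)) (*-zeroˡ ⟦ v′ k zero ⟧)) (trans (+-identityˡ (sum λ i → f i * ⟦ tails k i ⟧)) (h k))) (suc i)
        extend : Σ[ A₂ ∈ Mat n ] Iso A₂ complement × (∀ j → A₂ j j ≤ ι n * m) →
          Σ[ A₁ ∈ Mat (suc n) ] Iso A₁ A × (∀ j → A₁ j j ≤ ι (suc n) * m)
        extend (A₂ , (u₂ , w₂ , I₂) , A₂≤) = A₁ , iso-trans (pullback A′ u₁ w₁ u₁w₁ w₁u₁) I′ , A₁≤
          where
          -- `q j` is the component of a lifted vector along the first one. Subtracting its floor
          -- leaves `t` between 0 and 1, which contributes `a t² ≤ a ≤ m`; the rest is bounded by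
          -- induction, whence the factor `ι (suc n)`.
          q : Fin n → ℚ
          q j = a⁻¹ * β ⟦ u₂ j ⟧ᵛ
          z : Fin n → ℤ
          z j = proj₁ (floor-spec (q j))
          c c′ : Fin n → ℤ
          c j = ℤ.- z j
          -- First column of the inverse basis change. The scalars `c k` are regarded as vectors
          -- with one coordinate, so that the facts about `app` apply to them.
          c′ j = ℤ.- appᶻ (λ k (_ : Fin 1) → c k) (w₂ j) zero
          ⟦c′⟧ : ∀ j → ⟦ c′ j ⟧ ≡ - sum (λ k → ⟦ w₂ j k ⟧ * ⟦ c k ⟧)
          ⟦c′⟧ j = trans (⟦⟧-neg (appᶻ (λ k (_ : Fin 1) → c k) (w₂ j) zero)) (cong -_ (⟦appᶻ⟧ (λ k (_ : Fin 1) → c k) (w₂ j) zero))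
          u₁ w₁ : Fin (suc n) → ℤ^ suc n
          u₁ = ((+ 1) ◂ λ _ → + 0) ◂ λ j → c j ◂ u₂ j
          w₁ = ((+ 1) ◂ λ _ → + 0) ◂ λ j → c′ j ◂ w₂ j
          u₁w₁ : Inverse u₁ w₁
          u₁w₁ zero zero = cong (_+_ (1ℚ * 1ℚ)) (sum-0 λ j → *-zeroˡ ⟦ c j ⟧)
          u₁w₁ zero (suc i) = cong (_+_ (1ℚ * 0ℚ)) (sum-0 λ j → *-zeroˡ ⟦ u₂ j i ⟧)
          u₁w₁ (suc k) zero = trans (cong (λ t → t * 1ℚ + S) (⟦c′⟧ k)) (solve 1 (λ s → :- s :* con 1ℚ :+ s := con 0ℚ) refl S)
            where S = sum (λ j → ⟦ w₂ k j ⟧ * ⟦ c j ⟧)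
          u₁w₁ (suc k) (suc i) = trans (cong (_+ app ⟦ u₂ ⟧ᶠ ⟦ w₂ k ⟧ᵛ i) (*-zeroʳ ⟦ c′ k ⟧)) (trans (+-identityˡ (app ⟦ u₂ ⟧ᶠ ⟦ w₂ k ⟧ᵛ i)) (IsIso.uw I₂ k i))
          w₁u₁ : Inverse w₁ u₁
          w₁u₁ zero zero = cong (_+_ (1ℚ * 1ℚ)) (sum-0 λ j → *-zeroˡ ⟦ c′ j ⟧)
          w₁u₁ zero (suc i) = cong (_+_ (1ℚ * 0ℚ)) (sum-0 λ j → *-zeroˡ ⟦ w₂ j i ⟧)
          w₁u₁ (suc k) zero = begin
            ⟦ c k ⟧ * 1ℚ + sum (λ j → ⟦ u₂ k j ⟧ * ⟦ c′ j ⟧)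
              ≡⟨ cong (λ t → ⟦ c k ⟧ * 1ℚ + t) (trans (sum-cong λ j → trans (cong (⟦ u₂ k j ⟧ *_) (⟦c′⟧ j)) (sym (neg-distribʳ-* ⟦ u₂ k j ⟧ (sum λ l → ⟦ w₂ j l ⟧ * ⟦ c l ⟧))))
                   (sum-neg λ j → ⟦ u₂ k j ⟧ * sum (λ l → ⟦ w₂ j l ⟧ * ⟦ c l ⟧))) ⟩
            ⟦ c k ⟧ * 1ℚ + - sum (λ j → ⟦ u₂ k j ⟧ * sum (λ l → ⟦ w₂ j l ⟧ * ⟦ c l ⟧))
              ≡⟨ cong (λ t → ⟦ c k ⟧ * 1ℚ + - t) (begin
                   sum (λ j → ⟦ u₂ k j ⟧ * sum (λ l → ⟦ w₂ j l ⟧ * ⟦ c l ⟧))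
                     ≡⟨ sym (app-app (λ l (_ : Fin 1) → ⟦ c l ⟧) ⟦ w₂ ⟧ᶠ ⟦ u₂ k ⟧ᵛ zero) ⟩
                   sum (λ l → app ⟦ w₂ ⟧ᶠ ⟦ u₂ k ⟧ᵛ l * ⟦ c l ⟧)
                     ≡⟨ trans (sum-cong λ l → cong (_* ⟦ c l ⟧) (IsIso.wu I₂ k l)) (sum-δ k λ l → ⟦ c l ⟧) ⟩
                   ⟦ c k ⟧ ∎) ⟩
            ⟦ c k ⟧ * 1ℚ + - ⟦ c k ⟧
              ≡⟨ solve 1 (λ c → c :* con 1ℚ :+ :- c := con 0ℚ) refl ⟦ c k ⟧ ⟩
            0ℚ ∎
          w₁u₁ (suc k) (suc i) = trans (cong (_+ app ⟦ w₂ ⟧ᶠ ⟦ u₂ k ⟧ᵛ i) (*-zeroʳ ⟦ c k ⟧)) (trans (+-identityˡ (app ⟦ w₂ ⟧ᶠ ⟦ u₂ k ⟧ᵛ i)) (IsIso.wu I₂ k i))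
          A₁ : Mat (suc n)
          A₁ i j = bil A′ ⟦ u₁ i ⟧ᵛ ⟦ u₁ j ⟧ᵛ
          ι-suc-* : ι (suc n) * m ≡ m + ι n * m
          ι-suc-* = trans (cong (_* m) (ι-suc n)) (solve 2 (λ k m → (k :+ con 1ℚ) :* m := m :+ k :* m) refl (ι n) m)
          A₁≤ : ∀ j → A₁ j j ≤ ι (suc n) * m
          A₁≤ zero = subst₂ _≤_ (trans (sym (bil-δ A′ zero zero)) (quad-cong A′ δ≡)) (sym ι-suc-*)
              (≤-trans a≤m (≤-by (ι n * m) (*-nonNeg (0≤ι n) (≤-trans (<⇒≤ 0<a) a≤m)) refl))
            where
            δ≡ : ∀ i → δ zero i ≡ ⟦ u₁ zero i ⟧
            δ≡ zero    = refl
            δ≡ (suc i) = refl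
          A₁≤ (suc j) = subst (A₁ (suc j) (suc j) ≤_) (sym ι-suc-*)
            (subst (_≤ m + ι n * m) (sym (complete-square ⟦ u₁ (suc j) ⟧ᵛ)) (+-mono-≤ (≤-trans y²≤ a≤m) (subst (_≤ ι n * m) (sym (IsIso.preserves I₂ j j)) (A₂≤ j))))
            where
            Z = ⟦ z j ⟧
            t = q j - Z
            0≤t : 0ℚ ≤ t
            0≤t = p≤q⇒0≤q-p (proj₁ (proj₂ (floor-spec (q j))))
            t≤1 : t ≤ 1ℚ
            t≤1 = <⇒≤ (subst (t <_) (solve 1 (λ z → z :+ con 1ℚ :- z := con 1ℚ) refl Z) (+-monoˡ-< (- Z) (proj₂ (proj₂ (floor-spec (q j))))))
            y≡ : y ⟦ u₁ (suc j) ⟧ᵛ ≡ a * t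
            y≡ = trans (cong (λ s → a * s + β ⟦ u₂ j ⟧ᵛ) (⟦⟧-neg (z j)))
              (sym (trans (solve 4 (λ a i b z → a :* (i :* b :- z) := a :* :- z :+ (i :* a) :* b) refl a a⁻¹ (β ⟦ u₂ j ⟧ᵛ) Z)
                (cong (λ s → a * - Z + s) (trans (cong (_* β ⟦ u₂ j ⟧ᵛ) (*-inverseˡ a)) (*-identityˡ (β ⟦ u₂ j ⟧ᵛ))))))
            y²≤ : a⁻¹ * (y ⟦ u₁ (suc j) ⟧ᵛ * y ⟦ u₁ (suc j) ⟧ᵛ) ≤ a
            y²≤ = subst₂ _≤_ (sym eq) (*-identityʳ a) (*-monoʳ a (<⇒≤ 0<a) (*-mono 0≤t (<⇒≤ 1>0) t≤1 t≤1))
              where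
              eq : a⁻¹ * (y ⟦ u₁ (suc j) ⟧ᵛ * y ⟦ u₁ (suc j) ⟧ᵛ) ≡ a * (t * t)
              eq = trans (cong (λ s → a⁻¹ * (s * s)) y≡) (trans (solve 3 (λ i a t → i :* (a :* t :* (a :* t)) := (i :* a) :* (a :* (t :* t))) refl a⁻¹ a t)
                (trans (cong (_* (a * (t * t))) (*-inverseˡ a)) (*-identityˡ (a * (t * t)))))

  ι-* : ∀ m n → ι (m ℕ.* n) ≡ ι m * ι n
  ι-* m n = trans (cong ⟦_⟧ (ℤ.pos-* m n)) (⟦⟧-* (+ m) (+ n))

  ι-+ : ∀ m n → ι (m ℕ.+ n) ≡ ι m + ι n
  ι-+ m n = ⟦⟧-+ (+ m) (+ n)

  ι-cancel-≤ : ∀ {m n} → ι m ≤ ι n → m ℕ.≤ n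
  ι-cancel-≤ h = ℤ.drop‿+≤+ (⟦⟧-cancel-≤ h)

  ι-mono-< : ∀ {m n} → m ℕ.< n → ι m < ι n
  ι-mono-< h = ⟦⟧-mono-< (ℤ.+<+ h)

  ∣⟦⟧∣ : ∀ z → ∣ ⟦ z ⟧ ∣ ≡ ι ℤ.∣ z ∣
  ∣⟦⟧∣ (+ n)      = 0≤p⇒∣p∣≡p (0≤ι n)
  ∣⟦⟧∣ -[1+ n ] = trans (cong ∣_∣ (⟦⟧-neg (+ suc n))) (trans (∣-p∣≡∣p∣ (ι (suc n))) (0≤p⇒∣p∣≡p (0≤ι (suc n))))

  ∣p∣≤ : ∀ {p q} → p ≤ q → - p ≤ q → ∣ p ∣ ≤ q
  ∣p∣≤ {p} {q} h h′ with ∣p∣≡p∨∣p∣≡-p p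
  ... | inj₁ eq = subst (_≤ q) (sym eq) h
  ... | inj₂ eq = subst (_≤ q) (sym eq) h′

  ∣bil∣≤ : ∀ {d} (A : Mat d) x y {R ρ σ} → 0ℚ ≤ R → 0ℚ ≤ ρ → 0ℚ ≤ σ → (∀ i j → ∣ A i j ∣ ≤ R) → (∀ i → ∣ x i ∣ ≤ ρ) → (∀ i → ∣ y i ∣ ≤ σ) →
    ∣ bil A x y ∣ ≤ ι d * (ι d * (ρ * R * σ))
  ∣bil∣≤ {d} A x y {R} {ρ} {σ} 0≤R 0≤ρ 0≤σ hA hx hy = begin
    ∣ bil A x y ∣                                       ≤⟨ ∣sum∣≤ (λ i → sum λ j → x i * A i j * y j) ⟩
    sum (λ i → ∣ sum (λ j → x i * A i j * y j) ∣)       ≤⟨ sum-mono (λ i → ≤-trans (∣sum∣≤ λ j → x i * A i j * y j) (sum-mono λ j → term i j)) ⟩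
    sum {d} (λ i → sum {d} (λ j → ρ * R * σ))           ≡⟨ trans (sum-cong {d} λ i → sum-const d (ρ * R * σ)) (sum-const d (ι d * (ρ * R * σ))) ⟩
    ι d * (ι d * (ρ * R * σ))                           ∎
    where
    open ≤-Reasoning
    term : ∀ i j → ∣ x i * A i j * y j ∣ ≤ ρ * R * σ
    term i j = subst (_≤ ρ * R * σ) (sym (trans (∣p*q∣≡∣p∣*∣q∣ (x i * A i j) (y j)) (cong (_* ∣ y j ∣) (∣p*q∣≡∣p∣*∣q∣ (x i) (A i j)))))
      (*-mono (0≤∣p∣ (y j)) (*-nonNeg 0≤ρ 0≤R) (*-mono (0≤∣p∣ (A i j)) 0≤ρ (hx i) (hA i j)) (hy j))

  quad-parallelogram : ∀ {d} {A : Mat d} → Symm A → (∀ x → 0ℚ ≤ quad A x) → ∀ x y →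
    quad A (λ i → x i - y i) ≤ (quad A x + quad A x) + (quad A y + quad A y)
  quad-parallelogram {A = A} symA A≥0 x y = ≤-by (quad A (λ i → 1ℚ * x i + 1ℚ * y i)) (A≥0 (λ i → 1ℚ * x i + 1ℚ * y i))
    (trans (cong₂ _+_ (trans (quad-cong A λ i → solve 2 (λ x y → x :- y := con 1ℚ :* x :+ con (- 1ℚ) :* y) refl (x i) (y i)) (quad-lin symA 1ℚ x (- 1ℚ) y)) (quad-lin symA 1ℚ x 1ℚ y))
      (solve 3 (λ p q r → (con 1ℚ :* con 1ℚ :* p :+ (con 1ℚ :* con (- 1ℚ) :+ con 1ℚ :* con (- 1ℚ)) :* q :+ con (- 1ℚ) :* con (- 1ℚ) :* r)
        :+ (con 1ℚ :* con 1ℚ :* p :+ (con 1ℚ :* con 1ℚ :+ con 1ℚ :* con 1ℚ) :* q :+ con 1ℚ :* con 1ℚ :* r) := (p :+ p) :+ (r :+ r)) refl (quad A x) (bil A x y) (quad A y)))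

  -- Positivity on `δ i + δ j` and on `δ i - δ j` gives `2 ∣A i j∣ ≤ A i i + A j j`.
  entry-bound : ∀ {d} {A : Mat d} → Symm A → (∀ x → 0ℚ ≤ quad A x) → ∀ {R} → (∀ j → A j j ≤ R) → ∀ i j → ∣ A i j ∣ ≤ R
  entry-bound {A = A} symA A≥0 {R} h i j = ∣p∣≤ (half (- 1ℚ) (solve 1 (λ b → con (- 1ℚ) :* (b :+ b) := :- (b :+ b)) refl (A i j)) (solve 0 (con (- 1ℚ) :* con (- 1ℚ) := con 1ℚ) refl))
      (half 1ℚ (solve 1 (λ b → con 1ℚ :* (b :+ b) := :- (:- b :+ :- b)) refl (A i j)) (solve 0 (con 1ℚ :* con 1ℚ := con 1ℚ) refl))
    where
    double : ∀ {p} → p + p ≤ R + R → p ≤ R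
    double {p} hp = ≮⇒≥ λ R<p → <-irrefl refl (<-≤-trans (+-mono-< R<p R<p) hp)
    half : ∀ e {p} → e * (A i j + A i j) ≡ - (p + p) → e * e ≡ 1ℚ → p ≤ R
    half e {p} eq e² = double (≤-trans
      (≤-by (quad A (λ k → 1ℚ * δ i k + e * δ j k)) (A≥0 (λ k → 1ℚ * δ i k + e * δ j k))
        (trans (cong (_+_ (p + p)) (trans (quad-lin symA 1ℚ (δ i) e (δ j))
          (trans (cong₂ (λ a b → 1ℚ * 1ℚ * a + (1ℚ * e + 1ℚ * e) * b + e * e * bil A (δ j) (δ j)) (bil-δ A i i) (bil-δ A i j))
            (trans (cong (λ c → 1ℚ * 1ℚ * A i i + (1ℚ * e + 1ℚ * e) * A i j + e * e * c) (bil-δ A j j))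
              (trans (cong (λ s → 1ℚ * 1ℚ * A i i + (1ℚ * e + 1ℚ * e) * A i j + s * A j j) e²)
                (trans (solve 4 (λ a e b c → con 1ℚ :* con 1ℚ :* a :+ (con 1ℚ :* e :+ con 1ℚ :* e) :* b :+ con 1ℚ :* c := a :+ e :* (b :+ b) :+ c) refl (A i i) e (A i j) (A j j))
                  (cong (λ s → A i i + s + A j j) eq)))))))
          (solve 3 (λ p a c → (p :+ p) :+ (a :+ :- (p :+ p) :+ c) := a :+ c) refl p (A i i) (A j j))))
      (+-mono-≤ (h i) (h j)))

  -- Makes the error in Dirichlet's argument at most half the main term. With entries at most `d m`
  -- and remainders at most `X / K`, twice the norm of the remainder is at most
  -- `2 d³ X² m / K² = X² m / (2 d)`. What remains is `X² ≤ 4 q²` with `q ≤ K ^ d`, whence the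
  -- factor 2 in `coordinateBound`.
  gridSize : ℕ → ℕ
  gridSize d = 2 ℕ.* (d ℕ.* d)

  coordinateBound : ℕ → ℕ
  coordinateBound d = 2 ℕ.* gridSize d ℕ.^ d

  -- Dirichlet: some multiple q w / ∣ w i ∣ with q ≤ K ^ d is within 1 / K of a
  -- nonzero lattice vector, whose norm is at least m.
  module Dirichlet {n} {A : Mat (suc n)} (symA : Symm A) (A≥0 : ∀ x → 0ℚ ≤ quad A x) {m} (0<m : 0ℚ < m)
    (diag : ∀ j → A j j ≤ ι (suc n) * m) (minimum : ∀ v → NonZeroVector v → m ≤ q[ A ] v)
    (w : ℤ^ suc n) (w≤ : q[ A ] w ≤ m) where

    private
      d = suc n
      K = gridSize d

    bound-at : ∀ i X .{{_ : ℕ.NonZero X}} → ℤ.∣ w i ∣ ≡ X → X ℕ.≤ coordinateBound d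
    bound-at i X ∣wᵢ∣≡X = conclude (F.pigeonhole (ℕ.n<1+n (K ℕ.^ d)) (F.funToFin ∘ cell))
      where
      ρ : ℕ → Fin d → ℕ
      ρ q j = (+ q ℤ.* w j) ℤ.%ℕ X
      κ : ℕ → Fin d → ℤ
      κ q j = (+ q ℤ.* w j) ℤ./ℕ X
      division : ∀ q j → + q ℤ.* w j ≡ + ρ q j ℤ.+ κ q j ℤ.* + X
      division q j = ℤ.a≡a%ℕn+[a/ℕn]*n (+ q ℤ.* w j) X
      -- The multiples of `w` by 0, ..., `K ^ d` are reduced modulo `X`, and each residue is located
      -- in one of `K` equal intervals. There is one multiple more than there are cells.
      cell : Fin (suc (K ℕ.^ d)) → Fin d → Fin K
      cell q j = F.fromℕ< (ℕ.m<n*o⇒m/o<n {K ℕ.* ρ (toℕ q) j} {K} {X} (ℕ.*-monoʳ-< K (ℤ.n%ℕd<d (+ toℕ q ℤ.* w j) X)))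
      conclude : (Σ[ a ∈ Fin (suc (K ℕ.^ d)) ] Σ[ b ∈ Fin (suc (K ℕ.^ d)) ] a F.< b × F.funToFin (cell a) ≡ F.funToFin (cell b)) →
        X ℕ.≤ coordinateBound d
      conclude (a , b , a<b , same) = ℕ.≤-trans X≤2q (ℕ.*-monoʳ-≤ 2 q≤)
        where
        q = toℕ b ℕ.∸ toℕ a
        q≤ : q ℕ.≤ K ℕ.^ d
        q≤ = ℕ.≤-trans (ℕ.m∸n≤m (toℕ b) (toℕ a)) (ℕ.<⇒≤pred (F.toℕ<n b))
        0<q : 0 ℕ.< q
        0<q = ℕ.m<n⇒0<n∸m a<b
        ⟦q⟧ : ι q ≡ ι (toℕ b) - ι (toℕ a)
        ⟦q⟧ = trans (solve 2 (λ q a → q := q :+ a :- a) refl (ι q) (ι (toℕ a)))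
          (cong (_- ι (toℕ a)) (trans (sym (ι-+ q (toℕ a))) (cong ι (ℕ.m∸n+n≡m (ℕ.<⇒≤ a<b)))))
        v : ℤ^ d
        v j = κ (toℕ b) j ℤ.- κ (toℕ a) j
        r : Vec d
        r j = ι (ρ (toℕ b) j) - ι (ρ (toℕ a) j)
        ⟦division⟧ : ∀ c j → ι c * ⟦ w j ⟧ ≡ ι (ρ c j) + ⟦ κ c j ⟧ * ι X
        ⟦division⟧ c j = trans (sym (⟦⟧-* (+ c) (w j))) (trans (cong ⟦_⟧ (division c j))
          (trans (⟦⟧-+ (+ ρ c j) (κ c j ℤ.* + X)) (cong (_+_ (ι (ρ c j))) (⟦⟧-* (κ c j) (+ X)))))
        Xv≡ : ∀ j → ι X * ⟦ v j ⟧ ≡ ι q * ⟦ w j ⟧ - r j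
        Xv≡ j = begin
          ι X * ⟦ v j ⟧
            ≡⟨ cong (ι X *_) (⟦⟧-- (κ (toℕ b) j) (κ (toℕ a) j)) ⟩
          ι X * (κᵇ - κᵃ)
            ≡⟨ solve 5 (λ x k l s t → x :* (k :- l) := (s :+ k :* x) :- (t :+ l :* x) :- (s :- t)) refl (ι X) κᵇ κᵃ (ι (ρ (toℕ b) j)) (ι (ρ (toℕ a) j)) ⟩
          (ι (ρ (toℕ b) j) + κᵇ * ι X) - (ι (ρ (toℕ a) j) + κᵃ * ι X) - r j
            ≡⟨ cong₂ (λ s t → s - t - r j) (sym (⟦division⟧ (toℕ b) j)) (sym (⟦division⟧ (toℕ a) j)) ⟩
          ι (toℕ b) * ⟦ w j ⟧ - ι (toℕ a) * ⟦ w j ⟧ - r j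
            ≡⟨ cong (_- r j) (trans (solve 3 (λ b a w → b :* w :- a :* w := (b :- a) :* w) refl (ι (toℕ b)) (ι (toℕ a)) ⟦ w j ⟧) (cong (_* ⟦ w j ⟧) (sym ⟦q⟧))) ⟩
          ι q * ⟦ w j ⟧ - r j ∎
          where
          open ≡-Reasoning
          κᵇ = ⟦ κ (toℕ b) j ⟧
          κᵃ = ⟦ κ (toℕ a) j ⟧
        same-cell : ∀ j → (K ℕ.* ρ (toℕ a) j) ℕ./ X ≡ (K ℕ.* ρ (toℕ b) j) ℕ./ X
        same-cell j = trans (sym (F.toℕ-fromℕ< _)) (trans (cong toℕ (trans (sym (F.finToFun-funToFin (cell a) j))
          (trans (cong (λ c → F.finToFun c j) same) (F.finToFun-funToFin (cell b) j)))) (F.toℕ-fromℕ< _))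
        close : ∀ s t → s ℕ./ X ≡ t ℕ./ X → ι s - ι t < ι X
        close s t eq = <-≤-trans (subst₂ (λ p q → p - q < ι X + (ι (t ℕ./ X ℕ.* X) - ι t)) (refl {x = ι s}) refl
            (subst (_< ι X + (ι (t ℕ./ X ℕ.* X) - ι t)) (solve 3 (λ s u t → s :- u :+ (u :- t) := s :- t) refl (ι s) (ι (t ℕ./ X ℕ.* X)) (ι t))
              (+-monoˡ-< (ι (t ℕ./ X ℕ.* X) - ι t) rem<X)))
          (subst (ι X + (ι (t ℕ./ X ℕ.* X) - ι t) ≤_) (+-identityʳ (ι X)) (+-monoʳ-≤ (ι X)
            (subst (ι (t ℕ./ X ℕ.* X) - ι t ≤_) (+-inverseʳ (ι t)) (+-monoˡ-≤ (- ι t) (ι-mono-≤ (ℕ.m/n*n≤m t X))))))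
          where
          s≡ : ι s ≡ ι (s ℕ.% X) + ι (t ℕ./ X ℕ.* X)
          s≡ = trans (cong ι (ℕ.m≡m%n+[m/n]*n s X)) (trans (ι-+ (s ℕ.% X) (s ℕ./ X ℕ.* X)) (cong (λ u → ι (s ℕ.% X) + ι (u ℕ.* X)) eq))
          rem<X : ι s - ι (t ℕ./ X ℕ.* X) < ι X
          rem<X = subst (_< ι X) (sym (trans (cong (_- ι (t ℕ./ X ℕ.* X)) s≡) (solve 2 (λ p q → p :+ q :- q := p) refl (ι (s ℕ.% X)) (ι (t ℕ./ X ℕ.* X))))) (ι-mono-< (ℕ.m%n<n s X))
        K∣r∣≤ : ∀ j → ∣ ι K * r j ∣ ≤ ι X
        K∣r∣≤ j = ∣p∣≤
          (<⇒≤ (subst (_< ι X) (trans (cong₂ _-_ (ι-* K (ρ (toℕ b) j)) (ι-* K (ρ (toℕ a) j))) (solve 3 (λ k b a → k :* b :- k :* a := k :* (b :- a)) refl (ι K) (ι (ρ (toℕ b) j)) (ι (ρ (toℕ a) j))))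
            (close (K ℕ.* ρ (toℕ b) j) (K ℕ.* ρ (toℕ a) j) (sym (same-cell j)))))
          (<⇒≤ (subst (_< ι X) (trans (cong₂ _-_ (ι-* K (ρ (toℕ a) j)) (ι-* K (ρ (toℕ b) j))) (solve 3 (λ k b a → k :* a :- k :* b := :- (k :* (b :- a))) refl (ι K) (ι (ρ (toℕ b) j)) (ι (ρ (toℕ a) j))))
            (close (K ℕ.* ρ (toℕ a) j) (K ℕ.* ρ (toℕ b) j) (same-cell j))))
        2≤K : 2 ℕ.≤ K
        2≤K = ℕ.m≤m*n 2 (d ℕ.* d)
        0<X : 0ℚ < ι X
        0<X = ι-mono-< (ℕ.>-nonZero⁻¹ X)
        -- If `v i` were zero, `r i` would equal `q * w i`, of absolute value at least `X`, whereas
        -- `K ≥ 2` forces `∣r i∣ ≤ X / 2`.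
        v-nonzero : NonZeroVector v
        v-nonzero = i , λ vᵢ≡0 → <-irrefl refl (begin-strict
          ι X                              ≤⟨ subst (_≤ ι q * ι X) (*-identityˡ (ι X)) (*-monoˡ (ι X) (<⇒≤ 0<X) (ι-mono-≤ 0<q)) ⟩
          ι q * ι X                        ≡⟨ cong (λ t → ι q * t) (trans (cong ι (sym ∣wᵢ∣≡X)) (sym (∣⟦⟧∣ (w i)))) ⟩
          ι q * ∣ ⟦ w i ⟧ ∣                ≡⟨ cong (_* ∣ ⟦ w i ⟧ ∣) (sym (0≤p⇒∣p∣≡p (0≤ι q))) ⟩
          ∣ ι q ∣ * ∣ ⟦ w i ⟧ ∣            ≡⟨ sym (∣p*q∣≡∣p∣*∣q∣ (ι q) ⟦ w i ⟧) ⟩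
          ∣ ι q * ⟦ w i ⟧ ∣                ≡⟨ cong ∣_∣ (trans (solve 2 (λ s r → s := s :- r :+ r) refl (ι q * ⟦ w i ⟧) (r i)) (cong (_+ r i) (trans (sym (Xv≡ i)) (trans (cong (λ z → ι X * ⟦ z ⟧) vᵢ≡0) (*-zeroʳ (ι X)))))) ⟩
          ∣ 0ℚ + r i ∣                     ≡⟨ cong ∣_∣ (+-identityˡ (r i)) ⟩
          ∣ r i ∣                          ≤⟨ ∣p∣≤ half₁ half₂ ⟩
          ι X * ½                          <⟨ subst (ι X * ½ <_) (½+½ (ι X)) (<-by (ι X * ½) (*-pos 0<X ½>0) refl) ⟩
          ι X                              ∎)
          where
          open ≤-Reasoning
          twice : ∀ p → ι K * p ≤ ι X → 0ℚ ≤ p → p ≤ ι X * ½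
          twice p h 0≤p = subst (_≤ ι X * ½) (solve 1 (λ p → (con 1ℚ :+ con 1ℚ) :* p :* con ½ := p) refl p)
            (*-monoˡ ½ (<⇒≤ ½>0) (≤-trans (*-monoˡ p 0≤p (ι-mono-≤ 2≤K)) h))
          dichotomy : ∀ p → ι K * p ≤ ι X → p ≤ ι X * ½
          dichotomy p h with ≤-total 0ℚ p
          ... | inj₁ 0≤p = twice p h 0≤p
          ... | inj₂ p≤0 = ≤-trans p≤0 (*-nonNeg (<⇒≤ 0<X) (<⇒≤ ½>0))
          half₁ : r i ≤ ι X * ½
          half₁ = dichotomy (r i) (≤-trans (p≤∣p∣ (ι K * r i)) (K∣r∣≤ i))
          half₂ : - r i ≤ ι X * ½
          half₂ = dichotomy (- r i) (≤-trans (≤-trans (p≤∣p∣ (ι K * - r i)) (≤-reflexive (trans (cong ∣_∣ (sym (neg-distribʳ-* (ι K) (r i)))) (∣-p∣≡∣p∣ (ι K * r i))))) (K∣r∣≤ i))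
        D = ι d
        k = ι K
        x = ι X
        Q = ι q
        k≡ : k ≡ (1ℚ + 1ℚ) * (D * D)
        k≡ = trans (ι-* 2 (d ℕ.* d)) (cong ((1ℚ + 1ℚ) *_) (ι-* d d))
        R = D * m
        0≤R = *-nonNeg (0≤ι d) (<⇒≤ 0<m)
        k²Gr≤ : k * k * quad A r ≤ D * (D * (x * R * x))
        k²Gr≤ = ≤-trans (≤-trans (≤-reflexive (sym (quad-* A k r))) (p≤∣p∣ (quad A (λ i → k * r i))))
          (∣bil∣≤ A (λ i → k * r i) (λ i → k * r i) 0≤R (0≤ι X) (0≤ι X) (entry-bound symA A≥0 diag) K∣r∣≤ K∣r∣≤)
        -- Compares the norm of `X v = q w - r` with `X² m`, after multiplication by `K²` to avoid
        -- denominators.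
        main : k * k * (x * x * m) ≤ k * k * (Q * Q * m + Q * Q * m) + (D * (D * (x * R * x)) + D * (D * (x * R * x)))
        main = begin
          k * k * (x * x * m)
            ≤⟨ *-monoʳ (k * k) (square k) (*-monoʳ (x * x) (square x) (minimum v v-nonzero)) ⟩
          k * k * (x * x * quad A ⟦ v ⟧ᵛ)
            ≡⟨ cong (k * k *_) (sym (quad-* A x ⟦ v ⟧ᵛ)) ⟩
          k * k * quad A (λ j → x * ⟦ v j ⟧)
            ≡⟨ cong (k * k *_) (quad-cong A Xv≡) ⟩
          k * k * quad A (λ j → Q * ⟦ w j ⟧ - r j)
            ≤⟨ *-monoʳ (k * k) (square k) (quad-parallelogram symA A≥0 (λ j → Q * ⟦ w j ⟧) r) ⟩
          k * k * ((quad A (λ j → Q * ⟦ w j ⟧) + quad A (λ j → Q * ⟦ w j ⟧)) + (quad A r + quad A r))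
            ≡⟨ cong (λ t → k * k * ((t + t) + (quad A r + quad A r))) (quad-* A Q ⟦ w ⟧ᵛ) ⟩
          k * k * ((Q * Q * q[ A ] w + Q * Q * q[ A ] w) + (quad A r + quad A r))
            ≤⟨ *-monoʳ (k * k) (square k) (+-monoˡ-≤ (quad A r + quad A r) (+-mono-≤ (*-monoʳ (Q * Q) (square Q) w≤) (*-monoʳ (Q * Q) (square Q) w≤))) ⟩
          k * k * ((Q * Q * m + Q * Q * m) + (quad A r + quad A r))
            ≡⟨ solve 3 (λ k a b → k :* (a :+ (b :+ b)) := k :* a :+ (k :* b :+ k :* b)) refl (k * k) (Q * Q * m + Q * Q * m) (quad A r) ⟩
          k * k * (Q * Q * m + Q * Q * m) + (k * k * quad A r + k * k * quad A r)
            ≤⟨ +-monoʳ-≤ (k * k * (Q * Q * m + Q * Q * m)) (+-mono-≤ k²Gr≤ k²Gr≤) ⟩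
          k * k * (Q * Q * m + Q * Q * m) + (D * (D * (x * R * x)) + D * (D * (x * R * x))) ∎
          where open ≤-Reasoning
        1≤D : 1ℚ ≤ D
        1≤D = ι-mono-≤ {1} {d} (s≤s z≤n)
        D³ = D * D * D
        T = m * (D³ + D³)
        0<D : 0ℚ < D
        0<D = <-≤-trans 1>0 1≤D
        0<T : 0ℚ < T
        0<T = *-pos 0<m (+-mono-< (*-pos (*-pos 0<D 0<D) 0<D) (*-pos (*-pos 0<D 0<D) 0<D))
        -- k² = 4 D⁴ absorbs the error term 2 D³ x² m.
        x²≤ : x * x ≤ (1ℚ + 1ℚ) * Q * ((1ℚ + 1ℚ) * Q)
        x²≤ = *-cancelˡ-≤-pos (T * D) {{positive (*-pos 0<T 0<D)}} (begin
          T * D * (x * x)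
            ≡⟨ solve 3 (λ m d x → m :* (d :* d :* d :+ d :* d :* d) :* d :* (x :* x) := (con 1ℚ :+ con 1ℚ) :* (d :* d) :* ((con 1ℚ :+ con 1ℚ) :* (d :* d)) :* (x :* x :* m) :- m :* (d :* d :* d :+ d :* d :* d) :* d :* (x :* x)) refl m D x ⟩
          (1ℚ + 1ℚ) * (D * D) * ((1ℚ + 1ℚ) * (D * D)) * (x * x * m) - T * D * (x * x)
            ≡⟨ cong (λ t → t * t * (x * x * m) - T * D * (x * x)) (sym k≡) ⟩
          k * k * (x * x * m) - T * D * (x * x)
            ≤⟨ +-mono-≤ main (neg-antimono-≤ absorb) ⟩
          k * k * (Q * Q * m + Q * Q * m) + (D * (D * (x * R * x)) + D * (D * (x * R * x))) - T * (x * x)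
            ≡⟨ cong (λ t → t * t * (Q * Q * m + Q * Q * m) + (D * (D * (x * R * x)) + D * (D * (x * R * x))) - T * (x * x)) k≡ ⟩
          (1ℚ + 1ℚ) * (D * D) * ((1ℚ + 1ℚ) * (D * D)) * (Q * Q * m + Q * Q * m) + (D * (D * (x * R * x)) + D * (D * (x * R * x))) - T * (x * x)
            ≡⟨ solve 4 (λ m d x q → (con 1ℚ :+ con 1ℚ) :* (d :* d) :* ((con 1ℚ :+ con 1ℚ) :* (d :* d)) :* (q :* q :* m :+ q :* q :* m) :+ (d :* (d :* (x :* (d :* m) :* x)) :+ d :* (d :* (x :* (d :* m) :* x))) :- m :* (d :* d :* d :+ d :* d :* d) :* (x :* x)
                 := m :* (d :* d :* d :+ d :* d :* d) :* d :* ((con 1ℚ :+ con 1ℚ) :* q :* ((con 1ℚ :+ con 1ℚ) :* q))) refl m D x Q ⟩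
          T * D * ((1ℚ + 1ℚ) * Q * ((1ℚ + 1ℚ) * Q)) ∎)
          where
          open ≤-Reasoning
          absorb : T * (x * x) ≤ T * D * (x * x)
          absorb = *-monoˡ (x * x) (square x) (subst (_≤ T * D) (*-identityʳ T) (*-monoʳ T (<⇒≤ 0<T) 1≤D))
        X≤2q : X ℕ.≤ 2 ℕ.* q
        X≤2q = ℕ.≮⇒≥ λ 2q<X → ℕ.<-irrefl refl (ℕ.<-≤-trans (ℕ.*-mono-< 2q<X 2q<X)
          (ι-cancel-≤ (subst₂ _≤_ (sym (ι-* X X)) (sym (trans (ι-* (2 ℕ.* q) (2 ℕ.* q)) (cong (λ t → t * t) (ι-* 2 q)))) x²≤)))

    coordinate≤ : ∀ i → ℤ.∣ w i ∣ ℕ.≤ coordinateBound d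
    coordinate≤ i = by-size ℤ.∣ w i ∣ refl
      where
      by-size : ∀ X → ℤ.∣ w i ∣ ≡ X → X ℕ.≤ coordinateBound d
      by-size zero    _  = z≤n
      by-size (suc X) eq = bound-at i (suc X) eq

  -- Classification.

  record Reduced {n} (g : Fin (suc n) → Fin (suc n) → ℤ) : Set where
    field
      good    : Good g
      frame   : MinimalFrame ⟦ g ⟧ᵐ
      μ       : ℕ
      minimum : ∀ v → Min ⟦ g ⟧ᵐ v → q[ ⟦ g ⟧ᵐ ] v ≡ ι μ
      μ≤      : ∀ v → NonZeroVector v → ι μ ≤ q[ ⟦ g ⟧ᵐ ] v
      0<μ     : 0ℚ < ι μ
      diag    : ∀ j → ⟦ g j j ⟧ ≤ ι (suc n) * ι μ

    open Good good public
    vectors = proj₁ frame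
    vectors-min = proj₁ (proj₂ frame)

  good⇒frame : ∀ {n} {g : Fin (suc n) → Fin (suc n) → ℤ} → Good g → MinimalFrame ⟦ g ⟧ᵐ
  good⇒frame {g = g} G = pick (minimalFrame? {A = ⟦ g ⟧ᵐ} (Good.bounded G))
    where
    pick : MinimalFrame ⟦ g ⟧ᵐ ⊎ (¬ Perfect ⟦ g ⟧ᵐ) → MinimalFrame ⟦ g ⟧ᵐ
    pick (inj₁ f)  = f
    pick (inj₂ ¬p) = contradiction (Good.perfect G) ¬p

  rank-one : ∀ {n} (f x : Vec n) → quad (λ i j → f i * f j) x ≡ sum (λ i → f i * x i) * sum (λ i → f i * x i)
  rank-one f x = begin
    sum (λ i → sum λ j → x i * (f i * f j) * x j)
      ≡⟨ sum-cong (λ i → trans (sum-cong λ j → solve 4 (λ x f g y → x :* (f :* g) :* y := f :* x :* (g :* y)) refl (x i) (f i) (f j) (x j)) (sum-* (f i * x i) λ j → f j * x j)) ⟩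
    sum (λ i → f i * x i * sum (λ j → f j * x j))
      ≡⟨ sum-*ʳ (sum λ j → f j * x j) (λ i → f i * x i) ⟩
    sum (λ i → f i * x i) * sum (λ i → f i * x i) ∎
    where open ≡-Reasoning

  -- A functional `f` that kills all frame vectors yields the rank-one matrix `f i * f j`, whose
  -- form vanishes on the frame; its diagonal entries are the squares of the `f i`.
  frame-separating : ∀ {n} {A : Mat n} ((w , _) : MinimalFrame A) → Separating w
  frame-separating (w , mw , sp) f h i = square≡0 (symSpanning⇒unannihilated {v = λ k → ⟦ w k ⟧ᵛ} sp (λ i j → f i * f j) (λ i j → *-comm (f i) (f j))
      (λ k → trans (rank-one f ⟦ w k ⟧ᵛ) (trans (cong (λ t → t * t) (h k)) (*-zeroˡ 0ℚ))) i i)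
    where
    square≡0 : ∀ {p} → p * p ≡ 0ℚ → p ≡ 0ℚ
    square≡0 {p} h with p ≟ 0ℚ
    ... | yes eq = eq
    ... | no ne = recip-cancel ne h

  min-value : ∀ {n} {A : Mat n} {v w} → Min A v → Min A w → q[ A ] v ≡ q[ A ] w
  min-value {v = v} {w} (nv , mv) (nw , mw) = ≤-antisym (mv w nw) (mw v nv)

  q≡ι : ∀ {n} {g : Fin n → Fin n → ℤ} → Bounded ⟦ g ⟧ᵐ → ∀ v → q[ ⟦ g ⟧ᵐ ] v ≡ ι ℤ.∣ bilᶻ g v v ∣
  q≡ι {g = g} B v = trans (sym (⟦bilᶻ⟧ g v v)) (as-ℕ (bilᶻ g v v) (subst (0ℚ ≤_) (sym (⟦bilᶻ⟧ g v v)) (Bounded.quad≥0 B ⟦ v ⟧ᵛ)))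
    where
    as-ℕ : ∀ z → 0ℚ ≤ ⟦ z ⟧ → ⟦ z ⟧ ≡ ι ℤ.∣ z ∣
    as-ℕ (+ k)      _ = refl
    as-ℕ -[1+ k ] h = contradiction (⟦⟧-cancel-≤ {+ 0} { -[1+ k ]} h) λ ()

  reduced : ∀ {n} {g : Fin (suc n) → Fin (suc n) → ℤ} → Good g → Σ[ g₁ ∈ (Fin (suc n) → Fin (suc n) → ℤ) ] Reduced g₁ × Iso ⟦ g₁ ⟧ᵐ ⟦ g ⟧ᵐ
  reduced {n} {g} G = finish (reduce (suc n) A symm bounded (ι μ₀) w w≤ (frame-separating {A = A} frame))
    where
    open Good G
    A = ⟦ g ⟧ᵐ
    frame = good⇒frame {g = g} G
    w = proj₁ frame
    mw = proj₁ (proj₂ frame)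
    k₀ : Fin (suc n ℕ.* suc n)
    k₀ = zero
    μ₀ : ℕ
    μ₀ = ℤ.∣ bilᶻ g (w k₀) (w k₀) ∣
    min≡ : ∀ v → Min A v → q[ A ] v ≡ ι μ₀
    min≡ v mv = trans (min-value {A = A} mv (mw k₀)) (q≡ι {g = g} bounded (w k₀))
    w≤ : ∀ k → q[ A ] (w k) ≤ ι μ₀
    w≤ k = ≤-reflexive (min≡ (w k) (mw k))
    0<μ₀ : 0ℚ < ι μ₀
    0<μ₀ = ≰⇒> λ μ≤0 → let i , ne = proj₁ (mw k₀) in
      ne (⟦⟧-injective {w k₀ i} {+ 0} (quad≡0⇒0 bounded ⟦ w k₀ ⟧ᵛ (subst (_≤ 0ℚ) (sym (min≡ (w k₀) (mw k₀))) μ≤0) i))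
    finish : Σ[ A₁ ∈ Mat (suc n) ] Iso A₁ A × (∀ j → A₁ j j ≤ ι (suc n) * ι μ₀) →
      Σ[ g₁ ∈ (Fin (suc n) → Fin (suc n) → ℤ) ] Reduced g₁ × Iso ⟦ g₁ ⟧ᵐ ⟦ g ⟧ᵐ
    finish (A₁ , (u , u⁻¹ , I) , A₁≤) = g₁ , record
        { good = G₁ ; frame = good⇒frame {g = g₁} G₁ ; μ = μ₀ ; minimum = minimum ; μ≤ = μ≤ ; 0<μ = 0<μ₀
        ; diag = λ j → subst (_≤ ι (suc n) * ι μ₀) (sym (g₁≡ j j)) (A₁≤ j) } , iso₁
      where
      g₁ : Fin (suc n) → Fin (suc n) → ℤ
      g₁ i j = bilᶻ g (u i) (u j)
      g₁≡ : ∀ i j → ⟦ g₁ i j ⟧ ≡ A₁ i j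
      g₁≡ i j = trans (⟦bilᶻ⟧ g (u i) (u j)) (IsIso.preserves I i j)
      iso₁ : Iso ⟦ g₁ ⟧ᵐ A
      iso₁ = iso-trans (iso-≡ {A = ⟦ g₁ ⟧ᵐ} {A₁} (λ i j → sym (g₁≡ i j))) (u , u⁻¹ , I)
      G₁ : Good g₁
      G₁ = good-iso {g = g₁} {g} iso₁ G
      minimum : ∀ v → Min ⟦ g₁ ⟧ᵐ v → q[ ⟦ g₁ ⟧ᵐ ] v ≡ ι μ₀
      minimum v mv = trans (min-value {A = ⟦ g₁ ⟧ᵐ} mv (min-iso iso₁ (w k₀) (mw k₀)))
        (trans (quad-cong ⟦ g₁ ⟧ᵐ (⟦appᶻ⟧ (proj₁ (proj₂ iso₁)) (w k₀)))
          (trans (IsIso.bil-w (proj₂ (proj₂ iso₁)) ⟦ w k₀ ⟧ᵛ ⟦ w k₀ ⟧ᵛ) (min≡ (w k₀) (mw k₀))))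
      μ≤ : ∀ v → NonZeroVector v → ι μ₀ ≤ q[ ⟦ g₁ ⟧ᵐ ] v
      μ≤ v nv = subst (_≤ q[ ⟦ g₁ ⟧ᵐ ] v) (minimum v₁ mv₁) (proj₂ mv₁ v nv)
        where
        v₁ = appᶻ (proj₁ (proj₂ iso₁)) (w k₀)
        mv₁ = min-iso iso₁ (w k₀) (mw k₀)

  -- Since g is determined up to scaling by its minimal vectors, primitivity determines it.
  proportional⇒≡ : ∀ {n} {g g′ : Fin n → Fin n → ℤ} {μ μ′} → Primitive g → Primitive g′ → 0ℚ < ι μ →
    (∀ i j → ι μ′ * ⟦ g i j ⟧ ≡ ι μ * ⟦ g′ i j ⟧) → ∀ i j → g′ i j ≡ g i j
  proportional⇒≡ {g = g} {g′} {μ} {μ′} P P′ 0<μ eq i j = ⟦⟧-injective {g′ i j} {g i j} (*-cancel ⟦ g′ i j ⟧ ⟦ g i j ⟧ (λ μ≡0 → <-irrefl (sym μ≡0) 0<μ)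
    (trans (sym (eq i j)) (cong (λ t → ι t * ⟦ g i j ⟧) μ′≡μ)))
    where
    μ′≡μ : μ′ ≡ μ
    μ′≡μ = trans (sym (ℕ.*-identityʳ μ′)) (trans (cong (μ′ ℕ.*_) (sym (primitive⇒content {g = g} P)))
      (trans (sym (content-* μ′ g)) (trans (content-cong λ i j → ⟦⟧-injective {+ μ′ ℤ.* g i j} {+ μ ℤ.* g′ i j}
          (trans (⟦⟧-* (+ μ′) (g i j)) (trans (eq i j) (sym (⟦⟧-* (+ μ) (g′ i j))))))
        (trans (content-* μ g′) (trans (cong (μ ℕ.*_) (primitive⇒content {g = g′} P′)) (ℕ.*-identityʳ μ))))))

  module _ {n} {g : Fin (suc n) → Fin (suc n) → ℤ} (R : Reduced g) where
    open Reduced R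

    -- The quadratic form takes the single value `μ` on the family, so `μ` factors out and the rest
    -- depends on the vectors alone.
    entries≡ : ∀ {M} {v : Fin M → ℤ^ suc n} ((C , _) : SymSpanning (λ k → ⟦ v k ⟧ᵛ)) → (∀ k → q[ ⟦ g ⟧ᵐ ] (v k) ≡ ι μ) →
      ∀ i j → ⟦ g i j ⟧ ≡ ι μ * sum (C i j)
    entries≡ (C , h) qv i j = trans (h ⟦ g ⟧ᵐ symm i j) (trans (sum-cong λ k → trans (cong (C i j k *_) (qv k)) (*-comm (C i j k) (ι μ))) (sum-* (ι μ) (C i j)))

    vectors≤ : ∀ k i → ℤ.∣ vectors k i ∣ ℕ.≤ coordinateBound (suc n)
    vectors≤ k = Dirichlet.coordinate≤ {A = ⟦ g ⟧ᵐ} symm (Bounded.quad≥0 bounded) {ι μ} 0<μ diag μ≤ (vectors k) (≤-reflexive (minimum (vectors k) (vectors-min k)))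

    entries≤ : ∀ i j → ∣ ⟦ g i j ⟧ ∣ ≤ ι (suc n) * ι μ
    entries≤ = entry-bound {A = ⟦ g ⟧ᵐ} symm (Bounded.quad≥0 bounded) diag

  module _ {n} {g g′ : Fin (suc n) → Fin (suc n) → ℤ} (R : Reduced g) (R′ : Reduced g′) where
    private
      module R = Reduced R
      module R′ = Reduced R′

    same-vectors⇒≡ : (∀ k i → R.vectors k i ≡ R′.vectors k i) → ∀ i j → g′ i j ≡ g i j
    same-vectors⇒≡ h = proportional⇒≡ {g = g} {g′} {R.μ} {R′.μ} R.coprime R′.coprime R.0<μ λ i j → begin
      ι R′.μ * ⟦ g i j ⟧                   ≡⟨ cong (ι R′.μ *_) (entries≡ R {v = R.vectors} sp (λ k → R.minimum (R.vectors k) (R.vectors-min k)) i j) ⟩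
      ι R′.μ * (ι R.μ * sum (C i j))       ≡⟨ solve 3 (λ a b c → a :* (b :* c) := b :* (a :* c)) refl (ι R′.μ) (ι R.μ) (sum (C i j)) ⟩
      ι R.μ * (ι R′.μ * sum (C i j))       ≡⟨ cong (ι R.μ *_) (sym (entries≡ R′ {v = R.vectors} sp (λ k → trans (quad-cong ⟦ g′ ⟧ᵐ (⟦⟧ᵛ-cong (h k))) (R′.minimum (R′.vectors k) (R′.vectors-min k))) i j)) ⟩
      ι R.μ * ⟦ g′ i j ⟧                   ∎
      where
      open ≡-Reasoning
      sp = proj₂ (proj₂ R.frame)
      C = proj₁ sp

  commonDenominator : ∀ {n} (f : Fin n → ℚ) → Σ[ D ∈ ℕ ] 0 ℕ.< D × Σ[ z ∈ (Fin n → ℤ) ] (∀ i → ι D * f i ≡ ⟦ z i ⟧)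
  commonDenominator {zero}  f = 1 , s≤s z≤n , (λ ()) , λ ()
  commonDenominator {suc n} f with commonDenominator (f ∘ suc)
  ... | D , 0<D , z , h = ↧ₙ (f zero) ℕ.* D , ℕ.*-mono-< {0} {↧ₙ (f zero)} {0} {D} (s≤s z≤n) 0<D , z′ , h′
    where
    z′ : Fin (suc n) → ℤ
    z′ = (+ D ℤ.* ↥ f zero) ◂ λ i → + ↧ₙ (f zero) ℤ.* z i
    h′ : ∀ i → ι (↧ₙ (f zero) ℕ.* D) * f i ≡ ⟦ z′ i ⟧
    h′ zero = trans (cong (_* f zero) (ι-* (↧ₙ (f zero)) D)) (trans (solve 3 (λ a d f → a :* d :* f := d :* (f :* a)) refl (ι (↧ₙ (f zero))) (ι D) (f zero))
      (trans (cong (ι D *_) (*-denominator (f zero))) (sym (⟦⟧-* (+ D) (↥ f zero)))))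
    h′ (suc i) = trans (cong (_* f (suc i)) (ι-* (↧ₙ (f zero)) D)) (trans (*-assoc (ι (↧ₙ (f zero))) (ι D) (f (suc i)))
      (trans (cong (ι (↧ₙ (f zero)) *_) (h i)) (sym (⟦⟧-* (+ ↧ₙ (f zero)) (z i)))))

  -- Clear the denominators of `F` by `D` and divide by the content `c`. If a primitive matrix is a
  -- positive multiple `μ F`, comparing contents gives `μ c = D`, so it is this one.
  primitiveMultiple : ∀ {n} (F : Mat n) → Σ[ g ∈ (Fin n → Fin n → ℤ) ]
    (∀ (g′ : Fin n → Fin n → ℤ) μ → 0ℚ < ι μ → Primitive g′ → (∀ i j → ⟦ g′ i j ⟧ ≡ ι μ * F i j) → ∀ i j → g i j ≡ g′ i j)
  primitiveMultiple {n} F = g , unique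
    where
    flat = commonDenominator {n ℕ.* n} λ p → let i , j = F.remQuot {n} n p in F i j
    D = proj₁ flat
    N : Fin n → Fin n → ℤ
    N i j = proj₁ (proj₂ (proj₂ flat)) (F.combine i j)
    N≡ : ∀ i j → ⟦ N i j ⟧ ≡ ι D * F i j
    N≡ i j = trans (sym (proj₂ (proj₂ (proj₂ flat)) (F.combine i j))) (cong (λ (x , y) → ι D * F x y) (F.remQuot-combine {n} {n} i j))
    c = content N
    c∣N : ∀ i j → (+ c) ℤˢ.∣ N i j
    c∣N i j = ℤˢ.∣ᵤ⇒∣ {+ c} {N i j} (content∣ N i j)
    g : Fin n → Fin n → ℤ
    g i j = ℤˢ.quotient (c∣N i j)
    unique : ∀ (g′ : Fin n → Fin n → ℤ) μ → 0ℚ < ι μ → Primitive g′ → (∀ i j → ⟦ g′ i j ⟧ ≡ ι μ * F i j) → ∀ i j → g i j ≡ g′ i j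
    unique g′ μ 0<μ P eq i j = ⟦⟧-injective {g i j} {g′ i j} (*-cancel ⟦ g i j ⟧ ⟦ g′ i j ⟧ D≢0 (begin
      ι D * ⟦ g i j ⟧               ≡⟨ cong (_* ⟦ g i j ⟧) (trans (cong ι (sym μc≡D)) (ι-* μ c)) ⟩
      ι μ * ι c * ⟦ g i j ⟧         ≡⟨ solve 3 (λ m c g → m :* c :* g := m :* (g :* c)) refl (ι μ) (ι c) ⟦ g i j ⟧ ⟩
      ι μ * (⟦ g i j ⟧ * ι c)       ≡⟨ cong (ι μ *_) (trans (sym (⟦⟧-* (g i j) (+ c))) (cong ⟦_⟧ (sym (ℤˢ._∣_.equality (c∣N i j))))) ⟩
      ι μ * ⟦ N i j ⟧               ≡⟨ μN≡ i j ⟩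
      ι D * ⟦ g′ i j ⟧              ∎))
      where
      open ≡-Reasoning
      μN≡ : ∀ i j → ι μ * ⟦ N i j ⟧ ≡ ι D * ⟦ g′ i j ⟧
      μN≡ i j = trans (cong (ι μ *_) (N≡ i j)) (trans (solve 3 (λ m d f → m :* (d :* f) := d :* (m :* f)) refl (ι μ) (ι D) (F i j)) (cong (ι D *_) (sym (eq i j))))
      μc≡D : μ ℕ.* c ≡ D
      μc≡D = trans (sym (content-* μ N)) (trans (content-cong λ i j → ⟦⟧-injective {+ μ ℤ.* N i j} {+ D ℤ.* g′ i j}
          (trans (⟦⟧-* (+ μ) (N i j)) (trans (μN≡ i j) (sym (⟦⟧-* (+ D) (g′ i j))))))
        (trans (content-* D g′) (trans (cong (D ℕ.*_) (primitive⇒content {g = g′} P)) (ℕ.*-identityʳ D))))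
      D≢0 : ι D ≢ 0ℚ
      D≢0 eq = <-irrefl (sym eq) (ι-mono-< (proj₁ (proj₂ flat)))

  module Classification (n : ℕ) where

    private
      d = suc n
      B = coordinateBound d

    Gram : Set
    Gram = Fin d → Fin d → ℤ

    Outcome : (Fin (d ℕ.* d) → ℤ^ d) → Set
    Outcome w = (Σ[ s ∈ (Fin (d ℕ.* d) → Fin (d ℕ.* d)) ] SymSpanning (λ k → ⟦ w (s k) ⟧ᵛ)) ⊎ SymAnnihilated (λ k → ⟦ w k ⟧ᵛ)

    solution : ∀ w → Outcome w → Gram
    solution w (inj₁ (s , C , _)) = proj₁ (primitiveMultiple λ i j → sum (C i j))
    solution w (inj₂ _)           = λ _ _ → + 0

    -- Turns a tuple of vectors into the only Gram matrix that can have it as a frame: normalize the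
    -- common value to 1, solve for the matrix, and take its primitive multiple. A tuple that does
    -- not span gets the zero matrix as default.
    candidate : (Fin (d ℕ.* d) → ℤ^ d) → Gram
    candidate w = solution w (symGauss λ k → ⟦ w k ⟧ᵛ)

    candidate-sound : ∀ {g : Gram} (R : Reduced g) (w : Fin (d ℕ.* d) → ℤ^ d) → (∀ k i → w k i ≡ Reduced.vectors R k i) →
      ∀ i j → candidate w i j ≡ g i j
    candidate-sound {g} R w h = sound (symGauss λ k → ⟦ w k ⟧ᵛ)
      where
      open Reduced R
      sound : ∀ o i j → solution w o i j ≡ g i j
      sound (inj₁ (s , sp)) = proj₂ (primitiveMultiple λ i j → sum (proj₁ sp i j)) g μ 0<μ coprime
        (entries≡ R {v = w ∘ s} sp λ k → trans (quad-cong ⟦ g ⟧ᵐ (⟦⟧ᵛ-cong (h (s k)))) (minimum (vectors (s k)) (vectors-min (s k))))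
      sound (inj₂ (S , symS , (i , j , S≢0) , kill)) = contradiction
        (symSpanning⇒unannihilated {v = λ k → ⟦ vectors k ⟧ᵛ} (proj₂ (proj₂ frame)) S symS
          (λ k → trans (quad-cong S (⟦⟧ᵛ-cong (λ i → sym (h k i)))) (kill k)) i j) S≢0

    Class : Set
    Class = Σ[ g ∈ Gram ] Good g

    _~_ : Class → Class → Set
    (g , _) ~ (g′ , _) = Iso ⟦ g ⟧ᵐ ⟦ g′ ⟧ᵐ

    insert : ∀ g → Dec (Good g) → List Class → List Class
    insert g (yes G) l = (g , G) ∷ l
    insert g (no _)  l = l

    ∈-insert : ∀ {x : Class} g (D : Dec (Good g)) {l} → x ∈ l → x ∈ insert g D l
    ∈-insert g (yes _) x∈ = there x∈
    ∈-insert g (no _)  x∈ = x∈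

    inserted : ∀ g (D : Dec (Good g)) {l} → Good g → ∃[ G ] (g , G) ∈ insert g D l
    inserted g (yes G) _ = G , here refl
    inserted g (no ¬G) G = contradiction G ¬G

    classes : List Gram → List Class
    classes []      = []
    classes (g ∷ l) = insert g (good? g) (classes l)

    ∈-classes : ∀ {g} l → g ∈ l → Good g → ∃[ G ] (g , G) ∈ classes l
    ∈-classes (g ∷ l) (here refl) G = inserted g (good? g) G
    ∈-classes (g ∷ l) (there g∈)  G = let G′ , p = ∈-classes l g∈ G in G′ , ∈-insert g (good? g) p

    Covers : List Class → Set
    Covers l = ∀ x → ∃[ y ] y ∈ l × (y ~ x)

    cover : (ws : List (Fin (d ℕ.* d) → ℤ^ d)) →
      (∀ {g} (R : Reduced g) → ∃[ w ] w ∈ ws × (∀ k i → w k i ≡ Reduced.vectors R k i)) →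
      ∃[ l ] Covers l
    cover ws complete = classes (List.map candidate ws) , λ (g , G) → found (g , G) (reduced {g = g} G)
      where
      found : ∀ ((g , _) : Class) → Σ[ g₁ ∈ Gram ] Reduced g₁ × Iso ⟦ g₁ ⟧ᵐ ⟦ g ⟧ᵐ →
        ∃[ y ] y ∈ classes (List.map candidate ws) × Iso ⟦ proj₁ y ⟧ᵐ ⟦ g ⟧ᵐ
      found (g , G) (g₁ , R , i) =
        let w , w∈ , w≡ = complete R
            same = candidate-sound R w w≡
            i₁ = iso-≡ {A = ⟦ candidate w ⟧ᵐ} {⟦ g₁ ⟧ᵐ} (λ i j → cong ⟦_⟧ (sym (same i j)))
            G′ , p = ∈-classes (List.map candidate ws) (∈.∈-map⁺ candidate w∈) (good-iso {g = candidate w} {g₁} i₁ (Reduced.good R))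
        in (candidate w , G′) , p , iso-trans i₁ i

    record Transversal : Set where
      field
        number      : ℕ
        rep         : Fin number → Class
        distinct    : ∀ {i j} → rep i ~ rep j → i ≡ j
        represented : ∀ x → ∃[ i ] rep i ~ x

    transversal-of : ∃[ l ] Covers l → Transversal
    transversal-of (l , cov) = record
      { number = number ; rep = rep ; distinct = distinct
      ; represented = λ x → let y , y∈ , y~x = cov x ; i , r~y = covers y∈ in i , iso-trans r~y y~x }
      where
      open Classes _~_ iso-sym iso-trans (iso-≡ (λ _ _ → refl)) (λ (g , G) (g′ , G′) → iso? (Good.bounded G) (Good.bounded G′))
      open Representatives (representatives l)

    -- Sealed, so that the enumeration of all tuples is never evaluated; only the recorded
    -- properties of the result are used.
    abstract
      transversal : Transversal
      transversal = transversal-of (cover (functions (cube d B) (d ℕ.* d)) λ R →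
        ∈-functions (λ v v′ → ∀ i → v i ≡ v′ i) (cube d B) (Reduced.vectors R) λ k → ∈-cube (Reduced.vectors R k) (vectors≤ R k))

  -- Codes of reduced Gram matrices.

  precision : ℕ → ℕ
  precision d = d ℕ.* d ℕ.* (coordinateBound d ℕ.* coordinateBound d)

  -- Entries have absolute value at most `d μ`. Scaled by `precision d / μ` and rounded, they lie
  -- between `-L` and `L` for `L = d * precision d`, which leaves `2 L + 1` values.
  gramCodes : ℕ → ℕ
  gramCodes d = suc (2 ℕ.* (d ℕ.* precision d))

  -- One factor for the d² rounded entries, one for the residues modulo 4 of the d coordinates of d²
  -- frame vectors.
  codeBound : ℕ → ℕ
  codeBound d = (gramCodes d ℕ.^ d) ℕ.^ d ℕ.* (4 ℕ.^ d) ℕ.^ (d ℕ.* d)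

  bil-*ᵐ : ∀ {d} (A : Mat d) c x y → bil (λ i j → c * A i j) x y ≡ c * bil A x y
  bil-*ᵐ A c x y = trans (sum-cong λ i → trans (sum-cong λ j → solve 4 (λ c a x y → x :* (c :* a) :* y := c :* (x :* a :* y)) refl c (A i j) (x i) (y j))
      (sum-* c λ j → x i * A i j * y j)) (sum-* c λ i → sum λ j → x i * A i j * y j)

  bil--ᵐ : ∀ {d} (A A′ : Mat d) x y → bil (λ i j → A i j - A′ i j) x y ≡ bil A x y - bil A′ x y
  bil--ᵐ A A′ x y = trans (sum-cong λ i → trans (sum-cong λ j → solve 4 (λ a b x y → x :* (a :- b) :* y := x :* a :* y :- x :* b :* y) refl (A i j) (A′ i j) (x i) (y j))
      (sum-- (λ j → x i * A i j * y j) (λ j → x i * A′ i j * y j))) (sum-- (λ i → sum λ j → x i * A i j * y j) (λ i → sum λ j → x i * A′ i j * y j))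

  funToFin-injective : ∀ {m n} {f f′ : Fin m → Fin n} → F.funToFin f ≡ F.funToFin f′ → ∀ i → f i ≡ f′ i
  funToFin-injective {f = f} {f′} eq i = trans (sym (F.finToFun-funToFin f i)) (trans (cong (λ c → F.finToFun c i) eq) (F.finToFun-funToFin f′ i))

  abs-shift : ∀ {z} {L : ℕ} → ℤ.- + L ℤ.≤ z → + ℤ.∣ z ℤ.+ + L ∣ ≡ z ℤ.+ + L
  abs-shift {z} {L} h = ℤ.0≤i⇒+∣i∣≡i (subst (ℤ._≤ z ℤ.+ + L) (ℤ.+-inverseˡ (+ L)) (ℤ.+-monoˡ-≤ (+ L) h))

  -- The Gram matrix rounded relative to the minimum, and the minimal vectors
  -- modulo 4; the latter are pinned down by the former because two vectors of
  -- norm at most twice the minimum that agree modulo 4 are equal.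
  module Encoding {n} {g : Fin (suc n) → Fin (suc n) → ℤ} (R : Reduced g) where
    open Reduced R

    private
      d = suc n
      N = precision d
      L = d ℕ.* N

    instance μ-nonZero = >-nonZero 0<μ

    μ⁻¹ : ℚ
    μ⁻¹ = 1/ ι μ

    0<μ⁻¹ : 0ℚ < μ⁻¹
    0<μ⁻¹ = positive⁻¹ μ⁻¹ {{1/pos⇒pos (ι μ) {{positive 0<μ}}}}

    scaled : Mat d
    scaled i j = ι N * μ⁻¹ * ⟦ g i j ⟧

    0≤Nμ⁻¹ : 0ℚ ≤ ι N * μ⁻¹
    0≤Nμ⁻¹ = *-nonNeg (0≤ι N) (<⇒≤ 0<μ⁻¹)

    ∣scaled∣≤ : ∀ i j → ∣ scaled i j ∣ ≤ ι L
    ∣scaled∣≤ i j = subst₂ _≤_ (sym (trans (∣p*q∣≡∣p∣*∣q∣ (ι N * μ⁻¹) ⟦ g i j ⟧) (cong (_* ∣ ⟦ g i j ⟧ ∣) (0≤p⇒∣p∣≡p 0≤Nμ⁻¹))))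
      (trans (solve 4 (λ n i d m → n :* i :* (d :* m) := (i :* m) :* (d :* n)) refl (ι N) μ⁻¹ (ι d) (ι μ))
        (trans (cong (_* (ι d * ι N)) (*-inverseˡ (ι μ))) (trans (*-identityˡ (ι d * ι N)) (sym (ι-* d N)))))
      (*-monoʳ (ι N * μ⁻¹) 0≤Nμ⁻¹ (entries≤ R i j))

    rounded : Fin d → Fin d → ℤ
    rounded i j = proj₁ (floor-spec (scaled i j))

    rounded≤ : ∀ i j → ⟦ rounded i j ⟧ ≤ scaled i j
    rounded≤ i j = proj₁ (proj₂ (floor-spec (scaled i j)))

    rounded> : ∀ i j → scaled i j < ⟦ rounded i j ⟧ + 1ℚ
    rounded> i j = proj₂ (proj₂ (floor-spec (scaled i j)))

    -L≤rounded : ∀ i j → ℤ.- + L ℤ.≤ rounded i j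
    -L≤rounded i j = ℤ.≮⇒≥ λ lt → <-irrefl refl (begin-strict
      scaled i j                        <⟨ rounded> i j ⟩
      ⟦ rounded i j ⟧ + 1ℚ              ≡⟨ trans (+-comm ⟦ rounded i j ⟧ 1ℚ) (sym (⟦⟧-+ (+ 1) (rounded i j))) ⟩
      ⟦ ℤ.suc (rounded i j) ⟧           ≤⟨ ⟦⟧-mono-≤ (ℤ.i<j⇒suc[i]≤j lt) ⟩
      ⟦ ℤ.- + L ⟧                       ≡⟨ ⟦⟧-neg (+ L) ⟩
      - ι L                             ≤⟨ neg-antimono-≤ (≤-trans (p≤∣p∣ (- scaled i j)) (subst (_≤ ι L) (sym (∣-p∣≡∣p∣ (scaled i j))) (∣scaled∣≤ i j))) ⟩
      - - scaled i j                    ≡⟨ solve 1 (λ a → :- (:- a) := a) refl (scaled i j) ⟩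
      scaled i j                        ∎)
      where open ≤-Reasoning

    rounded≤L : ∀ i j → rounded i j ℤ.≤ + L
    rounded≤L i j = ⟦⟧-cancel-≤ (≤-trans (rounded≤ i j) (≤-trans (p≤∣p∣ (scaled i j)) (∣scaled∣≤ i j)))

    shifted< : ∀ i j → ℤ.∣ rounded i j ℤ.+ + L ∣ ℕ.< gramCodes d
    shifted< i j = s≤s (ℤ.drop‿+≤+ (subst₂ ℤ._≤_ (sym (abs-shift (-L≤rounded i j))) (cong +_ (cong (L ℕ.+_) (sym (ℕ.+-identityʳ L)))) (ℤ.+-monoˡ-≤ (+ L) (rounded≤L i j))))

    gramCode : Fin d → Fin d → Fin (gramCodes d)
    gramCode i j = F.fromℕ< (shifted< i j)

    residue : Fin (d ℕ.* d) → Fin d → Fin 4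
    residue k i = F.fromℕ< (ℤ.n%ℕd<d (vectors k i) 4)

    code : Fin (codeBound d)
    code = F.combine (F.funToFin λ i → F.funToFin (gramCode i)) (F.funToFin λ k → F.funToFin (residue k))

  module _ {n} {g g′ : Fin (suc n) → Fin (suc n) → ℤ} (R : Reduced g) (R′ : Reduced g′)
    (same : Encoding.code R ≡ Encoding.code R′) where

    private
      d = suc n
      N = precision d
      B = coordinateBound d
      module R = Reduced R
      module R′ = Reduced R′
      module E = Encoding R
      module E′ = Encoding R′

      same-codes = F.combine-injective (F.funToFin λ i → F.funToFin (E.gramCode i)) (F.funToFin λ k → F.funToFin (E.residue k))
        (F.funToFin λ i → F.funToFin (E′.gramCode i)) (F.funToFin λ k → F.funToFin (E′.residue k)) same

      same-rounded : ∀ i j → E.rounded i j ≡ E′.rounded i j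
      same-rounded i j = unshift (E.rounded i j) (E′.rounded i j)
        (trans (sym (abs-shift (E.-L≤rounded i j))) (trans (cong +_ (trans (sym (F.toℕ-fromℕ< (E.shifted< i j)))
          (trans (cong toℕ (funToFin-injective {f = E.gramCode i} {E′.gramCode i} (funToFin-injective {f = λ i → F.funToFin (E.gramCode i)} {λ i → F.funToFin (E′.gramCode i)} (proj₁ same-codes) i) j))
            (F.toℕ-fromℕ< (E′.shifted< i j))))) (abs-shift (E′.-L≤rounded i j))))

        where
        unshift : ∀ a b → a ℤ.+ + (d ℕ.* N) ≡ b ℤ.+ + (d ℕ.* N) → a ≡ b
        unshift a b eq = trans (solveᶻ 2 (λ a l → a ≐ a ⊕ l ⊖ l) refl a (+ (d ℕ.* N)))
          (trans (cong (ℤ._- + (d ℕ.* N)) eq) (solveᶻ 2 (λ b l → b ⊕ l ⊖ l ≐ b) refl b (+ (d ℕ.* N))))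

      same-residue : ∀ k i → R.vectors k i ℤ.%ℕ 4 ≡ R′.vectors k i ℤ.%ℕ 4
      same-residue k i = trans (sym (F.toℕ-fromℕ< (ℤ.n%ℕd<d (R.vectors k i) 4)))
        (trans (cong toℕ (funToFin-injective {f = E.residue k} {E′.residue k} (funToFin-injective {f = λ k → F.funToFin (E.residue k)} {λ k → F.funToFin (E′.residue k)} (proj₂ same-codes) k) i))
          (F.toℕ-fromℕ< (ℤ.n%ℕd<d (R′.vectors k i) 4)))

      close : ∀ i j → ∣ E.scaled i j - E′.scaled i j ∣ ≤ 1ℚ
      close i j = ∣p∣≤ (near (E.rounded> i j) (subst (λ z → ⟦ z ⟧ ≤ E′.scaled i j) (sym (same-rounded i j)) (E′.rounded≤ i j)))
        (subst (_≤ 1ℚ) (solve 2 (λ a b → b :- a := :- (a :- b)) refl (E.scaled i j) (E′.scaled i j))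
          (near (E′.rounded> i j) (subst (λ z → ⟦ z ⟧ ≤ E.scaled i j) (same-rounded i j) (E.rounded≤ i j))))
        where
        near : ∀ {s t z} → s < z + 1ℚ → z ≤ t → s - t ≤ 1ℚ
        near {s} {t} {z} s< z≤ = ≤-trans (+-mono-≤ (<⇒≤ s<) (neg-antimono-≤ z≤)) (≤-reflexive (solve 1 (λ z → z :+ con 1ℚ :- z := con 1ℚ) refl z))

      0<N : 0ℚ < ι N
      0<N = ι-mono-< {0} {N} (ℕ.*-mono-< {0} {d ℕ.* d} {0} {B ℕ.* B} (s≤s z≤n) (ℕ.*-mono-< {0} {B} {0} {B} 0<B 0<B))
        where
        0<B : 0 ℕ.< B
        0<B = ℕ.*-mono-< {0} {2} {0} {gridSize d ℕ.^ d} (s≤s z≤n) (ℕ.m^n>0 (gridSize d) d)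

      -- Scaled entries with the same rounding differ by at most 1 and coordinates are at most `B`,
      -- so the scaled forms differ at `y` by at most `d² B² = N`. Since `N` corresponds to one
      -- minimum, `y` has norm at most two minima of `g`.
      short : ∀ k → q[ ⟦ g ⟧ᵐ ] (R′.vectors k) ≤ ι R.μ + ι R.μ
      short k = *-cancelˡ-≤-pos (ι N * E.μ⁻¹) {{positive (*-pos 0<N E.0<μ⁻¹)}} (begin
        ι N * E.μ⁻¹ * q[ ⟦ g ⟧ᵐ ] y
          ≡⟨ sym (bil-*ᵐ ⟦ g ⟧ᵐ (ι N * E.μ⁻¹) ⟦ y ⟧ᵛ ⟦ y ⟧ᵛ) ⟩
        q[ E.scaled ] y
          ≡⟨ solve 2 (λ a b → a := (a :- b) :+ b) refl (q[ E.scaled ] y) (q[ E′.scaled ] y) ⟩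
        q[ E.scaled ] y - q[ E′.scaled ] y + q[ E′.scaled ] y
          ≡⟨ cong₂ _+_ (sym (bil--ᵐ E.scaled E′.scaled ⟦ y ⟧ᵛ ⟦ y ⟧ᵛ)) (trans (bil-*ᵐ ⟦ g′ ⟧ᵐ (ι N * E′.μ⁻¹) ⟦ y ⟧ᵛ ⟦ y ⟧ᵛ) (cong (ι N * E′.μ⁻¹ *_) (R′.minimum y (R′.vectors-min k)))) ⟩
        q[ (λ i j → E.scaled i j - E′.scaled i j) ] y + ι N * E′.μ⁻¹ * ι R′.μ
          ≤⟨ +-monoˡ-≤ (ι N * E′.μ⁻¹ * ι R′.μ) (≤-trans (p≤∣p∣ (q[ (λ i j → E.scaled i j - E′.scaled i j) ] y))
               (∣bil∣≤ (λ i j → E.scaled i j - E′.scaled i j) ⟦ y ⟧ᵛ ⟦ y ⟧ᵛ (<⇒≤ 1>0) (0≤ι B) (0≤ι B) close y≤ y≤)) ⟩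
        ι d * (ι d * (ι B * 1ℚ * ι B)) + ι N * E′.μ⁻¹ * ι R′.μ
          ≡⟨ cong₂ _+_ (trans (solve 2 (λ d b → d :* (d :* (b :* con 1ℚ :* b)) := (d :* d) :* (b :* b)) refl (ι d) (ι B))
                 (sym (trans (ι-* (d ℕ.* d) (B ℕ.* B)) (cong₂ _*_ (ι-* d d) (ι-* B B)))))
               (trans (*-assoc (ι N) E′.μ⁻¹ (ι R′.μ)) (trans (cong (ι N *_) (*-inverseˡ (ι R′.μ))) (*-identityʳ (ι N)))) ⟩
        ι N + ι N
          ≡⟨ sym (trans (solve 3 (λ n i m → n :* i :* (m :+ m) := n :* (i :* m) :+ n :* (i :* m)) refl (ι N) E.μ⁻¹ (ι R.μ))
               (trans (cong (λ t → ι N * t + ι N * t) (*-inverseˡ (ι R.μ))) (cong₂ _+_ (*-identityʳ (ι N)) (*-identityʳ (ι N))))) ⟩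
        ι N * E.μ⁻¹ * (ι R.μ + ι R.μ) ∎)
        where
        open ≤-Reasoning
        y = R′.vectors k
        y≤ : ∀ i → ∣ ⟦ y i ⟧ ∣ ≤ ι B
        y≤ i = subst (_≤ ι B) (sym (∣⟦⟧∣ (y i))) (ι-mono-≤ (vectors≤ R′ k i))

      same-vectors : ∀ k i → R.vectors k i ≡ R′.vectors k i
      same-vectors k i = equal (u i ℤ.≟ + 0)
        where
        x = R.vectors k
        y = R′.vectors k
        u : ℤ^ d
        u i = (x i ℤ./ℕ 4) ℤ.- (y i ℤ./ℕ 4)
        x-y≡ : ∀ i → x i ℤ.- y i ≡ + 4 ℤ.* u i
        x-y≡ i = trans (cong₂ ℤ._-_ (ℤ.a≡a%ℕn+[a/ℕn]*n (x i) 4) (ℤ.a≡a%ℕn+[a/ℕn]*n (y i) 4))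
          (trans (cong (λ r → + (x i ℤ.%ℕ 4) ℤ.+ (x i ℤ./ℕ 4) ℤ.* + 4 ℤ.- (+ r ℤ.+ (y i ℤ./ℕ 4) ℤ.* + 4)) (sym (same-residue k i)))
            (solveᶻ 3 (λ r a b → r ⊕ a ⊛ conᶻ (+ 4) ⊖ (r ⊕ b ⊛ conᶻ (+ 4)) ≐ conᶻ (+ 4) ⊛ (a ⊖ b)) refl (+ (x i ℤ.%ℕ 4)) (x i ℤ./ℕ 4) (y i ℤ./ℕ 4)))
        m = ι R.μ
        q = quad ⟦ g ⟧ᵐ
        -- A nonzero `u` would give `16 μ ≤ q(4 u) = q(x - y) ≤ 2 μ + 4 μ`.
        u≡0 : ¬ NonZeroVector u
        u≡0 nz = <-irrefl refl (begin-strict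
          ⟦ + 6 ⟧ * m                                  <⟨ *-monoˡ-<-pos m {{positive R.0<μ}} (⟦⟧-mono-< {+ 6} {+ 16} (ℤ.+<+ (s≤s (s≤s (s≤s (s≤s (s≤s (s≤s (s≤s z≤n))))))))) ⟩
          ⟦ + 16 ⟧ * m                                 ≤⟨ *-monoʳ ⟦ + 16 ⟧ (0≤ι 16) (R.μ≤ u nz) ⟩
          ⟦ + 16 ⟧ * q ⟦ u ⟧ᵛ                          ≡⟨ sym (quad-* ⟦ g ⟧ᵐ ⟦ + 4 ⟧ ⟦ u ⟧ᵛ) ⟩
          q (λ i → ⟦ + 4 ⟧ * ⟦ u i ⟧)                  ≡⟨ quad-cong ⟦ g ⟧ᵐ (λ i → trans (sym (⟦⟧-* (+ 4) (u i))) (trans (cong ⟦_⟧ (sym (x-y≡ i))) (⟦⟧-- (x i) (y i)))) ⟩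
          q (λ i → ⟦ x i ⟧ - ⟦ y i ⟧)                  ≤⟨ quad-parallelogram {A = ⟦ g ⟧ᵐ} R.symm (Bounded.quad≥0 R.bounded) ⟦ x ⟧ᵛ ⟦ y ⟧ᵛ ⟩
          (q ⟦ x ⟧ᵛ + q ⟦ x ⟧ᵛ) + (q ⟦ y ⟧ᵛ + q ⟦ y ⟧ᵛ) ≤⟨ +-mono-≤ (≤-reflexive (cong₂ _+_ (R.minimum x (R.vectors-min k)) (R.minimum x (R.vectors-min k)))) (+-mono-≤ (short k) (short k)) ⟩
          (m + m) + ((m + m) + (m + m))                ≡⟨ solve 1 (λ m → (m :+ m) :+ ((m :+ m) :+ (m :+ m)) := con (+ 6 / 1) :* m) refl m ⟩
          ⟦ + 6 ⟧ * m                                  ∎)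
          where open ≤-Reasoning
        equal : Dec (u i ≡ + 0) → x i ≡ y i
        equal (no ne)  = contradiction (i , ne) u≡0
        equal (yes eq) = ℤ.i-j≡0⇒i≡j (x i) (y i) (trans (x-y≡ i) (cong (+ 4 ℤ.*_) eq))

    same-code⇒≡ : ∀ i j → g′ i j ≡ g i j
    same-code⇒≡ = same-vectors⇒≡ R R′ same-vectors

  module _ (n : ℕ) where
    open Classification n
    open Transversal transversal

    -- The code belongs to a chosen reduced form and a chosen frame. Injectivity on one
    -- representative per class suffices: equal codes give equal reduced Gram matrices, hence
    -- isometric lattices.
    number≤codeBound : number ℕ.≤ codeBound (suc n)
    number≤codeBound = F.injective⇒≤ {f = code-of ∘ rep} λ {i} {j} eq → distinct (code-injective (rep i) (rep j) eq)
      where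
      red : ((g , G) : Class) → Σ[ g₁ ∈ Gram ] Reduced g₁ × Iso ⟦ g₁ ⟧ᵐ ⟦ g ⟧ᵐ
      red (g , G) = reduced {g = g} G
      code-of : Class → Fin (codeBound (suc n))
      code-of x = Encoding.code (proj₁ (proj₂ (red x)))
      code-injective : ∀ x y → code-of x ≡ code-of y → x ~ y
      code-injective x y eq = iso-trans (iso-sym (proj₂ (proj₂ (red x)))) (iso-trans
        (iso-≡ {A = ⟦ proj₁ (red x) ⟧ᵐ} {⟦ proj₁ (red y) ⟧ᵐ} (λ i j → cong ⟦_⟧ (same-code⇒≡ (proj₁ (proj₂ (red x))) (proj₁ (proj₂ (red y))) eq i j)))
        (proj₂ (proj₂ (red y))))

    number≥ : ∀ {k} (f : Fin k → Class) → (∀ {i j} → f i ~ f j → i ≡ j) → k ℕ.≤ number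
    number≥ f inj = F.injective⇒≤ {f = λ a → proj₁ (represented (f a))} λ {a} {b} eq →
      inj (iso-trans (iso-sym (proj₂ (represented (f a)))) (subst (λ i → rep i ~ f b) (sym eq) (proj₂ (represented (f b)))))

  -- Exponential and logarithm.

  conv : (ℕ → ℚ) → (ℕ → ℚ) → ℕ → ℚ
  conv s t zero    = s 0 * t 0
  conv s t (suc k) = s 0 * t (suc k) + conv (s ∘ suc) t k

  conv-cong : ∀ {s s′ t t′ : ℕ → ℚ} → (∀ i → s i ≡ s′ i) → (∀ i → t i ≡ t′ i) → ∀ k → conv s t k ≡ conv s′ t′ k
  conv-cong hs ht zero    = cong₂ _*_ (hs 0) (ht 0)
  conv-cong hs ht (suc k) = cong₂ _+_ (cong₂ _*_ (hs 0) (ht (suc k))) (conv-cong (hs ∘ suc) ht k)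

  conv-+ˡ : ∀ (s s′ t : ℕ → ℚ) k → conv (λ i → s i + s′ i) t k ≡ conv s t k + conv s′ t k
  conv-+ˡ s s′ t zero    = *-distribʳ-+ (t 0) (s 0) (s′ 0)
  conv-+ˡ s s′ t (suc k) = trans (cong (λ u → (s 0 + s′ 0) * t (suc k) + u) (conv-+ˡ (s ∘ suc) (s′ ∘ suc) t k))
    (solve 5 (λ a b c d e → (a :+ b) :* c :+ (d :+ e) := (a :* c :+ d) :+ (b :* c :+ e)) refl (s 0) (s′ 0) (t (suc k)) (conv (s ∘ suc) t k) (conv (s′ ∘ suc) t k))

  conv-*ˡ : ∀ x (s t : ℕ → ℚ) k → conv (λ i → x * s i) t k ≡ x * conv s t k
  conv-*ˡ x s t zero    = *-assoc x (s 0) (t 0)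
  conv-*ˡ x s t (suc k) = trans (cong (λ u → x * s 0 * t (suc k) + u) (conv-*ˡ x (s ∘ suc) t k))
    (solve 4 (λ x a b c → x :* a :* b :+ x :* c := x :* (a :* b :+ c)) refl x (s 0) (t (suc k)) (conv (s ∘ suc) t k))

  conv-*ʳ : ∀ x (s t : ℕ → ℚ) k → conv s (λ i → x * t i) k ≡ x * conv s t k
  conv-*ʳ x s t zero    = solve 3 (λ x a b → a :* (x :* b) := x :* (a :* b)) refl x (s 0) (t 0)
  conv-*ʳ x s t (suc k) = trans (cong (λ u → s 0 * (x * t (suc k)) + u) (conv-*ʳ x (s ∘ suc) t k))
    (solve 4 (λ x a b c → a :* (x :* b) :+ x :* c := x :* (a :* b :+ c)) refl x (s 0) (t (suc k)) (conv (s ∘ suc) t k))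

  conv-0ʳ : ∀ (s t : ℕ → ℚ) → t 0 ≡ 0ℚ → ∀ k → conv s t (suc k) ≡ conv s (t ∘ suc) k
  conv-0ʳ s t t₀ zero    = trans (cong (λ u → s 0 * t 1 + s 1 * u) t₀) (solve 2 (λ a b → a :+ b :* con 0ℚ := a) refl (s 0 * t 1) (s 1))
  conv-0ʳ s t t₀ (suc k) = cong (_+_ (s 0 * t (suc (suc k)))) (conv-0ʳ (s ∘ suc) t t₀ k)

  -- Multiplying the `k`-th coefficient by `k` is the derivation `x d/dx` of power series, and this
  -- is its Leibniz rule.
  conv-weight : ∀ (s t : ℕ → ℚ) k → conv (λ i → ι i * s i) t k + conv s (λ j → ι j * t j) k ≡ ι k * conv s t k
  conv-weight s t zero    = solve 2 (λ a b → con 0ℚ :* a :* b :+ a :* (con 0ℚ :* b) := con 0ℚ :* (a :* b)) refl (s 0) (t 0)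
  conv-weight s t (suc k) = begin
    0ℚ * s 0 * t (suc k) + conv (λ i → ι (suc i) * s⁺ i) t k + (s 0 * (ι (suc k) * t (suc k)) + Y)
      ≡⟨ cong (λ u → 0ℚ * s 0 * t (suc k) + u + (s 0 * (ι (suc k) * t (suc k)) + Y))
           (trans (conv-cong {t = t} (λ i → trans (cong (_* s⁺ i) (ι-suc i)) (trans (*-distribʳ-+ (s⁺ i) (ι i) 1ℚ) (cong (_+_ (ι i * s⁺ i)) (*-identityˡ (s⁺ i))))) (λ _ → refl) k)
             (conv-+ˡ (λ i → ι i * s⁺ i) s⁺ t k)) ⟩
    0ℚ * s 0 * t (suc k) + (X + Z) + (s 0 * (ι (suc k) * t (suc k)) + Y)
      ≡⟨ solve 6 (λ a b n x y z → con 0ℚ :* a :* b :+ (x :+ z) :+ (a :* (n :* b) :+ y) := n :* (a :* b) :+ ((x :+ y) :+ z)) refl (s 0) (t (suc k)) (ι (suc k)) X Y Z ⟩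
    ι (suc k) * (s 0 * t (suc k)) + ((X + Y) + Z)
      ≡⟨ cong (λ u → ι (suc k) * (s 0 * t (suc k)) + u) (trans (cong (_+ Z) (conv-weight s⁺ t k))
           (trans (solve 2 (λ n z → n :* z :+ z := (n :+ con 1ℚ) :* z) refl (ι k) Z) (cong (_* Z) (sym (ι-suc k))))) ⟩
    ι (suc k) * (s 0 * t (suc k)) + ι (suc k) * Z
      ≡⟨ sym (*-distribˡ-+ (ι (suc k)) (s 0 * t (suc k)) Z) ⟩
    ι (suc k) * (s 0 * t (suc k) + Z) ∎
    where
    open ≡-Reasoning
    s⁺ = s ∘ suc
    X = conv (λ i → ι i * s⁺ i) t k
    Y = conv s⁺ (λ j → ι j * t j) k
    Z = conv s⁺ t k

  expTerm-suc : ∀ x k → ι (suc k) * expTerm x (suc k) ≡ x * expTerm x k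
  expTerm-suc x k = trans (solve 4 (λ n e x r → n :* (e :* (x :* r)) := (n :* r) :* (x :* e)) refl (ι (suc k)) (expTerm x k) x (recip k))
    (trans (cong (_* (x * expTerm x k)) (ι*recip k)) (*-identityˡ (x * expTerm x k)))

  -- Both sides satisfy `(k + 1) c(k+1) = (x + y) c(k)`. For the Cauchy product this is
  -- `conv-weight`; the binomial theorem is thus obtained without binomial coefficients.
  expTerm-+ : ∀ x y k → conv (expTerm x) (expTerm y) k ≡ expTerm (x + y) k
  expTerm-+ x y zero    = *-identityˡ 1ℚ
  expTerm-+ x y (suc k) = begin
    conv s t (suc k)
      ≡⟨ trans (sym (*-identityˡ (conv s t (suc k)))) (cong (_* conv s t (suc k)) (sym (trans (*-comm (recip k) (ι (suc k))) (ι*recip k)))) ⟩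
    recip k * ι (suc k) * conv s t (suc k)
      ≡⟨ *-assoc (recip k) (ι (suc k)) (conv s t (suc k)) ⟩
    recip k * (ι (suc k) * conv s t (suc k))
      ≡⟨ cong (recip k *_) (sym (conv-weight s t (suc k))) ⟩
    recip k * (conv (λ i → ι i * s i) t (suc k) + conv s (λ j → ι j * t j) (suc k))
      ≡⟨ cong₂ (λ p q → recip k * (p + q)) left right ⟩
    recip k * (x * conv s t k + y * conv s t k)
      ≡⟨ trans (solve 4 (λ r x y c → r :* (x :* c :+ y :* c) := c :* ((x :+ y) :* r)) refl (recip k) x y (conv s t k)) (cong (_* ((x + y) * recip k)) (expTerm-+ x y k)) ⟩
    expTerm (x + y) (suc k) ∎
    where
    open ≡-Reasoning
    s = expTerm x
    t = expTerm y
    left : conv (λ i → ι i * s i) t (suc k) ≡ x * conv s t k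
    left = trans (cong (_+ conv (λ i → ι (suc i) * s (suc i)) t k) (solve 2 (λ a b → con 0ℚ :* a :* b := con 0ℚ) refl (s 0) (t (suc k))))
      (trans (+-identityˡ (conv (λ i → ι (suc i) * s (suc i)) t k)) (trans (conv-cong {t = t} (expTerm-suc x) (λ _ → refl) k) (conv-*ˡ x s t k)))
    right : conv s (λ j → ι j * t j) (suc k) ≡ y * conv s t k
    right = trans (conv-0ʳ s (λ j → ι j * t j) (*-zeroˡ (t 0)) k) (trans (conv-cong {s} {s} (λ _ → refl) (expTerm-suc y) k) (conv-*ʳ y s t k))

  partialSum-cong : ∀ {f f′ : ℕ → ℚ} → (∀ k → f k ≡ f′ k) → ∀ n → partialSum f n ≡ partialSum f′ n
  partialSum-cong h zero    = refl
  partialSum-cong h (suc n) = cong₂ _+_ (partialSum-cong h n) (h n)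

  partialSum-head : ∀ (f : ℕ → ℚ) n → partialSum f (suc n) ≡ f 0 + partialSum (f ∘ suc) n
  partialSum-head f zero    = +-comm 0ℚ (f 0)
  partialSum-head f (suc n) = trans (cong (_+ f (suc n)) (partialSum-head f n)) (+-assoc (f 0) (partialSum (f ∘ suc) n) (f (suc n)))

  partialSum-nonNeg : ∀ {f : ℕ → ℚ} → (∀ k → 0ℚ ≤ f k) → ∀ n → 0ℚ ≤ partialSum f n
  partialSum-nonNeg h zero    = ≤-refl
  partialSum-nonNeg h (suc n) = +-nonNeg (partialSum-nonNeg h n) (h n)

  partialSum-mono : ∀ {f f′ : ℕ → ℚ} n → (∀ k → k ℕ.< n → f k ≤ f′ k) → partialSum f n ≤ partialSum f′ n
  partialSum-mono zero    h = ≤-refl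
  partialSum-mono (suc n) h = +-mono-≤ (partialSum-mono n λ k k<n → h k (ℕ.m<n⇒m<1+n k<n)) (h n ℕ.≤-refl)

  partialSum-extend : ∀ {f : ℕ → ℚ} → (∀ k → 0ℚ ≤ f k) → ∀ {m n} → m ℕ.≤ n → partialSum f m ≤ partialSum f n
  partialSum-extend {f} h {m} {n} m≤n = subst (λ k → partialSum f m ≤ partialSum f k) (ℕ.m∸n+n≡m m≤n) (go (n ℕ.∸ m))
    where
    go : ∀ j → partialSum f m ≤ partialSum f (j ℕ.+ m)
    go zero    = ≤-refl
    go (suc j) = ≤-trans (go j) (≤-by (f (j ℕ.+ m)) (h (j ℕ.+ m)) refl)

  conv-head : ∀ (s t : ℕ → ℚ) n → partialSum (conv s t) (suc n) ≡ s 0 * partialSum t (suc n) + partialSum (conv (s ∘ suc) t) n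
  conv-head s t zero    = solve 2 (λ a b → con 0ℚ :+ a :* b := a :* (con 0ℚ :+ b) :+ con 0ℚ) refl (s 0) (t 0)
  conv-head s t (suc n) = trans (cong (_+ conv s t (suc n)) (conv-head s t n))
    (solve 5 (λ a p u b c → a :* p :+ u :+ (a :* b :+ c) := a :* (p :+ b) :+ (u :+ c)) refl (s 0) (partialSum t (suc n)) (partialSum (conv (s ∘ suc) t) n) (t (suc n)) (conv (s ∘ suc) t n))

  product≤conv : ∀ {s t : ℕ → ℚ} → (∀ k → 0ℚ ≤ s k) → (∀ k → 0ℚ ≤ t k) → ∀ m n → partialSum s m * partialSum t n ≤ partialSum (conv s t) (m ℕ.+ n)
  product≤conv {s} {t} hs ht zero n = subst (_≤ partialSum (conv s t) n) (sym (*-zeroˡ (partialSum t n))) (partialSum-nonNeg (conv-nonNeg s hs) n)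
    where
    conv-nonNeg : ∀ s → (∀ k → 0ℚ ≤ s k) → ∀ k → 0ℚ ≤ conv s t k
    conv-nonNeg s hs zero    = *-nonNeg (hs 0) (ht 0)
    conv-nonNeg s hs (suc k) = +-nonNeg (*-nonNeg (hs 0) (ht (suc k))) (conv-nonNeg (s ∘ suc) (hs ∘ suc) k)
  product≤conv {s} {t} hs ht (suc m) n = subst₂ _≤_
    (sym (trans (cong (_* partialSum t n) (partialSum-head s m)) (*-distribʳ-+ (partialSum t n) (s 0) (partialSum (s ∘ suc) m))))
    (sym (conv-head s t (m ℕ.+ n)))
    (+-mono-≤ (*-monoʳ (s 0) (hs 0) (partialSum-extend ht (ℕ.≤-trans (ℕ.m≤n+m n m) (ℕ.n≤1+n (m ℕ.+ n))))) (product≤conv (hs ∘ suc) ht m n))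

  -- The difference is the sum of the products `s i * t j` with `i < m`, `j < n` and `i + j ≥ m`; it
  -- is dominated term by term by the same sum for the majorants.
  product-conv : ∀ (s t s′ t′ : ℕ → ℚ) → (∀ k → ∣ s k ∣ ≤ s′ k) → (∀ k → ∣ t k ∣ ≤ t′ k) → ∀ {m n} → m ℕ.≤ n →
    ∣ partialSum s m * partialSum t n - partialSum (conv s t) m ∣ ≤ partialSum s′ m * partialSum t′ n - partialSum (conv s′ t′) m
  product-conv s t s′ t′ hs ht {zero} {n} _ = ≤-reflexive (trans (cong ∣_∣ (solve 1 (λ a → con 0ℚ :* a :- con 0ℚ := con 0ℚ) refl (partialSum t n)))
    (solve 1 (λ a → con 0ℚ := con 0ℚ :* a :- con 0ℚ) refl (partialSum t′ n)))
  product-conv s t s′ t′ hs ht {suc m} {n} m<n = begin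
    ∣ partialSum s (suc m) * T n - partialSum (conv s t) (suc m) ∣
      ≡⟨ cong ∣_∣ (split s t) ⟩
    ∣ s 0 * (T n - T (suc m)) + (partialSum (s ∘ suc) m * T n - partialSum (conv (s ∘ suc) t) m) ∣
      ≤⟨ ∣p+q∣≤∣p∣+∣q∣ (s 0 * (T n - T (suc m))) (partialSum (s ∘ suc) m * T n - partialSum (conv (s ∘ suc) t) m) ⟩
    ∣ s 0 * (T n - T (suc m)) ∣ + ∣ partialSum (s ∘ suc) m * T n - partialSum (conv (s ∘ suc) t) m ∣
      ≤⟨ +-mono-≤ (subst (_≤ s′ 0 * (T′ n - T′ (suc m))) (sym (∣p*q∣≡∣p∣*∣q∣ (s 0) (T n - T (suc m)))) (*-mono (0≤∣p∣ (T n - T (suc m))) (≤-trans (0≤∣p∣ (s 0)) (hs 0)) (hs 0) tail))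
           (product-conv (s ∘ suc) t (s′ ∘ suc) t′ (hs ∘ suc) ht {m} {n} (ℕ.<⇒≤ m<n)) ⟩
    s′ 0 * (T′ n - T′ (suc m)) + (partialSum (s′ ∘ suc) m * T′ n - partialSum (conv (s′ ∘ suc) t′) m)
      ≡⟨ sym (split s′ t′) ⟩
    partialSum s′ (suc m) * T′ n - partialSum (conv s′ t′) (suc m) ∎
    where
    open ≤-Reasoning
    T = partialSum t
    T′ = partialSum t′
    split : ∀ (s t : ℕ → ℚ) → partialSum s (suc m) * partialSum t n - partialSum (conv s t) (suc m) ≡
      s 0 * (partialSum t n - partialSum t (suc m)) + (partialSum (s ∘ suc) m * partialSum t n - partialSum (conv (s ∘ suc) t) m)
    split s t = trans (cong₂ (λ p q → p * partialSum t n - q) (partialSum-head s m) (conv-head s t m))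
      (solve 5 (λ a p u v w → (a :+ p) :* u :- (a :* v :+ w) := a :* (u :- v) :+ (p :* u :- w)) refl (s 0) (partialSum (s ∘ suc) m) (partialSum t n) (partialSum t (suc m)) (partialSum (conv (s ∘ suc) t) m))
    tail : ∣ T n - T (suc m) ∣ ≤ T′ n - T′ (suc m)
    tail = subst (λ k → ∣ T k - T (suc m) ∣ ≤ T′ k - T′ (suc m)) (ℕ.m∸n+n≡m m<n) (dominated {t} {t′} ht (n ℕ.∸ suc m) (suc m))

  E : ℕ → ℚ → ℚ
  E n x = partialSum (expTerm x) n

  E-conv : ∀ x y n → partialSum (conv (expTerm x) (expTerm y)) n ≡ E n (x + y)
  E-conv x y = partialSum-cong (expTerm-+ x y)

  E-nonNeg : ∀ {x} n → 0ℚ ≤ x → 0ℚ ≤ E n x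
  E-nonNeg n 0≤x = partialSum-nonNeg (0≤expTerm 0≤x) n

  E-extend : ∀ {x m n} → 0ℚ ≤ x → m ℕ.≤ n → E m x ≤ E n x
  E-extend {x} 0≤x = partialSum-extend {expTerm x} (0≤expTerm 0≤x)

  E-mono : ∀ {x y} n → 0ℚ ≤ x → x ≤ y → E n x ≤ E n y
  E-mono {x} {y} n 0≤x x≤y = partialSum-mono {expTerm x} {expTerm y} n λ k _ → ≤-trans (p≤∣p∣ (expTerm x k))
    (∣expTerm∣≤ (subst (_≤ y) (sym (0≤p⇒∣p∣≡p 0≤x)) x≤y) k)

  1≤E : ∀ {x} n → 0ℚ ≤ x → 1ℚ ≤ E (suc n) x
  1≤E {x} n 0≤x = E-extend {x} {1} {suc n} 0≤x (s≤s z≤n)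

  E-*≤ : ∀ {x y} m n → 0ℚ ≤ x → 0ℚ ≤ y → E m x * E n y ≤ E (m ℕ.+ n) (x + y)
  E-*≤ {x} {y} m n 0≤x 0≤y = subst (E m x * E n y ≤_) (E-conv x y (m ℕ.+ n)) (product≤conv (0≤expTerm 0≤x) (0≤expTerm 0≤y) m n)

  -- The functional equation for truncated series. The error is a piece of the tail of the series at
  -- `X + Y`, uniform in `x` and `y`.
  E-product : ∀ {x y X Y} n → ∣ x ∣ ≤ X → ∣ y ∣ ≤ Y → ∣ E n x * E n y - E n (x + y) ∣ ≤ E (n ℕ.+ n) (X + Y) - E n (X + Y)
  E-product {x} {y} {X} {Y} n hx hy = ≤-trans
    (subst₂ (λ u v → ∣ E n x * E n y - u ∣ ≤ E n X * E n Y - v) (E-conv x y n) (E-conv X Y n)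
      (product-conv (expTerm x) (expTerm y) (expTerm X) (expTerm Y) (∣expTerm∣≤ hx) (∣expTerm∣≤ hy) {n} {n} ℕ.≤-refl))
    (+-monoˡ-≤ (- E n (X + Y)) (E-*≤ n n (≤-trans (0≤∣p∣ x) hx) (≤-trans (0≤∣p∣ y) hy)))

  E-+≤ : ∀ {x y} n → 0ℚ ≤ x → 0ℚ ≤ y → E n (x + y) ≤ E n x * E n y
  E-+≤ {x} {y} n 0≤x 0≤y = subst (_≤ E n x * E n y) (E-conv x y n) (≤-by (E n x * E n y - partialSum (conv (expTerm x) (expTerm y)) n)
    (≤-trans (0≤∣p∣ (E n x * E n y - partialSum (conv (expTerm x) (expTerm y)) n))
      (product-conv (expTerm x) (expTerm y) (expTerm x) (expTerm y) (self 0≤x) (self 0≤y) {n} {n} ℕ.≤-refl))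
    (solve 2 (λ a b → b :+ (a :- b) := a) refl (E n x * E n y) (partialSum (conv (expTerm x) (expTerm y)) n)))
    where
    self : ∀ {z} → 0ℚ ≤ z → ∀ k → ∣ expTerm z k ∣ ≤ expTerm z k
    self 0≤z k = ≤-reflexive (0≤p⇒∣p∣≡p (0≤expTerm 0≤z k))

  0≤^ : ∀ {y} k → 0ℚ ≤ y → 0ℚ ≤ y ^ℚ k
  0≤^ zero    0≤y = <⇒≤ 1>0
  0≤^ (suc k) 0≤y = *-nonNeg (0≤^ k 0≤y) 0≤y

  ^-mono : ∀ {x y} k → 0ℚ ≤ x → x ≤ y → x ^ℚ k ≤ y ^ℚ k
  ^-mono zero    0≤x x≤y = ≤-refl
  ^-mono (suc k) 0≤x x≤y = *-mono 0≤x (0≤^ k (≤-trans 0≤x x≤y)) (^-mono k 0≤x x≤y) x≤y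

  ^-mono-< : ∀ {x y} k → 0ℚ ≤ x → x < y → x ^ℚ suc k < y ^ℚ suc k
  ^-mono-< {x} {y} k 0≤x x<y = ≤-<-trans (*-monoˡ x 0≤x (^-mono k 0≤x (<⇒≤ x<y)))
    (*-monoʳ-<-pos (y ^ℚ k) {{positive (^-pos k)}} x<y)
    where
    ^-pos : ∀ k → 0ℚ < y ^ℚ k
    ^-pos zero    = 1>0
    ^-pos (suc k) = *-pos (^-pos k) (≤-<-trans 0≤x x<y)

  ^-cancel-≤ : ∀ {x y} k → 0ℚ ≤ y → x ^ℚ suc k ≤ y ^ℚ suc k → x ≤ y
  ^-cancel-≤ k 0≤y h = ≮⇒≥ λ y<x → <-irrefl refl (<-≤-trans (^-mono-< k 0≤y y<x) h)

  ι-^ : ∀ m k → ι (m ℕ.^ k) ≡ ι m ^ℚ k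
  ι-^ m zero    = refl
  ι-^ m (suc k) = trans (ι-* m (m ℕ.^ k)) (trans (*-comm (ι m) (ι (m ℕ.^ k))) (cong (_* ι m) (ι-^ m k)))

  -- The additional term serves the case `k = 0`, where the power is 1 but a sum of length zero
  -- would be 0.
  E-^≤ : ∀ {x} k n → 0ℚ ≤ x → E n x ^ℚ k ≤ E (k ℕ.* n ℕ.+ 1) (ι k * x)
  E-^≤ {x} zero    n 0≤x = ≤-reflexive (cong (λ t → 0ℚ + expTerm t 0) (sym (*-zeroˡ x)))
  E-^≤ {x} (suc k) n 0≤x = ≤-trans (*-monoˡ (E n x) (E-nonNeg n 0≤x) (E-^≤ k n 0≤x))
    (≤-trans (E-*≤ (k ℕ.* n ℕ.+ 1) n (*-nonNeg (0≤ι k) 0≤x) 0≤x)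
      (≤-reflexive (cong₂ E (trans (ℕ.+-comm (k ℕ.* n ℕ.+ 1) n) (sym (ℕ.+-assoc n (k ℕ.* n) 1)))
        (trans (solve 2 (λ k x → k :* x :+ x := (k :+ con 1ℚ) :* x) refl (ι k) x) (cong (_* x) (sym (ι-suc k)))))))

  E-*≤^ : ∀ {x} k n → 0ℚ ≤ x → E (suc n) (ι k * x) ≤ E (suc n) x ^ℚ k
  E-*≤^ {x} zero    n 0≤x = ≤-reflexive (trans (cong (E (suc n)) (*-zeroˡ x)) (E-0 n))
    where
    E-0 : ∀ n → E (suc n) 0ℚ ≡ 1ℚ
    E-0 zero    = refl
    E-0 (suc n) = trans (cong (_+_ (E (suc n) 0ℚ)) (solve 2 (λ e r → e :* (con 0ℚ :* r) := con 0ℚ) refl (expTerm 0ℚ n) (recip n)))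
      (trans (+-identityʳ (E (suc n) 0ℚ)) (E-0 n))
  E-*≤^ {x} (suc k) n 0≤x = ≤-trans (≤-reflexive (cong (E (suc n)) (trans (cong (_* x) (ι-suc k)) (solve 2 (λ k x → (k :+ con 1ℚ) :* x := k :* x :+ x) refl (ι k) x))))
    (≤-trans (E-+≤ (suc n) (*-nonNeg (0≤ι k) 0≤x) 0≤x) (*-monoˡ (E (suc n) x) (E-nonNeg (suc n) 0≤x) (E-*≤^ k n 0≤x)))

  expTerm≤^ : ∀ {x} → 0ℚ ≤ x → ∀ k → expTerm x k ≤ x ^ℚ k
  expTerm≤^ {x} 0≤x zero    = ≤-refl
  expTerm≤^ {x} 0≤x (suc k) = *-mono (*-nonNeg 0≤x (<⇒≤ (0<recip k))) (0≤^ k 0≤x) (expTerm≤^ 0≤x k)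
    (subst (x * recip k ≤_) (*-identityʳ x) (*-monoʳ x 0≤x (recip≤1 k)))

  E-geometric : ∀ {x} n → 0ℚ ≤ x → x ≤ 1ℚ → E n x * (1ℚ - x) ≤ 1ℚ
  E-geometric {x} n 0≤x x≤1 = ≤-trans (*-monoˡ (1ℚ - x) (p≤q⇒0≤q-p x≤1) (partialSum-mono {expTerm x} {x ^ℚ_} n λ k _ → expTerm≤^ 0≤x k))
    (subst (_≤ 1ℚ) (sym (telescoped n)) (≤-by (x ^ℚ n) (0≤^ n 0≤x) (p-q+q≡p 1ℚ (x ^ℚ n))))
    where
    telescoped : ∀ n → partialSum (x ^ℚ_) n * (1ℚ - x) ≡ 1ℚ - x ^ℚ n
    telescoped zero    = *-zeroˡ (1ℚ - x)
    telescoped (suc n) = trans (*-distribʳ-+ (1ℚ - x) (partialSum (x ^ℚ_) n) (x ^ℚ n)) (trans (cong (_+ x ^ℚ n * (1ℚ - x)) (telescoped n))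
      (solve 2 (λ p x → con 1ℚ :- p :+ p :* (con 1ℚ :- x) := con 1ℚ :- p :* x) refl (x ^ℚ n) x))

  -- The geometric series bounds `exp ½` by `1 / (1 - ½) = 2`; then square.
  E-1≤4 : ∀ n → E n 1ℚ ≤ ι 4
  E-1≤4 n = ≤-trans (E-+≤ {½} {½} n (<⇒≤ ½>0) (<⇒≤ ½>0)) (*-mono (E-nonNeg n (<⇒≤ ½>0)) (0≤ι 2) half half)
    where
    half : E n ½ ≤ ι 2
    half = subst₂ _≤_ (solve 1 (λ e → con (ι 2) :* (e :* con ½) := e) refl (E n ½)) refl (*-monoʳ (ι 2) (0≤ι 2) (E-geometric {½} n (<⇒≤ ½>0) (≤-by ½ (<⇒≤ ½>0) refl)))

  -- The logarithm compared with harmonic sums, and real powers.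

  H : ℕ → ℚ
  H = partialSum recip

  0≤H : ∀ d → 0ℚ ≤ H d
  0≤H = partialSum-nonNeg λ k → <⇒≤ (0<recip k)

  -- For `k ≥ 2` the geometric series gives `exp (1 / k) ≤ k / (k - 1)`, a telescoping product; the
  -- factor 4 bounds the first term `exp 1`.
  E-H≤ : ∀ n d → E n (H (suc d)) ≤ ι 4 * ι (suc d)
  E-H≤ n zero    = E-1≤4 n
  E-H≤ n (suc d) = ≤-trans (E-+≤ n (0≤H (suc d)) (<⇒≤ (0<recip (suc d))))
    (≤-trans (*-monoˡ (E n r) (E-nonNeg n (<⇒≤ (0<recip (suc d)))) (E-H≤ n d))
      (subst₂ _≤_ lhs rhs (*-monoʳ (ι 4 * ι (suc (suc d))) (*-nonNeg (0≤ι 4) (0≤ι (suc (suc d)))) (E-geometric n (<⇒≤ (0<recip (suc d))) (recip≤1 (suc d))))))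
    where
    r = recip (suc d)
    k = ι (suc d)
    lhs : ι 4 * ι (suc (suc d)) * (E n r * (1ℚ - r)) ≡ ι 4 * k * E n r
    lhs = trans (solve 4 (λ f k e r → f :* k :* (e :* (con 1ℚ :- r)) := f :* (k :- k :* r) :* e) refl (ι 4) (ι (suc (suc d))) (E n r) r)
      (cong (λ t → ι 4 * t * E n r) (trans (cong₂ _-_ (ι-suc (suc d)) (ι*recip (suc d))) (solve 1 (λ k → k :+ con 1ℚ :- con 1ℚ := k) refl k)))
    rhs : ι 4 * ι (suc (suc d)) * 1ℚ ≡ ι 4 * ι (suc (suc d))
    rhs = *-identityʳ (ι 4 * ι (suc (suc d)))

  -- The product of the `1 + 1 / k` telescopes to `d + 1`, and two terms of the series for
  -- `exp (1 / k)` already give `1 + 1 / k`; hence the length `2 d + 1`.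
  ≤E-H : ∀ d → ι (suc d) ≤ E (2 ℕ.* d ℕ.+ 1) (H d)
  ≤E-H zero    = ≤-refl
  ≤E-H (suc d) = subst₂ _≤_ lhs (cong (λ n → E n (H (suc d))) size)
    (≤-trans (*-monoˡ (1ℚ + r) (+-nonNeg (<⇒≤ 1>0) (<⇒≤ (0<recip d))) (≤E-H d))
      (≤-trans (≤-reflexive (cong (E (2 ℕ.* d ℕ.+ 1) (H d) *_) (solve 1 (λ r → con 1ℚ :+ r := con 0ℚ :+ con 1ℚ :+ con 1ℚ :* (r :* con 1ℚ)) refl r)))
        (E-*≤ (2 ℕ.* d ℕ.+ 1) 2 (0≤H d) (<⇒≤ (0<recip d)))))
    where
    r = recip d
    lhs : ι (suc d) * (1ℚ + r) ≡ ι (suc (suc d))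
    lhs = trans (solve 2 (λ k r → k :* (con 1ℚ :+ r) := k :+ k :* r) refl (ι (suc d)) r) (trans (cong (_+_ (ι (suc d))) (ι*recip d)) (sym (ι-suc (suc d))))
    size : 2 ℕ.* d ℕ.+ 1 ℕ.+ 2 ≡ 2 ℕ.* suc d ℕ.+ 1
    size = solveⁿ 1 (λ d → con′ 2 :*′ d :+′ con′ 1 :+′ con′ 2 :=′ con′ 2 :*′ (con′ 1 :+′ d) :+′ con′ 1) refl d
      where open ℕ.+-*-Solver using () renaming (solve to solveⁿ; _:=_ to _:=′_; _:+_ to _:+′_; _:*_ to _:*′_; con to con′)

  2^≤E : ∀ k → ι (2 ℕ.^ k) ≤ E (k ℕ.* 2 ℕ.+ 1) (ι k)
  2^≤E k = subst₂ _≤_ (sym (ι-^ 2 k)) (cong (E (k ℕ.* 2 ℕ.+ 1)) (*-identityʳ (ι k))) (E-^≤ {1ℚ} k 2 (<⇒≤ 1>0))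

  E≤4^ : ∀ n k → E (suc n) (ι k) ≤ ι (4 ℕ.^ k)
  E≤4^ n k = subst₂ _≤_ (cong (E (suc n)) (*-identityʳ (ι k))) (sym (ι-^ 4 k)) (≤-trans (E-*≤^ {1ℚ} k n (<⇒≤ 1>0)) (^-mono k (E-nonNeg (suc n) (<⇒≤ 1>0)) (E-1≤4 (suc n))))

  module LogBounds (c : ℕ) where

    private
      d = suc c
      r = recip c
      y = 1ℚ - r
      0≤r = <⇒≤ (0<recip c)
      0≤y = p≤q⇒0≤q-p (recip≤1 c)
      y≤1 : y ≤ 1ℚ
      y≤1 = ≤-by r 0≤r (p-q+q≡p 1ℚ r)

    L : ℕ → ℚ
    L = partialSum (logTerm y)

    0≤logTerm : ∀ k → 0ℚ ≤ logTerm y k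
    0≤logTerm k = *-nonNeg (0≤^ (suc k) 0≤y) (<⇒≤ (0<recip k))

    0≤L : ∀ n → 0ℚ ≤ L n
    0≤L = partialSum-nonNeg 0≤logTerm

    private
      ^≤1 : ∀ k → y ^ℚ k ≤ 1ℚ
      ^≤1 zero    = ≤-refl
      ^≤1 (suc k) = *-mono {q = 1ℚ} {s = 1ℚ} 0≤y (<⇒≤ 1>0) (^≤1 k) y≤1

      L≤H : L d ≤ H d
      L≤H = partialSum-mono {logTerm y} {recip} d λ k _ → subst (logTerm y k ≤_) (*-identityˡ (recip k)) (*-monoˡ (recip k) (<⇒≤ (0<recip k)) (^≤1 (suc k)))

      recip-mono : ∀ j k → recip (j ℕ.+ k) ≤ recip k
      recip-mono zero    k = ≤-refl
      recip-mono (suc j) k = ≤-trans (recip-anti (j ℕ.+ k)) (recip-mono j k)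

      -- Beyond index `d` the denominators exceed `d`, so a term is at most `y ^ (k + 1) / d`, which
      -- equals `y ^ (k + 1) - y ^ (k + 2)` because `1 / d = 1 - y`. The tail telescopes.
      tail : ∀ j → L (j ℕ.+ d) + y ^ℚ suc (j ℕ.+ d) ≤ H d + y ^ℚ suc d
      tail zero    = +-monoˡ-≤ (y ^ℚ suc d) L≤H
      tail (suc j) = ≤-trans (≤-by (Y * r - Y * recip k) (p≤q⇒0≤q-p (*-monoʳ Y (0≤^ (suc k) 0≤y) (subst (λ m → recip m ≤ r) (sym (ℕ.+-suc j c)) (recip-mono (suc j) c))))
          (solve 4 (λ l y r s → l :+ y :* s :+ y :* (con 1ℚ :- r) :+ (y :* r :- y :* s) := l :+ y) refl (L k) Y r (recip k))) (tail j)
        where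
        k = j ℕ.+ d
        Y = y ^ℚ suc k

    L≤H+1 : ∀ n → L n ≤ H d + 1ℚ
    L≤H+1 n = ≤-trans (partialSum-extend 0≤logTerm (ℕ.m≤m+n n d)) (≤-trans (≤-by (y ^ℚ suc (n ℕ.+ d)) (0≤^ (suc (n ℕ.+ d)) 0≤y) refl)
      (≤-trans (tail n) (+-monoʳ-≤ (H d) (^≤1 (suc d)))))

    private
      bernoulli : ∀ k → 1ℚ - ι k * r ≤ y ^ℚ k
      bernoulli zero    = ≤-reflexive (solve 1 (λ r → con 1ℚ :- con 0ℚ :* r := con 1ℚ) refl r)
      bernoulli (suc k) = ≤-trans (≤-by (ι k * r * r) (*-nonNeg (*-nonNeg (0≤ι k) 0≤r) 0≤r)
          (trans (cong (λ t → 1ℚ - t * r + ι k * r * r) (ι-suc k)) (solve 2 (λ k r → con 1ℚ :- (k :+ con 1ℚ) :* r :+ k :* r :* r := (con 1ℚ :- k :* r) :* (con 1ℚ :- r)) refl (ι k) r)))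
        (*-monoˡ y 0≤y (bernoulli k))

      term≥ : ∀ k → recip k - r ≤ logTerm y k
      term≥ k = subst (_≤ logTerm y k)
        (trans (solve 3 (λ k r s → (con 1ℚ :- k :* r) :* s := s :- (k :* s) :* r) refl (ι (suc k)) r (recip k))
          (cong (λ t → recip k - t) (trans (cong (_* r) (ι*recip k)) (*-identityˡ r))))
        (*-monoˡ (recip k) (<⇒≤ (0<recip k)) (bernoulli (suc k)))

      -- By Bernoulli's inequality each term falls short of the harmonic one by at most `1 / d`;
      -- over the first `d` terms the loss is 1.
      sum≥ : ∀ n → H n - ι n * r ≤ L n
      sum≥ zero    = ≤-reflexive (solve 1 (λ r → con 0ℚ :- con 0ℚ :* r := con 0ℚ) refl r)
      sum≥ (suc n) = subst (_≤ L (suc n)) (trans (solve 4 (λ h s k r → h :- k :* r :+ (s :- r) := h :+ s :- (k :+ con 1ℚ) :* r) refl (H n) (recip n) (ι n) r)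
        (cong (λ t → H (suc n) - t * r) (sym (ι-suc n)))) (+-mono-≤ (sum≥ n) (term≥ n))

    H-1≤L : ∀ {n} → d ℕ.≤ n → H d - 1ℚ ≤ L n
    H-1≤L d≤n = ≤-trans (subst (λ t → H d - t ≤ L d) (ι*recip c) (sum≥ d)) (partialSum-extend 0≤logTerm d≤n)

  -- Monotonicity of truncated exponentials is available only for nonnegative arguments, and `x n`
  -- may be negative. Instead `E (x n)` is multiplied by `E (V - x n) ≥ 1`, and the product is close
  -- to `E V`; the summand 1 absorbs the error for large `n`.
  cauchy-≤ : ∀ (x : ℕ → ℚ) V → IsCauchy x → 0ℚ ≤ V → (∃[ N ] (∀ n → N ℕ.≤ n → x n ≤ V)) →
    ∃[ N ] (∀ n → N ℕ.≤ n → E (suc n) (x n) ≤ E (suc n) V + 1ℚ)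
  cauchy-≤ x V cx 0≤V (N₁ , x≤V) =
    let B , N₂ , ∣x∣≤ = cauchy-bounded {x} cx
        M , Z≤M = archimedean (ι (suc B) + (V + ι (suc B)))
        N₃ , tail = ExpBound.cauchy M {expTerm (ι (suc B) + (V + ι (suc B)))} (∣expTerm∣≤ Z≤M) 1ℚ 1>0
    in N₁ ℕ.⊔ (N₂ ℕ.⊔ N₃) , Bound.bound (ι (suc B)) N₂ ∣x∣≤ N₃ tail
    where
    module Bound (X : ℚ) (N₂ : ℕ) (∣x∣≤ : ∀ n → N₂ ℕ.≤ n → ∣ x n ∣ ≤ X) (N₃ : ℕ)
      (tail : ∀ m n → N₃ ℕ.≤ m → N₃ ℕ.≤ n → ∣ E m (X + (V + X)) - E n (X + (V + X)) ∣ < 1ℚ) where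
     Y = V + X
     Z = X + Y
     bound : ∀ n → N₁ ℕ.⊔ (N₂ ℕ.⊔ N₃) ℕ.≤ n → E (suc n) (x n) ≤ E (suc n) V + 1ℚ
     bound n N≤n = by-sign (≤-total 0ℚ (E (suc n) (x n)))
      where
      open ≤-Reasoning
      u = V - x n
      N₂₃≤n = ℕ.m⊔n≤o⇒n≤o N₁ (N₂ ℕ.⊔ N₃) N≤n
      N₂≤n = ℕ.m⊔n≤o⇒m≤o N₂ N₃ N₂₃≤n
      N₃≤n = ℕ.m⊔n≤o⇒n≤o N₂ N₃ N₂₃≤n
      0≤u = p≤q⇒0≤q-p (x≤V n (ℕ.m⊔n≤o⇒m≤o N₁ (N₂ ℕ.⊔ N₃) N≤n))
      ∣u∣≤ : ∣ u ∣ ≤ Y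
      ∣u∣≤ = ≤-trans (∣p-q∣≤∣p∣+∣q∣ V (x n)) (+-mono-≤ (≤-reflexive (0≤p⇒∣p∣≡p 0≤V)) (∣x∣≤ n N₂≤n))
      by-sign : 0ℚ ≤ E (suc n) (x n) ⊎ E (suc n) (x n) ≤ 0ℚ → E (suc n) (x n) ≤ E (suc n) V + 1ℚ
      by-sign (inj₂ E≤0) = ≤-trans E≤0 (+-nonNeg (E-nonNeg (suc n) 0≤V) (<⇒≤ 1>0))
      by-sign (inj₁ 0≤E) = begin
        E (suc n) (x n)
          ≤⟨ subst (_≤ E (suc n) (x n) * E (suc n) u) (*-identityʳ (E (suc n) (x n))) (*-monoʳ (E (suc n) (x n)) 0≤E (1≤E n 0≤u)) ⟩
        E (suc n) (x n) * E (suc n) u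
          ≡⟨ solve 2 (λ a b → a := b :+ (a :- b)) refl (E (suc n) (x n) * E (suc n) u) (E (suc n) (x n + u)) ⟩
        E (suc n) (x n + u) + (E (suc n) (x n) * E (suc n) u - E (suc n) (x n + u))
          ≤⟨ +-mono-≤ (≤-reflexive (cong (E (suc n)) (solve 2 (λ x v → x :+ (v :- x) := v) refl (x n) V)))
               (≤-trans (p≤∣p∣ (E (suc n) (x n) * E (suc n) u - E (suc n) (x n + u))) (≤-trans (E-product (suc n) (∣x∣≤ n N₂≤n) ∣u∣≤)
                 (≤-trans (p≤∣p∣ (E (suc n ℕ.+ suc n) Z - E (suc n) Z)) (<⇒≤ (tail (suc n ℕ.+ suc n) (suc n) (ℕ.≤-trans N₃≤n (ℕ.≤-trans (ℕ.n≤1+n n) (ℕ.m≤m+n (suc n) (suc n)))) (ℕ.≤-trans N₃≤n (ℕ.n≤1+n n))))))) ⟩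
        E (suc n) V + 1ℚ ∎

  recip≤ : ∀ δ → 0ℚ < δ → ∃[ b ] recip b ≤ δ
  recip≤ δ 0<δ = let j , 1<jδ = archimedean-< 1ℚ 0<δ in j , subst₂ _≤_ (*-identityʳ (recip j))
    (trans (sym (*-assoc (recip j) (ι (suc j)) δ)) (trans (cong (_* δ) (trans (*-comm (recip j) (ι (suc j))) (ι*recip j))) (*-identityˡ δ)))
    (*-monoʳ (recip j) (<⇒≤ (0<recip j)) (≤-trans (<⇒≤ 1<jδ) (*-monoˡ δ (<⇒≤ 0<δ) (ι-mono 1 j))))

  ^-*-distrib : ∀ x y k → (x * y) ^ℚ k ≡ x ^ℚ k * y ^ℚ k
  ^-*-distrib x y zero    = sym (*-identityˡ 1ℚ)
  ^-*-distrib x y (suc k) = trans (cong (_* (x * y)) (^-*-distrib x y k)) (solve 4 (λ a b x y → a :* b :* (x :* y) := a :* x :* (b :* y)) refl (x ^ℚ k) (y ^ℚ k) x y)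

  module _ (ε : ℝ) (b : ℕ) (N₀ : ℕ) (ε≥ : ∀ n → N₀ ℕ.≤ n → recip b ≤ seq ε n) where

    -- Reduction to natural numbers. As `exp (H d + 1) ≤ 16 d`, the first hypothesis makes `W` an
    -- upper bound for `exp ((1 - 1/(b+1)) (H d + 1))`. The unit in `W + 1` and one of the two in
    -- `2 + 4 ^ (W + 1)` absorb the errors of the two uses of `cauchy-≤`; the last gives the strict
    -- inequality.
    exp-power<-by : ∀ c W p → (16 ℕ.* suc c) ℕ.^ b ℕ.≤ W ℕ.^ suc b → 2 ℕ.+ 4 ℕ.^ (W ℕ.+ 1) ℕ.≤ p →
      exp (suc c ^ᴿ (fromℕ 1 -ᴿ ε)) <ᴿ fromℕ p
    exp-power<-by c W p hW hp = step (cauchy-≤ x V (cauchy (s *ᴿ log d)) 0≤V (N₀ , x≤V))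
      where
      open LogBounds c
      d = suc c
      s = fromℕ 1 -ᴿ ε
      Λ = H d + 1ℚ
      0≤Λ = +-nonNeg (0≤H d) (<⇒≤ 1>0)
      σ = 1ℚ - recip b
      0≤σ = p≤q⇒0≤q-p (recip≤1 b)
      V = σ * Λ
      0≤V = *-nonNeg 0≤σ 0≤Λ
      x : ℕ → ℚ
      x n = seq s n * L n
      x≤V : ∀ n → N₀ ℕ.≤ n → x n ≤ V
      x≤V n N≤n = *-mono (0≤L n) 0≤σ (+-monoʳ-≤ 1ℚ (neg-antimono-≤ (ε≥ n N≤n))) (L≤H+1 n)
      βV≡ : ι (suc b) * V ≡ ι b * Λ
      βV≡ = trans (solve 3 (λ k r l → k :* ((con 1ℚ :- r) :* l) := (k :- k :* r) :* l) refl (ι (suc b)) (recip b) Λ)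
        (cong (_* Λ) (trans (cong₂ _-_ (ι-suc b) (ι*recip b)) (solve 1 (λ b → b :+ con 1ℚ :- con 1ℚ := b) refl (ι b))))
      EΛ≤ : ∀ N → E N Λ ≤ ι (16 ℕ.* d)
      EΛ≤ N = ≤-trans (E-+≤ N (0≤H d) (<⇒≤ 1>0)) (subst (E N (H d) * E N 1ℚ ≤_) (trans (solve 1 (λ d → con (ι 4) :* d :* con (ι 4) := con (ι 16) :* d) refl (ι d)) (sym (ι-* 16 d)))
        (*-mono (E-nonNeg N (<⇒≤ 1>0)) (*-nonNeg (0≤ι 4) (0≤ι d)) (E-H≤ N c) (E-1≤4 N)))
      EV≤W : ∀ n → E (suc n) V ≤ ι W
      EV≤W n = ^-cancel-≤ b (0≤ι W) (begin
        E (suc n) V ^ℚ suc b                              ≤⟨ E-^≤ (suc b) (suc n) 0≤V ⟩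
        E (suc b ℕ.* suc n ℕ.+ 1) (ι (suc b) * V)         ≡⟨ cong₂ E (ℕ.+-comm (suc b ℕ.* suc n) 1) βV≡ ⟩
        E (suc (suc b ℕ.* suc n)) (ι b * Λ)               ≤⟨ E-*≤^ b (suc b ℕ.* suc n) 0≤Λ ⟩
        E (suc (suc b ℕ.* suc n)) Λ ^ℚ b                  ≤⟨ ^-mono b (E-nonNeg (suc (suc b ℕ.* suc n)) 0≤Λ) (EΛ≤ (suc (suc b ℕ.* suc n))) ⟩
        ι (16 ℕ.* d) ^ℚ b                                 ≡⟨ sym (ι-^ (16 ℕ.* d) b) ⟩
        ι ((16 ℕ.* d) ℕ.^ b)                              ≤⟨ ι-mono-≤ hW ⟩
        ι (W ℕ.^ suc b)                                   ≡⟨ ι-^ W (suc b) ⟩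
        ι W ^ℚ suc b                                      ∎)
        where open ≤-Reasoning
      v : ℕ → ℚ
      v n = E (suc n) (x n)
      large : ∀ n → E (suc n) (v n) ≤ E (suc n) (ι (W ℕ.+ 1)) + 1ℚ → ½ < ι p - E (suc n) (v n)
      large n h = <-≤-trans (<-by ½ ½>0 refl) (subst (_≤ ι p - E (suc n) (v n)) (solve 1 (λ q → (con (ι 2) :+ q) :- (q :+ con 1ℚ) := con 1ℚ) refl (ι (4 ℕ.^ (W ℕ.+ 1))))
        (+-mono-≤ (subst (_≤ ι p) (ι-+ 2 (4 ℕ.^ (W ℕ.+ 1))) (ι-mono-≤ hp)) (neg-antimono-≤ (≤-trans h (+-monoˡ-≤ 1ℚ (E≤4^ n (W ℕ.+ 1)))))))
      conclude : ∃[ N ] (∀ n → N ℕ.≤ n → E (suc n) (v n) ≤ E (suc n) (ι (W ℕ.+ 1)) + 1ℚ) → exp (d ^ᴿ s) <ᴿ fromℕ p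
      conclude (N , outer) = ½ , ½>0 , N , λ n N≤n → large n (outer n N≤n)
      step : ∃[ N ] (∀ n → N ℕ.≤ n → v n ≤ E (suc n) V + 1ℚ) → exp (d ^ᴿ s) <ᴿ fromℕ p
      step (N , inner) = conclude (cauchy-≤ v (ι (W ℕ.+ 1)) (cauchy (d ^ᴿ s)) (0≤ι (W ℕ.+ 1)) (N , λ n N≤n →
        ≤-trans (inner n N≤n) (subst (E (suc n) V + 1ℚ ≤_) (sym (ι-+ W 1)) (+-monoˡ-≤ 1ℚ (EV≤W n)))))

    -- `γ` is `3 + 1/(b+1)` times `b + 1`. The factor `4 ^ γ` pays for `d + 1 ≤ 4 exp (H d - 1)`,
    -- where `H d - 1` is the lower bound for `log d`; thus `T` is at most the inner power, and
    -- `2 ^ T ≤ exp T`.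
    <exp-power-by : ∀ c T p → let γ = 3 ℕ.* suc b ℕ.+ 1 in 4 ℕ.^ γ ℕ.* T ℕ.^ suc b ℕ.≤ suc (suc c) ℕ.^ γ → 1 ℕ.+ p ℕ.≤ 2 ℕ.^ T →
      fromℕ p <ᴿ exp (suc c ^ᴿ (fromℕ 3 +ᴿ ε))
    <exp-power-by c T p hT hp = ½ , ½>0 , N , large
      where
      open LogBounds c
      d = suc c
      γ = 3 ℕ.* suc b ℕ.+ 1
      s = fromℕ 3 +ᴿ ε
      Λ = H d - 1ℚ
      0≤Λ : 0ℚ ≤ Λ
      0≤Λ = p≤q⇒0≤q-p (partialSum-extend {recip} (λ k → <⇒≤ (0<recip k)) {1} {d} (s≤s z≤n))
      σ = ι 3 + recip b
      0≤σ = +-nonNeg (0≤ι 3) (<⇒≤ (0<recip b))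
      V = σ * Λ
      0≤V = *-nonNeg 0≤σ 0≤Λ
      n′ = 2 ℕ.* d ℕ.+ 1
      N = N₀ ℕ.⊔ (d ℕ.⊔ ((γ ℕ.* n′) ℕ.⊔ (T ℕ.* 2)))
      x : ℕ → ℚ
      x n = seq s n * L n
      γΛ≡ : ι (suc b) * V ≡ ι γ * Λ
      γΛ≡ = trans (solve 3 (λ k r l → k :* ((con (ι 3) :+ r) :* l) := (con (ι 3) :* k :+ k :* r) :* l) refl (ι (suc b)) (recip b) Λ)
        (cong (_* Λ) (trans (cong (λ t → ι 3 * ι (suc b) + t) (ι*recip b)) (sym (trans (ι-+ (3 ℕ.* suc b) 1) (cong (_+ 1ℚ) (ι-* 3 (suc b)))))))
      d+1≤ : ι (suc d) ≤ ι 4 * E n′ Λ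
      d+1≤ = ≤-trans (≤E-H d) (≤-trans (≤-reflexive (cong (E n′) (solve 1 (λ h → h := (h :- con 1ℚ) :+ con 1ℚ) refl (H d))))
        (≤-trans (E-+≤ n′ 0≤Λ (<⇒≤ 1>0)) (subst (E n′ Λ * E n′ 1ℚ ≤_) (*-comm (E n′ Λ) (ι 4)) (*-monoʳ (E n′ Λ) (E-nonNeg n′ 0≤Λ) (E-1≤4 n′)))))
      T≤EV : ∀ n → γ ℕ.* n′ ℕ.≤ n → ι T ≤ E (suc n) V
      T≤EV n h = ^-cancel-≤ b (E-nonNeg (suc n) 0≤V) (*-cancelˡ-≤-pos (ι (4 ℕ.^ γ)) {{positive (ι-mono-< {0} {4 ℕ.^ γ} (ℕ.m^n>0 4 γ))}} (begin
        ι (4 ℕ.^ γ) * ι T ^ℚ suc b                  ≡⟨ trans (cong (ι (4 ℕ.^ γ) *_) (sym (ι-^ T (suc b)))) (sym (ι-* (4 ℕ.^ γ) (T ℕ.^ suc b))) ⟩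
        ι (4 ℕ.^ γ ℕ.* T ℕ.^ suc b)                 ≤⟨ ι-mono-≤ hT ⟩
        ι (suc d ℕ.^ γ)                             ≡⟨ ι-^ (suc d) γ ⟩
        ι (suc d) ^ℚ γ                              ≤⟨ ^-mono γ (0≤ι (suc d)) d+1≤ ⟩
        (ι 4 * E n′ Λ) ^ℚ γ                         ≡⟨ trans (^-*-distrib (ι 4) (E n′ Λ) γ) (cong (_* E n′ Λ ^ℚ γ) (sym (ι-^ 4 γ))) ⟩
        ι (4 ℕ.^ γ) * E n′ Λ ^ℚ γ                   ≤⟨ *-monoʳ (ι (4 ℕ.^ γ)) (0≤ι (4 ℕ.^ γ)) (begin
          E n′ Λ ^ℚ γ                                 ≤⟨ E-^≤ γ n′ 0≤Λ ⟩
          E (γ ℕ.* n′ ℕ.+ 1) (ι γ * Λ)                ≤⟨ E-extend (*-nonNeg (0≤ι γ) 0≤Λ) (subst (ℕ._≤ suc n) (ℕ.+-comm 1 (γ ℕ.* n′)) (s≤s h)) ⟩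
          E (suc n) (ι γ * Λ)                         ≡⟨ cong (E (suc n)) (sym γΛ≡) ⟩
          E (suc n) (ι (suc b) * V)                   ≤⟨ E-*≤^ (suc b) n 0≤V ⟩
          E (suc n) V ^ℚ suc b                        ∎) ⟩
        ι (4 ℕ.^ γ) * E (suc n) V ^ℚ suc b          ∎))
        where open ≤-Reasoning
      large : ∀ n → N ℕ.≤ n → ½ < E (suc n) (E (suc n) (x n)) - ι p
      large n N≤n = <-≤-trans (<-by ½ ½>0 refl) (subst (_≤ E (suc n) (E (suc n) (x n)) - ι p) (solve 1 (λ p → (con 1ℚ :+ p) :- p := con 1ℚ) refl (ι p))
        (+-monoˡ-≤ (- ι p) (begin
          1ℚ + ι p                       ≡⟨ sym (ι-+ 1 p) ⟩
          ι (1 ℕ.+ p)                    ≤⟨ ι-mono-≤ hp ⟩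
          ι (2 ℕ.^ T)                    ≤⟨ 2^≤E T ⟩
          E (T ℕ.* 2 ℕ.+ 1) (ι T)        ≤⟨ E-extend (0≤ι T) (subst (ℕ._≤ suc n) (ℕ.+-comm 1 (T ℕ.* 2)) (s≤s T2≤n)) ⟩
          E (suc n) (ι T)                ≤⟨ E-mono (suc n) (0≤ι T) (≤-trans (T≤EV n γn′≤n) (E-mono (suc n) 0≤V V≤x)) ⟩
          E (suc n) (E (suc n) (x n))    ∎)))
        where
        open ≤-Reasoning
        N₀≤n = ℕ.m⊔n≤o⇒m≤o N₀ (d ℕ.⊔ ((γ ℕ.* n′) ℕ.⊔ (T ℕ.* 2))) N≤n
        rest = ℕ.m⊔n≤o⇒n≤o N₀ (d ℕ.⊔ ((γ ℕ.* n′) ℕ.⊔ (T ℕ.* 2))) N≤n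
        d≤n = ℕ.m⊔n≤o⇒m≤o d ((γ ℕ.* n′) ℕ.⊔ (T ℕ.* 2)) rest
        rest′ = ℕ.m⊔n≤o⇒n≤o d ((γ ℕ.* n′) ℕ.⊔ (T ℕ.* 2)) rest
        γn′≤n = ℕ.m⊔n≤o⇒m≤o (γ ℕ.* n′) (T ℕ.* 2) rest′
        T2≤n = ℕ.m⊔n≤o⇒n≤o (γ ℕ.* n′) (T ℕ.* 2) rest′
        V≤x : V ≤ x n
        V≤x = *-mono 0≤Λ (≤-trans 0≤σ σ≤) σ≤ (H-1≤L d≤n)
          where
          σ≤ : σ ≤ seq s n
          σ≤ = +-monoʳ-≤ (ι 3) (ε≥ n N₀≤n)

  positive-real : ∀ ε → 0ᴿ <ᴿ ε → ∃[ b ] ∃[ N ] (∀ n → N ℕ.≤ n → recip b ≤ seq ε n)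
  positive-real ε (δ , 0<δ , N , h) = let b , r≤δ = recip≤ δ 0<δ in b , N , λ n N≤n →
    ≤-trans r≤δ (<⇒≤ (subst (δ <_) (solve 1 (λ e → e :- con 0ℚ := e) refl (seq ε n)) (h n N≤n)))

  -- Growth estimates in natural numbers.

  ^-distribʳ : ∀ m n k → (m ℕ.* n) ℕ.^ k ≡ m ℕ.^ k ℕ.* n ℕ.^ k
  ^-distribʳ m n zero    = refl
  ^-distribʳ m n (suc k) = trans (cong (m ℕ.* n ℕ.*_) (^-distribʳ m n k))
    (solveⁿ 4 (λ m n a b → m ⊗ⁿ n ⊗ⁿ (a ⊗ⁿ b) ≗′ m ⊗ⁿ a ⊗ⁿ (n ⊗ⁿ b)) refl m n (m ℕ.^ k) (n ℕ.^ k))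

  n<2^n : ∀ n → n ℕ.< 2 ℕ.^ n
  n<2^n zero    = s≤s z≤n
  n<2^n (suc n) = ℕ.≤-trans (s≤s (n<2^n n)) (ℕ.+-mono-≤ (ℕ.m^n>0 2 n) (ℕ.≤-reflexive (sym (ℕ.+-identityʳ (2 ℕ.^ n)))))

  binaryLength : ∀ d → ∃[ l ] 2 ℕ.^ l ℕ.≤ suc d × suc d ℕ.< 2 ℕ.^ suc l
  binaryLength zero    = 0 , s≤s z≤n , s≤s (s≤s z≤n)
  binaryLength (suc d) = let l , lo , hi = binaryLength d in next l lo hi (suc (suc d) ℕ.<? 2 ℕ.^ suc l)
    where
    next : ∀ l → 2 ℕ.^ l ℕ.≤ suc d → suc d ℕ.< 2 ℕ.^ suc l → Dec (suc (suc d) ℕ.< 2 ℕ.^ suc l) →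
      ∃[ l ] 2 ℕ.^ l ℕ.≤ suc (suc d) × suc (suc d) ℕ.< 2 ℕ.^ suc l
    next l lo hi (yes lt) = l , ℕ.≤-trans lo (ℕ.n≤1+n (suc d)) , lt
    next l lo hi (no ¬lt) = suc l , ℕ.≮⇒≥ ¬lt , ℕ.≤-<-trans hi (ℕ.^-monoʳ-< 2 (s≤s (s≤s z≤n)) {suc l} {suc (suc l)} ℕ.≤-refl)

  -- Divide `l` by `q = 2 (b + 1)`, with quotient `μ`. Then `l + 2 ≤ 2 q 2 ^ μ`, so its power
  -- contributes `2 ^ (μ (b + 1))` besides a constant. For large `l` the constant is at most the
  -- same power of 2, and the product of both is at most `2 ^ l`.
  polynomial≤2^ : ∀ K b → ∃[ l₀ ] (∀ l → l₀ ℕ.≤ l → K ℕ.* (l ℕ.+ 2) ℕ.^ suc b ℕ.≤ 2 ℕ.^ l)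
  polynomial≤2^ K b = K′ ℕ.* q , bound
    where
    β = suc b
    q = 2 ℕ.* β
    K′ = K ℕ.* (2 ℕ.* q) ℕ.^ β
    bound : ∀ l → K′ ℕ.* q ℕ.≤ l → K ℕ.* (l ℕ.+ 2) ℕ.^ β ℕ.≤ 2 ℕ.^ l
    bound l h = begin
      K ℕ.* (l ℕ.+ 2) ℕ.^ β                       ≤⟨ ℕ.*-monoʳ-≤ K (ℕ.^-monoˡ-≤ β l+2≤) ⟩
      K ℕ.* (2 ℕ.* q ℕ.* 2 ℕ.^ μ) ℕ.^ β           ≡⟨ trans (cong (K ℕ.*_) (^-distribʳ (2 ℕ.* q) (2 ℕ.^ μ) β)) (sym (ℕ.*-assoc K ((2 ℕ.* q) ℕ.^ β) ((2 ℕ.^ μ) ℕ.^ β))) ⟩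
      K′ ℕ.* (2 ℕ.^ μ) ℕ.^ β                      ≤⟨ ℕ.*-monoˡ-≤ ((2 ℕ.^ μ) ℕ.^ β) (ℕ.≤-trans (ℕ.<⇒≤ (n<2^n K′)) (ℕ.^-monoʳ-≤ 2 K′≤)) ⟩
      2 ℕ.^ (μ ℕ.* β) ℕ.* (2 ℕ.^ μ) ℕ.^ β         ≡⟨ cong (2 ℕ.^ (μ ℕ.* β) ℕ.*_) (ℕ.^-*-assoc 2 μ β) ⟩
      2 ℕ.^ (μ ℕ.* β) ℕ.* 2 ℕ.^ (μ ℕ.* β)         ≡⟨ sym (ℕ.^-distribˡ-+-* 2 (μ ℕ.* β) (μ ℕ.* β)) ⟩
      2 ℕ.^ (μ ℕ.* β ℕ.+ μ ℕ.* β)                 ≤⟨ ℕ.^-monoʳ-≤ 2 (ℕ.≤-trans (ℕ.≤-reflexive (solveⁿ 2 (λ m b → m ⊗ⁿ b ⊞ m ⊗ⁿ b ≗′ m ⊗ⁿ (conⁿ 2 ⊗ⁿ b)) refl μ β)) (ℕ.m/n*n≤m l q)) ⟩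
      2 ℕ.^ l                                     ∎
      where
      open ℕ.≤-Reasoning
      μ = l ℕ./ q
      K′≤μ : K′ ℕ.≤ μ
      K′≤μ = ℕ.≤-trans (ℕ.≤-reflexive (sym (ℕ.m*n/n≡m K′ q))) (ℕ./-monoˡ-≤ q h)
      K′≤ : K′ ℕ.≤ μ ℕ.* β
      K′≤ = ℕ.≤-trans K′≤μ (ℕ.m≤m*n μ β)
      2≤q : 2 ℕ.≤ q
      2≤q = ℕ.m≤m*n 2 β
      l+2≤ : l ℕ.+ 2 ℕ.≤ 2 ℕ.* q ℕ.* 2 ℕ.^ μ
      l+2≤ = begin
        l ℕ.+ 2                            ≡⟨ cong (ℕ._+ 2) (ℕ.m≡m%n+[m/n]*n l q) ⟩
        l ℕ.% q ℕ.+ μ ℕ.* q ℕ.+ 2          ≤⟨ ℕ.+-mono-≤ (ℕ.+-monoˡ-≤ (μ ℕ.* q) (ℕ.<⇒≤ (ℕ.m%n<n l q))) 2≤q ⟩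
        q ℕ.+ μ ℕ.* q ℕ.+ q                ≤⟨ ℕ.m≤m+n (q ℕ.+ μ ℕ.* q ℕ.+ q) (μ ℕ.* q) ⟩
        q ℕ.+ μ ℕ.* q ℕ.+ q ℕ.+ μ ℕ.* q    ≡⟨ solveⁿ 2 (λ q m → q ⊞ m ⊗ⁿ q ⊞ q ⊞ m ⊗ⁿ q ≗′ conⁿ 2 ⊗ⁿ q ⊗ⁿ (conⁿ 1 ⊞ m)) refl q μ ⟩
        2 ℕ.* q ℕ.* suc μ                  ≤⟨ ℕ.*-monoʳ-≤ (2 ℕ.* q) (n<2^n μ) ⟩
        2 ℕ.* q ℕ.* 2 ℕ.^ μ                ∎

  record _≤2^_ (m e : ℕ) : Set where
    constructor exponent
    field ≤2^-holds : m ℕ.≤ 2 ℕ.^ e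

  open _≤2^_

  *-≤2^ : ∀ {m n e f} → m ≤2^ e → n ≤2^ f → (m ℕ.* n) ≤2^ (e ℕ.+ f)
  *-≤2^ {m} {n} {e} {f} (exponent h) (exponent h′) = exponent (subst (m ℕ.* n ℕ.≤_) (sym (ℕ.^-distribˡ-+-* 2 e f)) (ℕ.*-mono-≤ h h′))

  ^-≤2^ : ∀ {m e} k → m ≤2^ e → (m ℕ.^ k) ≤2^ (e ℕ.* k)
  ^-≤2^ {m} {e} k (exponent h) = exponent (subst (m ℕ.^ k ℕ.≤_) (ℕ.^-*-assoc 2 e k) (ℕ.^-monoˡ-≤ k h))

  suc-≤2^ : ∀ {m e} → m ≤2^ e → suc m ≤2^ suc e
  suc-≤2^ {m} {e} (exponent h) = exponent (ℕ.≤-trans (s≤s h) (ℕ.+-mono-≤ (ℕ.m^n>0 2 e) (ℕ.≤-reflexive (sym (ℕ.+-identityʳ (2 ℕ.^ e))))))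

  2≤2^1 : 2 ≤2^ 1
  2≤2^1 = exponent ℕ.≤-refl

  -- `coordinateBound d` has about `2 l d` bits, so a rounded entry takes O(l d) bits and all of
  -- them O(l d³); the residues add 2 d³. The constant 8 is generous.
  codeBound≤ : ∀ d l → 0 ℕ.< d → d ≤2^ l → codeBound d ≤2^ (8 ℕ.* (l ℕ.+ 1) ℕ.* (d ℕ.* d ℕ.* d))
  codeBound≤ d@(suc _) l _ d≤ = exponent (ℕ.≤-trans (≤2^-holds (*-≤2^ (^-≤2^ d (^-≤2^ d codes)) (^-≤2^ (d ℕ.* d) (^-≤2^ d 4≤))))
      (ℕ.^-monoʳ-≤ 2 (begin
        e ℕ.* d ℕ.* d ℕ.+ 2 ℕ.* d ℕ.* (d ℕ.* d)
          ≡⟨ solveⁿ 2 (λ l d → (conⁿ 2 ⊞ (l ⊞ (l ⊞ l ⊞ (f d l ⊞ f d l)))) ⊗ⁿ d ⊗ⁿ d ⊞ conⁿ 2 ⊗ⁿ d ⊗ⁿ (d ⊗ⁿ d)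
               ≗′ (conⁿ 3 ⊗ⁿ l ⊞ conⁿ 4) ⊗ⁿ (d ⊗ⁿ d) ⊞ (conⁿ 4 ⊗ⁿ l ⊞ conⁿ 4) ⊗ⁿ (d ⊗ⁿ d ⊗ⁿ d)) refl l d ⟩
        (3 ℕ.* l ℕ.+ 4) ℕ.* (d ℕ.* d) ℕ.+ (4 ℕ.* l ℕ.+ 4) ℕ.* (d ℕ.* d ℕ.* d)
          ≤⟨ ℕ.+-monoˡ-≤ ((4 ℕ.* l ℕ.+ 4) ℕ.* (d ℕ.* d ℕ.* d)) (ℕ.*-mono-≤ (ℕ.+-monoˡ-≤ 4 (ℕ.*-monoˡ-≤ l (ℕ.n≤1+n 3))) (ℕ.m≤m*n (d ℕ.* d) d)) ⟩
        (4 ℕ.* l ℕ.+ 4) ℕ.* (d ℕ.* d ℕ.* d) ℕ.+ (4 ℕ.* l ℕ.+ 4) ℕ.* (d ℕ.* d ℕ.* d)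
          ≡⟨ solveⁿ 2 (λ l d → (conⁿ 4 ⊗ⁿ l ⊞ conⁿ 4) ⊗ⁿ d ⊞ (conⁿ 4 ⊗ⁿ l ⊞ conⁿ 4) ⊗ⁿ d ≗′ conⁿ 8 ⊗ⁿ (l ⊞ conⁿ 1) ⊗ⁿ d) refl l (d ℕ.* d ℕ.* d) ⟩
        8 ℕ.* (l ℕ.+ 1) ℕ.* (d ℕ.* d ℕ.* d) ∎)))
    where
    open ℕ.≤-Reasoning
    e₁ = 1 ℕ.+ (1 ℕ.+ (l ℕ.+ l)) ℕ.* d
    e = 2 ℕ.+ (l ℕ.+ (l ℕ.+ l ℕ.+ (e₁ ℕ.+ e₁)))
    f = λ d l → conⁿ 1 ⊞ (conⁿ 1 ⊞ (l ⊞ l)) ⊗ⁿ d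
    4≤ : 4 ≤2^ 2
    4≤ = exponent ℕ.≤-refl
    coordinate : coordinateBound d ≤2^ e₁
    coordinate = *-≤2^ 2≤2^1 (^-≤2^ d (*-≤2^ 2≤2^1 (*-≤2^ d≤ d≤)))
    codes : gramCodes d ≤2^ e
    codes = suc-≤2^ (*-≤2^ 2≤2^1 (*-≤2^ d≤ (*-≤2^ (*-≤2^ d≤ d≤) (*-≤2^ coordinate coordinate))))

  -- `T` exceeds the bit bound of the code by one, and `T ^ (b + 1)` is at most `d ^ (3 (b + 1))`
  -- times a polynomial in the binary length `l`. Since `γ` is larger than `3 (b + 1)` by one, a
  -- factor `d ≥ 2 ^ l` is left to absorb the polynomial.
  upperExponent : ∀ b → ∃[ N ] (∀ c → N ℕ.≤ suc c → let γ = 3 ℕ.* suc b ℕ.+ 1 in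
    ∃[ T ] 4 ℕ.^ γ ℕ.* T ℕ.^ suc b ℕ.≤ suc (suc c) ℕ.^ γ × 1 ℕ.+ codeBound (suc c) ℕ.≤ 2 ℕ.^ T)
  upperExponent b = let l₀ , growth = polynomial≤2^ (4 ℕ.^ γ ℕ.* 9 ℕ.^ β) b in 2 ℕ.^ l₀ , λ c N≤d →
      let l , lo , hi = binaryLength c in choose l₀ growth c N≤d l lo hi
    where
    β = suc b
    γ = 3 ℕ.* β ℕ.+ 1
    choose : ∀ l₀ → (∀ l → l₀ ℕ.≤ l → 4 ℕ.^ γ ℕ.* 9 ℕ.^ β ℕ.* (l ℕ.+ 2) ℕ.^ β ℕ.≤ 2 ℕ.^ l) →
      ∀ c → 2 ℕ.^ l₀ ℕ.≤ suc c → ∀ l → 2 ℕ.^ l ℕ.≤ suc c → suc c ℕ.< 2 ℕ.^ suc l →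
      ∃[ T ] 4 ℕ.^ γ ℕ.* T ℕ.^ β ℕ.≤ suc (suc c) ℕ.^ γ × 1 ℕ.+ codeBound (suc c) ℕ.≤ 2 ℕ.^ T
    choose l₀ growth c N≤d l lo hi = T , (begin
        4 ℕ.^ γ ℕ.* T ℕ.^ β
          ≤⟨ ℕ.*-monoʳ-≤ (4 ℕ.^ γ) (ℕ.^-monoˡ-≤ β T≤) ⟩
        4 ℕ.^ γ ℕ.* (9 ℕ.* (l ℕ.+ 2) ℕ.* D) ℕ.^ β
          ≡⟨ cong (4 ℕ.^ γ ℕ.*_) (trans (^-distribʳ (9 ℕ.* (l ℕ.+ 2)) D β) (cong (ℕ._* D ℕ.^ β) (^-distribʳ 9 (l ℕ.+ 2) β))) ⟩
        4 ℕ.^ γ ℕ.* (9 ℕ.^ β ℕ.* (l ℕ.+ 2) ℕ.^ β ℕ.* D ℕ.^ β)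
          ≡⟨ solveⁿ 4 (λ a b c d → a ⊗ⁿ (b ⊗ⁿ c ⊗ⁿ d) ≗′ a ⊗ⁿ b ⊗ⁿ c ⊗ⁿ d) refl (4 ℕ.^ γ) (9 ℕ.^ β) ((l ℕ.+ 2) ℕ.^ β) (D ℕ.^ β) ⟩
        4 ℕ.^ γ ℕ.* 9 ℕ.^ β ℕ.* (l ℕ.+ 2) ℕ.^ β ℕ.* D ℕ.^ β
          ≤⟨ ℕ.*-monoˡ-≤ (D ℕ.^ β) (ℕ.≤-trans (growth l l₀≤l) lo) ⟩
        d ℕ.* D ℕ.^ β
          ≡⟨ cong (d ℕ.*_) (trans (cong (ℕ._^ β) (solveⁿ 1 (λ d → d ⊗ⁿ d ⊗ⁿ d ≗′ d ⊗ⁿ (d ⊗ⁿ (d ⊗ⁿ conⁿ 1))) refl d)) (ℕ.^-*-assoc d 3 β)) ⟩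
        d ℕ.^ suc (3 ℕ.* β)
          ≡⟨ cong (d ℕ.^_) (ℕ.+-comm 1 (3 ℕ.* β)) ⟩
        d ℕ.^ γ
          ≤⟨ ℕ.^-monoˡ-≤ γ (ℕ.n≤1+n d) ⟩
        suc d ℕ.^ γ ∎) , ≤2^-holds (suc-≤2^ (codeBound≤ d (suc l) (s≤s z≤n) (exponent (ℕ.<⇒≤ hi))))
      where
      open ℕ.≤-Reasoning
      d = suc c
      D = d ℕ.* d ℕ.* d
      T = 1 ℕ.+ 8 ℕ.* (suc l ℕ.+ 1) ℕ.* D
      l₀≤l : l₀ ℕ.≤ l
      l₀≤l = ℕ.≮⇒≥ λ l<l₀ → ℕ.<-irrefl refl (ℕ.<-≤-trans hi (ℕ.≤-trans (ℕ.^-monoʳ-≤ 2 l<l₀) N≤d))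
      T≤ : T ℕ.≤ 9 ℕ.* (l ℕ.+ 2) ℕ.* D
      T≤ = begin
        1 ℕ.+ 8 ℕ.* (suc l ℕ.+ 1) ℕ.* D            ≤⟨ ℕ.+-monoˡ-≤ (8 ℕ.* (suc l ℕ.+ 1) ℕ.* D) (ℕ.*-mono-≤ {1} {l ℕ.+ 2} {1} {D} (ℕ.≤-trans (s≤s z≤n) (ℕ.m≤n+m 2 l)) (s≤s z≤n)) ⟩
        (l ℕ.+ 2) ℕ.* D ℕ.+ 8 ℕ.* (suc l ℕ.+ 1) ℕ.* D ≡⟨ solveⁿ 2 (λ l D → (l ⊞ conⁿ 2) ⊗ⁿ D ⊞ conⁿ 8 ⊗ⁿ (conⁿ 1 ⊞ l ⊞ conⁿ 1) ⊗ⁿ D ≗′ conⁿ 9 ⊗ⁿ (l ⊞ conⁿ 2) ⊗ⁿ D) refl l D ⟩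
        9 ℕ.* (l ℕ.+ 2) ℕ.* D                      ∎

  -- `W` is a fixed fraction of `d`, so the additional factor `W` in `W ^ suc b` eventually beats
  -- the constant `(32 C) ^ b`. The choice `C = 2 A + 1` leaves one `W` over in the linear
  -- inequality for `3 A + A₀`.
  lowerExponent : ∀ A A₀ b → ∃[ N ] (∀ d → N ℕ.≤ d →
    ∃[ W ] (16 ℕ.* d) ℕ.^ b ℕ.≤ W ℕ.^ suc b × A ℕ.* (2 ℕ.* W ℕ.+ 3) ℕ.+ A₀ ℕ.≤ d)
  lowerExponent A A₀ b = M ℕ.* C , λ d N≤d → W d , power d N≤d , linear d N≤d
    where
    open ℕ.≤-Reasoning
    C = suc (2 ℕ.* A)
    M = suc ((32 ℕ.* C) ℕ.^ b ℕ.+ (A ℕ.* 3 ℕ.+ A₀))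
    W : ℕ → ℕ
    W d = d ℕ./ C
    M≤W : ∀ d → M ℕ.* C ℕ.≤ d → M ℕ.≤ W d
    M≤W d h = ℕ.≤-trans (ℕ.≤-reflexive (sym (ℕ.m*n/n≡m M C))) (ℕ./-monoˡ-≤ C h)
    power : ∀ d → M ℕ.* C ℕ.≤ d → (16 ℕ.* d) ℕ.^ b ℕ.≤ W d ℕ.^ suc b
    power d h = begin
      (16 ℕ.* d) ℕ.^ b                           ≤⟨ ℕ.^-monoˡ-≤ b (ℕ.*-monoʳ-≤ 16 d≤) ⟩
      (16 ℕ.* (2 ℕ.* (W d ℕ.* C))) ℕ.^ b         ≡⟨ trans (cong (ℕ._^ b) (solveⁿ 2 (λ w c → conⁿ 16 ⊗ⁿ (conⁿ 2 ⊗ⁿ (w ⊗ⁿ c)) ≗′ conⁿ 32 ⊗ⁿ c ⊗ⁿ w) refl (W d) C)) (^-distribʳ (32 ℕ.* C) (W d) b) ⟩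
      (32 ℕ.* C) ℕ.^ b ℕ.* W d ℕ.^ b             ≤⟨ ℕ.*-monoˡ-≤ (W d ℕ.^ b) (ℕ.≤-trans (ℕ.≤-trans (ℕ.m≤m+n ((32 ℕ.* C) ℕ.^ b) (A ℕ.* 3 ℕ.+ A₀)) (ℕ.n≤1+n _)) (M≤W d h)) ⟩
      W d ℕ.^ suc b                              ∎
      where
      d≤ : d ℕ.≤ 2 ℕ.* (W d ℕ.* C)
      d≤ = begin
        d                                        ≡⟨ ℕ.m≡m%n+[m/n]*n d C ⟩
        d ℕ.% C ℕ.+ W d ℕ.* C                    ≤⟨ ℕ.+-monoˡ-≤ (W d ℕ.* C) (ℕ.≤-trans (ℕ.<⇒≤ (ℕ.m%n<n d C)) (ℕ.≤-trans (ℕ.≤-reflexive (sym (ℕ.*-identityˡ C))) (ℕ.*-monoˡ-≤ C (ℕ.≤-trans (s≤s z≤n) (M≤W d h))))) ⟩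
        W d ℕ.* C ℕ.+ W d ℕ.* C                  ≡⟨ solveⁿ 1 (λ x → x ⊞ x ≗′ conⁿ 2 ⊗ⁿ x) refl (W d ℕ.* C) ⟩
        2 ℕ.* (W d ℕ.* C)                        ∎
    linear : ∀ d → M ℕ.* C ℕ.≤ d → A ℕ.* (2 ℕ.* W d ℕ.+ 3) ℕ.+ A₀ ℕ.≤ d
    linear d h = begin
      A ℕ.* (2 ℕ.* W d ℕ.+ 3) ℕ.+ A₀             ≡⟨ solveⁿ 3 (λ a w z → a ⊗ⁿ (conⁿ 2 ⊗ⁿ w ⊞ conⁿ 3) ⊞ z ≗′ w ⊗ⁿ (conⁿ 2 ⊗ⁿ a) ⊞ (a ⊗ⁿ conⁿ 3 ⊞ z)) refl A (W d) A₀ ⟩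
      W d ℕ.* (2 ℕ.* A) ℕ.+ (A ℕ.* 3 ℕ.+ A₀)     ≤⟨ ℕ.+-monoʳ-≤ (W d ℕ.* (2 ℕ.* A)) (ℕ.≤-trans (ℕ.≤-trans (ℕ.m≤n+m (A ℕ.* 3 ℕ.+ A₀) ((32 ℕ.* C) ℕ.^ b)) (ℕ.n≤1+n _)) (M≤W d h)) ⟩
      W d ℕ.* (2 ℕ.* A) ℕ.+ W d                  ≡⟨ solveⁿ 2 (λ w a → w ⊗ⁿ (conⁿ 2 ⊗ⁿ a) ⊞ w ≗′ w ⊗ⁿ (conⁿ 1 ⊞ conⁿ 2 ⊗ⁿ a)) refl (W d) A ⟩
      W d ℕ.* C                                  ≤⟨ ℕ.m/n*n≤m d C ⟩
      d                                          ∎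

  -- A family of perfect lattices.

  sum-injective : ∀ {k N} (g : Fin k → Fin N) → (∀ {a b} → g a ≡ g b → a ≡ b) → ∀ (f : Fin N → ℚ) → (∀ i → 0ℚ ≤ f i) →
    sum (λ a → f (g a)) ≤ sum f
  sum-injective {k} {N} g inj f f≥0 = begin
    sum (λ a → f (g a))                          ≡⟨ sum-cong (λ a → sym (sum-δ (g a) f)) ⟩
    sum (λ a → sum (λ i → δ (g a) i * f i))      ≡⟨ sum-swap (λ a i → δ (g a) i * f i) ⟩
    sum (λ i → sum (λ a → δ (g a) i * f i))      ≡⟨ sum-cong (λ i → sum-*ʳ (f i) λ a → δ (g a) i) ⟩
    sum (λ i → sum (λ a → δ (g a) i) * f i)      ≤⟨ sum-mono (λ i → subst (sum (λ a → δ (g a) i) * f i ≤_) (*-identityˡ (f i)) (*-monoˡ (f i) (f≥0 i) (count≤1 i (F.any? λ a → g a F.≟ i)))) ⟩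
    sum f                                        ∎
    where
    open ≤-Reasoning
    count≤1 : ∀ i → Dec (∃[ a ] g a ≡ i) → sum (λ a → δ (g a) i) ≤ 1ℚ
    count≤1 i (no none) = ≤-trans (≤-reflexive (sum-0 λ a → cong ⟦_⟧ (δ-≢ λ eq → none (a , eq)))) (<⇒≤ 1>0)
    count≤1 i (yes (a₀ , refl)) = ≤-reflexive (trans (sum-cong λ a → trans (cong ⟦_⟧ (same a (a F.≟ a₀))) (sym (*-identityˡ (δ a a₀)))) (sum-δʳ a₀ λ _ → 1ℚ))
      where
      same : ∀ a → Dec (a ≡ a₀) → δᶻ (g a) (g a₀) ≡ δᶻ a a₀
      same a (yes refl) = trans (δ-refl (g a)) (sym (δ-refl a))
      same a (no ne)    = trans (δ-≢ λ eq → ne (inj eq)) (sym (δ-≢ ne))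

  square≥1 : ∀ z → z ≢ + 0 → 1ℚ ≤ ⟦ z ⟧ * ⟦ z ⟧
  square≥1 z ne = subst (1ℚ ≤_) (⟦⟧-* z z) (⟦⟧-mono-≤ {+ 1} {z ℤ.* z} (go z ne))
    where
    go : ∀ z → z ≢ + 0 → + 1 ℤ.≤ z ℤ.* z
    go (+ zero)  ne = contradiction refl ne
    go (+ suc k) ne = ℤ.+≤+ (s≤s z≤n)
    go -[1+ k ]  ne = ℤ.+≤+ (s≤s z≤n)

  sum-two : ∀ {N} (f : Fin N → ℚ) → (∀ i → 0ℚ ≤ f i) → ∀ {a b} → a ≢ b → f a + f b ≤ sum f
  sum-two f f≥0 {a} {b} a≢b = subst (_≤ sum f) (cong (_+_ (f a)) (+-identityʳ (f b))) (sum-injective {2} g inj f f≥0)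
    where
    g : Fin 2 → Fin _
    g zero    = a
    g (suc _) = b
    inj : ∀ {x y} → g x ≡ g y → x ≡ y
    inj {zero}     {zero}     _  = refl
    inj {zero}     {suc zero} eq = contradiction eq a≢b
    inj {suc zero} {zero}     eq = contradiction (sym eq) a≢b
    inj {suc zero} {suc zero} _  = refl

  positive-entry : ∀ {N} (X : Fin N → ℤ) → sum (λ i → ⟦ X i ⟧) ≡ 0ℚ → (∃[ i ] X i ≢ + 0) → ∃[ a ] + 0 ℤ.< X a
  positive-entry X ΣX≡0 (i , ne) = go (F.any? λ a → + 0 ℤ.<? X a)
    where
    go : Dec (∃[ a ] + 0 ℤ.< X a) → ∃[ a ] + 0 ℤ.< X a
    go (yes p) = p
    go (no ¬p) = contradiction (ℤ.≤-antisym (entry≤0 i) (⟦⟧-cancel-≤ {+ 0} {X i} (subst (0ℚ ≤_) (solve 1 (λ x → :- :- x := x) refl ⟦ X i ⟧)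
        (neg-antimono-≤ (≤-trans (term≤sum {f = λ i → - ⟦ X i ⟧} (λ i → neg-antimono-≤ (⟦⟧-mono-≤ (entry≤0 i))) i)
          (≤-reflexive (trans (sum-neg λ i → ⟦ X i ⟧) (cong -_ ΣX≡0)))))))) ne
      where
      entry≤0 : ∀ a → X a ℤ.≤ + 0
      entry≤0 a = ℤ.≮⇒≥ λ lt → ¬p (a , lt)

  negative-entry : ∀ {N} (X : Fin N → ℤ) → sum (λ i → ⟦ X i ⟧) ≡ 0ℚ → (∃[ i ] X i ≢ + 0) → ∃[ a ] X a ℤ.< + 0
  negative-entry X ΣX≡0 (i , ne) =
    let a , lt = positive-entry (λ i → ℤ.- X i) (trans (sum-cong λ i → ⟦⟧-neg (X i)) (trans (sum-neg λ i → ⟦ X i ⟧) (cong -_ ΣX≡0)))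
                   (i , λ eq → ne (trans (sym (ℤ.neg-involutive (X i))) (cong ℤ.-_ eq)))
    in a , subst (ℤ._< + 0) (ℤ.neg-involutive (X a)) (ℤ.neg-mono-< lt)

  square≥4 : ∀ z → z ≢ + 0 → z ≢ + 1 → z ≢ -[1+ 0 ] → ι 4 ≤ ⟦ z ⟧ * ⟦ z ⟧
  square≥4 z n0 n1 n-1 = subst (ι 4 ≤_) (⟦⟧-* z z) (⟦⟧-mono-≤ {+ 4} {z ℤ.* z} (go z n0 n1 n-1))
    where
    go : ∀ z → z ≢ + 0 → z ≢ + 1 → z ≢ -[1+ 0 ] → + 4 ℤ.≤ z ℤ.* z
    go (+ 0)             n0 n1 n-1 = contradiction refl n0
    go (+ 1)             n0 n1 n-1 = contradiction refl n1
    go (+ suc (suc k))   n0 n1 n-1 = ℤ.+≤+ (ℕ.*-mono-≤ {2} {suc (suc k)} {2} {suc (suc k)} (s≤s (s≤s z≤n)) (s≤s (s≤s z≤n)))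
    go -[1+ 0 ]          n0 n1 n-1 = contradiction refl n-1
    go -[1+ suc k ]      n0 n1 n-1 = ℤ.+≤+ (ℕ.*-mono-≤ {2} {suc (suc k)} {2} {suc (suc k)} (s≤s (s≤s z≤n)) (s≤s (s≤s z≤n)))

  -- A shorter vector would have exactly one entry 1 and one entry -1 after
  -- removing a matching pair, contradicting injectivity of H.
  norm≥4 : ∀ {N} (H : Fin N → ℕ) → (∀ {i j} → H i ≡ H j → i ≡ j) → ∀ (X : Fin N → ℤ) →
    sum (λ i → ⟦ X i ⟧) ≡ 0ℚ → sum (λ i → ι (H i) * ⟦ X i ⟧) ≡ 0ℚ → (∃[ i ] X i ≢ + 0) → ι 4 ≤ sum (λ i → ⟦ X i ⟧ * ⟦ X i ⟧)
  norm≥4 {N} H H-inj X ΣX ΣHX nz = by-entries (X a ℤ.≟ + 1) (X b ℤ.≟ -[1+ 0 ])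
    where
    open ≤-Reasoning
    sq≥0 : ∀ i → 0ℚ ≤ ⟦ X i ⟧ * ⟦ X i ⟧
    sq≥0 i = square ⟦ X i ⟧
    pos-a = positive-entry X ΣX nz
    neg-b = negative-entry X ΣX nz
    a = proj₁ pos-a
    b = proj₁ neg-b
    0<Xa = proj₂ pos-a
    Xb<0 = proj₂ neg-b
    by-entries : Dec (X a ≡ + 1) → Dec (X b ≡ -[1+ 0 ]) → ι 4 ≤ sum (λ i → ⟦ X i ⟧ * ⟦ X i ⟧)
    by-entries (no ne) _ = ≤-trans (square≥4 (X a) (λ eq → ℤ.<-irrefl (sym eq) 0<Xa) ne (λ eq → contradiction (subst (+ 0 ℤ.<_) eq 0<Xa) λ ())) (term≤sum sq≥0 a)
    by-entries (yes _) (no ne) = ≤-trans (square≥4 (X b) (λ eq → ℤ.<-irrefl eq Xb<0) (λ eq → contradiction (subst (ℤ._< + 0) eq Xb<0) λ { (ℤ.+<+ ()) }) ne) (term≤sum sq≥0 b)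
    by-entries (yes Xa≡1) (yes Xb≡-1) = begin
      ι 4                                                          ≡⟨⟩
      1ℚ + 1ℚ + (1ℚ + 1ℚ)                                          ≤⟨ +-monoʳ-≤ (1ℚ + 1ℚ) (≤-trans (+-mono-≤ (square≥1 (Y c) Yc≢0) (square≥1 (Y e) Ye≢0)) (sum-two (λ i → ⟦ Y i ⟧ * ⟦ Y i ⟧) (λ i → square ⟦ Y i ⟧) c≢e)) ⟩
      1ℚ + 1ℚ + sum (λ i → ⟦ Y i ⟧ * ⟦ Y i ⟧)                      ≡⟨ sym ΣX²≡ ⟩
      sum (λ i → ⟦ X i ⟧ * ⟦ X i ⟧)                                ∎
      where
      a≢b : a ≢ b
      a≢b eq = contradiction (trans (sym Xa≡1) (trans (cong X eq) Xb≡-1)) λ ()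
      Y : Fin N → ℤ
      Y i = X i ℤ.- δᶻ a i ℤ.+ δᶻ b i
      ⟦Y⟧ : ∀ i → ⟦ Y i ⟧ ≡ ⟦ X i ⟧ - δ a i + δ b i
      ⟦Y⟧ i = trans (⟦⟧-+ (X i ℤ.- δᶻ a i) (δᶻ b i)) (cong (_+ δ b i) (⟦⟧-- (X i) (δᶻ a i)))
      linear : ∀ (f : Fin N → ℚ) → sum (λ i → f i * ⟦ Y i ⟧) ≡ sum (λ i → f i * ⟦ X i ⟧) - f a + f b
      linear f = trans (sum-cong λ i → trans (cong (f i *_) (⟦Y⟧ i)) (solve 4 (λ f x a b → f :* (x :- a :+ b) := f :* x :- a :* f :+ b :* f) refl (f i) ⟦ X i ⟧ (δ a i) (δ b i)))
        (trans (sum-+ (λ i → f i * ⟦ X i ⟧ - δ a i * f i) (λ i → δ b i * f i))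
          (cong₂ _+_ (trans (sum-- (λ i → f i * ⟦ X i ⟧) (λ i → δ a i * f i)) (cong (λ t → sum (λ i → f i * ⟦ X i ⟧) - t) (sum-δ a f))) (sum-δ b f)))
      ΣY : sum (λ i → ⟦ Y i ⟧) ≡ 0ℚ
      ΣY = trans (sum-cong λ i → sym (*-identityˡ ⟦ Y i ⟧)) (trans (linear λ _ → 1ℚ)
        (trans (cong (λ t → t - 1ℚ + 1ℚ) (trans (sum-cong λ i → *-identityˡ ⟦ X i ⟧) ΣX)) refl))
      Y≢0 : ∃[ i ] Y i ≢ + 0
      Y≢0 = go (F.any? λ i → ¬? (Y i ℤ.≟ + 0))
        where
        go : Dec (∃[ i ] Y i ≢ + 0) → ∃[ i ] Y i ≢ + 0
        go (yes p) = p
        go (no ¬p) = contradiction (H-inj (ℤ.+-injective (⟦⟧-injective (sym (p-q≡0⇒p≡q (ι (H b)) (ι (H a))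
          (trans (solve 2 (λ a b → b :- a := con 0ℚ :- a :+ b) refl (ι (H a)) (ι (H b)))
            (trans (cong (λ t → t - ι (H a) + ι (H b)) (sym ΣHX)) (trans (sym (linear λ i → ι (H i)))
              (sum-0 λ i → trans (cong (λ z → ι (H i) * ⟦ z ⟧) (vanish i (Y i ℤ.≟ + 0))) (*-zeroʳ (ι (H i)))))))))))) a≢b
          where
          vanish : ∀ i → Dec (Y i ≡ + 0) → Y i ≡ + 0
          vanish i (yes eq) = eq
          vanish i (no ne)  = contradiction (i , ne) ¬p
      c = proj₁ (positive-entry Y ΣY Y≢0)
      e = proj₁ (negative-entry Y ΣY Y≢0)
      0<Yc = proj₂ (positive-entry Y ΣY Y≢0)
      Ye<0 = proj₂ (negative-entry Y ΣY Y≢0)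
      Yc≢0 : Y c ≢ + 0
      Yc≢0 eq = ℤ.<-irrefl (sym eq) 0<Yc
      Ye≢0 : Y e ≢ + 0
      Ye≢0 eq = ℤ.<-irrefl eq Ye<0
      c≢e : c ≢ e
      c≢e eq = ℤ.<-asym 0<Yc (subst (λ i → Y i ℤ.< + 0) (sym eq) Ye<0)
      -- The norm drops by exactly 2 because `Y` vanishes at `a` and `b`. The other 2 come from a
      -- positive and a negative entry of the balanced vector `Y`.
      ΣX²≡ : sum (λ i → ⟦ X i ⟧ * ⟦ X i ⟧) ≡ 1ℚ + 1ℚ + sum (λ i → ⟦ Y i ⟧ * ⟦ Y i ⟧)
      ΣX²≡ = sym (begin-equality
        1ℚ + 1ℚ + sum (λ i → ⟦ Y i ⟧ * ⟦ Y i ⟧)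
          ≡⟨ cong (λ t → 1ℚ + 1ℚ + t) (linear (λ i → ⟦ Y i ⟧)) ⟩
        1ℚ + 1ℚ + (sum (λ i → ⟦ Y i ⟧ * ⟦ X i ⟧) - ⟦ Y a ⟧ + ⟦ Y b ⟧)
          ≡⟨ cong (λ t → 1ℚ + 1ℚ + (t - ⟦ Y a ⟧ + ⟦ Y b ⟧)) (trans (sum-cong λ i → *-comm ⟦ Y i ⟧ ⟦ X i ⟧) (linear (λ i → ⟦ X i ⟧))) ⟩
        1ℚ + 1ℚ + (sum (λ i → ⟦ X i ⟧ * ⟦ X i ⟧) - ⟦ X a ⟧ + ⟦ X b ⟧ - ⟦ Y a ⟧ + ⟦ Y b ⟧)
          ≡⟨ cong₂ (λ s t → 1ℚ + 1ℚ + (sum (λ i → ⟦ X i ⟧ * ⟦ X i ⟧) - s + t - ⟦ Y a ⟧ + ⟦ Y b ⟧)) (cong ⟦_⟧ Xa≡1) (cong ⟦_⟧ Xb≡-1) ⟩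
        1ℚ + 1ℚ + (sum (λ i → ⟦ X i ⟧ * ⟦ X i ⟧) - 1ℚ + ⟦ -[1+ 0 ] ⟧ - ⟦ Y a ⟧ + ⟦ Y b ⟧)
          ≡⟨ cong₂ (λ s t → 1ℚ + 1ℚ + (sum (λ i → ⟦ X i ⟧ * ⟦ X i ⟧) - 1ℚ + ⟦ -[1+ 0 ] ⟧ - s + t)) (cong ⟦_⟧ Ya≡0) (cong ⟦_⟧ Yb≡0) ⟩
        1ℚ + 1ℚ + (sum (λ i → ⟦ X i ⟧ * ⟦ X i ⟧) - 1ℚ + ⟦ -[1+ 0 ] ⟧ - 0ℚ + 0ℚ)
          ≡⟨ solve 1 (λ s → con 1ℚ :+ con 1ℚ :+ (s :- con 1ℚ :+ con (- 1ℚ) :- con 0ℚ :+ con 0ℚ) := s) refl (sum (λ i → ⟦ X i ⟧ * ⟦ X i ⟧)) ⟩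
        sum (λ i → ⟦ X i ⟧ * ⟦ X i ⟧) ∎)
        where
        Ya≡0 : Y a ≡ + 0
        Ya≡0 = cong₂ ℤ._+_ (cong₂ ℤ._-_ Xa≡1 (δ-refl a)) (δ-≢ (a≢b ∘ sym))
        Yb≡0 : Y b ≡ + 0
        Yb≡0 = cong₂ ℤ._+_ (cong₂ ℤ._-_ Xb≡-1 (δ-≢ a≢b)) (δ-refl b)

  -- The lattice of all X ∈ ℤ^(2+d) with Σ Xᵢ = Σ Hᵢ Xᵢ = 0, in the coordinates
  -- x = (X₂ , X₃ , …), from which X₀ and X₁ are recovered because H₀ = 0, H₁ = 1.
  module Balanced {d} (H : Fin (2 ℕ.+ d) → ℕ) (H₀ : H zero ≡ 0) (H₁ : H (suc zero) ≡ 1) where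

    η : Fin (2 ℕ.+ d) → ℚ
    η i = ι (H i)

    h : Fin d → ℕ
    h i = H (suc (suc i))

    -- The Euclidean norm of the full vector: the three terms are the contributions of the free
    -- coordinates, of X₁ and of X₀.
    gram : Fin d → Fin d → ℤ
    gram i j = δᶻ i j ℤ.+ + h i ℤ.* + h j ℤ.+ (+ h i ℤ.- + 1) ℤ.* (+ h j ℤ.- + 1)

    full : Vec d → Vec (2 ℕ.+ d)
    full x zero          = sum λ i → (ι (h i) - 1ℚ) * x i
    full x (suc zero)    = - sum λ i → ι (h i) * x i
    full x (suc (suc i)) = x i

    fullᶻ : ℤ^ d → ℤ^ (2 ℕ.+ d)
    fullᶻ x zero          = sumᶻ λ i → (+ h i ℤ.- + 1) ℤ.* x i
    fullᶻ x (suc zero)    = ℤ.- sumᶻ λ i → + h i ℤ.* x i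
    fullᶻ x (suc (suc i)) = x i

    ⟦fullᶻ⟧ : ∀ x i → ⟦ fullᶻ x i ⟧ ≡ full ⟦ x ⟧ᵛ i
    ⟦fullᶻ⟧ x zero          = trans (⟦⟧-sum λ i → (+ h i ℤ.- + 1) ℤ.* x i) (sum-cong λ i → trans (⟦⟧-* (+ h i ℤ.- + 1) (x i)) (cong (_* ⟦ x i ⟧) (⟦⟧-- (+ h i) (+ 1))))
    ⟦fullᶻ⟧ x (suc zero)    = trans (⟦⟧-neg (sumᶻ λ i → + h i ℤ.* x i)) (cong -_ (trans (⟦⟧-sum λ i → + h i ℤ.* x i) (sum-cong λ i → ⟦⟧-* (+ h i) (x i))))
    ⟦fullᶻ⟧ x (suc (suc i)) = refl

    sum-full : ∀ x → sum (full x) ≡ 0ℚ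
    sum-full x = begin
      sum (λ i → (ι (h i) - 1ℚ) * x i) + (- B + sum x)
        ≡⟨ cong (_+ (- B + sum x)) (trans (sum-cong λ i → solve 2 (λ h x → (h :- con 1ℚ) :* x := h :* x :- x) refl (ι (h i)) (x i)) (sum-- (λ i → ι (h i) * x i) x)) ⟩
      B - sum x + (- B + sum x)
        ≡⟨ solve 2 (λ b s → b :- s :+ (:- b :+ s) := con 0ℚ) refl B (sum x) ⟩
      0ℚ ∎
      where
      open ≡-Reasoning
      B = sum λ i → ι (h i) * x i

    sum-H-full : ∀ x → sum (λ i → η i * full x i) ≡ 0ℚ
    sum-H-full x = trans (cong₂ (λ p q → ι p * full x zero + (ι q * - B + B)) H₀ H₁)
      (solve 2 (λ a b → con 0ℚ :* a :+ (con 1ℚ :* :- b :+ b) := con 0ℚ) refl (full x zero) B)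
      where B = sum λ i → ι (h i) * x i

    full-tail : ∀ (Y : Vec (2 ℕ.+ d)) → sum Y ≡ 0ℚ → sum (λ i → η i * Y i) ≡ 0ℚ → ∀ i → full (λ i → Y (suc (suc i))) i ≡ Y i
    full-tail Y ΣY ΣHY = entry
      where
      y = λ i → Y (suc (suc i))
      B = sum λ i → ι (h i) * y i
      Y₁ : - B ≡ Y (suc zero)
      Y₁ = trans (solve 3 (λ p q b → :- b := q :- (con 0ℚ :* p :+ (con 1ℚ :* q :+ b))) refl (Y zero) (Y (suc zero)) B)
        (trans (cong (λ t → Y (suc zero) - t) (trans (cong₂ (λ p q → ι p * Y zero + (ι q * Y (suc zero) + B)) (sym H₀) (sym H₁)) ΣHY))
          (solve 1 (λ q → q :- con 0ℚ := q) refl (Y (suc zero))))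
      entry : ∀ i → full y i ≡ Y i
      entry zero = trans (trans (sum-cong λ i → solve 2 (λ h x → (h :- con 1ℚ) :* x := h :* x :- x) refl (ι (h i)) (y i)) (sum-- (λ i → ι (h i) * y i) y))
        (trans (solve 3 (λ p b s → b :- s := p :- (p :+ (:- b :+ s))) refl (Y zero) B (sum y))
          (trans (cong (λ t → Y zero - t) (trans (cong (λ t → Y zero + (t + sum y)) Y₁) ΣY)) (solve 1 (λ p → p :- con 0ℚ := p) refl (Y zero))))
      entry (suc zero)    = Y₁
      entry (suc (suc i)) = refl

    ⟦gram⟧ : ∀ i j → ⟦ gram i j ⟧ ≡ δ i j + ι (h i) * ι (h j) + (ι (h i) - 1ℚ) * (ι (h j) - 1ℚ)
    ⟦gram⟧ i j = trans (⟦⟧-+ (δᶻ i j ℤ.+ + h i ℤ.* + h j) ((+ h i ℤ.- + 1) ℤ.* (+ h j ℤ.- + 1)))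
      (cong₂ _+_ (trans (⟦⟧-+ (δᶻ i j) (+ h i ℤ.* + h j)) (cong (_+_ (δ i j)) (⟦⟧-* (+ h i) (+ h j))))
        (trans (⟦⟧-* (+ h i ℤ.- + 1) (+ h j ℤ.- + 1)) (cong₂ _*_ (⟦⟧-- (+ h i) (+ 1)) (⟦⟧-- (+ h j) (+ 1)))))

    quad-gram : ∀ x → quad ⟦ gram ⟧ᵐ x ≡ sum (λ i → full x i * full x i)
    quad-gram x = begin
      quad ⟦ gram ⟧ᵐ x
        ≡⟨ sum-cong (λ i → trans (sum-cong λ j → trans (cong (λ t → x i * t * x j) (⟦gram⟧ i j))
             (solve 5 (λ x d p q y → x :* (d :+ p :+ q) :* y := x :* (d :* y) :+ x :* p :* y :+ x :* q :* y) refl (x i) (δ i j) (ι (h i) * ι (h j)) ((ι (h i) - 1ℚ) * (ι (h j) - 1ℚ)) (x j)))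
             (trans (sum-+ (λ j → x i * (δ i j * x j) + P i j) (Q i)) (cong (_+ sum (Q i)) (trans (sum-+ (λ j → x i * (δ i j * x j)) (P i))
               (cong (_+ sum (P i)) (trans (sum-* (x i) λ j → δ i j * x j) (cong (x i *_) (sum-δ i x)))))))) ⟩
      sum (λ i → x i * x i + sum (P i) + sum (Q i))
        ≡⟨ trans (sum-+ (λ i → x i * x i + sum (P i)) (λ i → sum (Q i))) (cong (_+ sum (λ i → sum (Q i))) (sum-+ (λ i → x i * x i) (λ i → sum (P i)))) ⟩
      sum (λ i → x i * x i) + sum (λ i → sum (P i)) + sum (λ i → sum (Q i))
        ≡⟨ cong₂ (λ p q → sum (λ i → x i * x i) + p + q) (rank-one (λ i → ι (h i)) x) (rank-one (λ i → ι (h i) - 1ℚ) x) ⟩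
      sum (λ i → x i * x i) + B * B + A * A
        ≡⟨ solve 3 (λ s b a → s :+ b :* b :+ a :* a := a :* a :+ (:- b :* :- b :+ s)) refl (sum (λ i → x i * x i)) B A ⟩
      A * A + (- B * - B + sum (λ i → x i * x i)) ∎
      where
      open ≡-Reasoning
      P Q : Fin d → Fin d → ℚ
      P i j = x i * (ι (h i) * ι (h j)) * x j
      Q i j = x i * ((ι (h i) - 1ℚ) * (ι (h j) - 1ℚ)) * x j
      A = full x zero
      B = sum λ i → ι (h i) * x i

    BoundedFunctional : (Fin (2 ℕ.+ d) → ℤ) → Set
    BoundedFunctional z = ∀ (x : ℤ^ d) → sum (λ i → ⟦ z i ⟧ * full ⟦ x ⟧ᵛ i) * sum (λ i → ⟦ z i ⟧ * full ⟦ x ⟧ᵛ i) ≤ q[ ⟦ gram ⟧ᵐ ] x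

    gram-bounded : Bounded ⟦ gram ⟧ᵐ
    gram-bounded = record
      { bound   = 1ℚ
      ; bound≥0 = <⇒≤ 1>0
      ; quad≥0  = λ x → subst (0ℚ ≤_) (sym (quad-gram x)) (sum-nonNeg λ i → square (full x i))
      ; square≤ = λ x i → subst (x i * x i ≤_) (trans (sym (quad-gram x)) (sym (*-identityˡ (quad ⟦ gram ⟧ᵐ x))))
                    (term≤sum {f = λ i → full x i * full x i} (λ i → square (full x i)) (suc (suc i)))
      }

    module _ (H-inj : ∀ {i j} → H i ≡ H j → i ≡ j) where

      gram≥4 : ∀ x → NonZeroVector x → ι 4 ≤ q[ ⟦ gram ⟧ᵐ ] x
      gram≥4 x (i , ne) = subst (ι 4 ≤_) (trans (sum-cong λ i → cong₂ _*_ (⟦fullᶻ⟧ x i) (⟦fullᶻ⟧ x i)) (sym (quad-gram ⟦ x ⟧ᵛ)))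
        (norm≥4 H H-inj (fullᶻ x) (trans (sum-cong (⟦fullᶻ⟧ x)) (sum-full ⟦ x ⟧ᵛ))
          (trans (sum-cong λ i → cong (η i *_) (⟦fullᶻ⟧ x i)) (sum-H-full ⟦ x ⟧ᵛ)) (suc (suc i) , ne))

      module Parallelogram {a b c e : Fin (2 ℕ.+ d)} (balance : H a ℕ.+ H b ≡ H c ℕ.+ H e)
        (a≢b : a ≢ b) (a≢c : a ≢ c) (a≢e : a ≢ e) (b≢c : b ≢ c) (b≢e : b ≢ e) (c≢e : c ≢ e) where

        Y : Fin (2 ℕ.+ d) → ℤ
        Y i = δᶻ a i ℤ.+ δᶻ b i ℤ.- (δᶻ c i ℤ.+ δᶻ e i)

        ⟦Y⟧ : ∀ i → ⟦ Y i ⟧ ≡ δ a i + δ b i - (δ c i + δ e i)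
        ⟦Y⟧ i = trans (⟦⟧-- (δᶻ a i ℤ.+ δᶻ b i) (δᶻ c i ℤ.+ δᶻ e i)) (cong₂ _-_ (⟦⟧-+ (δᶻ a i) (δᶻ b i)) (⟦⟧-+ (δᶻ c i) (δᶻ e i)))

        pair : ∀ (f : Fin (2 ℕ.+ d) → ℚ) → sum (λ i → f i * ⟦ Y i ⟧) ≡ f a + f b - (f c + f e)
        pair f = trans (sum-cong λ i → trans (cong (f i *_) (⟦Y⟧ i))
            (solve 5 (λ f a b c e → f :* (a :+ b :- (c :+ e)) := (a :* f :+ b :* f) :- (c :* f :+ e :* f)) refl (f i) (δ a i) (δ b i) (δ c i) (δ e i)))
          (trans (sum-- (λ i → δ a i * f i + δ b i * f i) (λ i → δ c i * f i + δ e i * f i))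
            (cong₂ _-_ (trans (sum-+ (λ i → δ a i * f i) (λ i → δ b i * f i)) (cong₂ _+_ (sum-δ a f) (sum-δ b f)))
                       (trans (sum-+ (λ i → δ c i * f i) (λ i → δ e i * f i)) (cong₂ _+_ (sum-δ c f) (sum-δ e f)))))

        ΣY : sum (λ i → ⟦ Y i ⟧) ≡ 0ℚ
        ΣY = trans (sum-cong λ i → sym (*-identityˡ ⟦ Y i ⟧)) (pair λ _ → 1ℚ)

        ΣHY : sum (λ i → η i * ⟦ Y i ⟧) ≡ 0ℚ
        ΣHY = trans (pair η) (trans (cong₂ _-_ (trans (sym (ι-+ (H a) (H b))) (cong ι balance)) (sym (ι-+ (H c) (H e)))) (+-inverseʳ (ι (H c ℕ.+ H e))))

        Yᵃ : Y a ≡ + 1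
        Yᵃ = cong₂ ℤ._-_ (cong₂ ℤ._+_ (δ-refl a) (δ-≢ (a≢b ∘ sym))) (cong₂ ℤ._+_ (δ-≢ (a≢c ∘ sym)) (δ-≢ (a≢e ∘ sym)))
        Yᵇ : Y b ≡ + 1
        Yᵇ = cong₂ ℤ._-_ (cong₂ ℤ._+_ (δ-≢ a≢b) (δ-refl b)) (cong₂ ℤ._+_ (δ-≢ (b≢c ∘ sym)) (δ-≢ (b≢e ∘ sym)))
        Yᶜ : Y c ≡ -[1+ 0 ]
        Yᶜ = cong₂ ℤ._-_ (cong₂ ℤ._+_ (δ-≢ a≢c) (δ-≢ b≢c)) (cong₂ ℤ._+_ (δ-refl c) (δ-≢ (c≢e ∘ sym)))
        Yᵉ : Y e ≡ -[1+ 0 ]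
        Yᵉ = cong₂ ℤ._-_ (cong₂ ℤ._+_ (δ-≢ a≢e) (δ-≢ b≢e)) (cong₂ ℤ._+_ (δ-≢ c≢e) (δ-refl e))

        ΣY² : sum (λ i → ⟦ Y i ⟧ * ⟦ Y i ⟧) ≡ ι 4
        ΣY² = trans (pair λ i → ⟦ Y i ⟧) (cong₂ _-_ (cong₂ _+_ (cong ⟦_⟧ Yᵃ) (cong ⟦_⟧ Yᵇ)) (cong₂ _+_ (cong ⟦_⟧ Yᶜ) (cong ⟦_⟧ Yᵉ)))

        vector : ℤ^ d
        vector i = Y (suc (suc i))

        full-vector : ∀ i → full ⟦ vector ⟧ᵛ i ≡ ⟦ Y i ⟧
        full-vector = full-tail (λ i → ⟦ Y i ⟧) ΣY ΣHY

        vector-norm : q[ ⟦ gram ⟧ᵐ ] vector ≡ ι 4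
        vector-norm = trans (quad-gram ⟦ vector ⟧ᵛ) (trans (sum-cong λ i → cong₂ _*_ (full-vector i) (full-vector i)) ΣY²)

        vector-min : Min ⟦ gram ⟧ᵐ vector
        vector-min = nonzero (nonZeroVector? vector) , λ w nw → ≤-trans (≤-reflexive vector-norm) (gram≥4 w nw)
          where
          nonzero : Dec (NonZeroVector vector) → NonZeroVector vector
          nonzero (yes nz) = nz
          nonzero (no ¬nz) = contradiction (trans (sym vector-norm) (bil-0ˡ ⟦ gram ⟧ᵐ ⟦ vector ⟧ᵛ λ i → cong ⟦_⟧ (vanish i (vector i ℤ.≟ + 0)))) λ ()
            where
            vanish : ∀ i → Dec (vector i ≡ + 0) → vector i ≡ + 0
            vanish i (yes eq) = eq
            vanish i (no ne)  = contradiction (i , ne) ¬nz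

  -- Perfection of the family.

  record Shape {d} (H : Fin (2 ℕ.+ d) → ℕ) (m P : ℕ) : Set where
    field
      H₀    : H zero ≡ 0
      H₁    : H (suc zero) ≡ 1
      H-inj : ∀ {i j} → H i ≡ H j → i ≡ j
      core  : ℕ → Fin (2 ℕ.+ d)
      H-core : ∀ {v} → v ℕ.≤ m → H (core v) ≡ v
      -- Leaves the gap at `m + 1`.
      place : ∀ i → H i ℕ.≤ m ⊎ (m ℕ.+ 2 ℕ.≤ H i × H i ℕ.≤ m ℕ.+ P)

  -- C is the matrix of A on the differences of consecutive points.  The
  -- parallelograms force C i j to have the form M i + M j, and M vanishes because
  -- the first two rows of A do.
  module Flat (m : ℕ) (10≤m : 10 ℕ.≤ m) (A : ℕ → ℕ → ℚ) (symA : ∀ i j → A i j ≡ A j i)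
    (A₀ : ∀ j → A 0 j ≡ 0ℚ) (A₁ : ∀ j → A 1 j ≡ 0ℚ)
    (rel : ∀ a b c e → c ℕ.< a → a ℕ.< b → b ℕ.< e → e ℕ.≤ m → c ℕ.+ e ≡ a ℕ.+ b →
      (A c c + A c e - A c a - A c b) + (A e c + A e e - A e a - A e b) - (A a c + A a e - A a a - A a b) - (A b c + A b e - A b a - A b b) ≡ 0ℚ) where

    -- Value of the bilinear form `A` on the differences `e (g + i) - e i` and `e (g + j) - e j`.
    block : ℕ → ℕ → ℕ → ℚ
    block g i j = A (g ℕ.+ i) (g ℕ.+ j) - A (g ℕ.+ i) j - A i (g ℕ.+ j) + A i j

    block-sym : ∀ g i j → block g i j ≡ block g j i
    block-sym g i j = trans (cong₂ _+_ (cong₂ _-_ (cong₂ _-_ (symA (g ℕ.+ i) (g ℕ.+ j)) (symA (g ℕ.+ i) j)) (symA i (g ℕ.+ j))) (symA i j))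
      (solve 4 (λ a b c d → a :- b :- c :+ d := a :- c :- b :+ d) refl (A (g ℕ.+ j) (g ℕ.+ i)) (A j (g ℕ.+ i)) (A (g ℕ.+ j) i) (A j i))

    -- The parallelogram with outer points `i`, `g + j` and inner points `g + i`, `j` is the
    -- difference of two translates of the same step `g`.
    block-rel : ∀ g i j → 0 ℕ.< g → g ℕ.+ i ℕ.< j → g ℕ.+ j ℕ.≤ m → block g i i + block g j j ≡ block g i j + block g i j
    block-rel g i j 0<g i<j j≤m = begin
      block g i i + block g j j
        ≡⟨ expand (A i i) (A i j′) (A i i′) (A i j) (A j′ i) (A j′ j′) (A j′ i′) (A j′ j) (A i′ i) (A i′ j′) (A i′ i′) (A i′ j) (A j i) (A j j′) (A j i′) (A j j) ⟩
      K + (block g i j + block g j i)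
        ≡⟨ cong (_+ (block g i j + block g j i)) (rel i′ j i j′ (ℕ.m<n+m i 0<g) i<j (ℕ.m<n+m j 0<g) j≤m
             (solveⁿ 3 (λ g i j → i ⊞ (g ⊞ j) ≗′ g ⊞ i ⊞ j) refl g i j)) ⟩
      0ℚ + (block g i j + block g j i)
        ≡⟨ trans (+-identityˡ (block g i j + block g j i)) (cong (_+_ (block g i j)) (block-sym g j i)) ⟩
      block g i j + block g i j ∎
      where
      open ≡-Reasoning
      i′ = g ℕ.+ i
      j′ = g ℕ.+ j
      K = (A i i + A i j′ - A i i′ - A i j) + (A j′ i + A j′ j′ - A j′ i′ - A j′ j) - (A i′ i + A i′ j′ - A i′ i′ - A i′ j) - (A j i + A j j′ - A j i′ - A j j)
      expand : ∀ ii ij′ ii′ ij j′i j′j′ j′i′ j′j i′i i′j′ i′i′ i′j ji jj′ ji′ jj →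
        (i′i′ - i′i - ii′ + ii) + (j′j′ - j′j - jj′ + jj) ≡
        ((ii + ij′ - ii′ - ij) + (j′i + j′j′ - j′i′ - j′j) - (i′i + i′j′ - i′i′ - i′j) - (ji + jj′ - ji′ - jj)) + ((i′j′ - i′j - ij′ + ij) + (j′i′ - j′i - ji′ + ji))
      expand ii ij′ ii′ ij j′i j′j′ j′i′ j′j i′i i′j′ i′i′ i′j ji jj′ ji′ jj = begin
        (i′i′ - i′i - ii′ + ii) + (j′j′ - j′j - jj′ + jj)
          ≡⟨ solve 8 (λ a b c d e f g h → (a :- b :- c :+ d) :+ (e :- f :- g :+ h) := (d :- c) :+ (e :- f) :- (b :- a) :- (g :- h)) refl i′i′ i′i ii′ ii j′j′ j′j jj′ jj ⟩
        (ii - ii′) + (j′j′ - j′j) - (i′i - i′i′) - (jj′ - jj)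
          ≡⟨ solve 8 (λ p q r s w x y z → p :+ q :- r :- s := ((p :+ w :- x) :+ (q :+ y :- z) :- r :- s) :+ (x :- w :+ (z :- y))) refl (ii - ii′) (j′j′ - j′j) (i′i - i′i′) (jj′ - jj) ij′ ij j′i j′i′ ⟩
        ((ii - ii′ + ij′ - ij) + (j′j′ - j′j + j′i - j′i′) - (i′i - i′i′) - (jj′ - jj)) + (ij - ij′ + (j′i′ - j′i))
          ≡⟨ solve 8 (λ p q r s w x y z → (p :+ q :- r :- s) :+ (w :+ x) := (p :+ q :- (r :+ y) :- (s :+ z)) :+ ((y :+ w) :+ (x :+ z))) refl
               (ii - ii′ + ij′ - ij) (j′j′ - j′j + j′i - j′i′) (i′i - i′i′) (jj′ - jj) (ij - ij′) (j′i′ - j′i) (i′j′ - i′j) (ji - ji′) ⟩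
        ((ii - ii′ + ij′ - ij) + (j′j′ - j′j + j′i - j′i′) - (i′i - i′i′ + (i′j′ - i′j)) - (jj′ - jj + (ji - ji′))) + ((i′j′ - i′j + (ij - ij′)) + (j′i′ - j′i + (ji - ji′)))
          ≡⟨ cong₂ _+_ (cong₂ _-_ (cong₂ _-_ (cong₂ _+_ (re₁ ii ii′ ij′ ij) (re₂ j′j′ j′j j′i j′i′)) (re₃ i′i i′i′ i′j′ i′j)) (re₄ jj′ jj ji ji′)) (cong₂ _+_ (re₅ i′j′ i′j ij ij′) (re₅ j′i′ j′i ji ji′)) ⟩
        _ ∎
        where
        re₁ : ∀ a b c e → a - b + c - e ≡ a + c - b - e
        re₁ = solve 4 (λ a b c e → a :- b :+ c :- e := a :+ c :- b :- e) refl
        re₂ : ∀ a b c e → a - b + c - e ≡ c + a - e - b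
        re₂ = solve 4 (λ a b c e → a :- b :+ c :- e := c :+ a :- e :- b) refl
        re₃ : ∀ a b c e → a - b + (c - e) ≡ a + c - b - e
        re₃ = solve 4 (λ a b c e → a :- b :+ (c :- e) := a :+ c :- b :- e) refl
        re₄ : ∀ a b c e → a - b + (c - e) ≡ c + a - e - b
        re₄ = solve 4 (λ a b c e → a :- b :+ (c :- e) := c :+ a :- e :- b) refl
        re₅ : ∀ a b c e → a - b + (c - e) ≡ a - b - e + c
        re₅ = solve 4 (λ a b c e → a :- b :+ (c :- e) := a :- b :- e :+ c) refl

    C : ℕ → ℕ → ℚ
    C = block 1

    M : ℕ → ℚ
    M i = C i i

    halve : ∀ {p q} → p + p ≡ q + q → p ≡ q
    halve {p} {q} eq = trans (solve 1 (λ p → p := con ½ :* (p :+ p)) refl p) (trans (cong (½ *_) eq) (solve 1 (λ q → con ½ :* (q :+ q) := q) refl q))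

    far : ∀ i j → 2 ℕ.+ i ℕ.≤ j → j ℕ.< m → M i + M j ≡ C i j + C i j
    far i j = block-rel 1 i j (s≤s z≤n)

    block₂ : ∀ i j → block 2 i j ≡ C i j + C i (suc j) + (C (suc i) j + C (suc i) (suc j))
    block₂ i j = solve 9 (λ a b c d e f g h k → a :- b :- c :+ d := (e :- f :- g :+ d) :+ (h :- e :- c :+ g) :+ ((k :- b :- e :+ f) :+ (a :- k :- h :+ e))) refl
      (A (2 ℕ.+ i) (2 ℕ.+ j)) (A (2 ℕ.+ i) j) (A i (2 ℕ.+ j)) (A i j) (A (suc i) (suc j)) (A (suc i) j) (A i (suc j)) (A (suc i) (2 ℕ.+ j)) (A (2 ℕ.+ i) (suc j))

    -- Defect of `M i + M j = 2 C i j` at neighbours: for `j = i + 1` the parallelogram of step 1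
    -- degenerates, so `far` leaves this case open.
    τ : ℕ → ℚ
    τ i = C i (suc i) + C i (suc i) - M i - M (suc i)

    block₂-diag : ∀ i → block 2 i i ≡ M i + (C i (suc i) + C i (suc i)) + M (suc i)
    block₂-diag i = trans (block₂ i i) (trans (cong (λ t → M i + C i (suc i) + (t + M (suc i))) (block-sym 1 (suc i) i))
      (solve 3 (λ a b c → a :+ b :+ (b :+ c) := a :+ (b :+ b) :+ c) refl (M i) (C i (suc i)) (M (suc i))))

    -- Parallelograms of step 2. Their diagonal blocks involve neighbours and contain `τ i` and
    -- `τ j`, while the mixed block consists of entries of `C` covered by `far`.
    τ-opposite : ∀ i j → 3 ℕ.+ i ℕ.≤ j → 2 ℕ.+ j ℕ.≤ m → τ i + τ j ≡ 0ℚ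
    τ-opposite i j i<j j≤m = begin
      τ i + τ j
        ≡⟨ solve 6 (λ a b c d e f → (a :- b :- c) :+ (d :- e :- f) := (b :+ a :+ c) :+ (e :+ d :+ f) :- ((b :+ c :+ (e :+ f)) :+ (b :+ c :+ (e :+ f)))) refl
             (C i (suc i) + C i (suc i)) (M i) (M (suc i)) (C j (suc j) + C j (suc j)) (M j) (M (suc j)) ⟩
      (M i + (C i (suc i) + C i (suc i)) + M (suc i)) + (M j + (C j (suc j) + C j (suc j)) + M (suc j)) - (Σ₄ + Σ₄)
        ≡⟨ cong (_- (Σ₄ + Σ₄)) (trans (cong₂ _+_ (sym (block₂-diag i)) (sym (block₂-diag j))) (trans (block-rel 2 i j (s≤s z≤n) i<j j≤m) (cong₂ _+_ cross cross))) ⟩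
      (Σ₄ + Σ₄) - (Σ₄ + Σ₄)
        ≡⟨ +-inverseʳ (Σ₄ + Σ₄) ⟩
      0ℚ ∎
      where
      open ≡-Reasoning
      Σ₄ = M i + M (suc i) + (M j + M (suc j))
      j<m = ℕ.≤-trans (ℕ.n≤1+n (suc j)) j≤m
      cross : block 2 i j ≡ Σ₄
      cross = halve (begin
        block 2 i j + block 2 i j
          ≡⟨ cong₂ _+_ (block₂ i j) (block₂ i j) ⟩
        _ ≡⟨ solve 4 (λ a b c d → (a :+ b :+ (c :+ d)) :+ (a :+ b :+ (c :+ d)) := ((a :+ a) :+ (b :+ b)) :+ ((c :+ c) :+ (d :+ d))) refl (C i j) (C i (suc j)) (C (suc i) j) (C (suc i) (suc j)) ⟩
        ((C i j + C i j) + (C i (suc j) + C i (suc j))) + ((C (suc i) j + C (suc i) j) + (C (suc i) (suc j) + C (suc i) (suc j)))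
          ≡⟨ cong₂ _+_ (cong₂ _+_ (sym (far i j (ℕ.≤-trans (ℕ.n≤1+n (2 ℕ.+ i)) i<j) j<m)) (sym (far i (suc j) (ℕ.≤-trans (ℕ.n≤1+n (2 ℕ.+ i)) (ℕ.≤-trans i<j (ℕ.n≤1+n j))) j≤m)))
               (cong₂ _+_ (sym (far (suc i) j i<j j<m)) (sym (far (suc i) (suc j) (ℕ.≤-trans i<j (ℕ.n≤1+n j)) j≤m))) ⟩
        _ ≡⟨ solve 4 (λ a b c d → ((a :+ c) :+ (a :+ d)) :+ ((b :+ c) :+ (b :+ d)) := (a :+ b :+ (c :+ d)) :+ (a :+ b :+ (c :+ d))) refl (M i) (M (suc i)) (M j) (M (suc j)) ⟩
        Σ₄ + Σ₄ ∎)

    opposite-0 : ∀ {p q} → p ≡ 0ℚ → p + q ≡ 0ℚ → q ≡ 0ℚ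
    opposite-0 {q = q} p≡0 eq = trans (sym (+-identityˡ q)) (trans (cong (_+ q) (sym p≡0)) eq)

    -- The indices 0, 3 and 6 are pairwise at distance at least 3, so the three values are pairwise
    -- opposite and hence zero.
    τ₀ : τ 0 ≡ 0ℚ
    τ₀ = halve {τ 0} {0ℚ} (trans (solve 3 (λ a b c → a :+ a := (a :+ b) :+ (a :+ c) :- (b :+ c)) refl (τ 0) (τ 3) (τ 6))
      (cong₂ _-_ (cong₂ _+_ (τ-opposite 0 3 ℕ.≤-refl (ℕ.≤-trans (ℕ.m≤m+n 5 5) 10≤m)) (τ-opposite 0 6 (ℕ.m≤m+n 3 3) (ℕ.≤-trans (ℕ.m≤m+n 8 2) 10≤m)))
        (τ-opposite 3 6 ℕ.≤-refl (ℕ.≤-trans (ℕ.m≤m+n 8 2) 10≤m))))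

    τ₆ : τ 6 ≡ 0ℚ
    τ₆ = opposite-0 τ₀ (τ-opposite 0 6 (ℕ.m≤m+n 3 3) (ℕ.≤-trans (ℕ.m≤m+n 8 2) 10≤m))

    τ≡0 : ∀ i → 2 ℕ.+ i ℕ.≤ m → τ i ≡ 0ℚ
    τ≡0 0 _ = τ₀
    τ≡0 1 _ = opposite-0 τ₆ (trans (+-comm (τ 6) (τ 1)) (τ-opposite 1 6 (ℕ.m≤m+n 4 2) (ℕ.≤-trans (ℕ.m≤m+n 8 2) 10≤m)))
    τ≡0 2 _ = opposite-0 τ₆ (trans (+-comm (τ 6) (τ 2)) (τ-opposite 2 6 (ℕ.m≤m+n 5 1) (ℕ.≤-trans (ℕ.m≤m+n 8 2) 10≤m)))
    τ≡0 i@(suc (suc (suc _))) i≤m = opposite-0 τ₀ (τ-opposite 0 i (s≤s (s≤s (s≤s z≤n))) i≤m)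

    M+M : ∀ j k → suc (j ℕ.+ k) ℕ.≤ m → M j + M (j ℕ.+ k) ≡ C j (j ℕ.+ k) + C j (j ℕ.+ k)
    M+M j zero h = subst (λ t → M j + M t ≡ C j t + C j t) (sym (ℕ.+-identityʳ j)) refl
    M+M j (suc zero) h = subst (λ t → M j + M t ≡ C j t + C j t) (ℕ.+-comm 1 j)
      (sym (p-q≡0⇒p≡q (C j (suc j) + C j (suc j)) (M j + M (suc j)) (trans (solve 3 (λ c a b → c :- (a :+ b) := c :- a :- b) refl (C j (suc j) + C j (suc j)) (M j) (M (suc j))) (τ≡0 j (subst (λ t → suc t ℕ.≤ m) (ℕ.+-comm j 1) h)))))
    M+M j (suc (suc k)) h = far j (j ℕ.+ suc (suc k)) (subst (ℕ._≤ j ℕ.+ suc (suc k)) (ℕ.+-comm j 2) (ℕ.+-monoʳ-≤ j (s≤s (s≤s z≤n)))) h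

    C₀ : ∀ j → C 0 j ≡ 0ℚ
    C₀ j = trans (cong₂ (λ p q → p - q - A 0 (suc j) + A 0 j) (A₁ (suc j)) (A₁ j)) (cong₂ (λ p q → 0ℚ - 0ℚ - p + q) (A₀ (suc j)) (A₀ j))

    M≡0 : ∀ j → suc j ℕ.≤ m → M j ≡ 0ℚ
    M≡0 j h = trans (sym (+-identityˡ (M j))) (trans (cong (_+ M j) (sym (C₀ 0))) (trans (M+M 0 j h) (cong₂ _+_ (C₀ j) (C₀ j))))

    C≡0 : ∀ j k → suc (j ℕ.+ k) ℕ.≤ m → C j (j ℕ.+ k) ≡ 0ℚ
    C≡0 j k h = halve {C j (j ℕ.+ k)} {0ℚ} (trans (sym (M+M j k h)) (cong₂ _+_ (M≡0 j (ℕ.≤-trans (s≤s (ℕ.m≤m+n j k)) h)) (M≡0 (j ℕ.+ k) h)))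

    C≡0′ : ∀ i j → suc i ℕ.≤ m → suc j ℕ.≤ m → C i j ≡ 0ℚ
    C≡0′ i j i<m j<m = by-order (ℕ.≤-total i j)
      where
      ordered : ∀ {i j} → i ℕ.≤ j → suc j ℕ.≤ m → C i j ≡ 0ℚ
      ordered {i} {j} i≤j j<m = subst (λ t → C i t ≡ 0ℚ) (ℕ.m+[n∸m]≡n i≤j) (C≡0 i (j ℕ.∸ i) (subst (λ t → suc t ℕ.≤ m) (sym (ℕ.m+[n∸m]≡n i≤j)) j<m))
      by-order : i ℕ.≤ j ⊎ j ℕ.≤ i → C i j ≡ 0ℚ
      by-order (inj₁ i≤j) = ordered i≤j j<m
      by-order (inj₂ j≤i) = trans (block-sym 1 i j) (ordered j≤i i<m)

    A≡0 : ∀ i j → i ℕ.≤ m → j ℕ.≤ m → A i j ≡ 0ℚ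
    A≡0 zero    j       _   _   = A₀ j
    A≡0 (suc i) zero    _   _   = trans (symA (suc i) 0) (A₀ (suc i))
    A≡0 (suc i) (suc j) i<m j<m = trans (solve 4 (λ a b c d → a := (a :- b :- c :+ d) :+ b :+ c :- d) refl (A (suc i) (suc j)) (A (suc i) j) (A i (suc j)) (A i j))
      (cong₂ _-_ (cong₂ _+_ (cong₂ _+_ (C≡0′ i j i<m j<m) (A≡0 (suc i) j i<m (ℕ.<⇒≤ j<m))) (A≡0 i (suc j) (ℕ.<⇒≤ i<m) j<m)) (A≡0 i j (ℕ.<⇒≤ i<m) (ℕ.<⇒≤ j<m)))

  module BalancedPerfect {d} (H : Fin (2 ℕ.+ d) → ℕ) {m₁ P : ℕ} (shape : Shape H (suc m₁) P) (big : 3 ℕ.* P ℕ.+ 20 ℕ.≤ m₁) where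
    open Shape shape
    open Balanced H H₀ H₁

    private
      m = suc m₁
      N = 2 ℕ.+ d

      10≤m : 10 ℕ.≤ m
      10≤m = ℕ.≤-trans (ℕ.m≤m+n 10 10) (ℕ.≤-trans (ℕ.m≤n+m 20 (3 ℕ.* P)) (ℕ.≤-trans big (ℕ.n≤1+n m₁)))

    perfect : Perfect ⟦ gram ⟧ᵐ
    perfect S symS kill i j = trans (sym (bil-δ S i j)) (all-0 (suc (suc i)) (suc (suc j)))
      where
      tl : Vec N → Vec d
      tl Y i = Y (suc (suc i))
      -- `S` extended to all `N` coordinates. The tails of the first two basis vectors are zero,
      -- which provides the two vanishing rows that `Flat` starts from.
      s : Fin N → Fin N → ℚ
      s a b = bil S (tl (δ a)) (tl (δ b))
      s-sym : ∀ a b → s a b ≡ s b a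
      s-sym a b = bil-sym symS (tl (δ a)) (tl (δ b))
      relation : ∀ {a b c e} → H a ℕ.+ H b ≡ H c ℕ.+ H e → a ≢ b → a ≢ c → a ≢ e → b ≢ c → b ≢ e → c ≢ e →
        (s a a + s a b - s a c - s a e) + (s b a + s b b - s b c - s b e) - (s c a + s c b - s c c - s c e) - (s e a + s e b - s e c - s e e) ≡ 0ℚ
      relation {a} {b} {c} {e} bal ab ac ae bc be ce = trans (sym (trans (combination (λ u → bil S u V) (λ x y → bil-+ˡ S x y V) (λ k x → bil-*ˡ S k x V) (λ {x} {y} h → bil-cong {A = S} {x = x} {y} {V} {V} (λ _ _ → refl) h (λ _ → refl)))
          (cong₂ _-_ (cong₂ _-_ (cong₂ _+_ (row a) (row b)) (row c)) (row e)))) (kill vector vector-min)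
        where
        open Parallelogram H-inj {a} {b} {c} {e} bal ab ac ae bc be ce
        V = ⟦ vector ⟧ᵛ
        combination : ∀ (φ : Vec d → ℚ) → (∀ x y → φ (λ i → x i + y i) ≡ φ x + φ y) → (∀ k x → φ (λ i → k * x i) ≡ k * φ x) → (∀ {x y} → (∀ i → x i ≡ y i) → φ x ≡ φ y) →
          φ V ≡ φ (tl (δ a)) + φ (tl (δ b)) - φ (tl (δ c)) - φ (tl (δ e))
        combination φ φ-+ φ-* φ-cong = begin
          φ V
            ≡⟨ φ-cong (λ i → trans (⟦Y⟧ (suc (suc i))) (solve 4 (λ a b c e → a :+ b :- (c :+ e) := (a :+ b) :+ con (- 1ℚ) :* (c :+ e)) refl (tl (δ a) i) (tl (δ b) i) (tl (δ c) i) (tl (δ e) i))) ⟩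
          φ (λ i → (tl (δ a) i + tl (δ b) i) + - 1ℚ * (tl (δ c) i + tl (δ e) i))
            ≡⟨ trans (φ-+ (λ i → tl (δ a) i + tl (δ b) i) (λ i → - 1ℚ * (tl (δ c) i + tl (δ e) i)))
                 (cong₂ _+_ (φ-+ (tl (δ a)) (tl (δ b))) (trans (φ-* (- 1ℚ) (λ i → tl (δ c) i + tl (δ e) i)) (cong (- 1ℚ *_) (φ-+ (tl (δ c)) (tl (δ e)))))) ⟩
          (φ (tl (δ a)) + φ (tl (δ b))) + - 1ℚ * (φ (tl (δ c)) + φ (tl (δ e)))
            ≡⟨ solve 4 (λ a b c e → (a :+ b) :+ con (- 1ℚ) :* (c :+ e) := a :+ b :- c :- e) refl (φ (tl (δ a))) (φ (tl (δ b))) (φ (tl (δ c))) (φ (tl (δ e))) ⟩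
          φ (tl (δ a)) + φ (tl (δ b)) - φ (tl (δ c)) - φ (tl (δ e)) ∎
          where open ≡-Reasoning
        row : ∀ u → bil S (tl (δ u)) V ≡ s u a + s u b - s u c - s u e
        row u = combination (bil S (tl (δ u))) (bil-+ʳ S (tl (δ u))) (λ k x → bil-*ʳ S k (tl (δ u)) x) (λ {x} {y} h → bil-cong {A = S} {x = tl (δ u)} {tl (δ u)} {x} {y} (λ _ _ → refl) (λ _ → refl) h)
      s-zero : ∀ v → v ℕ.≤ 1 → ∀ b → s (core v) b ≡ 0ℚ
      s-zero 0 _ b = trans (cong (λ c → s c b) (H-inj {core 0} {zero} (trans (H-core z≤n) (sym H₀)))) (bil-0ˡ S (tl (δ b)) λ _ → refl)
      s-zero 1 _ b = trans (cong (λ c → s c b) (H-inj {core 1} {suc zero} (trans (H-core (s≤s z≤n)) (sym H₁)))) (bil-0ˡ S (tl (δ b)) λ _ → refl)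
      s-zero (suc (suc v)) (s≤s ()) b
      core≢ : ∀ {v w} → v ℕ.≤ m → w ℕ.≤ m → v ℕ.< w → core v ≢ core w
      core≢ v≤ w≤ v<w eq = ℕ.<-irrefl (trans (sym (H-core v≤)) (trans (cong H eq) (H-core w≤))) v<w
      core-0 : ∀ v w → v ℕ.≤ m → w ℕ.≤ m → s (core v) (core w) ≡ 0ℚ
      core-0 = Flat.A≡0 m 10≤m (λ v w → s (core v) (core w)) (λ v w → s-sym (core v) (core w)) (λ w → s-zero 0 z≤n (core w)) (λ w → s-zero 1 (s≤s z≤n) (core w))
        λ a b c e c<a a<b b<e e≤m eq →
          let b≤ = ℕ.≤-trans (ℕ.<⇒≤ b<e) e≤m ; a≤ = ℕ.≤-trans (ℕ.<⇒≤ a<b) b≤ ; c≤ = ℕ.≤-trans (ℕ.<⇒≤ c<a) a≤ ; c<b = ℕ.<-trans c<a a<b ; a<e = ℕ.<-trans a<b b<e in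
          relation {core c} {core e} {core a} {core b} (trans (cong₂ ℕ._+_ (H-core c≤) (H-core e≤m)) (trans eq (sym (cong₂ ℕ._+_ (H-core a≤) (H-core b≤)))))
            (core≢ c≤ e≤m (ℕ.<-trans c<b b<e)) (core≢ c≤ a≤ c<a) (core≢ c≤ b≤ c<b) (core≢ a≤ e≤m a<e ∘ sym) (core≢ b≤ e≤m b<e ∘ sym) (core≢ a≤ b≤ a<b)
      core-of : ∀ i → H i ℕ.≤ m → core (H i) ≡ i
      core-of i h = H-inj (H-core h)
      -- The row `r` of a point `e` of height `m₁ + u` vanishes at heights 0 and 1, so it suffices
      -- that its increments `ρ` agree; they are compared through relations of `e` with three core
      -- points.
      module Extra (e : Fin N) (lo : m ℕ.+ 2 ℕ.≤ H e) (hi : H e ℕ.≤ m ℕ.+ P) where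
        u = H e ℕ.∸ m₁
        u+m₁ : m₁ ℕ.+ u ≡ H e
        u+m₁ = ℕ.m+[n∸m]≡n (ℕ.≤-trans (ℕ.n≤1+n m₁) (ℕ.≤-trans (ℕ.m≤m+n m 2) lo))
        3≤u : 3 ℕ.≤ u
        3≤u = ℕ.+-cancelˡ-≤ m₁ 3 u (subst₂ ℕ._≤_ (trans (cong suc (ℕ.+-comm m₁ 2)) (ℕ.+-comm 3 m₁)) (sym u+m₁) lo)
        u≤ : u ℕ.≤ P ℕ.+ 1
        u≤ = ℕ.+-cancelˡ-≤ m₁ u (P ℕ.+ 1) (subst₂ ℕ._≤_ (sym u+m₁) (trans (cong suc refl) (solveⁿ 2 (λ m p → conⁿ 1 ⊞ m ⊞ p ≗′ m ⊞ (p ⊞ conⁿ 1)) refl m₁ P)) hi)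
        3u<m₁ : 3 ℕ.* u ℕ.+ 1 ℕ.≤ m₁
        3u<m₁ = ℕ.≤-trans (ℕ.+-monoˡ-≤ 1 (ℕ.*-monoʳ-≤ 3 u≤)) (ℕ.≤-trans (ℕ.≤-trans (ℕ.≤-reflexive (solveⁿ 1 (λ p → conⁿ 3 ⊗ⁿ (p ⊞ conⁿ 1) ⊞ conⁿ 1 ≗′ conⁿ 3 ⊗ⁿ p ⊞ conⁿ 4) refl P)) (ℕ.+-monoʳ-≤ (3 ℕ.* P) (ℕ.m≤m+n 4 16))) big)
        e≢core : ∀ {v} → v ℕ.≤ m → e ≢ core v
        e≢core v≤ eq = ℕ.<-irrefl (trans (sym (H-core v≤)) (cong H (sym eq))) (ℕ.≤-<-trans v≤ (ℕ.≤-trans (ℕ.m<m+n m (s≤s z≤n)) lo))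
        r : ℕ → ℚ
        r v = s e (core v)
        extra-relation : ∀ {a b c} → a ℕ.< c → c ℕ.< b → b ℕ.≤ m → H e ℕ.+ a ≡ b ℕ.+ c → s e e + (r a + r a) ≡ (r b + r b) + (r c + r c)
        extra-relation {a} {b} {c} a<c c<b b≤ eq = p-q≡0⇒p≡q (s e e + (r a + r a)) ((r b + r b) + (r c + r c)) (begin
          s e e + (r a + r a) - ((r b + r b) + (r c + r c))
            ≡⟨ solve 4 (λ x a b c → x :+ (a :+ a) :- ((b :+ b) :+ (c :+ c)) := (x :+ a :- b :- c) :+ (a :+ con 0ℚ :- con 0ℚ :- con 0ℚ) :- (b :+ con 0ℚ :- con 0ℚ :- con 0ℚ) :- (c :+ con 0ℚ :- con 0ℚ :- con 0ℚ)) refl (s e e) (r a) (r b) (r c) ⟩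
          (s e e + r a - r b - r c) + (r a + 0ℚ - 0ℚ - 0ℚ) - (r b + 0ℚ - 0ℚ - 0ℚ) - (r c + 0ℚ - 0ℚ - 0ℚ)
            ≡⟨ sym (cong₂ _-_ (cong₂ _-_ (cong (_+_ (s e e + r a - r b - r c)) (core-row a≤)) (core-row b≤)) (core-row c≤)) ⟩
          _ ≡⟨ relation {e} {core a} {core b} {core c} (trans (cong (H e ℕ.+_) (H-core a≤)) (trans eq (sym (cong₂ ℕ._+_ (H-core b≤) (H-core c≤)))))
                 (e≢core a≤) (e≢core b≤) (e≢core c≤) (core≢ a≤ b≤ (ℕ.<-trans a<c c<b)) (core≢ a≤ c≤ a<c) (core≢ c≤ b≤ c<b ∘ sym) ⟩
          0ℚ ∎)
          where
          open ≡-Reasoning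
          c≤ = ℕ.≤-trans (ℕ.<⇒≤ c<b) b≤
          a≤ = ℕ.≤-trans (ℕ.<⇒≤ a<c) c≤
          core-row : ∀ {v} → v ℕ.≤ m → s (core v) e + s (core v) (core a) - s (core v) (core b) - s (core v) (core c) ≡ r v + 0ℚ - 0ℚ - 0ℚ
          core-row {v} v≤ = cong₂ _-_ (cong₂ _-_ (cong₂ _+_ (s-sym (core v) e) (core-0 v a v≤ a≤)) (core-0 v b v≤ b≤)) (core-0 v c v≤ c≤)
        ρ : ℕ → ℚ
        ρ v = r (suc v) - r v
        -- Difference of the relations for `(a, b, c)` and `(a + 1, b + 1, c)`.
        shift : ∀ {a b c} → suc a ℕ.< c → c ℕ.< b → suc b ℕ.≤ m → H e ℕ.+ a ≡ b ℕ.+ c → ρ a ≡ ρ b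
        shift {a} {b} {c} a<c c<b b<m eq = double-cancel (trans
          (solve 6 (λ x a b a′ b′ c → (a′ :- a) :+ (a′ :- a) := (x :+ (a′ :+ a′)) :- (x :+ (a :+ a))) refl (s e e) (r a) (r b) (r (suc a)) (r (suc b)) (r c))
          (trans (cong₂ _-_ (extra-relation a<c (ℕ.<-trans c<b ℕ.≤-refl) b<m (trans (ℕ.+-suc (H e) a) (cong suc eq))) (extra-relation (ℕ.<-trans ℕ.≤-refl a<c) c<b (ℕ.<⇒≤ b<m) eq))
            (solve 3 (λ b b′ c → ((b′ :+ b′) :+ (c :+ c)) :- ((b :+ b) :+ (c :+ c)) := (b′ :- b) :+ (b′ :- b)) refl (r b) (r (suc b)) (r c))))
          where
          double-cancel : ∀ {p q} → p + p ≡ q + q → p ≡ q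
          double-cancel {p} {q} eq = trans (solve 1 (λ p → p := con ½ :* (p :+ p)) refl p) (trans (cong (½ *_) eq) (solve 1 (λ q → con ½ :* (q :+ q) := q) refl q))
        r-0 : ∀ v → v ℕ.≤ 1 → r v ≡ 0ℚ
        r-0 v v≤1 = trans (s-sym e (core v)) (s-zero v v≤1 e)
        ρ₀ : ρ 0 ≡ 0ℚ
        ρ₀ = cong₂ _-_ (r-0 1 (s≤s z≤n)) (r-0 0 z≤n)
        -- From the relation `H e + b = m₁ + (u + b)`.
        low : ∀ b → u ℕ.+ b ℕ.< m₁ → ρ b ≡ ρ m₁
        low b h = shift {b} {m₁} {u ℕ.+ b} (ℕ.+-monoˡ-≤ b (ℕ.≤-trans (s≤s (s≤s z≤n)) 3≤u)) h ℕ.≤-refl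
          (trans (cong (ℕ._+ b) (sym u+m₁)) (ℕ.+-assoc m₁ u b))
        u<m₁ : u ℕ.+ 0 ℕ.< m₁
        u<m₁ = ℕ.≤-trans (ℕ.≤-trans (ℕ.≤-reflexive (cong suc (ℕ.+-identityʳ u))) (ℕ.≤-trans (ℕ.+-monoˡ-≤ u (s≤s (z≤n {0}))) (ℕ.≤-trans (ℕ.m≤m+n (1 ℕ.+ u) (u ℕ.+ u)) (ℕ.≤-reflexive (solveⁿ 1 (λ u → conⁿ 1 ⊞ u ⊞ (u ⊞ u) ≗′ conⁿ 3 ⊗ⁿ u ⊞ conⁿ 1) refl u))))) 3u<m₁
        ρ-m₁ : ρ m₁ ≡ 0ℚ
        ρ-m₁ = trans (sym (low 0 u<m₁)) ρ₀
        -- From `H e + 0 = b + (H e - b)`. The last term lies below `b` because `3 u < m₁`, which is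
        -- what the factor 3 in `big` provides.
        high : ∀ b → b ℕ.≤ m₁ → m₁ ℕ.≤ u ℕ.+ b → ρ b ≡ 0ℚ
        high b b≤ h = trans (sym (shift {0} {b} {H e ℕ.∸ b} 1<c c<b (s≤s b≤) (trans (ℕ.+-identityʳ (H e)) (sym (ℕ.m+[n∸m]≡n b≤t))))) ρ₀
          where
          b≤t : b ℕ.≤ H e
          b≤t = ℕ.≤-trans b≤ (subst (m₁ ℕ.≤_) u+m₁ (ℕ.m≤m+n m₁ u))
          1<c : 1 ℕ.< H e ℕ.∸ b
          1<c = ℕ.≤-trans (ℕ.≤-trans (s≤s (s≤s z≤n)) 3≤u) (ℕ.m+n≤o⇒m≤o∸n u (subst (u ℕ.+ b ℕ.≤_) (trans (ℕ.+-comm u m₁) u+m₁) (ℕ.+-monoʳ-≤ u b≤)))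
          c<b : H e ℕ.∸ b ℕ.< b
          c<b = ℕ.+-cancelˡ-< b (H e ℕ.∸ b) b (subst (ℕ._< b ℕ.+ b) (sym (ℕ.m+[n∸m]≡n b≤t)) (ℕ.+-cancelˡ-< (u ℕ.+ u) (H e) (b ℕ.+ b) (begin-strict
            u ℕ.+ u ℕ.+ H e                        ≡⟨ trans (cong (u ℕ.+ u ℕ.+_) (sym u+m₁)) (solveⁿ 2 (λ u m → u ⊞ u ⊞ (m ⊞ u) ≗′ conⁿ 3 ⊗ⁿ u ⊞ m) refl u m₁) ⟩
            3 ℕ.* u ℕ.+ m₁                         <⟨ ℕ.+-monoˡ-< m₁ (subst (ℕ._≤ m₁) (ℕ.+-comm (3 ℕ.* u) 1) 3u<m₁) ⟩
            m₁ ℕ.+ m₁                              ≤⟨ ℕ.+-mono-≤ h h ⟩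
            u ℕ.+ b ℕ.+ (u ℕ.+ b)                  ≡⟨ solveⁿ 2 (λ u b → u ⊞ b ⊞ (u ⊞ b) ≗′ u ⊞ u ⊞ (b ⊞ b)) refl u b ⟩
            u ℕ.+ u ℕ.+ (b ℕ.+ b)                  ∎)))
            where open ℕ.≤-Reasoning
        ρ≡0 : ∀ b → b ℕ.≤ m₁ → ρ b ≡ 0ℚ
        ρ≡0 b b≤ = split (u ℕ.+ b ℕ.<? m₁)
          where
          split : Dec (u ℕ.+ b ℕ.< m₁) → ρ b ≡ 0ℚ
          split (yes h) = trans (low b h) ρ-m₁
          split (no h)  = high b b≤ (ℕ.≮⇒≥ h)
        r≡0 : ∀ v → v ℕ.≤ m → r v ≡ 0ℚ
        r≡0 zero    _   = r-0 0 z≤n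
        r≡0 (suc v) v≤ = trans (p-q≡0⇒p≡q (r (suc v)) (r v) (ρ≡0 v (ℕ.≤-pred v≤))) (r≡0 v (ℕ.<⇒≤ v≤))
        see≡0 : s e e ≡ 0ℚ
        see≡0 = trans (solve 1 (λ x → x := x :+ (con 0ℚ :+ con 0ℚ)) refl (s e e)) (trans (cong (λ t → s e e + (t + t)) (sym (r≡0 0 z≤n)))
          (trans (extra-relation {0} {m₁} {u ℕ.+ 0} (ℕ.≤-trans (ℕ.≤-trans (s≤s z≤n) 3≤u) (ℕ.m≤m+n u 0)) u<m₁ (ℕ.n≤1+n m₁) (trans (cong (ℕ._+ 0) (sym u+m₁)) (ℕ.+-assoc m₁ u 0)))
            (cong₂ (λ p q → (p + p) + (q + q)) (r≡0 m₁ (ℕ.n≤1+n m₁)) (r≡0 (u ℕ.+ 0) (ℕ.≤-trans (ℕ.<⇒≤ u<m₁) (ℕ.n≤1+n m₁))))))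
      -- In the relation of `e` and a core point with `e′` and the core point 0, all values but
      -- `s e e′` are known to be zero, and this one occurs with factor -2.
      extra-pair : ∀ e e′ → m ℕ.+ 2 ℕ.≤ H e → H e ℕ.≤ m ℕ.+ P → m ℕ.+ 2 ℕ.≤ H e′ → H e′ ℕ.≤ m ℕ.+ P → H e ℕ.< H e′ → s e e′ ≡ 0ℚ
      extra-pair e e′ lo hi lo′ hi′ lt = begin
        s e e′
          ≡⟨ solve 1 (λ x → x := con (- ½) :* ((con 0ℚ :+ con 0ℚ :- x :- con 0ℚ) :+ (con 0ℚ :+ con 0ℚ :- con 0ℚ :- con 0ℚ) :- (x :+ con 0ℚ :- con 0ℚ :- con 0ℚ) :- (con 0ℚ :+ con 0ℚ :- con 0ℚ :- con 0ℚ))) refl (s e e′) ⟩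
        - ½ * ((0ℚ + 0ℚ - s e e′ - 0ℚ) + (0ℚ + 0ℚ - 0ℚ - 0ℚ) - (s e e′ + 0ℚ - 0ℚ - 0ℚ) - (0ℚ + 0ℚ - 0ℚ - 0ℚ))
          ≡⟨ cong (- ½ *_) (sym (cong₂ _-_ (cong₂ _-_ (cong₂ _+_
               (cong₂ _-_ (cong (_- s e e′) (cong₂ _+_ X.see≡0 (X.r≡0 a a≤))) (X.r≡0 0 z≤n))
               (cong₂ _-_ (cong₂ _-_ (cong₂ _+_ (trans (s-sym (core a) e) (X.r≡0 a a≤)) (core-0 a a a≤ a≤)) (trans (s-sym (core a) e′) (X′.r≡0 a a≤))) (core-0 a 0 a≤ z≤n)))
               (cong₂ _-_ (cong₂ _-_ (cong₂ _+_ (s-sym e′ e) (X′.r≡0 a a≤)) X′.see≡0) (X′.r≡0 0 z≤n)))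
               (cong₂ _-_ (cong₂ _-_ (cong₂ _+_ (trans (s-sym (core 0) e) (X.r≡0 0 z≤n)) (core-0 0 a z≤n a≤)) (trans (s-sym (core 0) e′) (X′.r≡0 0 z≤n))) (core-0 0 0 z≤n z≤n)))) ⟩
        - ½ * ((s e e + s e (core a) - s e e′ - s e (core 0)) + (s (core a) e + s (core a) (core a) - s (core a) e′ - s (core a) (core 0))
          - (s e′ e + s e′ (core a) - s e′ e′ - s e′ (core 0)) - (s (core 0) e + s (core 0) (core a) - s (core 0) e′ - s (core 0) (core 0)))
          ≡⟨ cong (- ½ *_) (relation {e} {core a} {e′} {core 0} (trans (cong (H e ℕ.+_) (H-core a≤)) (trans (ℕ.m+[n∸m]≡n (ℕ.<⇒≤ lt)) (sym (trans (cong (H e′ ℕ.+_) (H-core z≤n)) (ℕ.+-identityʳ (H e′))))))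
               (X.e≢core a≤) (λ eq → ℕ.<-irrefl (cong H eq) lt) (X.e≢core z≤n) (X′.e≢core a≤ ∘ sym) (core≢ z≤n a≤ (ℕ.m<n⇒0<n∸m lt) ∘ sym) (X′.e≢core z≤n)) ⟩
        0ℚ ∎
        where
        open ≡-Reasoning
        module X = Extra e lo hi
        module X′ = Extra e′ lo′ hi′
        a = H e′ ℕ.∸ H e
        a≤ : a ℕ.≤ m
        a≤ = ℕ.≤-trans (ℕ.∸-mono hi′ (ℕ.≤-trans (ℕ.m≤m+n m 2) lo)) (ℕ.≤-trans (ℕ.≤-reflexive (ℕ.m+n∸m≡n m P))
          (ℕ.≤-trans (ℕ.≤-trans (ℕ.m≤m+n P (2 ℕ.* P)) (ℕ.≤-trans (ℕ.m≤m+n (3 ℕ.* P) 20) big)) (ℕ.n≤1+n m₁)))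
      all-0 : ∀ a b → s a b ≡ 0ℚ
      all-0 a b = by-place (place a) (place b)
        where
        by-place : H a ℕ.≤ m ⊎ (m ℕ.+ 2 ℕ.≤ H a × H a ℕ.≤ m ℕ.+ P) → H b ℕ.≤ m ⊎ (m ℕ.+ 2 ℕ.≤ H b × H b ℕ.≤ m ℕ.+ P) → s a b ≡ 0ℚ
        by-place (inj₁ p) (inj₁ q) = trans (cong₂ s (sym (core-of a p)) (sym (core-of b q))) (core-0 (H a) (H b) p q)
        by-place (inj₁ p) (inj₂ (lo , hi)) = trans (cong (λ c → s c b) (sym (core-of a p))) (trans (s-sym (core (H a)) b) (Extra.r≡0 b lo hi (H a) p))
        by-place (inj₂ (lo , hi)) (inj₁ q) = trans (cong (s a) (sym (core-of b q))) (Extra.r≡0 a lo hi (H b) q)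
        by-place (inj₂ (lo , hi)) (inj₂ (lo′ , hi′)) = by-cmp (ℕ.<-cmp (H a) (H b))
          where
          by-cmp : Relation.Binary.Definitions.Tri (H a ℕ.< H b) (H a ≡ H b) (H b ℕ.< H a) → s a b ≡ 0ℚ
          by-cmp (tri< lt _ _) = extra-pair a b lo hi lo′ hi′ lt
          by-cmp (tri≈ _ eq _) = trans (cong (s a) (sym (H-inj eq))) (Extra.see≡0 a lo hi)
          by-cmp (tri> _ _ gt) = trans (s-sym a b) (extra-pair b a lo′ hi′ lo hi gt)

    balanced-good : Good gram
    balanced-good = record { symmetric = symmetric ; bounded = gram-bounded ; perfect = perfect ; coprime = prim }
      where
      symmetric : ∀ i j → gram i j ≡ gram j i
      symmetric i j = cong₂ ℤ._+_ (cong₂ ℤ._+_ (δ-sym i j) (ℤ.*-comm (+ h i) (+ h j))) (ℤ.*-comm (+ h i ℤ.- + 1) (+ h j ℤ.- + 1))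
      tail-index : ∀ v → 2 ℕ.≤ v → v ℕ.≤ m → ∃[ i ] h i ≡ v
      tail-index v 2≤v v≤m = locate (core v) refl
        where
        locate : ∀ c → c ≡ core v → ∃[ i ] h i ≡ v
        locate zero eq = contradiction (trans (sym H₀) (trans (cong H eq) (H-core v≤m))) λ 0≡v → ℕ.<-irrefl 0≡v (ℕ.≤-trans (s≤s z≤n) 2≤v)
        locate (suc zero) eq = contradiction (trans (sym H₁) (trans (cong H eq) (H-core v≤m))) λ 1≡v → ℕ.<-irrefl 1≡v 2≤v
        locate (suc (suc i)) eq = i , trans (cong H eq) (H-core v≤m)
      4≤m : 4 ℕ.≤ m
      4≤m = ℕ.≤-trans (ℕ.m≤m+n 4 6) 10≤m
      i₂ = tail-index 2 ℕ.≤-refl (ℕ.≤-trans (ℕ.m≤m+n 2 2) 4≤m)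
      i₃ = tail-index 3 (ℕ.n≤1+n 2) (ℕ.≤-trans (ℕ.m≤m+n 3 1) 4≤m)
      i₄ = tail-index 4 (ℕ.m≤m+n 2 2) 4≤m
      entry : ∀ {i j v w} → h i ≡ v → h j ≡ w → v ≢ w → gram i j ≡ + v ℤ.* + w ℤ.+ (+ v ℤ.- + 1) ℤ.* (+ w ℤ.- + 1)
      entry {i} {j} refl refl ne = trans (cong (λ t → t ℤ.+ + h i ℤ.* + h j ℤ.+ (+ h i ℤ.- + 1) ℤ.* (+ h j ℤ.- + 1)) (δ-≢ λ eq → ne (cong h eq)))
        (cong (ℤ._+ (+ h i ℤ.- + 1) ℤ.* (+ h j ℤ.- + 1)) (ℤ.+-identityˡ (+ h i ℤ.* + h j)))
      -- Heights 2, 3 and 2, 4 give the coprime entries 8 and 11.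
      prim : Primitive gram
      prim k k∣ = ℕ.∣1⇒≡1 (ℕ.∣m+n∣m⇒∣n {k} {8} {1} (ℕ.∣-trans k∣3 (ℕ.divides 3 refl)) k∣8)
        where
        k∣8 : k ℕ.∣ 8
        k∣8 = subst (λ z → k ℕ.∣ ℤ.∣ z ∣) (entry {proj₁ i₂} {proj₁ i₃} (proj₂ i₂) (proj₂ i₃) λ ()) (k∣ (proj₁ i₂) (proj₁ i₃))
        k∣11 : k ℕ.∣ 11
        k∣11 = subst (λ z → k ℕ.∣ ℤ.∣ z ∣) (entry {proj₁ i₂} {proj₁ i₄} (proj₂ i₂) (proj₂ i₄) λ ()) (k∣ (proj₁ i₂) (proj₁ i₄))
        k∣3 : k ℕ.∣ 3
        k∣3 = ℕ.∣m+n∣m⇒∣n {k} {8} {3} k∣11 k∣8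

  -- Rigidity of the family.

  -- X is Δ times the residual of the least squares approximation of z by affine
  -- functions of H; testing the bound on X itself gives Σ X² ≤ Δ².
  module Functional {d} (H : Fin (2 ℕ.+ d) → ℕ) {m P : ℕ} (shape : Shape H m P) (B ℓ τ : ℕ) (16<B : 16 ℕ.< B) (108<τ : 108 ℕ.< τ) (τ≤ℓ : 2 ℕ.* τ ℕ.+ 2 ℕ.≤ ℓ) (Bℓ≤m : B ℕ.* ℓ ℕ.≤ m) (P+ℓ≤m : P ℕ.+ ℓ ℕ.≤ m)
    (z : Fin (2 ℕ.+ d) → ℤ)
    (bounded : Balanced.BoundedFunctional H (Shape.H₀ shape) (Shape.H₁ shape) z) where

    open Shape shape
    open Balanced H H₀ H₁

    private
      N = 2 ℕ.+ d
      n = ι N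
      ζ : Fin N → ℚ
      ζ i = ⟦ z i ⟧
      S₁ᶻ = sumᶻ λ i → + H i
      S₂ᶻ = sumᶻ λ i → + H i ℤ.* + H i
      Z₀ᶻ = sumᶻ z
      Z₁ᶻ = sumᶻ λ i → + H i ℤ.* z i
      -- Cramer's rule: `Δ` is the determinant of the normal equations, and `α`, `β` are the
      -- numerators of the coefficients. Without division `X` stays integral, so `bounded` applies
      -- to it.
      Δᶻ = + N ℤ.* S₂ᶻ ℤ.- S₁ᶻ ℤ.* S₁ᶻ
      αᶻ = S₂ᶻ ℤ.* Z₀ᶻ ℤ.- S₁ᶻ ℤ.* Z₁ᶻ
      βᶻ = + N ℤ.* Z₁ᶻ ℤ.- S₁ᶻ ℤ.* Z₀ᶻ
      Xᶻ : Fin N → ℤ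
      Xᶻ i = Δᶻ ℤ.* z i ℤ.- (αᶻ ℤ.+ βᶻ ℤ.* + H i)
      S₁ = sum η
      S₂ = sum λ i → η i * η i
      Z₀ = sum ζ
      Z₁ = sum λ i → η i * ζ i
      Δ = n * S₂ - S₁ * S₁
      α = S₂ * Z₀ - S₁ * Z₁
      β = n * Z₁ - S₁ * Z₀
      X : Fin N → ℚ
      X i = Δ * ζ i - (α + β * η i)
      S₁≡ : ⟦ S₁ᶻ ⟧ ≡ S₁
      S₁≡ = ⟦⟧-sum λ i → + H i
      S₂≡ : ⟦ S₂ᶻ ⟧ ≡ S₂
      S₂≡ = trans (⟦⟧-sum λ i → + H i ℤ.* + H i) (sum-cong λ i → ⟦⟧-* (+ H i) (+ H i))
      Z₀≡ : ⟦ Z₀ᶻ ⟧ ≡ Z₀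
      Z₀≡ = ⟦⟧-sum z
      Z₁≡ : ⟦ Z₁ᶻ ⟧ ≡ Z₁
      Z₁≡ = trans (⟦⟧-sum λ i → + H i ℤ.* z i) (sum-cong λ i → ⟦⟧-* (+ H i) (z i))
      minor : ∀ a b c e → ⟦ a ℤ.* b ℤ.- c ℤ.* e ⟧ ≡ ⟦ a ⟧ * ⟦ b ⟧ - ⟦ c ⟧ * ⟦ e ⟧
      minor a b c e = trans (⟦⟧-- (a ℤ.* b) (c ℤ.* e)) (cong₂ _-_ (⟦⟧-* a b) (⟦⟧-* c e))
      ⟦Xᶻ⟧ : ∀ i → ⟦ Xᶻ i ⟧ ≡ X i
      ⟦Xᶻ⟧ i = trans (⟦⟧-- (Δᶻ ℤ.* z i) (αᶻ ℤ.+ βᶻ ℤ.* + H i)) (cong₂ _-_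
        (trans (⟦⟧-* Δᶻ (z i)) (cong (_* ζ i) (trans (minor (+ N) S₂ᶻ S₁ᶻ S₁ᶻ) (cong₂ (λ p q → n * p - q * q) S₂≡ S₁≡))))
        (trans (⟦⟧-+ αᶻ (βᶻ ℤ.* + H i)) (cong₂ _+_
          (trans (minor S₂ᶻ Z₀ᶻ S₁ᶻ Z₁ᶻ) (cong₂ _-_ (cong₂ _*_ S₂≡ Z₀≡) (cong₂ _*_ S₁≡ Z₁≡)))
          (trans (⟦⟧-* βᶻ (+ H i)) (cong (_* η i) (trans (minor (+ N) Z₁ᶻ S₁ᶻ Z₀ᶻ) (cong₂ (λ p q → n * p - q) Z₁≡ (cong₂ _*_ S₁≡ Z₀≡))))))))

      against : ∀ (w : Fin N → ℚ) → sum (λ i → w i * X i) ≡ Δ * sum (λ i → w i * ζ i) - (α * sum w + β * sum (λ i → w i * η i))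
      against w = begin
        sum (λ i → w i * X i)
          ≡⟨ sum-cong (λ i → solve 6 (λ w d z a b h → w :* (d :* z :- (a :+ b :* h)) := d :* (w :* z) :- (a :* w :+ b :* (w :* h))) refl (w i) Δ (ζ i) α β (η i)) ⟩
        sum (λ i → Δ * (w i * ζ i) - (α * w i + β * (w i * η i)))
          ≡⟨ sum-- (λ i → Δ * (w i * ζ i)) (λ i → α * w i + β * (w i * η i)) ⟩
        sum (λ i → Δ * (w i * ζ i)) - sum (λ i → α * w i + β * (w i * η i))
          ≡⟨ cong₂ _-_ (sum-* Δ λ i → w i * ζ i) (trans (sum-+ (λ i → α * w i) (λ i → β * (w i * η i))) (cong₂ _+_ (sum-* α w) (sum-* β λ i → w i * η i))) ⟩
        Δ * sum (λ i → w i * ζ i) - (α * sum w + β * sum (λ i → w i * η i)) ∎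
        where open ≡-Reasoning

      ΣX : sum X ≡ 0ℚ
      ΣX = trans (sum-cong λ i → sym (*-identityˡ (X i))) (trans (against λ _ → 1ℚ) (trans
        (cong₂ (λ p q → Δ * p - q) (sum-cong λ i → *-identityˡ (ζ i)) (cong₂ (λ p q → α * p + β * q) (trans (sum-const N 1ℚ) (*-identityʳ n)) (sum-cong λ i → *-identityˡ (η i))))
        (solve 5 (λ n s t y z → (n :* t :- s :* s) :* y :- ((t :* y :- s :* z) :* n :+ (n :* z :- s :* y) :* s) := con 0ℚ) refl n S₁ S₂ Z₀ Z₁)))

      ΣHX : sum (λ i → η i * X i) ≡ 0ℚ
      ΣHX = trans (against η) (solve 5 (λ n s t y z → (n :* t :- s :* s) :* z :- ((t :* y :- s :* z) :* s :+ (n :* z :- s :* y) :* t) := con 0ℚ) refl n S₁ S₂ Z₀ Z₁)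

      0<n : 0ℚ < n
      0<n = ι-mono-< {0} {N} (s≤s z≤n)

      -- `n Δ` is the squared length of `n η - S₁`, whose entries at heights 0 and 1 differ by `n`.
      0<Δ : 0ℚ < Δ
      0<Δ = ≰⇒> λ Δ≤0 → <-irrefl refl (begin-strict
        0ℚ                                            <⟨ *-pos 0<n 0<n ⟩
        n * n                                         ≡⟨ solve 1 (λ n → n :* n := n :* con 1ℚ :* (n :* con 1ℚ)) refl n ⟩
        n * 1ℚ * (n * 1ℚ)                             ≡⟨ cong (λ t → t * t) difference ⟩
        (Y one + - Y zero) * (Y one + - Y zero)       ≤⟨ square-+≤ (Y one) (- Y zero) ⟩
        (Y one * Y one + Y one * Y one) + (- Y zero * - Y zero + - Y zero * - Y zero)
          ≡⟨ solve 2 (λ a b → (a :* a :+ a :* a) :+ (:- b :* :- b :+ :- b :* :- b) := (b :* b :+ a :* a) :+ (b :* b :+ a :* a)) refl (Y one) (Y zero) ⟩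
        (Y zero * Y zero + Y one * Y one) + (Y zero * Y zero + Y one * Y one)
          ≤⟨ +-mono-≤ two two ⟩
        sum (λ i → Y i * Y i) + sum (λ i → Y i * Y i) ≡⟨ cong₂ _+_ ΣY² ΣY² ⟩
        n * Δ + n * Δ                                 ≤⟨ +-mono-≤ (nΔ≤0 Δ≤0) (nΔ≤0 Δ≤0) ⟩
        0ℚ + 0ℚ                                       ≡⟨⟩
        0ℚ                                            ∎)
        where
        open ≤-Reasoning
        one : Fin N
        one = suc zero
        Y : Fin N → ℚ
        Y i = n * η i - S₁
        two : Y zero * Y zero + Y one * Y one ≤ sum (λ i → Y i * Y i)
        two = sum-two (λ i → Y i * Y i) (λ i → square (Y i)) {zero} {one} λ ()
        nΔ≤0 : Δ ≤ 0ℚ → n * Δ ≤ 0ℚ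
        nΔ≤0 h = subst (n * Δ ≤_) (*-zeroʳ n) (*-monoʳ n (<⇒≤ 0<n) h)
        difference : n * 1ℚ ≡ Y one + - Y zero
        difference = trans (solve 2 (λ n s → n :* con 1ℚ := (n :* con 1ℚ :- s) :+ :- (n :* con 0ℚ :- s)) refl n S₁)
          (cong₂ (λ p q → (n * ι p - S₁) + - (n * ι q - S₁)) (sym H₁) (sym H₀))
        ΣY : sum Y ≡ 0ℚ
        ΣY = trans (sum-- (λ i → n * η i) (λ _ → S₁)) (trans (cong₂ _-_ (sum-* n η) (sum-const N S₁)) (+-inverseʳ (n * S₁)))
        Yη : sum (λ i → Y i * η i) ≡ Δ
        Yη = trans (sum-cong λ i → solve 3 (λ n h s → (n :* h :- s) :* h := n :* (h :* h) :- s :* h) refl n (η i) S₁)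
          (trans (sum-- (λ i → n * (η i * η i)) (λ i → S₁ * η i)) (cong₂ _-_ (sum-* n λ i → η i * η i) (sum-* S₁ η)))
        ΣY² : sum (λ i → Y i * Y i) ≡ n * Δ
        ΣY² = trans (sum-cong λ i → solve 4 (λ y n h s → y :* (n :* h :- s) := n :* (y :* h) :- s :* y) refl (Y i) n (η i) S₁)
          (trans (sum-- (λ i → n * (Y i * η i)) (λ i → S₁ * Y i)) (trans (cong₂ _-_ (trans (sum-* n λ i → Y i * η i) (cong (n *_) Yη)) (trans (sum-* S₁ Y) (cong (S₁ *_) ΣY)))
            (solve 2 (λ a s → a :- s :* con 0ℚ := a) refl (n * Δ) S₁)))

      X²≥0 : ∀ i → 0ℚ ≤ X i * X i
      X²≥0 i = square (X i)

      -- `X` is orthogonal to 1 and `η`, so its norm `Q` equals `Δ T`, where `T` is its pairing with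
      -- `z`. The assumption `T² ≤ Q` gives `Q² ≤ Δ² Q`.
      ΣX²≤ : sum (λ i → X i * X i) ≤ Δ * Δ
      ΣX²≤ = ≮⇒≥ λ lt → <-irrefl refl (begin-strict
        Q * (Δ * Δ)      <⟨ *-monoʳ-<-pos Q {{positive (≤-<-trans (square Δ) lt)}} lt ⟩
        Q * Q            ≡⟨ trans (cong (λ t → t * t) Q≡) (solve 2 (λ d t → d :* t :* (d :* t) := d :* d :* (t :* t)) refl Δ T) ⟩
        Δ * Δ * (T * T)  ≤⟨ *-monoʳ (Δ * Δ) (square Δ) T²≤Q ⟩
        Δ * Δ * Q        ≡⟨ *-comm (Δ * Δ) Q ⟩
        Q * (Δ * Δ)      ∎)
        where
        open ≤-Reasoning
        Q = sum (λ i → X i * X i)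
        T = sum (λ i → X i * ζ i)
        Q≡ : Q ≡ Δ * T
        Q≡ = trans (against X) (trans (cong₂ (λ p q → Δ * T - (α * p + β * q)) ΣX (trans (sum-cong λ i → *-comm (X i) (η i)) ΣHX))
          (solve 3 (λ t a b → t :- (a :* con 0ℚ :+ b :* con 0ℚ) := t) refl (Δ * T) α β))
        x : ℤ^ d
        x i = Xᶻ (suc (suc i))
        full-x : ∀ i → full ⟦ x ⟧ᵛ i ≡ X i
        full-x i = trans (full-tail (λ i → ⟦ Xᶻ i ⟧) (trans (sum-cong ⟦Xᶻ⟧) ΣX) (trans (sum-cong λ i → cong (η i *_) (⟦Xᶻ⟧ i)) ΣHX) i) (⟦Xᶻ⟧ i)
        T²≤Q : T * T ≤ Q
        T²≤Q = subst₂ _≤_ (cong (λ t → t * t) (sum-cong λ i → trans (cong (ζ i *_) (full-x i)) (*-comm (ζ i) (X i))))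
          (trans (quad-gram ⟦ x ⟧ᵛ) (sum-cong λ i → cong₂ _*_ (full-x i) (full-x i))) (bounded x)

      sum≤ : ∀ {k} (g : Fin k → Fin N) → (∀ {a b} → g a ≡ g b → a ≡ b) → sum (λ a → X (g a) * X (g a)) ≤ Δ * Δ
      sum≤ g inj = ≤-trans (sum-injective g inj (λ i → X i * X i) X²≥0) ΣX²≤

      D² = Δ * Δ
      0<D² : 0ℚ < D²
      0<D² = *-pos 0<Δ 0<Δ

      integral : ∀ w → Δ * ⟦ w ⟧ * (Δ * ⟦ w ⟧) < D² → w ≡ + 0
      integral w h = by-dec (w ℤ.≟ + 0)
        where
        by-dec : Dec (w ≡ + 0) → w ≡ + 0
        by-dec (yes eq) = eq
        by-dec (no ne) = contradiction (<-≤-trans h (subst₂ _≤_ (*-identityʳ D²) (solve 2 (λ d w → d :* d :* (w :* w) := d :* w :* (d :* w)) refl Δ ⟦ w ⟧)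
          (*-monoʳ D² (<⇒≤ 0<D²) (square≥1 w ne)))) (<-irrefl refl)

      core-injective : ∀ {v w} → v ℕ.≤ m → w ℕ.≤ m → core v ≡ core w → v ≡ w
      core-injective v≤ w≤ eq = trans (sym (H-core v≤)) (trans (cong H eq) (H-core w≤))

      ℓ₀ : Fin ℓ
      ℓ₀ = F.fromℕ< {0} (ℕ.≤-trans (ℕ.≤-trans (s≤s z≤n) (ℕ.m≤n+m 2 (2 ℕ.* τ))) τ≤ℓ)

      in-core : ∀ {k} → k ℕ.< B ℕ.* ℓ → k ℕ.≤ m
      in-core h = ℕ.≤-trans (ℕ.<⇒≤ h) Bℓ≤m

      blockSum : Fin B → ℚ
      blockSum t = sum {ℓ} λ a → X (core (toℕ (F.combine t a))) * X (core (toℕ (F.combine t a)))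

      ΣblockSum≤ : sum blockSum ≤ D²
      ΣblockSum≤ = ≤-trans (≤-reflexive (sym (sum-combine B λ p → X (core (toℕ p)) * X (core (toℕ p)))))
        (sum≤ (core ∘ toℕ {B ℕ.* ℓ}) λ {a} {b} eq → F.toℕ-injective (core-injective (in-core (F.toℕ<n a)) (in-core (F.toℕ<n b)) eq))

      -- More than 16 disjoint blocks share a total of at most `Δ²`. The 16 is what `block-affine`
      -- needs: four terms, and another 4 from `four-squares`.
      quietBlock : ∃[ t ] ι 16 * blockSum t < D²
      quietBlock = by-dec (F.any? λ t → ι 16 * blockSum t <? D²)
        where
        by-dec : Dec (∃[ t ] ι 16 * blockSum t < D²) → ∃[ t ] ι 16 * blockSum t < D²
        by-dec (yes p) = p
        by-dec (no ¬p) = contradiction (<-≤-trans (*-monoˡ-<-pos D² {{positive 0<D²}} (ι-mono-< {16} {B} 16<B))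
          (≤-trans (≤-reflexive (sym (sum-const B D²))) (≤-trans (sum-mono {B} {λ _ → D²} {λ t → ι 16 * blockSum t} λ t → ≮⇒≥ λ lt → ¬p (t , lt))
            (≤-trans (≤-reflexive (sum-* (ι 16) blockSum)) (*-monoʳ (ι 16) (0≤ι 16) ΣblockSum≤))))) (<-irrefl refl)

      w₀ : ℕ
      w₀ = toℕ (F.combine {B} {ℓ} (proj₁ quietBlock) ℓ₀)

      block-index : ∀ t (a : Fin ℓ) → toℕ (F.combine {B} {ℓ} t a) ≡ toℕ (F.combine {B} {ℓ} t ℓ₀) ℕ.+ toℕ a
      block-index t a = trans (F.toℕ-combine t a) (cong (ℕ._+ toℕ a) (sym (trans (F.toℕ-combine {B} {ℓ} t ℓ₀)
        (trans (cong (ℓ ℕ.* toℕ t ℕ.+_) (F.toℕ-fromℕ< _)) (ℕ.+-identityʳ (ℓ ℕ.* toℕ t))))))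

      block≤m : ∀ {k} → k ℕ.< ℓ → w₀ ℕ.+ k ℕ.≤ m
      block≤m {k} h = in-core (subst (ℕ._< B ℕ.* ℓ) (trans (block-index (proj₁ quietBlock) (F.fromℕ< h)) (cong (w₀ ℕ.+_) (F.toℕ-fromℕ< h))) (F.toℕ<n (F.combine (proj₁ quietBlock) (F.fromℕ< h))))

      quiet : ∀ {k} → k ℕ.< ℓ → ι 16 * (X (core (w₀ ℕ.+ k)) * X (core (w₀ ℕ.+ k))) < D²
      quiet {k} h = ≤-<-trans (*-monoʳ (ι 16) (0≤ι 16) (subst (λ v → X (core v) * X (core v) ≤ blockSum t)
          (trans (block-index t (F.fromℕ< h)) (cong (w₀ ℕ.+_) (F.toℕ-fromℕ< h)))
          (term≤sum {f = λ a → X (core (toℕ (F.combine t a))) * X (core (toℕ (F.combine t a)))} (λ a → square (X (core (toℕ (F.combine t a))))) (F.fromℕ< h))))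
        (proj₂ quietBlock)
        where t = proj₁ quietBlock

      four-squares : ∀ p q r s → (p + q - r - s) * (p + q - r - s) ≤ ι 4 * (p * p + q * q + r * r + s * s)
      four-squares p q r s = ≤-by ((p - q) * (p - q) + (r - s) * (r - s) + (p + r) * (p + r) + (p + s) * (p + s) + (q + r) * (q + r) + (q + s) * (q + s))
        (+-nonNeg (+-nonNeg (+-nonNeg (+-nonNeg (+-nonNeg (square (p - q)) (square (r - s))) (square (p + r))) (square (p + s))) (square (q + r))) (square (q + s)))
        (solve 4 (λ p q r s → (p :+ q :- r :- s) :* (p :+ q :- r :- s) :+ ((p :- q) :* (p :- q) :+ (r :- s) :* (r :- s) :+ (p :+ r) :* (p :+ r) :+ (p :+ s) :* (p :+ s) :+ (q :+ r) :* (q :+ r) :+ (q :+ s) :* (q :+ s))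
          := con (ι 4) :* (p :* p :+ q :* q :+ r :* r :+ s :* s)) refl p q r s)

      a₀ b₀ : ℤ
      b₀ = z (core (w₀ ℕ.+ 1)) ℤ.- z (core (w₀ ℕ.+ 0))
      a₀ = z (core (w₀ ℕ.+ 0)) ℤ.- b₀ ℤ.* + w₀

      z′ : Fin N → ℤ
      z′ i = z i ℤ.- (a₀ ℤ.+ b₀ ℤ.* + H i)

      ⟦z′⟧ : ∀ i → ⟦ z′ i ⟧ ≡ ζ i - (⟦ a₀ ⟧ + ⟦ b₀ ⟧ * η i)
      ⟦z′⟧ i = trans (⟦⟧-- (z i) (a₀ ℤ.+ b₀ ℤ.* + H i)) (cong (λ t → ζ i - t) (trans (⟦⟧-+ a₀ (b₀ ℤ.* + H i)) (cong (_+_ ⟦ a₀ ⟧) (⟦⟧-* b₀ (+ H i)))))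

      -- The affine part of `X` cancels in a balanced combination, leaving an integral multiple of
      -- `Δ`; it must vanish once its square is below `Δ²`.
      balanced : ∀ {i j k l} → H i ℕ.+ H j ≡ H k ℕ.+ H l → X i + X j - X k - X l ≡ Δ * ⟦ z i ℤ.+ z j ℤ.- z k ℤ.- z l ⟧
      balanced {i} {j} {k} {l} eq = begin
        X i + X j - X k - X l
          ≡⟨ solve 11 (λ d a b zi zj zk zl hi hj hk hl → (d :* zi :- (a :+ b :* hi)) :+ (d :* zj :- (a :+ b :* hj)) :- (d :* zk :- (a :+ b :* hk)) :- (d :* zl :- (a :+ b :* hl))
               := d :* (zi :+ zj :- zk :- zl) :- b :* ((hi :+ hj) :- (hk :+ hl))) refl Δ α β (ζ i) (ζ j) (ζ k) (ζ l) (η i) (η j) (η k) (η l) ⟩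
        Δ * (ζ i + ζ j - ζ k - ζ l) - β * ((η i + η j) - (η k + η l))
          ≡⟨ cong (λ t → Δ * (ζ i + ζ j - ζ k - ζ l) - β * t) (trans (cong₂ _-_ (trans (sym (ι-+ (H i) (H j))) (cong ι eq)) (sym (ι-+ (H k) (H l)))) (+-inverseʳ (ι (H k ℕ.+ H l)))) ⟩
        Δ * (ζ i + ζ j - ζ k - ζ l) - β * 0ℚ
          ≡⟨ solve 2 (λ a b → a :- b :* con 0ℚ := a) refl (Δ * (ζ i + ζ j - ζ k - ζ l)) β ⟩
        Δ * (ζ i + ζ j - ζ k - ζ l)
          ≡⟨ cong (Δ *_) (sym (trans (⟦⟧-- (z i ℤ.+ z j ℤ.- z k) (z l)) (cong (_- ζ l) (trans (⟦⟧-- (z i ℤ.+ z j) (z k)) (cong (_- ζ k) (⟦⟧-+ (z i) (z j))))))) ⟩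
        Δ * ⟦ z i ℤ.+ z j ℤ.- z k ℤ.- z l ⟧ ∎
        where open ≡-Reasoning

      block-affine : ∀ {a b c e} → a ℕ.< ℓ → b ℕ.< ℓ → c ℕ.< ℓ → e ℕ.< ℓ → a ℕ.+ b ≡ c ℕ.+ e →
        z (core (w₀ ℕ.+ a)) ℤ.+ z (core (w₀ ℕ.+ b)) ℤ.- z (core (w₀ ℕ.+ c)) ℤ.- z (core (w₀ ℕ.+ e)) ≡ + 0
      block-affine {a} {b} {c} {e} a< b< c< e< eq = integral (z i ℤ.+ z j ℤ.- z k ℤ.- z l) (subst (λ t → t * t < D²) (balanced {i} {j} {k} {l} bal)
          (≤-<-trans (four-squares (X i) (X j) (X k) (X l)) (*-cancelˡ-<-nonNeg (ι 4) {{nonNegative (0≤ι 4)}} (subst₂ _<_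
            (solve 4 (λ p q r s → con (ι 16) :* p :+ con (ι 16) :* q :+ con (ι 16) :* r :+ con (ι 16) :* s := con (ι 4) :* (con (ι 4) :* (p :+ q :+ r :+ s))) refl (X i * X i) (X j * X j) (X k * X k) (X l * X l))
            (solve 1 (λ d → d :+ d :+ d :+ d := con (ι 4) :* d) refl D²)
            (+-mono-< (+-mono-< (+-mono-< (quiet a<) (quiet b<)) (quiet c<)) (quiet e<))))))
        where
        i = core (w₀ ℕ.+ a)
        j = core (w₀ ℕ.+ b)
        k = core (w₀ ℕ.+ c)
        l = core (w₀ ℕ.+ e)
        bal : H i ℕ.+ H j ≡ H k ℕ.+ H l
        bal = trans (cong₂ ℕ._+_ (H-core (block≤m a<)) (H-core (block≤m b<))) (trans
          (trans (solveⁿ 3 (λ w a b → w ⊞ a ⊞ (w ⊞ b) ≗′ w ⊞ w ⊞ (a ⊞ b)) refl w₀ a b) (trans (cong (w₀ ℕ.+ w₀ ℕ.+_) eq) (solveⁿ 3 (λ w a b → w ⊞ w ⊞ (a ⊞ b) ≗′ w ⊞ a ⊞ (w ⊞ b)) refl w₀ c e)))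
          (sym (cong₂ ℕ._+_ (H-core (block≤m c<)) (H-core (block≤m e<)))))

      z-block : ∀ k → k ℕ.< ℓ → z (core (w₀ ℕ.+ k)) ≡ z (core (w₀ ℕ.+ 0)) ℤ.+ b₀ ℤ.* + k
      z-block zero    _ = sym (trans (cong (ℤ._+_ (z (core (w₀ ℕ.+ 0)))) (ℤ.*-zeroʳ b₀)) (ℤ.+-identityʳ (z (core (w₀ ℕ.+ 0)))))
      z-block (suc k) h = begin
        zₛ
          ≡⟨ solveᶻ 4 (λ s o k i → s ≐ (s ⊕ o ⊖ k ⊖ i) ⊕ k ⊕ (i ⊖ o)) refl zₛ zₒ zₖ z₁ ⟩
        (zₛ ℤ.+ zₒ ℤ.- zₖ ℤ.- z₁) ℤ.+ zₖ ℤ.+ b₀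
          ≡⟨ cong₂ (λ p q → p ℤ.+ q ℤ.+ b₀) (block-affine {suc k} {0} {k} {1} h (ℕ.≤-<-trans z≤n h) (ℕ.<⇒≤ h) (ℕ.≤-<-trans (s≤s z≤n) h) (trans (ℕ.+-identityʳ (suc k)) (ℕ.+-comm 1 k))) (z-block k (ℕ.<⇒≤ h)) ⟩
        + 0 ℤ.+ (zₒ ℤ.+ b₀ ℤ.* + k) ℤ.+ b₀
          ≡⟨ solveᶻ 3 (λ o b k → conᶻ (+ 0) ⊕ (o ⊕ b ⊛ k) ⊕ b ≐ o ⊕ b ⊛ (conᶻ (+ 1) ⊕ k)) refl zₒ b₀ (+ k) ⟩
        zₒ ℤ.+ b₀ ℤ.* + suc k ∎
        where
        open ≡-Reasoning
        zₛ = z (core (w₀ ℕ.+ suc k))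
        zₒ = z (core (w₀ ℕ.+ 0))
        zₖ = z (core (w₀ ℕ.+ k))
        z₁ = z (core (w₀ ℕ.+ 1))

      z′-block : ∀ k → k ℕ.< ℓ → z′ (core (w₀ ℕ.+ k)) ≡ + 0
      z′-block k h = trans (cong₂ (λ p q → p ℤ.- (a₀ ℤ.+ b₀ ℤ.* q)) (z-block k h) (cong +_ (H-core (block≤m h))))
        (trans (cong (λ q → z (core (w₀ ℕ.+ 0)) ℤ.+ b₀ ℤ.* + k ℤ.- (a₀ ℤ.+ b₀ ℤ.* q)) (ℤ.pos-+ w₀ k))
          (solveᶻ 4 (λ o b k w → o ⊕ b ⊛ k ⊖ (o ⊖ b ⊛ w ⊕ b ⊛ (w ⊕ k)) ≐ conᶻ (+ 0)) refl (z (core (w₀ ℕ.+ 0))) b₀ (+ k) (+ w₀)))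

      -- Either the residual at `i` carries more than half of the total `Δ²`, or `z` agrees at `i`
      -- with the affine function of `H` read off from the quiet block.
      Fits : Fin N → Set
      Fits i = D² < X i * X i + X i * X i ⊎ z′ i ≡ + 0

      -- The weights suit `p² ≤ Δ² / 2`: then `Δ² ≤ (p + s)²` leaves `3 s² ≥ Δ² / 4`. With
      -- `three-squares` this is the 36 in `propagate`, and the three sums there turn it into 108.
      weighted : ∀ p s → (p + s) * (p + s) ≤ (1ℚ + ½) * (p * p) + ι 3 * (s * s)
      weighted p s = ≤-by (½ * ((p - (1ℚ + 1ℚ) * s) * (p - (1ℚ + 1ℚ) * s))) (*-nonNeg (<⇒≤ ½>0) (square (p - (1ℚ + 1ℚ) * s)))
        (solve 2 (λ p s → (p :+ s) :* (p :+ s) :+ con ½ :* ((p :- (con 1ℚ :+ con 1ℚ) :* s) :* (p :- (con 1ℚ :+ con 1ℚ) :* s)) := (con 1ℚ :+ con ½) :* (p :* p) :+ con (ι 3) :* (s :* s)) refl p s)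

      three-squares : ∀ a b c → (a - b - c) * (a - b - c) ≤ ι 3 * (a * a + b * b + c * c)
      three-squares a b c = ≤-by ((a + b) * (a + b) + (a + c) * (a + c) + (b - c) * (b - c)) (+-nonNeg (+-nonNeg (square (a + b)) (square (a + c))) (square (b - c)))
        (solve 3 (λ a b c → (a :- b :- c) :* (a :- b :- c) :+ ((a :+ b) :* (a :+ b) :+ (a :+ c) :* (a :+ c) :+ (b :- c) :* (b :- c)) := con (ι 3) :* (a :* a :+ b :* b :+ c :* c)) refl a b c)

      -- If z′ x ≠ 0 but X x is small, each of the τ > 108 triples contributes at
      -- least Δ² / 36 to one of three sums bounded by Δ².
      propagate : ∀ x (U V W : Fin τ → Fin N) → (∀ {k l} → U k ≡ U l → k ≡ l) → (∀ {k l} → V k ≡ V l → k ≡ l) → (∀ {k l} → W k ≡ W l → k ≡ l) →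
        (∀ k → H x ℕ.+ H (U k) ≡ H (V k) ℕ.+ H (W k)) → (∀ k → Fits (U k)) → (∀ k → Fits (V k)) → (∀ k → Fits (W k)) → Fits x
      propagate x U V W injA injB injC bal fA fB fC = by-dec (z′ x ℤ.≟ + 0) (D² <? X x * X x + X x * X x)
        where
        open ≤-Reasoning
        by-dec : Dec (z′ x ≡ + 0) → Dec (D² < X x * X x + X x * X x) → Fits x
        by-dec (yes eq) _       = inj₂ eq
        by-dec (no _) (yes big) = inj₁ big
        by-dec (no ne) (no ¬big) = contradiction (<-≤-trans (*-monoˡ-<-pos D² {{positive 0<D²}} (ι-mono-< {108} {τ} 108<τ)) (begin
          ι τ * D²                                     ≡⟨ sym (sum-const τ D²) ⟩
          sum {τ} (λ _ → D²)                           ≤⟨ sum-mono {τ} {λ _ → D²} {λ k → ι 36 * ρ k} heavy ⟩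
          sum (λ k → ι 36 * ρ k)                         ≡⟨ trans (sum-* (ι 36) ρ) (cong (ι 36 *_) (trans (sum-+ (λ k → sqA k + sqB k) sqC) (cong (_+ sum sqC) (sum-+ sqA sqB)))) ⟩
          ι 36 * (sum sqA + sum sqB + sum sqC)           ≤⟨ *-monoʳ (ι 36) (0≤ι 36) (+-mono-≤ (+-mono-≤ (sum≤ U injA) (sum≤ V injB)) (sum≤ W injC)) ⟩
          ι 36 * (D² + D² + D²)                          ≡⟨ solve 1 (λ d → con (ι 36) :* (d :+ d :+ d) := con (ι 108) :* d) refl D² ⟩
          ι 108 * D²                                     ∎)) (<-irrefl refl)
          where
          sqA sqB sqC ρ : Fin τ → ℚ
          sqA k = X (U k) * X (U k)
          sqB k = X (V k) * X (V k)
          sqC k = X (W k) * X (W k)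
          ρ k = sqA k + sqB k + sqC k
          one-big : ∀ k {p} → D² < p + p → p ≤ ρ k → D² ≤ ι 36 * ρ k
          one-big k {p} h p≤ρ = ≤-trans (<⇒≤ h) (≤-trans (+-mono-≤ p≤ρ p≤ρ) (≤-by (ι 34 * ρ k) (*-nonNeg (0≤ι 34) ρ≥0)
            (solve 1 (λ r → (r :+ r) :+ con (ι 34) :* r := con (ι 36) :* r) refl (ρ k))))
            where ρ≥0 = +-nonNeg (+-nonNeg (square (X (U k))) (square (X (V k)))) (square (X (W k)))
          heavy : ∀ k → D² ≤ ι 36 * ρ k
          heavy k = by-fits (fA k) (fB k) (fC k)
            where
            by-fits : Fits (U k) → Fits (V k) → Fits (W k) → D² ≤ ι 36 * ρ k
            by-fits (inj₁ h) _ _ = one-big k {sqA k} h (≤-by (sqB k + sqC k) (+-nonNeg (square (X (V k))) (square (X (W k)))) (sym (+-assoc (sqA k) (sqB k) (sqC k))))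
            by-fits (inj₂ _) (inj₁ h) _ = one-big k {sqB k} h (≤-by (sqA k + sqC k) (+-nonNeg (square (X (U k))) (square (X (W k))))
              (solve 3 (λ a b c → b :+ (a :+ c) := a :+ b :+ c) refl (sqA k) (sqB k) (sqC k)))
            by-fits (inj₂ _) (inj₂ _) (inj₁ h) = one-big k {sqC k} h (≤-by (sqA k + sqB k) (+-nonNeg (square (X (U k))) (square (X (V k)))) (+-comm (sqC k) (sqA k + sqB k)))
            by-fits (inj₂ zA) (inj₂ zB) (inj₂ zC) = cancel (begin
                ι 4 * D²                                                   ≤⟨ *-monoʳ (ι 4) (0≤ι 4) (subst₂ _≤_ (*-identityʳ D²) (trans (solve 2 (λ d w → d :* d :* (w :* w) := d :* w :* (d :* w)) refl Δ ⟦ z′ x ⟧) (cong (λ t → t * t) (sym Δz))) (*-monoʳ D² (<⇒≤ 0<D²) (square≥1 (z′ x) ne))) ⟩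
                ι 4 * ((X x + S) * (X x + S))                              ≤⟨ *-monoʳ (ι 4) (0≤ι 4) (weighted (X x) S) ⟩
                ι 4 * ((1ℚ + ½) * (X x * X x) + ι 3 * (S * S))             ≤⟨ *-monoʳ (ι 4) (0≤ι 4) (+-monoʳ-≤ ((1ℚ + ½) * (X x * X x)) (*-monoʳ (ι 3) (0≤ι 3) (three-squares (X (U k)) (X (V k)) (X (W k))))) ⟩
                ι 4 * ((1ℚ + ½) * (X x * X x) + ι 3 * (ι 3 * ρ k))         ≡⟨ solve 2 (λ p r → con (ι 4) :* ((con 1ℚ :+ con ½) :* p :+ con (ι 3) :* (con (ι 3) :* r)) := con (ι 3) :* (p :+ p) :+ con (ι 36) :* r) refl (X x * X x) (ρ k) ⟩
                ι 3 * (X x * X x + X x * X x) + ι 36 * ρ k                 ≤⟨ +-monoˡ-≤ (ι 36 * ρ k) (*-monoʳ (ι 3) (0≤ι 3) (≮⇒≥ ¬big)) ⟩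
                ι 3 * D² + ι 36 * ρ k                                      ∎)
              where
              S = X (U k) - X (V k) - X (W k)
              Δz : X x + S ≡ Δ * ⟦ z′ x ⟧
              Δz = trans (solve 4 (λ x a b c → x :+ (a :- b :- c) := x :+ a :- b :- c) refl (X x) (X (U k)) (X (V k)) (X (W k)))
                (trans (balanced {x} {U k} {V k} {W k} (bal k)) (cong (λ w → Δ * ⟦ w ⟧) combination))
                where
                affine : ∀ {i} → z′ i ≡ + 0 → z i ≡ a₀ ℤ.+ b₀ ℤ.* + H i
                affine {i} = ℤ.i-j≡0⇒i≡j (z i) (a₀ ℤ.+ b₀ ℤ.* + H i)
                H-balance : + H x ≡ + H (V k) ℤ.+ + H (W k) ℤ.- + H (U k)
                H-balance = trans (solveᶻ 2 (λ x a → x ≐ x ⊕ a ⊖ a) refl (+ H x) (+ H (U k))) (cong (ℤ._- + H (U k)) (trans (sym (ℤ.pos-+ (H x) (H (U k)))) (trans (cong +_ (bal k)) (ℤ.pos-+ (H (V k)) (H (W k))))))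
                combination : z x ℤ.+ z (U k) ℤ.- z (V k) ℤ.- z (W k) ≡ z′ x
                combination = trans (cong₂ ℤ._-_ (cong₂ ℤ._-_ (cong (ℤ._+_ (z x)) (affine zA)) (affine zB)) (affine zC))
                  (trans (solveᶻ 6 (λ z a b p q r → z ⊕ (a ⊕ b ⊛ p) ⊖ (a ⊕ b ⊛ q) ⊖ (a ⊕ b ⊛ r) ≐ z ⊖ (a ⊕ b ⊛ (q ⊕ r ⊖ p))) refl (z x) a₀ b₀ (+ H (U k)) (+ H (V k)) (+ H (W k)))
                    (cong (λ t → z x ℤ.- (a₀ ℤ.+ b₀ ℤ.* t)) (sym H-balance)))
              cancel : ι 4 * D² ≤ ι 3 * D² + ι 36 * ρ k → D² ≤ ι 36 * ρ k
              cancel h = subst₂ _≤_ (solve 1 (λ d → con (ι 4) :* d :- con (ι 3) :* d := d) refl D²) (solve 2 (λ d r → con (ι 3) :* d :+ r :- con (ι 3) :* d := r) refl D² (ι 36 * ρ k)) (+-monoˡ-≤ (- (ι 3 * D²)) h)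

      τ+τ+2<ℓ : ∀ {k} → k ℕ.< τ → 3 ℕ.+ (k ℕ.+ k) ℕ.≤ ℓ
      τ+τ+2<ℓ {k} h = ℕ.≤-trans (ℕ.≤-trans (ℕ.≤-trans (ℕ.n≤1+n (3 ℕ.+ (k ℕ.+ k))) (ℕ.≤-reflexive (solveⁿ 1 (λ k → conⁿ 4 ⊞ (k ⊞ k) ≗′ conⁿ 2 ⊗ⁿ (conⁿ 1 ⊞ k) ⊞ conⁿ 2) refl k)))
        (ℕ.+-monoˡ-≤ 2 (ℕ.*-monoʳ-≤ 2 h))) τ≤ℓ

      double-injective : ∀ {k l} → k ℕ.+ k ≡ l ℕ.+ l → k ≡ l
      double-injective {k} {l} eq = ℕ.*-cancelˡ-≡ k l 2 (trans (cong (k ℕ.+_) (ℕ.+-identityʳ k)) (trans eq (cong (l ℕ.+_) (sym (ℕ.+-identityʳ l)))))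

      Upto : ℕ → Set
      Upto v = ∀ u → w₀ ℕ.≤ u → u ℕ.< v → u ℕ.≤ m → Fits (core u)

      -- Starting from the quiet block, a height `u` is reached through the relations `u + (u - 3 -
      -- 2 t) = (u - 1 - t) + (u - 2 - t)` for `t <
      -- τ`. Their other terms lie at most `ℓ` below `u`, which explains `2 τ + 2 ≤ ℓ`.
      upward : ∀ j → Upto (w₀ ℕ.+ (ℓ ℕ.+ j))
      upward zero u w₀≤u u< u≤m = inj₂ (subst (λ v → z′ (core v) ≡ + 0) (ℕ.m+[n∸m]≡n w₀≤u) (z′-block (u ℕ.∸ w₀)
        (ℕ.+-cancelˡ-< w₀ (u ℕ.∸ w₀) ℓ (subst₂ ℕ._<_ (sym (ℕ.m+[n∸m]≡n w₀≤u)) (cong (w₀ ℕ.+_) (ℕ.+-identityʳ ℓ)) u<))))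
      upward (suc j) u w₀≤u u< u≤m = by-dec (u ℕ.<? w₀ ℕ.+ (ℓ ℕ.+ j))
        where
        by-dec : Dec (u ℕ.< w₀ ℕ.+ (ℓ ℕ.+ j)) → Fits (core u)
        by-dec (yes lt) = upward j u w₀≤u lt u≤m
        by-dec (no ¬lt) = propagate (core u) (at 3 toℕ₂) (at 1 toℕ) (at 2 toℕ)
            (λ {k} {l} eq → F.toℕ-injective (double-injective {toℕ k} {toℕ l} (at-injective 3 toℕ₂ (λ k → τ+τ+2<ℓ (F.toℕ<n k)) {k} {l} eq)))
            (λ {k} {l} eq → F.toℕ-injective (at-injective 1 toℕ small₁ eq))
            (λ {k} {l} eq → F.toℕ-injective (at-injective 2 toℕ small₂ eq))
            (λ k → trans (cong₂ ℕ._+_ (H-core u≤m) (H-at 3 toℕ₂ k)) (trans (balance k (toℕ k) refl) (sym (cong₂ ℕ._+_ (H-at 1 toℕ k) (H-at 2 toℕ k)))))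
            (fits 3 toℕ₂ λ k → τ+τ+2<ℓ (F.toℕ<n k)) (fits 1 toℕ small₁) (fits 2 toℕ small₂)
          where
          toℕ₂ : Fin τ → ℕ
          toℕ₂ k = toℕ k ℕ.+ toℕ k
          small₁ : ∀ k → 1 ℕ.+ toℕ {τ} k ℕ.≤ ℓ
          small₁ k = ℕ.≤-trans (ℕ.+-mono-≤ {1} {3} (s≤s z≤n) (ℕ.m≤m+n (toℕ k) (toℕ k))) (τ+τ+2<ℓ (F.toℕ<n k))
          small₂ : ∀ k → 2 ℕ.+ toℕ {τ} k ℕ.≤ ℓ
          small₂ k = ℕ.≤-trans (ℕ.+-mono-≤ {2} {3} (s≤s (s≤s z≤n)) (ℕ.m≤m+n (toℕ k) (toℕ k))) (τ+τ+2<ℓ (F.toℕ<n k))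
          ℓ≤u : w₀ ℕ.+ ℓ ℕ.≤ u
          ℓ≤u = ℕ.≤-trans (ℕ.+-monoʳ-≤ w₀ (ℕ.m≤m+n ℓ j)) (ℕ.≮⇒≥ ¬lt)
          at : ℕ → (Fin τ → ℕ) → Fin τ → Fin N
          at c f k = core (u ℕ.∸ (c ℕ.+ f k))
          below : ∀ {x} → x ℕ.≤ ℓ → x ℕ.≤ u
          below x≤ = ℕ.≤-trans x≤ (ℕ.≤-trans (ℕ.m≤n+m ℓ w₀) ℓ≤u)
          ∸≤m : ∀ x → u ℕ.∸ x ℕ.≤ m
          ∸≤m x = ℕ.≤-trans (ℕ.m∸n≤m u x) u≤m
          H-at : ∀ c f k → H (at c f k) ≡ u ℕ.∸ (c ℕ.+ f k)
          H-at c f k = H-core (∸≤m (c ℕ.+ f k))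
          at-injective : ∀ c f → (∀ k → c ℕ.+ f k ℕ.≤ ℓ) → ∀ {k l} → at c f k ≡ at c f l → f k ≡ f l
          at-injective c f small {k} {l} eq = ℕ.+-cancelˡ-≡ c (f k) (f l) (ℕ.∸-cancelˡ-≡ (below (small k)) (below (small l)) (trans (sym (H-at c f k)) (trans (cong H eq) (H-at c f l))))
          fits : ∀ c f → (∀ k → c ℕ.+ f k ℕ.≤ ℓ) → {{ℕ.NonZero c}} → ∀ k → Fits (at c f k)
          fits c f small k = upward j (u ℕ.∸ (c ℕ.+ f k)) (ℕ.m+n≤o⇒m≤o∸n w₀ (ℕ.≤-trans (ℕ.+-monoʳ-≤ w₀ (small k)) ℓ≤u)) lt′ (∸≤m (c ℕ.+ f k))
            where
            lt′ : u ℕ.∸ (c ℕ.+ f k) ℕ.< w₀ ℕ.+ (ℓ ℕ.+ j)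
            lt′ = ℕ.<-≤-trans (ℕ.∸-monoʳ-< {u} {c ℕ.+ f k} {0} (ℕ.≤-trans (ℕ.>-nonZero⁻¹ c) (ℕ.m≤m+n c (f k))) (below (small k)))
              (ℕ.≤-pred (subst (u ℕ.<_) (trans (cong (w₀ ℕ.+_) (ℕ.+-suc ℓ j)) (ℕ.+-suc w₀ (ℓ ℕ.+ j))) u<))
          balance : ∀ k t → toℕ {τ} k ≡ t → u ℕ.+ (u ℕ.∸ (3 ℕ.+ (t ℕ.+ t))) ≡ (u ℕ.∸ (1 ℕ.+ t)) ℕ.+ (u ℕ.∸ (2 ℕ.+ t))
          balance k t refl = go (u ℕ.∸ (3 ℕ.+ (t ℕ.+ t))) (ℕ.m+[n∸m]≡n (below (τ+τ+2<ℓ (F.toℕ<n k))))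
            where
            go : ∀ r → 3 ℕ.+ (t ℕ.+ t) ℕ.+ r ≡ u → u ℕ.+ r ≡ (u ℕ.∸ (1 ℕ.+ t)) ℕ.+ (u ℕ.∸ (2 ℕ.+ t))
            go r refl = trans (solveⁿ 2 (λ t r → conⁿ 3 ⊞ (t ⊞ t) ⊞ r ⊞ r ≗′ (conⁿ 2 ⊞ t ⊞ r) ⊞ (conⁿ 1 ⊞ t ⊞ r)) refl t r)
              (sym (cong₂ ℕ._+_
                (trans (cong (ℕ._∸ (1 ℕ.+ t)) (solveⁿ 2 (λ t r → conⁿ 3 ⊞ (t ⊞ t) ⊞ r ≗′ (conⁿ 1 ⊞ t) ⊞ (conⁿ 2 ⊞ t ⊞ r)) refl t r)) (ℕ.m+n∸m≡n (1 ℕ.+ t) (2 ℕ.+ t ℕ.+ r)))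
                (trans (cong (ℕ._∸ (2 ℕ.+ t)) (solveⁿ 2 (λ t r → conⁿ 3 ⊞ (t ⊞ t) ⊞ r ≗′ (conⁿ 2 ⊞ t) ⊞ (conⁿ 1 ⊞ t ⊞ r)) refl t r)) (ℕ.m+n∸m≡n (2 ℕ.+ t) (1 ℕ.+ t ℕ.+ r)))))

      above : ∀ u → w₀ ℕ.≤ u → u ℕ.≤ m → Fits (core u)
      above u w₀≤u u≤m = upward u u w₀≤u (ℕ.≤-trans (ℕ.≤-trans (s≤s (ℕ.≤-refl {u})) (ℕ.+-monoˡ-≤ u (ℕ.≤-trans (s≤s z≤n) (F.toℕ<n ℓ₀)))) (ℕ.m≤n+m (ℓ ℕ.+ u) w₀)) u≤m

      -- Mirror image of `upward` for the heights below the block, with `j` bounding the distance to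
      -- it.
      downward : ∀ j u → w₀ ℕ.≤ u ℕ.+ j → u ℕ.≤ m → Fits (core u)
      downward zero    u h u≤m = above u (subst (w₀ ℕ.≤_) (ℕ.+-identityʳ u) h) u≤m
      downward (suc j) u h u≤m = by-dec (w₀ ℕ.≤? u)
        where
        by-dec : Dec (w₀ ℕ.≤ u) → Fits (core u)
        by-dec (yes le) = above u le u≤m
        by-dec (no ¬le) = propagate (core u) (at 3 toℕ₂) (at 1 toℕ) (at 2 toℕ)
            (λ {k} {l} eq → F.toℕ-injective (double-injective {toℕ k} {toℕ l} (at-injective 3 toℕ₂ (λ k → τ+τ+2<ℓ (F.toℕ<n k)) {k} {l} eq)))
            (λ {k} {l} eq → F.toℕ-injective (at-injective 1 toℕ small₁ eq))
            (λ {k} {l} eq → F.toℕ-injective (at-injective 2 toℕ small₂ eq))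
            (λ k → trans (cong₂ ℕ._+_ (H-core u≤m) (H-at 3 toℕ₂ (λ k → τ+τ+2<ℓ (F.toℕ<n k)) k)) (trans (solveⁿ 2 (λ u t → u ⊞ (u ⊞ (conⁿ 3 ⊞ (t ⊞ t))) ≗′ u ⊞ (conⁿ 1 ⊞ t) ⊞ (u ⊞ (conⁿ 2 ⊞ t))) refl u (toℕ k))
              (sym (cong₂ ℕ._+_ (H-at 1 toℕ small₁ k) (H-at 2 toℕ small₂ k)))))
            (fits 3 toℕ₂ λ k → τ+τ+2<ℓ (F.toℕ<n k)) (fits 1 toℕ small₁) (fits 2 toℕ small₂)
          where
          toℕ₂ : Fin τ → ℕ
          toℕ₂ k = toℕ k ℕ.+ toℕ k
          small₁ : ∀ k → 1 ℕ.+ toℕ {τ} k ℕ.≤ ℓ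
          small₁ k = ℕ.≤-trans (ℕ.+-mono-≤ {1} {3} (s≤s z≤n) (ℕ.m≤m+n (toℕ k) (toℕ k))) (τ+τ+2<ℓ (F.toℕ<n k))
          small₂ : ∀ k → 2 ℕ.+ toℕ {τ} k ℕ.≤ ℓ
          small₂ k = ℕ.≤-trans (ℕ.+-mono-≤ {2} {3} (s≤s (s≤s z≤n)) (ℕ.m≤m+n (toℕ k) (toℕ k))) (τ+τ+2<ℓ (F.toℕ<n k))
          at : ℕ → (Fin τ → ℕ) → Fin τ → Fin N
          at c f k = core (u ℕ.+ (c ℕ.+ f k))
          +≤m : ∀ {x} → x ℕ.≤ ℓ → u ℕ.+ x ℕ.≤ m
          +≤m x≤ = ℕ.≤-trans (ℕ.<⇒≤pred (ℕ.+-mono-<-≤ (ℕ.≰⇒> ¬le) x≤)) w₀+ℓ≤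
            where
            w₀+ℓ≤ : ℕ.pred (w₀ ℕ.+ ℓ) ℕ.≤ m
            w₀+ℓ≤ = block-end ℓ refl
              where
              block-end : ∀ l → ℓ ≡ l → ℕ.pred (w₀ ℕ.+ l) ℕ.≤ m
              block-end zero eq = contradiction (F.toℕ<n ℓ₀) λ h → ℕ.<-irrefl refl (ℕ.≤-<-trans z≤n (subst (toℕ ℓ₀ ℕ.<_) eq h))
              block-end (suc l) eq = subst (λ t → ℕ.pred t ℕ.≤ m) (sym (ℕ.+-suc w₀ l)) (block≤m {l} (subst (l ℕ.<_) (sym eq) ℕ.≤-refl))
          H-at : ∀ c f → (∀ k → c ℕ.+ f k ℕ.≤ ℓ) → ∀ k → H (at c f k) ≡ u ℕ.+ (c ℕ.+ f k)
          H-at c f small k = H-core (+≤m (small k))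
          at-injective : ∀ c f → (∀ k → c ℕ.+ f k ℕ.≤ ℓ) → ∀ {k l} → at c f k ≡ at c f l → f k ≡ f l
          at-injective c f small {k} {l} eq = ℕ.+-cancelˡ-≡ c (f k) (f l) (ℕ.+-cancelˡ-≡ u (c ℕ.+ f k) (c ℕ.+ f l) (trans (sym (H-at c f small k)) (trans (cong H eq) (H-at c f small l))))
          fits : ∀ c f → (∀ k → c ℕ.+ f k ℕ.≤ ℓ) → {{ℕ.NonZero c}} → ∀ k → Fits (at c f k)
          fits c f small k = downward j (u ℕ.+ (c ℕ.+ f k)) (ℕ.≤-trans h (ℕ.≤-trans (ℕ.≤-reflexive (ℕ.+-suc u j)) (ℕ.+-monoˡ-≤ j (ℕ.m<m+n u (ℕ.≤-trans (ℕ.>-nonZero⁻¹ c) (ℕ.m≤m+n c (f k))))))) (+≤m (small k))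

      core-fits : ∀ u → u ℕ.≤ m → Fits (core u)
      core-fits u = downward w₀ u (ℕ.m≤n+m w₀ u)

      all-fit : ∀ i → Fits i
      all-fit i = by-place (place i)
        where
        by-place : H i ℕ.≤ m ⊎ (m ℕ.+ 2 ℕ.≤ H i × H i ℕ.≤ m ℕ.+ P) → Fits i
        by-place (inj₁ h) = subst Fits (H-inj (H-core h)) (core-fits (H i) h)
        -- A height `m + p` is reached from the top of the core by `(m + p) + (m - p - 1 - 2 t) = (m
        -- - t) + (m - 1 - t)`; this requires `P + ℓ ≤ m`.
        by-place (inj₂ (lo , hi)) = propagate i (core ∘ a) (core ∘ b) (core ∘ c)
            (λ {k} {l} eq → F.toℕ-injective (double-injective {toℕ k} {toℕ l} (ℕ.+-cancelˡ-≡ (p ℕ.+ 1) (toℕ k ℕ.+ toℕ k) (toℕ l ℕ.+ toℕ l) (ℕ.∸-cancelˡ-≡ (fit₃ k) (fit₃ l) (core-injective (≤m (p ℕ.+ 1 ℕ.+ (toℕ k ℕ.+ toℕ k))) (≤m (p ℕ.+ 1 ℕ.+ (toℕ l ℕ.+ toℕ l))) eq)))))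
            (λ {k} {l} eq → F.toℕ-injective (ℕ.∸-cancelˡ-≡ (fit₁ k) (fit₁ l) (core-injective (≤m (toℕ k)) (≤m (toℕ l)) eq)))
            (λ {k} {l} eq → F.toℕ-injective (ℕ.suc-injective (ℕ.∸-cancelˡ-≡ (fit₂ k) (fit₂ l) (core-injective (≤m (1 ℕ.+ toℕ k)) (≤m (1 ℕ.+ toℕ l)) eq))))
            (λ k → trans (cong₂ ℕ._+_ H-i (H-core (≤m (p ℕ.+ 1 ℕ.+ (toℕ k ℕ.+ toℕ k))))) (trans (balance (toℕ k) (fit₃ k)) (sym (cong₂ ℕ._+_ (H-core (≤m (toℕ k))) (H-core (≤m (1 ℕ.+ toℕ k)))))))
            (λ k → core-fits (a k) (≤m (p ℕ.+ 1 ℕ.+ (toℕ k ℕ.+ toℕ k)))) (λ k → core-fits (b k) (≤m (toℕ k))) (λ k → core-fits (c k) (≤m (1 ℕ.+ toℕ k)))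
          where
          p = H i ℕ.∸ m
          H-i : H i ≡ m ℕ.+ p
          H-i = sym (ℕ.m+[n∸m]≡n (ℕ.≤-trans (ℕ.m≤m+n m 2) lo))
          p≤P : p ℕ.≤ P
          p≤P = ℕ.≤-trans (ℕ.∸-monoˡ-≤ m hi) (ℕ.≤-reflexive (ℕ.m+n∸m≡n m P))
          a b c : Fin τ → ℕ
          a k = m ℕ.∸ (p ℕ.+ 1 ℕ.+ (toℕ k ℕ.+ toℕ k))
          b k = m ℕ.∸ toℕ k
          c k = m ℕ.∸ (1 ℕ.+ toℕ k)
          ≤m : ∀ x → m ℕ.∸ x ℕ.≤ m
          ≤m x = ℕ.m∸n≤m m x
          fit₃ : ∀ k → p ℕ.+ 1 ℕ.+ (toℕ k ℕ.+ toℕ k) ℕ.≤ m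
          fit₃ k = ℕ.≤-trans (ℕ.≤-reflexive (ℕ.+-assoc p 1 (toℕ k ℕ.+ toℕ k))) (ℕ.≤-trans (ℕ.+-mono-≤ p≤P (ℕ.≤-trans (ℕ.m≤n+m (1 ℕ.+ (toℕ k ℕ.+ toℕ k)) 2) (τ+τ+2<ℓ (F.toℕ<n k)))) P+ℓ≤m)
          fit₂ : ∀ k → 1 ℕ.+ toℕ k ℕ.≤ m
          fit₂ k = ℕ.≤-trans (ℕ.+-mono-≤ (ℕ.m≤n+m 1 p) (ℕ.m≤m+n (toℕ k) (toℕ k))) (fit₃ k)
          fit₁ : ∀ k → toℕ {τ} k ℕ.≤ m
          fit₁ k = ℕ.≤-trans (ℕ.n≤1+n (toℕ k)) (fit₂ k)
          balance : ∀ t → p ℕ.+ 1 ℕ.+ (t ℕ.+ t) ℕ.≤ m → m ℕ.+ p ℕ.+ (m ℕ.∸ (p ℕ.+ 1 ℕ.+ (t ℕ.+ t))) ≡ (m ℕ.∸ t) ℕ.+ (m ℕ.∸ (1 ℕ.+ t))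
          balance t h = go (m ℕ.∸ (p ℕ.+ 1 ℕ.+ (t ℕ.+ t))) m refl (ℕ.m+[n∸m]≡n h)
            where
            go : ∀ r m′ → m′ ≡ m → p ℕ.+ 1 ℕ.+ (t ℕ.+ t) ℕ.+ r ≡ m′ → m′ ℕ.+ p ℕ.+ r ≡ (m′ ℕ.∸ t) ℕ.+ (m′ ℕ.∸ (1 ℕ.+ t))
            go r _ _ refl = trans (solveⁿ 3 (λ p t r → p ⊞ conⁿ 1 ⊞ (t ⊞ t) ⊞ r ⊞ p ⊞ r ≗′ (p ⊞ conⁿ 1 ⊞ t ⊞ r) ⊞ (p ⊞ t ⊞ r)) refl p t r)
              (sym (cong₂ ℕ._+_
                (trans (cong (ℕ._∸ t) (solveⁿ 3 (λ p t r → p ⊞ conⁿ 1 ⊞ (t ⊞ t) ⊞ r ≗′ t ⊞ (p ⊞ conⁿ 1 ⊞ t ⊞ r)) refl p t r)) (ℕ.m+n∸m≡n t (p ℕ.+ 1 ℕ.+ t ℕ.+ r)))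
                (trans (cong (ℕ._∸ (1 ℕ.+ t)) (solveⁿ 3 (λ p t r → p ⊞ conⁿ 1 ⊞ (t ⊞ t) ⊞ r ≗′ (conⁿ 1 ⊞ t) ⊞ (p ⊞ t ⊞ r)) refl p t r)) (ℕ.m+n∸m≡n (1 ℕ.+ t) (p ℕ.+ t ℕ.+ r)))))

      -- Two distinct exceptions would together carry more than the total `Δ²`.
      exceptional-unique : ∀ {i j} → z′ i ≢ + 0 → z′ j ≢ + 0 → i ≡ j
      exceptional-unique {i} {j} ni nj = by-fits (all-fit i) (all-fit j) (i F.≟ j)
        where
        by-fits : Fits i → Fits j → Dec (i ≡ j) → i ≡ j
        by-fits _ _ (yes eq) = eq
        by-fits (inj₂ eq) _ _ = contradiction eq ni
        by-fits _ (inj₂ eq) _ = contradiction eq nj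
        by-fits (inj₁ p) (inj₁ q) (no ne) = contradiction (<-≤-trans (+-mono-< p q) (≤-trans (≤-reflexive (solve 2 (λ a b → (a :+ a) :+ (b :+ b) := (a :+ b) :+ (a :+ b)) refl (X i * X i) (X j * X j)))
          (+-mono-≤ two two))) (<-irrefl refl)
          where
          two : X i * X i + X j * X j ≤ D²
          two = ≤-trans (sum-two (λ i → X i * X i) X²≥0 ne) ΣX²≤

    -- Affine functions of `H` vanish on the lattice, so `z` may be replaced by `z′`, which is
    -- supported at one coordinate at most. If there is none, coordinate `zero` with factor 0
    -- serves.
    is-coordinate : Σ[ s ∈ ℤ ] Σ[ j ∈ Fin (2 ℕ.+ d) ] (∀ x → sum (λ i → ⟦ z i ⟧ * full x i) ≡ ⟦ s ⟧ * full x j)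
    is-coordinate = by-dec (F.any? λ j → ¬? (z′ j ℤ.≟ + 0))
      where
      expand : ∀ x → sum (λ i → ⟦ z i ⟧ * full x i) ≡ sum (λ i → ⟦ z′ i ⟧ * full x i)
      expand x = sym (begin
        sum (λ i → ⟦ z′ i ⟧ * full x i)
          ≡⟨ sum-cong (λ i → trans (cong (_* full x i) (⟦z′⟧ i)) (solve 5 (λ z a b h x → (z :- (a :+ b :* h)) :* x := z :* x :- (a :* x :+ b :* (h :* x))) refl (ζ i) ⟦ a₀ ⟧ ⟦ b₀ ⟧ (η i) (full x i))) ⟩
        sum (λ i → ζ i * full x i - (⟦ a₀ ⟧ * full x i + ⟦ b₀ ⟧ * (η i * full x i)))
          ≡⟨ trans (sum-- (λ i → ζ i * full x i) (λ i → ⟦ a₀ ⟧ * full x i + ⟦ b₀ ⟧ * (η i * full x i))) (cong (λ t → sum (λ i → ζ i * full x i) - t)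
               (trans (sum-+ (λ i → ⟦ a₀ ⟧ * full x i) (λ i → ⟦ b₀ ⟧ * (η i * full x i))) (cong₂ _+_ (trans (sum-* ⟦ a₀ ⟧ (full x)) (cong (⟦ a₀ ⟧ *_) (sum-full x))) (trans (sum-* ⟦ b₀ ⟧ λ i → η i * full x i) (cong (⟦ b₀ ⟧ *_) (sum-H-full x)))))) ⟩
        sum (λ i → ζ i * full x i) - (⟦ a₀ ⟧ * 0ℚ + ⟦ b₀ ⟧ * 0ℚ)
          ≡⟨ solve 3 (λ t a b → t :- (a :* con 0ℚ :+ b :* con 0ℚ) := t) refl (sum (λ i → ζ i * full x i)) ⟦ a₀ ⟧ ⟦ b₀ ⟧ ⟩
        sum (λ i → ζ i * full x i) ∎)
        where open ≡-Reasoning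
      by-dec : Dec (∃[ j ] z′ j ≢ + 0) → Σ[ s ∈ ℤ ] Σ[ j ∈ Fin (2 ℕ.+ d) ] (∀ x → sum (λ i → ⟦ z i ⟧ * full x i) ≡ ⟦ s ⟧ * full x j)
      by-dec (no none) = + 0 , zero , λ x → trans (expand x) (trans (sum-0 λ i → trans (cong (λ w → ⟦ w ⟧ * full x i) (vanish i (z′ i ℤ.≟ + 0))) (*-zeroˡ (full x i))) (sym (*-zeroˡ (full x zero))))
        where
        vanish : ∀ i → Dec (z′ i ≡ + 0) → z′ i ≡ + 0
        vanish i (yes eq) = eq
        vanish i (no ne)  = contradiction (i , ne) none
      by-dec (yes (j , nj)) = z′ j , j , λ x → trans (expand x) (trans (sum-cong λ i → concentrated x i (i F.≟ j)) (trans (sum-* ⟦ z′ j ⟧ λ i → δ j i * full x i) (cong (⟦ z′ j ⟧ *_) (sum-δ j (full x)))))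
        where
        concentrated : ∀ x i → Dec (i ≡ j) → ⟦ z′ i ⟧ * full x i ≡ ⟦ z′ j ⟧ * (δ j i * full x i)
        concentrated x i (yes refl) = cong (⟦ z′ j ⟧ *_) (trans (sym (*-identityˡ (full x i))) (cong (λ w → ⟦ w ⟧ * full x i) (sym (δ-refl j))))
        concentrated x i (no ne) = trans (trans (cong (λ w → ⟦ w ⟧ * full x i) (vanish (z′ i ℤ.≟ + 0))) (*-zeroˡ (full x i)))
          (sym (trans (cong (λ w → ⟦ z′ j ⟧ * (⟦ w ⟧ * full x i)) (δ-≢ (ne ∘ sym))) (solve 2 (λ a b → a :* (con 0ℚ :* b) := con 0ℚ) refl ⟦ z′ j ⟧ (full x i))))
          where
          vanish : Dec (z′ i ≡ + 0) → z′ i ≡ + 0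
          vanish (yes eq) = eq
          vanish (no ni)  = contradiction (exceptional-unique ni nj) ne

  -- Isometries permute the coordinates.

  avoid : ∀ {N} (c : Fin 3 → Fin N) → (∀ {a b} → c a ≡ c b → a ≡ b) → ∀ i j → ∃[ a ] c a ≢ i × c a ≢ j
  avoid c inj i j = by-dec (F.any? λ a → ¬? (c a F.≟ i) ×-dec ¬? (c a F.≟ j))
    where
    by-dec : Dec (∃[ a ] c a ≢ i × c a ≢ j) → ∃[ a ] c a ≢ i × c a ≢ j
    by-dec (yes p) = p
    by-dec (no ¬p) = contradiction (F.injective⇒≤ {f = λ a → which a (c a F.≟ i)} λ {a} {b} → which-injective a b (c a F.≟ i) (c b F.≟ i)) λ { (s≤s (s≤s ())) }
      where
      which : ∀ a → Dec (c a ≡ i) → Fin 2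
      which a (yes _) = zero
      which a (no _)  = suc zero
      is-j : ∀ a → c a ≢ i → Dec (c a ≡ j) → c a ≡ j
      is-j a ni (yes eq) = eq
      is-j a ni (no nj)  = contradiction (a , ni , nj) ¬p
      which-injective : ∀ a b (p : Dec (c a ≡ i)) (q : Dec (c b ≡ i)) → which a p ≡ which b q → a ≡ b
      which-injective a b (yes p) (yes q) _ = inj (trans p (sym q))
      which-injective a b (no p) (no q) _   = inj (trans (is-j a p (c a F.≟ j)) (sym (is-j b q (c b F.≟ j))))

  module _ {d} (H : Fin (2 ℕ.+ d) → ℕ) (H₀ : H zero ≡ 0) (H₁ : H (suc zero) ≡ 1) where
    open Balanced H H₀ H₁

    full-cong : ∀ {x y : Vec d} → (∀ i → x i ≡ y i) → ∀ k → full x k ≡ full y k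
    full-cong eq zero          = sum-cong λ i → cong ((ι (h i) - 1ℚ) *_) (eq i)
    full-cong eq (suc zero)    = cong -_ (sum-cong λ i → cong (ι (h i) *_) (eq i))
    full-cong eq (suc (suc i)) = eq i

    full-app : ∀ (u : Fin d → Vec d) x k → full (app u x) k ≡ sum λ i → x i * full (u i) k
    full-app u x = λ where
        zero          → weigh λ l → ι (h l) - 1ℚ
        (suc zero)    → trans (cong -_ (weigh λ l → ι (h l))) (trans (sym (sum-neg λ i → x i * sum λ l → ι (h l) * u i l))
                          (sum-cong λ i → solve 2 (λ x s → :- (x :* s) := x :* :- s) refl (x i) (sum λ l → ι (h l) * u i l)))
        (suc (suc l)) → refl
      where
      weigh : ∀ (c : Vec d) → sum (λ l → c l * app u x l) ≡ sum λ i → x i * sum λ l → c l * u i l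
      weigh c = trans (sum-cong λ l → sym (sum-* (c l) λ i → x i * u i l)) (trans (sum-swap λ l i → c l * (x i * u i l))
        (sum-cong λ i → trans (sum-cong λ l → solve 3 (λ c x u → c :* (x :* u) := x :* (c :* u)) refl (c l) (x i) (u i l)) (sum-* (x i) λ l → c l * u i l)))

    -- Evaluation at the basis vectors: the first two coordinates of their full vectors are
    -- `h i - 1` and `- h i`, so the relation expresses every `f i` through `f` at heights 0 and 1.
    relation⇒affine : ∀ (f : Vec (2 ℕ.+ d)) → (∀ x → sum (λ i → f i * full x i) ≡ 0ℚ) → ∀ i → f i ≡ f zero + η i * (f (suc zero) - f zero)
    relation⇒affine f rel zero = trans (solve 2 (λ a b → a := a :+ con 0ℚ :* (b :- a)) refl (f zero) (f (suc zero))) (cong (λ p → f zero + ι p * (f (suc zero) - f zero)) (sym H₀))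
    relation⇒affine f rel (suc zero) = trans (solve 2 (λ a b → b := a :+ con 1ℚ :* (b :- a)) refl (f zero) (f (suc zero))) (cong (λ p → f zero + ι p * (f (suc zero) - f zero)) (sym H₁))
    relation⇒affine f rel (suc (suc i)) = begin
      f (suc (suc i))
        ≡⟨ solve 4 (λ a b t h → t := a :* (h :- con 1ℚ) :+ (b :* :- h :+ t) :+ (a :+ h :* (b :- a))) refl (f zero) (f (suc zero)) (f (suc (suc i))) (ι (h i)) ⟩
      f zero * (ι (h i) - 1ℚ) + (f (suc zero) * - ι (h i) + f (suc (suc i))) + (f zero + ι (h i) * (f (suc zero) - f zero))
        ≡⟨ cong (_+ (f zero + ι (h i) * (f (suc zero) - f zero))) (trans (sym (cong₂ _+_ (cong (f zero *_) (at λ l → ι (h l) - 1ℚ)) (cong₂ _+_ (cong (λ t → f (suc zero) * - t) (at λ l → ι (h l))) (at λ l → f (suc (suc l)))))) (rel (δ i))) ⟩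
      0ℚ + (f zero + ι (h i) * (f (suc zero) - f zero))
        ≡⟨ +-identityˡ (f zero + ι (h i) * (f (suc zero) - f zero)) ⟩
      f zero + ι (h i) * (f (suc zero) - f zero) ∎
      where
      open ≡-Reasoning
      at : ∀ (c : Vec d) → sum (λ l → c l * δ i l) ≡ c i
      at c = trans (sum-cong λ l → *-comm (c l) (δ i l)) (sum-δ i c)

  module _ {d} (H : Fin (2 ℕ.+ d) → ℕ) {m P} (shape : Shape H m P) (5≤m : 5 ℕ.≤ m) where
    open Shape shape
    open Balanced H H₀ H₁

    -- The functional `δ j - t δ i` vanishes on the lattice and so is affine in `H`. Among the
    -- heights 0, 1, 2 and among 3, 4, 5 there is one belonging to neither `i` nor `j`; two zeros at
    -- different heights make the functional zero.
    coordinates-independent : ∀ t {i j} → (∀ x → full x j ≡ ⟦ t ⟧ * full x i) → i ≡ j × t ≡ + 1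
    coordinates-independent t {i} {j} eq = by-dec (i F.≟ j)
      where
      f : Vec (2 ℕ.+ d)
      f l = δ j l - ⟦ t ⟧ * δ i l
      f-rel : ∀ x → sum (λ l → f l * full x l) ≡ 0ℚ
      f-rel x = trans (sum-cong λ l → solve 4 (λ a t b x → (a :- t :* b) :* x := a :* x :- t :* (b :* x)) refl (δ j l) ⟦ t ⟧ (δ i l) (full x l))
        (trans (sum-- (λ l → δ j l * full x l) (λ l → ⟦ t ⟧ * (δ i l * full x l)))
          (trans (cong₂ _-_ (sum-δ j (full x)) (trans (sum-* ⟦ t ⟧ λ l → δ i l * full x l) (cong (⟦ t ⟧ *_) (sum-δ i (full x)))))
            (trans (cong (_- ⟦ t ⟧ * full x i) (eq x)) (+-inverseʳ (⟦ t ⟧ * full x i)))))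
      slope = f (suc zero) - f zero
      affine : ∀ l → f l ≡ f zero + η l * slope
      affine = relation⇒affine H H₀ H₁ f f-rel
      off : ∀ {l} → l ≢ i → l ≢ j → f l ≡ 0ℚ
      off {l} ni nj = trans (cong₂ (λ a b → ⟦ a ⟧ - ⟦ t ⟧ * ⟦ b ⟧) (δ-≢ (nj ∘ sym)) (δ-≢ (ni ∘ sym))) (solve 1 (λ t → con 0ℚ :- t :* con 0ℚ := con 0ℚ) refl ⟦ t ⟧)
      c : ℕ → Fin 3 → Fin (2 ℕ.+ d)
      c o r = core (o ℕ.+ toℕ r)
      c≤ : ∀ {o} → o ℕ.≤ 3 → ∀ r → o ℕ.+ toℕ {3} r ℕ.≤ m
      c≤ o≤ r = ℕ.≤-trans (ℕ.+-mono-≤ o≤ (ℕ.≤-pred (F.toℕ<n r))) 5≤m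
      c-injective : ∀ {o} → o ℕ.≤ 3 → ∀ {a b} → c o a ≡ c o b → a ≡ b
      c-injective {o} o≤ {a} {b} e = F.toℕ-injective (ℕ.+-cancelˡ-≡ o (toℕ a) (toℕ b) (trans (sym (H-core (c≤ o≤ a))) (trans (cong H e) (H-core (c≤ o≤ b)))))
      low = avoid (c 0) (c-injective z≤n) i j
      high = avoid (c 3) (c-injective ℕ.≤-refl) i j
      p = c 0 (proj₁ low)
      q = c 3 (proj₁ high)
      Hp<Hq : H p ℕ.< H q
      Hp<Hq = subst₂ ℕ._<_ (sym (H-core (c≤ z≤n (proj₁ low)))) (sym (H-core (c≤ ℕ.≤-refl (proj₁ high)))) (ℕ.<-≤-trans (F.toℕ<n (proj₁ low)) (ℕ.m≤m+n 3 (toℕ (proj₁ high))))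
      vanish-p : f zero + η p * slope ≡ 0ℚ
      vanish-p = trans (sym (affine p)) (off (proj₁ (proj₂ low)) (proj₂ (proj₂ low)))
      vanish-q : f zero + η q * slope ≡ 0ℚ
      vanish-q = trans (sym (affine q)) (off (proj₁ (proj₂ high)) (proj₂ (proj₂ high)))
      slope≡0 : slope ≡ 0ℚ
      slope≡0 = recip-cancel {η q - η p} (λ e → <-irrefl (sym e) (p<q⇒0<q-p (ι-mono-< {H p} {H q} Hp<Hq)))
        (trans (solve 4 (λ a b p q → (q :- p) :* b := (a :+ q :* b) :- (a :+ p :* b)) refl (f zero) slope (η p) (η q)) (cong₂ _-_ vanish-q vanish-p))
      f≡0 : ∀ l → f l ≡ 0ℚ
      f≡0 l = trans (affine l) (trans (cong (λ b → f zero + η l * b) slope≡0) (trans (solve 3 (λ a p q → a :+ p :* con 0ℚ := a :+ q :* con 0ℚ) refl (f zero) (η l) (η p))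
        (trans (cong (λ b → f zero + η p * b) (sym slope≡0)) vanish-p)))
      by-dec : Dec (i ≡ j) → i ≡ j × t ≡ + 1
      by-dec (yes refl) = refl , sym (⟦⟧-injective {+ 1} {t} (p-q≡0⇒p≡q 1ℚ ⟦ t ⟧ (trans (trans (solve 1 (λ t → con 1ℚ :- t := con 1ℚ :- t :* con 1ℚ) refl ⟦ t ⟧) (cong (λ a → ⟦ a ⟧ - ⟦ t ⟧ * ⟦ a ⟧) (sym (δ-refl i)))) (f≡0 i))))
      by-dec (no ne) = contradiction (trans (sym (trans (cong₂ (λ a b → ⟦ a ⟧ - ⟦ t ⟧ * ⟦ b ⟧) (δ-refl j) (δ-≢ ne)) (solve 1 (λ t → con 1ℚ :- t :* con 0ℚ := con 1ℚ) refl ⟦ t ⟧))) (f≡0 j)) λ ()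

  module _ {d} (H H′ : Fin (2 ℕ.+ d) → ℕ) {m P : ℕ} (shape : Shape H m P) (shape′ : Shape H′ m P)
    (B ℓ τ : ℕ) (16<B : 16 ℕ.< B) (108<τ : 108 ℕ.< τ) (τ≤ℓ : 2 ℕ.* τ ℕ.+ 2 ℕ.≤ ℓ) (Bℓ≤m : B ℕ.* ℓ ℕ.≤ m) (P+ℓ≤m : P ℕ.+ ℓ ℕ.≤ m) where
    private
      module L  = Balanced H  (Shape.H₀ shape)  (Shape.H₁ shape)
      module L′ = Balanced H′ (Shape.H₀ shape′) (Shape.H₁ shape′)

    -- A coordinate of the image is a functional whose square is one of the terms of the norm, and
    -- the isometry preserves the norm. The functional is written on the free coordinates, with
    -- zeros in the first two places.
    coordinate-image : ∀ {u w} → IsIso ⟦ L.gram ⟧ᵐ ⟦ L′.gram ⟧ᵐ u w → ∀ k →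
      Σ[ s ∈ ℤ ] Σ[ j ∈ Fin (2 ℕ.+ d) ] (∀ x → L′.full (app ⟦ u ⟧ᶠ x) k ≡ ⟦ s ⟧ * L.full x j)
    coordinate-image {u} {w} I k = let s , j , eq = Functional.is-coordinate H shape B ℓ τ 16<B 108<τ τ≤ℓ Bℓ≤m P+ℓ≤m z bounded in s , j , λ x → trans (sym (value x)) (eq x)
      where
      z : Fin (2 ℕ.+ d) → ℤ
      z zero          = + 0
      z (suc zero)    = + 0
      z (suc (suc i)) = L′.fullᶻ (u i) k
      value : ∀ x → sum (λ i → ⟦ z i ⟧ * L.full x i) ≡ L′.full (app ⟦ u ⟧ᶠ x) k
      value x = trans (solve 3 (λ a b s → con 0ℚ :* a :+ (con 0ℚ :* b :+ s) := s) refl (L.full x zero) (L.full x (suc zero)) (sum λ i → ⟦ L′.fullᶻ (u i) k ⟧ * x i))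
        (trans (sum-cong λ i → trans (*-comm ⟦ L′.fullᶻ (u i) k ⟧ (x i)) (cong (x i *_) (L′.⟦fullᶻ⟧ (u i) k)))
          (sym (full-app H′ (Shape.H₀ shape′) (Shape.H₁ shape′) ⟦ u ⟧ᶠ x k)))
      bounded : L.BoundedFunctional z
      bounded x = subst₂ _≤_ (cong (λ t → t * t) (sym (value ⟦ x ⟧ᵛ))) (trans (sym (L′.quad-gram y)) (IsIso.bil-u I ⟦ x ⟧ᵛ ⟦ x ⟧ᵛ))
        (term≤sum {f = λ i → L′.full y i * L′.full y i} (λ i → square (L′.full y i)) k)
        where y = app ⟦ u ⟧ᶠ ⟦ x ⟧ᵛ

  factor-1 : ∀ a b → a ℤ.* b ≡ + 1 → a ≡ + 1 ⊎ a ≡ -[1+ 0 ]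
  factor-1 a b eq = by-abs a (ℕ.m*n≡1⇒m≡1 ℤ.∣ a ∣ ℤ.∣ b ∣ (trans (sym (ℤ.abs-* a b)) (cong ℤ.∣_∣ eq)))
    where
    by-abs : ∀ a → ℤ.∣ a ∣ ≡ 1 → a ≡ + 1 ⊎ a ≡ -[1+ 0 ]
    by-abs (+ _)    refl = inj₁ refl
    by-abs -[1+ _ ] eq   = inj₂ (cong -[1+_] (ℕ.suc-injective eq))

  module _ {d} (H H′ : Fin (2 ℕ.+ d) → ℕ) {m P : ℕ} (shape : Shape H m P) (shape′ : Shape H′ m P) where
    private
      module S  = Shape shape
      module S′ = Shape shape′
      module L  = Balanced H  S.H₀ S.H₁
      module L′ = Balanced H′ S′.H₀ S′.H₁

    -- An isometry permutes the coordinates up to a common sign, so H′ is an affine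
    -- function of H; the gap at m + 1 excludes a reflection.
    module Monomial (5≤m : 5 ℕ.≤ m) (P≤m : P ℕ.≤ m) (top : Fin (2 ℕ.+ d)) (m+2≤top : m ℕ.+ 2 ℕ.≤ H top)
      {u w : Fin d → ℤ^ d} (I : IsIso ⟦ L.gram ⟧ᵐ ⟦ L′.gram ⟧ᵐ u w)
      (s s′ : Fin (2 ℕ.+ d) → ℤ) (σ ρ : Fin (2 ℕ.+ d) → Fin (2 ℕ.+ d))
      (image : ∀ k x → L′.full (app ⟦ u ⟧ᶠ x) k ≡ ⟦ s k ⟧ * L.full x (σ k))
      (image′ : ∀ j y → L.full (app ⟦ w ⟧ᶠ y) j ≡ ⟦ s′ j ⟧ * L′.full y (ρ j)) where

      through : ∀ j x → L.full x j ≡ ⟦ s′ j ℤ.* s (ρ j) ⟧ * L.full x (σ (ρ j))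
      through j x = begin
        L.full x j                                         ≡⟨ full-cong H S.H₀ S.H₁ (λ i → sym (IsIso.wu-app I x i)) j ⟩
        L.full (app ⟦ w ⟧ᶠ (app ⟦ u ⟧ᶠ x)) j               ≡⟨ image′ j (app ⟦ u ⟧ᶠ x) ⟩
        ⟦ s′ j ⟧ * L′.full (app ⟦ u ⟧ᶠ x) (ρ j)            ≡⟨ cong (⟦ s′ j ⟧ *_) (image (ρ j) x) ⟩
        ⟦ s′ j ⟧ * (⟦ s (ρ j) ⟧ * L.full x (σ (ρ j)))      ≡⟨ trans (sym (*-assoc ⟦ s′ j ⟧ ⟦ s (ρ j) ⟧ (L.full x (σ (ρ j))))) (cong (_* L.full x (σ (ρ j))) (sym (⟦⟧-* (s′ j) (s (ρ j))))) ⟩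
        ⟦ s′ j ℤ.* s (ρ j) ⟧ * L.full x (σ (ρ j))          ∎
        where open ≡-Reasoning
      through′ : ∀ k y → L′.full y k ≡ ⟦ s k ℤ.* s′ (σ k) ⟧ * L′.full y (ρ (σ k))
      through′ k y = begin
        L′.full y k                                        ≡⟨ full-cong H′ S′.H₀ S′.H₁ (λ i → sym (IsIso.uw-app I y i)) k ⟩
        L′.full (app ⟦ u ⟧ᶠ (app ⟦ w ⟧ᶠ y)) k              ≡⟨ image k (app ⟦ w ⟧ᶠ y) ⟩
        ⟦ s k ⟧ * L.full (app ⟦ w ⟧ᶠ y) (σ k)              ≡⟨ cong (⟦ s k ⟧ *_) (image′ (σ k) y) ⟩
        ⟦ s k ⟧ * (⟦ s′ (σ k) ⟧ * L′.full y (ρ (σ k)))     ≡⟨ trans (sym (*-assoc ⟦ s k ⟧ ⟦ s′ (σ k) ⟧ (L′.full y (ρ (σ k))))) (cong (_* L′.full y (ρ (σ k))) (sym (⟦⟧-* (s k) (s′ (σ k))))) ⟩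
        ⟦ s k ℤ.* s′ (σ k) ⟧ * L′.full y (ρ (σ k))         ∎
        where open ≡-Reasoning
      σρ : ∀ j → σ (ρ j) ≡ j
      σρ j = proj₁ (coordinates-independent H shape 5≤m (s′ j ℤ.* s (ρ j)) {σ (ρ j)} {j} (through j))
      ρσ : ∀ k → ρ (σ k) ≡ k
      ρσ k = proj₁ (coordinates-independent H′ shape′ 5≤m (s k ℤ.* s′ (σ k)) {ρ (σ k)} {k} (through′ k))
      π : Permutation (2 ℕ.+ d) (2 ℕ.+ d)
      π = permutation ρ σ ρσ σρ

      e : Fin (2 ℕ.+ d) → ℤ
      e j = s (ρ j)
      e-unit : ∀ j → e j ≡ + 1 ⊎ e j ≡ -[1+ 0 ]
      e-unit j = factor-1 (e j) (s′ j) (trans (ℤ.*-comm (e j) (s′ j)) (proj₂ (coordinates-independent H shape 5≤m (s′ j ℤ.* s (ρ j)) {σ (ρ j)} {j} (through j))))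
      transported : ∀ x j → L′.full (app ⟦ u ⟧ᶠ x) (ρ j) ≡ ⟦ e j ⟧ * L.full x j
      transported x j = trans (image (ρ j) x) (cong (λ i → ⟦ e j ⟧ * L.full x i) (σρ j))
      e-relation : ∀ x → sum (λ j → ⟦ e j ⟧ * L.full x j) ≡ 0ℚ
      e-relation x = trans (sum-cong λ j → sym (transported x j)) (trans (sym (ΣQ.sum-permute (L′.full (app ⟦ u ⟧ᶠ x)) π)) (L′.sum-full (app ⟦ u ⟧ᶠ x)))
      ⟦affine⟧ : ∀ (f : Fin (2 ℕ.+ d) → ℤ) → (∀ x → sum (λ j → ⟦ f j ⟧ * L.full x j) ≡ 0ℚ) → ∀ j → f j ≡ f zero ℤ.+ + H j ℤ.* (f (suc zero) ℤ.- f zero)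
      ⟦affine⟧ f rel j = ⟦⟧-injective (trans (relation⇒affine H S.H₀ S.H₁ (λ j → ⟦ f j ⟧) rel j) (sym (trans (⟦⟧-+ (f zero) (+ H j ℤ.* (f (suc zero) ℤ.- f zero)))
        (cong (_+_ ⟦ f zero ⟧) (trans (⟦⟧-* (+ H j) (f (suc zero) ℤ.- f zero)) (cong (L.η j *_) (⟦⟧-- (f (suc zero)) (f zero))))))))
      -- Since the coordinates sum to zero in both lattices, the signs satisfy a linear relation and
      -- are affine in `H`; signs at the heights 0, 1, 2 in arithmetic progression are equal.
      e-constant : ∀ j → e j ≡ e zero
      e-constant j = trans (⟦affine⟧ e e-relation j) (trans (cong (λ t → e zero ℤ.+ + H j ℤ.* t) (ℤ.i≡j⇒i-j≡0 (sym step))) (trans (cong (λ t → e zero ℤ.+ t) (ℤ.*-zeroʳ (+ H j))) (ℤ.+-identityʳ (e zero))))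
        where
        e₂ : e (S.core 2) ≡ e zero ℤ.+ + 2 ℤ.* (e (suc zero) ℤ.- e zero)
        e₂ = trans (⟦affine⟧ e e-relation (S.core 2)) (cong (λ t → e zero ℤ.+ + t ℤ.* (e (suc zero) ℤ.- e zero)) (S.H-core (ℕ.≤-trans (s≤s (s≤s z≤n)) 5≤m)))
        by-signs : ∀ {p q r} → p ≡ + 1 ⊎ p ≡ -[1+ 0 ] → q ≡ + 1 ⊎ q ≡ -[1+ 0 ] → r ≡ + 1 ⊎ r ≡ -[1+ 0 ] → r ≡ p ℤ.+ + 2 ℤ.* (q ℤ.- p) → p ≡ q
        by-signs (inj₁ refl) (inj₁ refl) _ _ = refl
        by-signs (inj₂ refl) (inj₂ refl) _ _ = refl
        by-signs (inj₁ refl) (inj₂ refl) (inj₁ refl) ()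
        by-signs (inj₁ refl) (inj₂ refl) (inj₂ refl) ()
        by-signs (inj₂ refl) (inj₁ refl) (inj₁ refl) ()
        by-signs (inj₂ refl) (inj₁ refl) (inj₂ refl) ()
        step : e zero ≡ e (suc zero)
        step = by-signs (e-unit zero) (e-unit (suc zero)) (e-unit (S.core 2)) e₂

      K : Fin (2 ℕ.+ d) → ℤ
      K j = + H′ (ρ j)
      K-relation : ∀ x → sum (λ j → ⟦ K j ⟧ * L.full x j) ≡ 0ℚ
      K-relation x = recip-cancel {⟦ e zero ⟧} (e≢0 (e-unit zero)) (trans (sym (sum-* ⟦ e zero ⟧ λ j → ⟦ K j ⟧ * L.full x j)) (trans
        (sum-cong λ j → trans (solve 3 (λ e k x → e :* (k :* x) := k :* (e :* x)) refl ⟦ e zero ⟧ ⟦ K j ⟧ (L.full x j))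
          (cong (⟦ K j ⟧ *_) (trans (cong (λ t → ⟦ t ⟧ * L.full x j) (sym (e-constant j))) (sym (transported x j)))))
        (trans (sym (ΣQ.sum-permute (λ k → L′.η k * L′.full (app ⟦ u ⟧ᶠ x) k) π)) (L′.sum-H-full (app ⟦ u ⟧ᶠ x)))))
        where
        e≢0 : ∀ {p} → p ≡ + 1 ⊎ p ≡ -[1+ 0 ] → ⟦ p ⟧ ≢ 0ℚ
        e≢0 (inj₁ refl) ()
        e≢0 (inj₂ refl) ()
      b = K (suc zero) ℤ.- K zero
      heights : ∀ j → + H′ (ρ j) ≡ K zero ℤ.+ + H j ℤ.* b
      heights = ⟦affine⟧ K K-relation
      attained : ∀ k → + H′ k ≡ K zero ℤ.+ + H (σ k) ℤ.* b
      attained k = trans (cong (λ i → + H′ i) (sym (ρσ k))) (heights (σ k))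
      -- `H′` attains 0 and 1, so the slope divides their difference.
      b-unit : b ℤ.* (+ H (σ (suc zero)) ℤ.- + H (σ zero)) ≡ + 1
      b-unit = trans (solveᶻ 4 (λ b p q k → b ⊛ (q ⊖ p) ≐ (k ⊕ q ⊛ b) ⊖ (k ⊕ p ⊛ b)) refl b (+ H (σ zero)) (+ H (σ (suc zero))) (K zero))
        (trans (cong₂ ℤ._-_ (sym (attained (suc zero))) (sym (attained zero))) (cong₂ (λ p q → + p ℤ.- + q) S′.H₁ S′.H₀))

      by-slope : b ≡ + 1 ⊎ b ≡ -[1+ 0 ] → ∀ j → H′ (ρ j) ≡ H j
      by-slope (inj₁ b≡1) j = trans (shift j) (cong (ℕ._+ H j) (ℕ.m+n≡0⇒m≡0 (H′ (ρ zero)) (trans (sym (shift (σ zero))) (trans (cong H′ (ρσ zero)) S′.H₀))))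
        where
        shift : ∀ j → H′ (ρ j) ≡ H′ (ρ zero) ℕ.+ H j
        shift j = ℤ.+-injective (trans (heights j) (trans (cong (λ t → K zero ℤ.+ t) (trans (cong (+ H j ℤ.*_) b≡1) (ℤ.*-identityʳ (+ H j)))) (sym (ℤ.pos-+ (H′ (ρ zero)) (H j)))))
      -- Here `H′ (ρ j) = c - H j`. The point `top` forces `c ≥ m + 2`, so the core height
      -- `c - (m + 1)` would be sent into the gap.
      by-slope (inj₂ b≡-1) j = contradiction (S′.place (ρ (S.core v))) gap
        where
        reflect : ∀ j → H′ (ρ j) ℕ.+ H j ≡ H′ (ρ zero)
        reflect j = ℤ.+-injective (trans (ℤ.pos-+ (H′ (ρ j)) (H j)) (trans (cong (ℤ._+ + H j) (trans (heights j) (cong (λ t → K zero ℤ.+ + H j ℤ.* t) b≡-1)))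
          (solveᶻ 2 (λ k h → k ⊕ h ⊛ conᶻ -[1+ 0 ] ⊕ h ≐ k) refl (K zero) (+ H j))))
        c = H′ (ρ zero)
        m+2≤c : m ℕ.+ 2 ℕ.≤ c
        m+2≤c = ℕ.≤-trans m+2≤top (ℕ.≤-trans (ℕ.m≤n+m (H top) (H′ (ρ top))) (ℕ.≤-reflexive (reflect top)))
        c≤m+P : c ℕ.≤ m ℕ.+ P
        c≤m+P = bound (S′.place (ρ zero))
          where
          bound : H′ (ρ zero) ℕ.≤ m ⊎ (m ℕ.+ 2 ℕ.≤ H′ (ρ zero) × H′ (ρ zero) ℕ.≤ m ℕ.+ P) → c ℕ.≤ m ℕ.+ P
          bound (inj₁ h) = ℕ.≤-trans h (ℕ.m≤m+n m P)
          bound (inj₂ h) = proj₂ h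
        v = c ℕ.∸ suc m
        suc-m≤c : suc m ℕ.≤ c
        suc-m≤c = ℕ.≤-trans (ℕ.≤-trans (ℕ.≤-reflexive (ℕ.+-comm 1 m)) (ℕ.+-monoʳ-≤ m (s≤s z≤n))) m+2≤c
        v≤m : v ℕ.≤ m
        v≤m = ℕ.≤-trans (ℕ.∸-mono c≤m+P (ℕ.n≤1+n m)) (ℕ.≤-trans (ℕ.≤-reflexive (ℕ.m+n∸m≡n m P)) P≤m)
        missed : H′ (ρ (S.core v)) ≡ suc m
        missed = ℕ.+-cancelʳ-≡ v (H′ (ρ (S.core v))) (suc m) (trans (cong (H′ (ρ (S.core v)) ℕ.+_) (sym (S.H-core v≤m))) (trans (reflect (S.core v)) (sym (ℕ.m+[n∸m]≡n suc-m≤c))))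
        gap : ¬ (H′ (ρ (S.core v)) ℕ.≤ m ⊎ (m ℕ.+ 2 ℕ.≤ H′ (ρ (S.core v)) × H′ (ρ (S.core v)) ℕ.≤ m ℕ.+ P))
        gap (inj₁ h) = ℕ.<-irrefl refl (subst (ℕ._≤ m) missed h)
        gap (inj₂ (h , _)) = ℕ.<-irrefl refl (ℕ.≤-trans (ℕ.≤-reflexive (ℕ.+-comm 2 m)) (subst (m ℕ.+ 2 ℕ.≤_) missed h))

      same-heights : ∀ j → H′ (ρ j) ≡ H j
      same-heights = by-slope (factor-1 b (+ H (σ (suc zero)) ℤ.- + H (σ zero)) b-unit)

    isometric⇒same-heights : (B ℓ τ : ℕ) → 16 ℕ.< B → 108 ℕ.< τ → 2 ℕ.* τ ℕ.+ 2 ℕ.≤ ℓ → B ℕ.* ℓ ℕ.≤ m → P ℕ.+ ℓ ℕ.≤ m → 5 ℕ.≤ m →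
      (∃[ i ] m ℕ.+ 2 ℕ.≤ H i) → Iso ⟦ L.gram ⟧ᵐ ⟦ L′.gram ⟧ᵐ → ∀ j → ∃[ k ] H′ k ≡ H j
    isometric⇒same-heights B ℓ τ 16<B 108<τ τ≤ℓ Bℓ≤m P+ℓ≤m 5≤m (top , m+2≤top) (u , w , I) j = proj₁ (proj₂ (image′ j)) ,
      Monomial.same-heights 5≤m (ℕ.≤-trans (ℕ.m≤m+n P ℓ) P+ℓ≤m) top m+2≤top {u} {w} I
        (λ k → proj₁ (image k)) (λ j → proj₁ (image′ j)) (λ k → proj₁ (proj₂ (image k))) (λ j → proj₁ (proj₂ (image′ j)))
        (λ k → proj₂ (proj₂ (image k))) (λ j → proj₂ (proj₂ (image′ j))) j
      where
      image = coordinate-image H H′ shape shape′ B ℓ τ 16<B 108<τ τ≤ℓ Bℓ≤m P+ℓ≤m {u} {w} I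
      image′ = coordinate-image H′ H shape′ shape B ℓ τ 16<B 108<τ τ≤ℓ Bℓ≤m P+ℓ≤m {w} {u} (proj₂ (proj₂ (iso-sym (u , w , I))))

  -- Heights 0, …, μ + 1, a gap at μ + 2, and one of two heights in each of k pairs
  -- above it.
  module Family (μ k : ℕ) where

    private
      core# m P : ℕ
      core# = 2 ℕ.+ μ
      m = suc μ
      P = suc (k ℕ.* 2)

    height : (Fin k → Fin 2) → Fin core# ⊎ Fin k → ℕ
    height b (inj₁ a) = toℕ a
    height b (inj₂ j) = m ℕ.+ 2 ℕ.+ toℕ (F.combine j (b j))

    heights : (Fin k → Fin 2) → Fin (core# ℕ.+ k) → ℕ
    heights b i = height b (F.splitAt core# i)

    core<extra : ∀ (a : Fin core#) t → toℕ a ≢ m ℕ.+ 2 ℕ.+ t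
    core<extra a t eq = ℕ.<-irrefl eq (ℕ.<-≤-trans (F.toℕ<n a) (ℕ.≤-trans (ℕ.≤-trans (ℕ.≤-reflexive (ℕ.+-comm 1 m)) (ℕ.+-monoʳ-≤ m (s≤s z≤n))) (ℕ.m≤m+n (m ℕ.+ 2) t)))

    combine-unique : ∀ b b′ {i j} → height b (inj₂ i) ≡ height b′ (inj₂ j) → i ≡ j × b i ≡ b′ j
    combine-unique b b′ {i} {j} eq = F.combine-injective i (b i) j (b′ j) (F.toℕ-injective (ℕ.+-cancelˡ-≡ (m ℕ.+ 2) (toℕ (F.combine i (b i))) (toℕ (F.combine j (b′ j))) eq))

    height-injective : ∀ b x y → height b x ≡ height b y → x ≡ y
    height-injective b (inj₁ a) (inj₁ c) eq = cong inj₁ (F.toℕ-injective eq)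
    height-injective b (inj₁ a) (inj₂ j) eq = contradiction eq (core<extra a (toℕ (F.combine j (b j))))
    height-injective b (inj₂ i) (inj₁ c) eq = contradiction (sym eq) (core<extra c (toℕ (F.combine i (b i))))
    height-injective b (inj₂ i) (inj₂ j) eq = cong inj₂ (proj₁ (combine-unique b b eq))

    shape : ∀ b → Shape {μ ℕ.+ k} (heights b) m P
    shape b = record { H₀ = refl ; H₁ = refl ; H-inj = injective ; core = core ; H-core = H-core ; place = λ i → place (F.splitAt core# i) }
      where
      injective : ∀ {i j} → heights b i ≡ heights b j → i ≡ j
      injective {i} {j} eq = trans (sym (F.join-splitAt core# k i)) (trans (cong (F.join core# k) (height-injective b (F.splitAt core# i) (F.splitAt core# j) eq)) (F.join-splitAt core# k j))
      core : ℕ → Fin (core# ℕ.+ k)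
      -- The remainder makes `core` total and does not change heights `v ≤ m`.
      core v = F.fromℕ< (ℕ.m%n<n v core#) F.↑ˡ k
      H-core : ∀ {v} → v ℕ.≤ m → heights b (core v) ≡ v
      H-core {v} v≤m = trans (cong (height b) (F.splitAt-↑ˡ core# (F.fromℕ< (ℕ.m%n<n v core#)) k)) (trans (F.toℕ-fromℕ< (ℕ.m%n<n v core#)) (ℕ.m≤n⇒m%n≡m v≤m))
      place : ∀ x → height b x ℕ.≤ m ⊎ (m ℕ.+ 2 ℕ.≤ height b x × height b x ℕ.≤ m ℕ.+ P)
      place (inj₁ a) = inj₁ (ℕ.≤-pred (F.toℕ<n a))
      place (inj₂ j) = inj₂ (ℕ.m≤m+n (m ℕ.+ 2) t , ℕ.≤-trans (ℕ.≤-reflexive (trans (ℕ.+-assoc m 2 t) refl)) (ℕ.+-monoʳ-≤ m (s≤s (F.toℕ<n (F.combine j (b j))))))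
        where t = toℕ (F.combine j (b j))

    same-heights⇒same-bits : ∀ b b′ → (∀ j → ∃[ i ] heights b′ i ≡ heights b j) → ∀ j → b j ≡ b′ j
    same-heights⇒same-bits b b′ h j = let i , eq = h (core# F.↑ʳ j) in
      match (F.splitAt core# i) (trans eq (cong (height b) (F.splitAt-↑ʳ core# k j)))
      where
      match : ∀ x → height b′ x ≡ height b (inj₂ j) → b j ≡ b′ j
      match (inj₁ a) eq = contradiction eq (core<extra a (toℕ (F.combine j (b j))))
      match (inj₂ i) eq = let i≡j , bits = combine-unique b′ b {i} {j} eq in trans (sym bits) (cong b′ i≡j)

    gramOf : (Fin k → Fin 2) → Fin (μ ℕ.+ k) → Fin (μ ℕ.+ k) → ℤ
    gramOf b = Balanced.gram (heights b) refl refl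

    gramOf-good : 3 ℕ.* P ℕ.+ 20 ℕ.≤ μ → ∀ b → Good (gramOf b)
    gramOf-good h b = BalancedPerfect.balanced-good (heights b) (shape b) h

    isometric⇒same-bits : ∀ B ℓ τ → 16 ℕ.< B → 108 ℕ.< τ → 2 ℕ.* τ ℕ.+ 2 ℕ.≤ ℓ → B ℕ.* ℓ ℕ.≤ m → P ℕ.+ ℓ ℕ.≤ m → 5 ℕ.≤ m → (j₀ : Fin k) →
      ∀ b b′ → Iso ⟦ gramOf b ⟧ᵐ ⟦ gramOf b′ ⟧ᵐ → ∀ j → b j ≡ b′ j
    isometric⇒same-bits B ℓ τ 16<B 108<τ τ≤ℓ Bℓ≤m P+ℓ≤m 5≤m j₀ b b′ iso = same-heights⇒same-bits b b′
      (isometric⇒same-heights (heights b) (heights b′) (shape b) (shape b′) B ℓ τ 16<B 108<τ τ≤ℓ Bℓ≤m P+ℓ≤m 5≤m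
        (core# F.↑ʳ j₀ , subst (λ x → m ℕ.+ 2 ℕ.≤ height b x) (sym (F.splitAt-↑ʳ core# k j₀)) (ℕ.m≤m+n (m ℕ.+ 2) (toℕ (F.combine j₀ (b j₀))))) iso)

  -- Bounds on the class number.

  -- coordinate-image is applied to 17 blocks of 220 = 2 · 109 + 2 consecutive
  -- heights each, which fit because 17 · 220 ≤ 4000.
  bits≤number : ∀ μ′ k → let μ = suc μ′ in 6 ℕ.* suc k ℕ.+ 4000 ℕ.≤ μ →
    2 ℕ.^ suc k ℕ.≤ Classification.Transversal.number (Classification.transversal (μ′ ℕ.+ suc k))
  bits≤number μ′ k h = number≥ (μ′ ℕ.+ suc k) (λ x → gramOf (F.finToFun x) , gramOf-good good-size (F.finToFun x)) λ {x} {y} iso →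
    trans (sym (F.funToFin-finToFin {suc k} {2} x)) (trans (funToFin-cong (isometric⇒same-bits 17 220 109 (ℕ.<ᵇ⇒< 16 17 _) (ℕ.<ᵇ⇒< 108 109 _) (ℕ.≤ᵇ⇒≤ 220 220 _)
      (fits 0 3740 (ℕ.≤ᵇ⇒≤ 3740 4000 _) (z≤n)) (ℕ.≤-trans (ℕ.≤-reflexive (P-shift 220)) (fits (suc k ℕ.* 2) 221 (ℕ.≤ᵇ⇒≤ 221 4000 _) 2k≤6k)) (fits 0 5 (ℕ.≤ᵇ⇒≤ 5 4000 _) z≤n)
      zero (F.finToFun x) (F.finToFun y) iso)) (F.funToFin-finToFin {suc k} {2} y))
    where
    open Family (suc μ′) (suc k)
    funToFin-cong : ∀ {m} {f g : Fin m → Fin 2} → (∀ j → f j ≡ g j) → F.funToFin f ≡ F.funToFin g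
    funToFin-cong {zero}  eq = refl
    funToFin-cong {suc m} eq = cong₂ F.combine (eq zero) (funToFin-cong (eq ∘ suc))
    2k≤6k : suc k ℕ.* 2 ℕ.≤ 6 ℕ.* suc k
    2k≤6k = ℕ.≤-trans (ℕ.≤-reflexive (ℕ.*-comm (suc k) 2)) (ℕ.*-monoˡ-≤ (suc k) (ℕ.≤ᵇ⇒≤ 2 6 _))
    fits : ∀ a c → c ℕ.≤ 4000 → a ℕ.≤ 6 ℕ.* suc k → a ℕ.+ c ℕ.≤ suc (suc μ′)
    fits a c c≤ a≤ = ℕ.≤-trans (ℕ.≤-trans (ℕ.+-mono-≤ a≤ c≤) h) (ℕ.n≤1+n (suc μ′))
    P-shift : ∀ t → suc (suc k ℕ.* 2) ℕ.+ t ≡ suc k ℕ.* 2 ℕ.+ suc t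
    P-shift t = sym (ℕ.+-suc (suc k ℕ.* 2) t)
    good-size : 3 ℕ.* suc (suc k ℕ.* 2) ℕ.+ 20 ℕ.≤ suc μ′
    good-size = ℕ.≤-trans (ℕ.≤-trans (ℕ.≤-reflexive (solveⁿ 1 (λ k → conⁿ 3 ⊗ⁿ (conⁿ 1 ⊞ k ⊗ⁿ conⁿ 2) ⊞ conⁿ 20 ≗′ conⁿ 6 ⊗ⁿ k ⊞ conⁿ 23) refl (suc k)))
      (ℕ.+-monoʳ-≤ (6 ℕ.* suc k) (ℕ.≤ᵇ⇒≤ 23 4000 _))) h

  classNumber : ℕ → ℕ
  classNumber zero    = 0
  classNumber (suc n) = Classification.Transversal.number (Classification.transversal n)

  classNumber-correct : ∀ d → IsNumberOfClasses d (classNumber d)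
  classNumber-correct zero = (λ ()) , (λ {}) , λ P → contradiction P empty
    where
    -- In dimension 0 every integer divides all scalar products, so no lattice is primitive.
    empty : ¬ PerfectPrimitiveLattice 0
    empty P = contradiction (Good.coprime (good-gram P (proj₁ g) (proj₂ g)) 2 λ ()) λ ()
      where g = integral⇒hasGram (PerfectPrimitiveLattice.lattice P) (PerfectPrimitiveLattice.isIntegral P)
  classNumber-correct (suc n) = (λ i → toPerfect (proj₁ (rep i)) (proj₂ (rep i))) ,
    (λ {i} {j} iso → distinct (≅⇒iso {Λ = lat i} {lat j} {proj₁ (rep i)} {proj₁ (rep j)} (hasGram i) (hasGram j) iso)) ,
    λ P → let Λ = PerfectPrimitiveLattice.lattice P
              g , hg = integral⇒hasGram Λ (PerfectPrimitiveLattice.isIntegral P)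
              i , iso = represented (g , good-gram P g hg)
          in i , λ { refl → iso⇒≅ {Λ = lat i} {Λ} {proj₁ (rep i)} {g} (hasGram i) hg iso }
    where
    open Classification n using (module Transversal; transversal)
    open Transversal transversal
    lat : Fin number → Lattice (suc n)
    lat i = toLattice (proj₁ (rep i)) (proj₂ (rep i))
    hasGram : ∀ i → HasGram (lat i) (proj₁ (rep i))
    hasGram i = toLattice-hasGram (proj₁ (rep i)) (proj₂ (rep i))

  -- With `2 W + 3` pairs there are `2 * 4 ^ (W + 1)` classes. Each pair uses one dimension, and
  -- `bits≤number` asks for six more per pair besides the constant 4000; hence the 7.
  classNumber-≥ : ∀ c W → 7 ℕ.* (2 ℕ.* W ℕ.+ 3) ℕ.+ 4000 ℕ.≤ suc c → 2 ℕ.+ 4 ℕ.^ (W ℕ.+ 1) ℕ.≤ classNumber (suc c)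
  classNumber-≥ c W h = ℕ.≤-trans bits (subst (λ n → 2 ℕ.^ suc k ℕ.≤ classNumber (suc n)) μ′+k≡c (bits≤number μ′ k μ-large))
    where
    k = 2 ℕ.* W ℕ.+ 2
    K≡ : suc k ≡ 2 ℕ.* W ℕ.+ 3
    K≡ = sym (ℕ.+-suc (2 ℕ.* W) 2)
    7K≤ : suc k ℕ.+ (6 ℕ.* suc k ℕ.+ 4000) ℕ.≤ suc c
    7K≤ = ℕ.≤-trans (ℕ.≤-reflexive (trans (sym (ℕ.+-assoc (suc k) (6 ℕ.* suc k) 4000)) (cong (λ t → 7 ℕ.* t ℕ.+ 4000) K≡))) h
    μ′ = c ℕ.∸ suc k
    K≤c : suc k ℕ.≤ c
    K≤c = ℕ.≤-pred (ℕ.≤-trans (ℕ.≤-trans (ℕ.≤-reflexive (ℕ.+-comm 1 (suc k))) (ℕ.+-monoʳ-≤ (suc k) (ℕ.≤-trans (ℕ.≤ᵇ⇒≤ 1 4000 _) (ℕ.m≤n+m 4000 (6 ℕ.* suc k))))) 7K≤)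
    μ′+k≡c : μ′ ℕ.+ suc k ≡ c
    μ′+k≡c = ℕ.m∸n+n≡m K≤c
    μ-large : 6 ℕ.* suc k ℕ.+ 4000 ℕ.≤ suc μ′
    μ-large = ℕ.+-cancelˡ-≤ (suc k) (6 ℕ.* suc k ℕ.+ 4000) (suc μ′) (ℕ.≤-trans 7K≤ (ℕ.≤-reflexive (trans (cong suc (sym μ′+k≡c)) (ℕ.+-comm (suc μ′) (suc k)))))
    bits : 2 ℕ.+ 4 ℕ.^ (W ℕ.+ 1) ℕ.≤ 2 ℕ.^ suc k
    bits = ℕ.≤-trans (ℕ.+-monoˡ-≤ (4 ℕ.^ (W ℕ.+ 1)) (ℕ.≤-trans (ℕ.≤ᵇ⇒≤ 2 4 _) (ℕ.≤-trans (ℕ.≤-reflexive (sym (ℕ.^-identityʳ 4))) (ℕ.^-monoʳ-≤ 4 (ℕ.m≤n+m 1 W)))))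
      (ℕ.≤-reflexive (trans (cong (λ t → t ℕ.+ t) power) (trans (cong (2 ℕ.^ k ℕ.+_) (sym (ℕ.+-identityʳ (2 ℕ.^ k)))) refl)))
      where
      power : 4 ℕ.^ (W ℕ.+ 1) ≡ 2 ℕ.^ k
      power = trans (ℕ.^-*-assoc 2 2 (W ℕ.+ 1)) (cong (2 ℕ.^_) (ℕ.*-distribˡ-+ 2 W 1))

  classNumber-bounds : ∀ ε → 0ᴿ <ᴿ ε → ∃[ N ] (∀ d .{{_ : ℕ.NonZero d}} → N ℕ.≤ d →
    (exp (d ^ᴿ (fromℕ 1 -ᴿ ε)) <ᴿ fromℕ (classNumber d)) × (fromℕ (classNumber d) <ᴿ exp (d ^ᴿ (fromℕ 3 +ᴿ ε))))
  classNumber-bounds ε 0<ε =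
    let b , N₀ , ε≥ = positive-real ε 0<ε
        N₁ , lower = lowerExponent 7 4000 b
        N₂ , upper = upperExponent b
    in suc (N₁ ℕ.+ N₂) , λ where
      (suc c) h →
        let W , hW , size = lower (suc c) (ℕ.≤-trans (ℕ.≤-trans (ℕ.m≤m+n N₁ N₂) (ℕ.n≤1+n (N₁ ℕ.+ N₂))) h)
            T , hT , codes = upper c (ℕ.≤-trans (ℕ.≤-trans (ℕ.m≤n+m N₂ N₁) (ℕ.n≤1+n (N₁ ℕ.+ N₂))) h)
        in exp-power<-by ε b N₀ ε≥ c W (classNumber (suc c)) hW (classNumber-≥ c W size) ,
           <exp-power-by ε b N₀ ε≥ c T (classNumber (suc c)) hT (ℕ.≤-trans (s≤s (number≤codeBound c)) codes)

open import Data.Nat.Base using (ℕ; _≤_; NonZero)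
open import Data.Product.Base using (Σ-syntax; ∃-syntax; _×_)

theorem1p1 : Σ[ p ∈ (ℕ → ℕ) ]
    (∀ d → IsNumberOfClasses d (p d)) ×
    (∀ (ε : ℝ) → 0ᴿ <ᴿ ε →
    ∃[ N ] (∀ (d : ℕ) .{{_ : NonZero d}} → N ≤ d →
    (exp (d ^ᴿ (fromℕ 1 -ᴿ ε)) <ᴿ fromℕ (p d)) ×
    (fromℕ (p d) <ᴿ exp (d ^ᴿ (fromℕ 3 +ᴿ ε)))))
theorem1p1 = classNumber , classNumber-correct , classNumber-bounds
  where open PerfectLattices
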